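{- Let $\beta(s)=\sum_{n=1}^{+\infty}\frac{(-1)^{n-1}}{(2n-1)^s}$ for $\mathrm{Re}(s)>0$. Then $\beta(1)=\frac{\pi}{4}$, $\beta(3)=\frac{\pi^3}{32}$, $\beta(5)=\frac{5\pi^5}{1536}$, and more generally, for every positive integer $l$, $$\beta(2l-1)=\frac{(-1)^{l+1}\pi^{2l-1}}{2^{2l}}\left[\frac{1}{\Gamma(2l-1)}+2\sum_{j=1}^{l-1}\frac{(-1)^j2^{2j}\lambda(2j)}{\Gamma(2l-2j)\pi^{2j}}\right]$$ $$=\frac{(-1)^{l+1}\pi^{2l-1}}{2^{2l}}\left[\frac{1}{\Gamma(2l-1)}+2\sum_{j=1}^{l-1}\frac{(-1)^j(2^{2j}-1)\zeta(2j)}{\Gamma(2l-2j)\pi^{2j}}\right]$$ $$=\frac{(-1)^{l+1}\pi^{2l-1}}{2^{2l}}\left[\frac{1}{\Gamma(2l-1)}-\sum_{j=1}^{l-1}\frac{2^{2j}(2^{2j}-1)B_{2j}}{\Gamma(2l-2j)\Gamma(2j+1)}\right].$$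
   Context: Here $\zeta(s)=\sum_{n=1}^{+\infty}\frac{1}{n^s}$ and $\lambda(s)=\sum_{n=1}^{+\infty}\frac{1}{(2n-1)^s}$ for $\mathrm{Re}(s)>1$ (Riemann zeta function and Dirichlet lambda function), $\Gamma$ is the Gamma function, and $B_n$ is the $n$-th Bernoulli number, defined by $\frac{x}{e^x-1}=\sum_{n=0}^{+\infty}\frac{B_n}{n!}x^n$. An empty sum (such as $\sum_{j=1}^{0}$) equals $0$. -}

module Defs where

open import Data.Empty using (⊥-elim)
open import Data.Integer.Base as ℤ using (ℤ; +_)
import Data.Integer.Properties as ℤₚ
open import Data.Nat.Base as ℕ using (ℕ; zero; suc; _!; NonZero; NonTrivial)
import Data.Nat.Properties as ℕₚ
open import Data.Nat.Solver using (module +-*-Solver)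
open import Data.Product using (∃-syntax; _×_; _,_; proj₁; proj₂)
open import Data.Rational.Base as ℚ using (ℚ; 0ℚ; 1ℚ; ½; ∣_∣; _/_)
import Data.Rational.Properties as ℚₚ
import Data.Rational.Solver as ℚ-Solver
import Data.Rational.Unnormalised.Base as ℚᵘ
import Data.Rational.Unnormalised.Properties as ℚᵘₚ
open import Relation.Binary.PropositionalEquality
  using (_≡_; _≢_; refl; sym; trans; cong; cong₂; subst; subst₂; module ≡-Reasoning)
open import Relation.Nullary using (¬_; yes; no; recompute)

module _ where
  open ℚ-Solver.+-*-Solver

  ½+½ : ∀ e → ½ ℚ.* e ℚ.+ ½ ℚ.* e ≡ e
  ½+½ = solve 1 (λ e → con ½ :* e :+ con ½ :* e := e) refl

  sub-split : ∀ a b c → a ℚ.- b ≡ (a ℚ.- c) ℚ.+ (c ℚ.- b)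
  sub-split = solve 3 (λ a b c → a :- b := (a :- c) :+ (c :- b)) refl

  sub-+ : ∀ a b c d → (a ℚ.+ b) ℚ.- (c ℚ.+ d) ≡ (a ℚ.- c) ℚ.+ (b ℚ.- d)
  sub-+ = solve 4 (λ a b c d → (a :+ b) :- (c :+ d) := (a :- c) :+ (b :- d)) refl

  sub-neg : ∀ a b → (ℚ.- a) ℚ.- (ℚ.- b) ≡ ℚ.- (a ℚ.- b)
  sub-neg = solve 2 (λ a b → (:- a) :- (:- b) := :- (a :- b)) refl

  sub-* : ∀ a b c d → (a ℚ.* b) ℚ.- (c ℚ.* d) ≡ a ℚ.* (b ℚ.- d) ℚ.+ d ℚ.* (a ℚ.- c)
  sub-* = solve 4 (λ a b c d → (a :* b) :- (c :* d) := a :* (b :- d) :+ d :* (a :- c)) refl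

  sub-swap : ∀ a b → a ℚ.- b ≡ ℚ.- (b ℚ.- a)
  sub-swap = solve 2 (λ a b → a :- b := :- (b :- a)) refl

  add-sub : ∀ a b → a ≡ (a ℚ.- b) ℚ.+ b
  add-sub = solve 2 (λ a b → a := (a :- b) :+ b) refl

∣-∣-sym : ∀ a b → ∣ a ℚ.- b ∣ ≡ ∣ b ℚ.- a ∣
∣-∣-sym a b = trans (cong ∣_∣ (sub-swap a b)) (ℚₚ.∣-p∣≡∣p∣ (b ℚ.- a))

*-monoˡ-≤ : ∀ {r p q} → 0ℚ ℚ.≤ r → p ℚ.≤ q → r ℚ.* p ℚ.≤ r ℚ.* q
*-monoˡ-≤ {r} 0≤r = ℚₚ.*-monoˡ-≤-nonNeg r {{ℚ.nonNegative 0≤r}}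

*-mono-≤ : ∀ {a b c d} → 0ℚ ℚ.≤ b → 0ℚ ℚ.≤ c → a ℚ.≤ b → c ℚ.≤ d → a ℚ.* c ℚ.≤ b ℚ.* d
*-mono-≤ {a} {b} {c} {d} 0≤b 0≤c a≤b c≤d =
  ℚₚ.≤-trans (ℚₚ.*-monoʳ-≤-nonNeg c {{ℚ.nonNegative 0≤c}} a≤b) (*-monoˡ-≤ 0≤b c≤d)

0<p*q : ∀ {p q} → 0ℚ ℚ.< p → 0ℚ ℚ.< q → 0ℚ ℚ.< p ℚ.* q
0<p*q {p} {q} 0<p 0<q =
  ℚₚ.positive⁻¹ _ {{ℚₚ.pos*pos⇒pos p {{ℚ.positive 0<p}} q {{ℚ.positive 0<q}}}}

0<½ : 0ℚ ℚ.< ½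
0<½ = ℚₚ.positive⁻¹ ½

half>0 : ∀ {e} → 0ℚ ℚ.< e → 0ℚ ℚ.< ½ ℚ.* e
half>0 = 0<p*q 0<½

∣∣-triangle-< : ∀ {a b c e} → ∣ a ℚ.- c ∣ ℚ.< ½ ℚ.* e → ∣ c ℚ.- b ∣ ℚ.< ½ ℚ.* e → ∣ a ℚ.- b ∣ ℚ.< e
∣∣-triangle-< {a} {b} {c} {e} h k = begin-strict
  ∣ a ℚ.- b ∣                        ≡⟨ cong ∣_∣ (sub-split a b c) ⟩
  ∣ (a ℚ.- c) ℚ.+ (c ℚ.- b) ∣        ≤⟨ ℚₚ.∣p+q∣≤∣p∣+∣q∣ (a ℚ.- c) (c ℚ.- b) ⟩
  ∣ a ℚ.- c ∣ ℚ.+ ∣ c ℚ.- b ∣        <⟨ ℚₚ.+-mono-< h k ⟩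
  ½ ℚ.* e ℚ.+ ½ ℚ.* e                ≡⟨ ½+½ e ⟩
  e                                  ∎
  where open ℚₚ.≤-Reasoning

inv : ℚ → ℚ
inv p with p ℚₚ.≟ 0ℚ
... | yes _  = 0ℚ
... | no p≢0 = ℚ.1/_ p {{ℚ.≢-nonZero p≢0}}

inv-inverse : ∀ p → p ≢ 0ℚ → inv p ℚ.* p ≡ 1ℚ
inv-inverse p p≢0 with p ℚₚ.≟ 0ℚ
... | yes p≡0 = ⊥-elim (p≢0 p≡0)
... | no  p≢0 = ℚₚ.*-inverseˡ p {{ℚ.≢-nonZero p≢0}}

pos≢0 : ∀ {p} → 0ℚ ℚ.< p → p ≢ 0ℚ
pos≢0 0<p p≡0 = ℚₚ.<⇒≢ 0<p (sym p≡0)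

inv>0 : ∀ {p} → 0ℚ ℚ.< p → 0ℚ ℚ.< inv p
inv>0 {p} 0<p with p ℚₚ.≟ 0ℚ
... | yes p≡0 = ⊥-elim (pos≢0 0<p p≡0)
... | no  _   = ℚₚ.positive⁻¹ _ {{ℚₚ.1/pos⇒pos p {{ℚ.positive 0<p}}}}

frac-≤ : ∀ a b c d .{{_ : NonZero b}} .{{_ : NonZero d}} →
         a ℕ.* d ℕ.≤ c ℕ.* b → + a / b ℚ.≤ + c / d
frac-≤ a (suc b) c (suc d) h = ℚₚ.toℚᵘ-cancel-≤ (begin
  ℚ.toℚᵘ (+ a / suc b)  ≃⟨ ℚₚ.toℚᵘ-fromℚᵘ (ℚᵘ.mkℚᵘ (+ a) b) ⟩
  ℚᵘ.mkℚᵘ (+ a) b       ≤⟨ ℚᵘ.*≤* (subst₂ ℤ._≤_ (ℤₚ.pos-* a (suc d)) (ℤₚ.pos-* c (suc b)) (ℤ.+≤+ h)) ⟩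
  ℚᵘ.mkℚᵘ (+ c) d       ≃⟨ ℚₚ.toℚᵘ-fromℚᵘ (ℚᵘ.mkℚᵘ (+ c) d) ⟨
  ℚ.toℚᵘ (+ c / suc d)  ∎)
  where open ℚᵘₚ.≤-Reasoning

frac-≡ : ∀ a b c d .{{_ : NonZero b}} .{{_ : NonZero d}} →
         a ℕ.* d ≡ c ℕ.* b → + a / b ≡ + c / d
frac-≡ a b c d h =
  ℚₚ.≤-antisym (frac-≤ a b c d (ℕₚ.≤-reflexive h)) (frac-≤ c d a b (ℕₚ.≤-reflexive (sym h)))

frac-* : ∀ a b c d .{{_ : NonZero b}} .{{_ : NonZero d}} →
         (+ a / b) ℚ.* (+ c / d) ≡ _/_ (+ (a ℕ.* c)) (b ℕ.* d) {{ℕₚ.m*n≢0 b d}}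
frac-* a (suc b) c (suc d) = ℚₚ.toℚᵘ-injective (begin
  ℚ.toℚᵘ ((+ a / suc b) ℚ.* (+ c / suc d))
    ≈⟨ ℚₚ.toℚᵘ-homo-* (+ a / suc b) (+ c / suc d) ⟩
  ℚ.toℚᵘ (+ a / suc b) ℚᵘ.* ℚ.toℚᵘ (+ c / suc d)
    ≈⟨ ℚᵘₚ.*-cong (ℚₚ.toℚᵘ-fromℚᵘ (ℚᵘ.mkℚᵘ (+ a) b)) (ℚₚ.toℚᵘ-fromℚᵘ (ℚᵘ.mkℚᵘ (+ c) d)) ⟩
  ℚᵘ.mkℚᵘ (+ a) b ℚᵘ.* ℚᵘ.mkℚᵘ (+ c) d
    ≈⟨ ℚᵘₚ.≃-reflexive (cong (λ z → ℚᵘ.mkℚᵘ z (d ℕ.+ b ℕ.* suc d)) (sym (ℤₚ.pos-* a c))) ⟩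
  ℚᵘ.mkℚᵘ (+ (a ℕ.* c)) (d ℕ.+ b ℕ.* suc d)
    ≈⟨ ℚₚ.toℚᵘ-fromℚᵘ (ℚᵘ.mkℚᵘ (+ (a ℕ.* c)) (d ℕ.+ b ℕ.* suc d)) ⟨
  ℚ.toℚᵘ (+ (a ℕ.* c) / (suc b ℕ.* suc d)) ∎)
  where open ℚᵘₚ.≃-Reasoning

frac-+ : ∀ a c d .{{_ : NonZero d}} → (+ a / d) ℚ.+ (+ c / d) ≡ + (a ℕ.+ c) / d
frac-+ a c (suc d) = ℚₚ.toℚᵘ-injective (begin
  ℚ.toℚᵘ ((+ a / suc d) ℚ.+ (+ c / suc d))
    ≈⟨ ℚₚ.toℚᵘ-homo-+ (+ a / suc d) (+ c / suc d) ⟩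
  ℚ.toℚᵘ (+ a / suc d) ℚᵘ.+ ℚ.toℚᵘ (+ c / suc d)
    ≈⟨ ℚᵘₚ.+-cong (ℚₚ.toℚᵘ-fromℚᵘ (ℚᵘ.mkℚᵘ (+ a) d)) (ℚₚ.toℚᵘ-fromℚᵘ (ℚᵘ.mkℚᵘ (+ c) d)) ⟩
  ℚᵘ.mkℚᵘ (+ a) d ℚᵘ.+ ℚᵘ.mkℚᵘ (+ c) d
    ≈⟨ ℚᵘ.*≡* eq ⟩
  ℚᵘ.mkℚᵘ (+ (a ℕ.+ c)) d
    ≈⟨ ℚₚ.toℚᵘ-fromℚᵘ (ℚᵘ.mkℚᵘ (+ (a ℕ.+ c)) d) ⟨
  ℚ.toℚᵘ (+ (a ℕ.+ c) / suc d) ∎)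
  where
  open ℚᵘₚ.≃-Reasoning
  D = + suc d
  eq : (+ a ℤ.* D ℤ.+ + c ℤ.* D) ℤ.* D ≡ + (a ℕ.+ c) ℤ.* (D ℤ.* D)
  eq = trans (cong (ℤ._* D) (sym (ℤₚ.*-distribʳ-+ D (+ a) (+ c))))
             (ℤₚ.*-assoc (+ a ℤ.+ + c) D D)

frac-≥0 : ∀ a b .{{_ : NonZero b}} → 0ℚ ℚ.≤ + a / b
frac-≥0 a b = frac-≤ 0 1 a b ℕ.z≤n

neg-frac : ∀ i d .{{_ : NonZero d}} → (ℤ.- i) / d ≡ ℚ.- (i / d)
neg-frac (+ zero)     d = trans (ℚₚ.0/n≡0 d) (cong ℚ.-_ (sym (ℚₚ.0/n≡0 d)))
neg-frac (+ suc _)    d = refl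
neg-frac ℤ.-[1+ n ]   d = solve 1 (λ a → a := :- (:- a)) refl (+ suc n / d)
  where open ℚ-Solver.+-*-Solver

archimedean : ∀ c e → 0ℚ ℚ.< e → ∃[ N ] (∀ n → N ℕ.≤ n → + c / suc n ℚ.< e)
archimedean c e@(ℚ.mkℚ (+ suc p) q _) 0<e = c ℕ.* suc q , λ n N≤n →
  subst (+ c / suc n ℚ.<_) (ℚₚ.fromℚᵘ-toℚᵘ e) (ℚₚ.toℚᵘ-cancel-< (bound n N≤n))
  where
  open ℚᵘₚ.≤-Reasoning
  bound : ∀ n → c ℕ.* suc q ℕ.≤ n → ℚ.toℚᵘ (+ c / suc n) ℚᵘ.< ℚ.toℚᵘ (+ suc p / suc q)
  bound n h = begin-strict
    ℚ.toℚᵘ (+ c / suc n)       ≃⟨ ℚₚ.toℚᵘ-fromℚᵘ (ℚᵘ.mkℚᵘ (+ c) n) ⟩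
    ℚᵘ.mkℚᵘ (+ c) n            <⟨ ℚᵘ.*<* (subst₂ ℤ._<_ (ℤₚ.pos-* c (suc q)) (ℤₚ.pos-* (suc p) (suc n))
                                    (ℤ.+<+ (ℕₚ.≤-trans (ℕ.s≤s h) (ℕₚ.m≤m+n (suc n) (p ℕ.* suc n))))) ⟩
    ℚᵘ.mkℚᵘ (+ suc p) q        ≃⟨ ℚₚ.toℚᵘ-fromℚᵘ (ℚᵘ.mkℚᵘ (+ suc p) q) ⟨
    ℚ.toℚᵘ (+ suc p / suc q)   ∎
archimedean c (ℚ.mkℚ (+ zero) _ _) (ℚ.*<* (ℤ.+<+ ()))
archimedean c (ℚ.mkℚ ℤ.-[1+ _ ] _ _) (ℚ.*<* ())

-- Real numbers: Cauchy sequences of rationals, equal when their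
-- difference tends to 0.

IsCauchy : (ℕ → ℚ) → Set
IsCauchy a = ∀ ε → 0ℚ ℚ.< ε → ∃[ N ] (∀ m n → N ℕ.≤ m → N ℕ.≤ n → ∣ a m ℚ.- a n ∣ ℚ.< ε)

record ℝ : Set where
  constructor mkℝ
  field
    seq    : ℕ → ℚ
    cauchy : IsCauchy seq

open ℝ public

infix 4 _≈_ _<_

_≈_ : ℝ → ℝ → Set
x ≈ y = ∀ ε → 0ℚ ℚ.< ε → ∃[ N ] (∀ n → N ℕ.≤ n → ∣ seq x n ℚ.- seq y n ∣ ℚ.< ε)

_<_ : ℝ → ℝ → Set
x < y = ∃[ ε ] (0ℚ ℚ.< ε × ∃[ N ] (∀ n → N ℕ.≤ n → seq x n ℚ.+ ε ℚ.≤ seq y n))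

-- "x is apart from 0": positively different from 0, as needed to divide by x.
_#0 : ℝ → Set
x #0 = ∃[ δ ] (0ℚ ℚ.< δ × ∃[ N ] (∀ n → N ℕ.≤ n → δ ℚ.≤ ∣ seq x n ∣))

cauchy-from : ∀ {a} → (∀ ε → 0ℚ ℚ.< ε → ∃[ N ] (∀ n → N ℕ.≤ n → ∣ a n ℚ.- a N ∣ ℚ.< ε)) → IsCauchy a
cauchy-from {a} h ε 0<ε with h (½ ℚ.* ε) (half>0 0<ε)
... | N , k = N , λ m n N≤m N≤n →
  ∣∣-triangle-< {a m} {a n} {a N} {ε} (k m N≤m)
    (subst (ℚ._< ½ ℚ.* ε) (∣-∣-sym (a n) (a N)) (k n N≤n))

eventually-bounded : ∀ {a} → IsCauchy a →
  ∃[ M ] (0ℚ ℚ.< M × ∃[ N ] (∀ n → N ℕ.≤ n → ∣ a n ∣ ℚ.≤ M))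
eventually-bounded {a} c with c 1ℚ (ℚₚ.positive⁻¹ 1ℚ)
... | N , h = 1ℚ ℚ.+ ∣ a N ∣
            , ℚₚ.+-mono-<-≤ {0ℚ} {1ℚ} {0ℚ} (ℚₚ.positive⁻¹ 1ℚ) (ℚₚ.0≤∣p∣ (a N))
            , N , λ n N≤n → begin
  ∣ a n ∣                          ≡⟨ cong ∣_∣ (add-sub (a n) (a N)) ⟩
  ∣ (a n ℚ.- a N) ℚ.+ a N ∣        ≤⟨ ℚₚ.∣p+q∣≤∣p∣+∣q∣ (a n ℚ.- a N) (a N) ⟩
  ∣ a n ℚ.- a N ∣ ℚ.+ ∣ a N ∣      ≤⟨ ℚₚ.+-monoˡ-≤ ∣ a N ∣ (ℚₚ.<⇒≤ (h n N N≤n ℕₚ.≤-refl)) ⟩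
  1ℚ ℚ.+ ∣ a N ∣                   ∎
  where open ℚₚ.≤-Reasoning

fromℚ : ℚ → ℝ
fromℚ q = mkℝ (λ _ → q) λ ε 0<ε → 0 , λ _ _ _ _ →
  subst (ℚ._< ε) (sym (cong ∣_∣ (ℚₚ.+-inverseʳ q))) 0<ε

fromℕ : ℕ → ℝ
fromℕ n = fromℚ (+ n / 1)

0ℝ 1ℝ : ℝ
0ℝ = fromℚ 0ℚ
1ℝ = fromℚ 1ℚ

infix  8 -_
infixr 8 _^_
infixl 7 _*_ _÷_[_]
infixl 6 _+_ _-_

_+_ : ℝ → ℝ → ℝ
mkℝ a p + mkℝ b q = mkℝ (λ n → a n ℚ.+ b n) sum-cauchy
  where
  sum-cauchy : IsCauchy (λ n → a n ℚ.+ b n)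
  sum-cauchy ε 0<ε with p (½ ℚ.* ε) (half>0 0<ε) | q (½ ℚ.* ε) (half>0 0<ε)
  ... | M , h | N , k = M ℕ.⊔ N , λ m n l₁ l₂ → begin-strict
    ∣ (a m ℚ.+ b m) ℚ.- (a n ℚ.+ b n) ∣      ≡⟨ cong ∣_∣ (sub-+ (a m) (b m) (a n) (b n)) ⟩
    ∣ (a m ℚ.- a n) ℚ.+ (b m ℚ.- b n) ∣      ≤⟨ ℚₚ.∣p+q∣≤∣p∣+∣q∣ (a m ℚ.- a n) (b m ℚ.- b n) ⟩
    ∣ a m ℚ.- a n ∣ ℚ.+ ∣ b m ℚ.- b n ∣      <⟨ ℚₚ.+-mono-< (h m n (ℕₚ.m⊔n≤o⇒m≤o M N l₁) (ℕₚ.m⊔n≤o⇒m≤o M N l₂))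
                                                            (k m n (ℕₚ.m⊔n≤o⇒n≤o M N l₁) (ℕₚ.m⊔n≤o⇒n≤o M N l₂)) ⟩
    ½ ℚ.* ε ℚ.+ ½ ℚ.* ε                      ≡⟨ ½+½ ε ⟩
    ε                                        ∎
    where open ℚₚ.≤-Reasoning

-_ : ℝ → ℝ
- mkℝ a p = mkℝ (λ n → ℚ.- a n) λ ε 0<ε → proj₁ (p ε 0<ε) , λ m n l₁ l₂ →
  subst (ℚ._< ε)
    (sym (trans (cong ∣_∣ (sub-neg (a m) (a n))) (ℚₚ.∣-p∣≡∣p∣ (a m ℚ.- a n))))
    (proj₂ (p ε 0<ε) m n l₁ l₂)

_-_ : ℝ → ℝ → ℝ
x - y = x + (- y)

product-close : ∀ {a b c d M ε} → 0ℚ ℚ.< M → ∣ a ∣ ℚ.≤ M → ∣ d ∣ ℚ.≤ M →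
  ∣ b ℚ.- d ∣ ℚ.< inv M ℚ.* (½ ℚ.* ε) → ∣ a ℚ.- c ∣ ℚ.< inv M ℚ.* (½ ℚ.* ε) →
  ∣ a ℚ.* b ℚ.- c ℚ.* d ∣ ℚ.< ε
product-close {a} {b} {c} {d} {M} {ε} 0<M a≤M d≤M bd ac = begin-strict
  ∣ a ℚ.* b ℚ.- c ℚ.* d ∣                          ≡⟨ cong ∣_∣ (sub-* a b c d) ⟩
  ∣ a ℚ.* (b ℚ.- d) ℚ.+ d ℚ.* (a ℚ.- c) ∣          ≤⟨ ℚₚ.∣p+q∣≤∣p∣+∣q∣ (a ℚ.* (b ℚ.- d)) (d ℚ.* (a ℚ.- c)) ⟩
  ∣ a ℚ.* (b ℚ.- d) ∣ ℚ.+ ∣ d ℚ.* (a ℚ.- c) ∣      ≡⟨ cong₂ ℚ._+_ (ℚₚ.∣p*q∣≡∣p∣*∣q∣ a (b ℚ.- d)) (ℚₚ.∣p*q∣≡∣p∣*∣q∣ d (a ℚ.- c)) ⟩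
  ∣ a ∣ ℚ.* ∣ b ℚ.- d ∣ ℚ.+ ∣ d ∣ ℚ.* ∣ a ℚ.- c ∣  <⟨ ℚₚ.+-mono-< (lem a≤M bd) (lem d≤M ac) ⟩
  ½ ℚ.* ε ℚ.+ ½ ℚ.* ε                              ≡⟨ ½+½ ε ⟩
  ε                                                ∎
  where
  open ℚₚ.≤-Reasoning
  lem : ∀ {u v} → ∣ u ∣ ℚ.≤ M → ∣ v ∣ ℚ.< inv M ℚ.* (½ ℚ.* ε) → ∣ u ∣ ℚ.* ∣ v ∣ ℚ.< ½ ℚ.* ε
  lem {u} {v} u≤M v< = begin-strict
    ∣ u ∣ ℚ.* ∣ v ∣                 ≤⟨ *-mono-≤ (ℚₚ.<⇒≤ 0<M) (ℚₚ.0≤∣p∣ v) u≤M ℚₚ.≤-refl ⟩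
    M ℚ.* ∣ v ∣                     <⟨ ℚₚ.*-monoʳ-<-pos M {{ℚ.positive 0<M}} v< ⟩
    M ℚ.* (inv M ℚ.* (½ ℚ.* ε))     ≡⟨ ℚₚ.*-assoc M (inv M) _ ⟨
    (M ℚ.* inv M) ℚ.* (½ ℚ.* ε)     ≡⟨ cong (ℚ._* (½ ℚ.* ε)) (trans (ℚₚ.*-comm M (inv M)) (inv-inverse M (pos≢0 0<M))) ⟩
    1ℚ ℚ.* (½ ℚ.* ε)                ≡⟨ ℚₚ.*-identityˡ _ ⟩
    ½ ℚ.* ε                         ∎

product-cauchy : ∀ {a b} M N₀ → IsCauchy a → IsCauchy b → 0ℚ ℚ.< M →
  (∀ n → N₀ ℕ.≤ n → ∣ a n ∣ ℚ.≤ M) → (∀ n → N₀ ℕ.≤ n → ∣ b n ∣ ℚ.≤ M) →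
  IsCauchy (λ n → a n ℚ.* b n)
product-cauchy {a} {b} M N₀ p q 0<M a≤M b≤M ε 0<ε
  with p (inv M ℚ.* (½ ℚ.* ε)) (0<p*q (inv>0 0<M) (half>0 0<ε))
     | q (inv M ℚ.* (½ ℚ.* ε)) (0<p*q (inv>0 0<M) (half>0 0<ε))
... | N₁ , h | N₂ , k = N₀ ℕ.⊔ (N₁ ℕ.⊔ N₂) , λ m n l₁ l₂ →
  product-close {a m} {b m} {a n} {b n} {M} {ε} 0<M (a≤M m (N₀≤ l₁)) (b≤M n (N₀≤ l₂))
    (k m n (N₂≤ l₁) (N₂≤ l₂)) (h m n (N₁≤ l₁) (N₁≤ l₂))
  where
  N₀≤ : ∀ {m} → N₀ ℕ.⊔ (N₁ ℕ.⊔ N₂) ℕ.≤ m → N₀ ℕ.≤ m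
  N₀≤ = ℕₚ.m⊔n≤o⇒m≤o N₀ _
  N₁≤ : ∀ {m} → N₀ ℕ.⊔ (N₁ ℕ.⊔ N₂) ℕ.≤ m → N₁ ℕ.≤ m
  N₁≤ l = ℕₚ.m⊔n≤o⇒m≤o N₁ N₂ (ℕₚ.m⊔n≤o⇒n≤o N₀ _ l)
  N₂≤ : ∀ {m} → N₀ ℕ.⊔ (N₁ ℕ.⊔ N₂) ℕ.≤ m → N₂ ℕ.≤ m
  N₂≤ l = ℕₚ.m⊔n≤o⇒n≤o N₁ N₂ (ℕₚ.m⊔n≤o⇒n≤o N₀ _ l)

p≤p+q : ∀ p q → 0ℚ ℚ.< q → p ℚ.≤ p ℚ.+ q
p≤p+q p q 0<q = subst (ℚ._≤ p ℚ.+ q) (ℚₚ.+-identityʳ p) (ℚₚ.+-monoʳ-≤ p (ℚₚ.<⇒≤ 0<q))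

q≤p+q : ∀ p q → 0ℚ ℚ.< p → q ℚ.≤ p ℚ.+ q
q≤p+q p q 0<p = subst (q ℚ.≤_) (ℚₚ.+-comm q p) (p≤p+q q p 0<p)

EventuallyBoundedBy : (ℕ → ℚ) → ℚ → ℕ → Set
EventuallyBoundedBy a M N = ∀ n → N ℕ.≤ n → ∣ a n ∣ ℚ.≤ M

common-bound : ∀ {a b} → IsCauchy a → IsCauchy b →
  ∃[ M ] (0ℚ ℚ.< M × ∃[ N ] (EventuallyBoundedBy a M N × EventuallyBoundedBy b M N))
common-bound {a} {b} p q = combine (eventually-bounded {a} p) (eventually-bounded {b} q)
  where
  combine : ∃[ M ] (0ℚ ℚ.< M × ∃[ N ] EventuallyBoundedBy a M N) →
            ∃[ M ] (0ℚ ℚ.< M × ∃[ N ] EventuallyBoundedBy b M N) →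
            ∃[ M ] (0ℚ ℚ.< M × ∃[ N ] (EventuallyBoundedBy a M N × EventuallyBoundedBy b M N))
  combine (A , 0<A , N₁ , a≤A) (B , 0<B , N₂ , b≤B) =
    A ℚ.+ B , ℚₚ.<-≤-trans {0ℚ} {A} {A ℚ.+ B} 0<A (p≤p+q A B 0<B) , N₁ ℕ.⊔ N₂
    , (λ n l → ℚₚ.≤-trans {∣ a n ∣} {A} {A ℚ.+ B} (a≤A n (ℕₚ.m⊔n≤o⇒m≤o N₁ N₂ l)) (p≤p+q A B 0<B))
    , (λ n l → ℚₚ.≤-trans {∣ b n ∣} {B} {A ℚ.+ B} (b≤B n (ℕₚ.m⊔n≤o⇒n≤o N₁ N₂ l)) (q≤p+q A B 0<A))

_*_ : ℝ → ℝ → ℝ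
mkℝ a p * mkℝ b q = mkℝ (λ n → a n ℚ.* b n)
  (let M , 0<M , N , a≤M , b≤M = common-bound {a} {b} p q in product-cauchy {a} {b} M N p q 0<M a≤M b≤M)

_^_ : ℝ → ℕ → ℝ
x ^ zero  = 1ℝ
x ^ suc n = x * x ^ n

∣∣≥⇒≢0 : ∀ {δ p} → 0ℚ ℚ.< δ → δ ℚ.≤ ∣ p ∣ → p ≢ 0ℚ
∣∣≥⇒≢0 0<δ δ≤ refl = ℚₚ.<-irrefl refl (ℚₚ.<-≤-trans 0<δ δ≤)

∣inv∣-bound : ∀ {δ p} → 0ℚ ℚ.< δ → δ ℚ.≤ ∣ p ∣ → ∣ inv p ∣ ℚ.* δ ℚ.≤ 1ℚ
∣inv∣-bound {δ} {p} 0<δ δ≤ = begin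
  ∣ inv p ∣ ℚ.* δ        ≤⟨ *-monoˡ-≤ (ℚₚ.0≤∣p∣ (inv p)) δ≤ ⟩
  ∣ inv p ∣ ℚ.* ∣ p ∣    ≡⟨ ℚₚ.∣p*q∣≡∣p∣*∣q∣ (inv p) p ⟨
  ∣ inv p ℚ.* p ∣        ≡⟨ cong ∣_∣ (inv-inverse p (∣∣≥⇒≢0 0<δ δ≤)) ⟩
  1ℚ                     ∎
  where open ℚₚ.≤-Reasoning

inv-difference : ∀ p q → p ≢ 0ℚ → q ≢ 0ℚ → inv p ℚ.- inv q ≡ (inv p ℚ.* inv q) ℚ.* (q ℚ.- p)
inv-difference p q p≢0 q≢0 = sym (begin
  (inv p ℚ.* inv q) ℚ.* (q ℚ.- p)
    ≡⟨ solve 4 (λ u v p q → (u :* v) :* (q :- p) := u :* (v :* q) :- v :* (u :* p)) refl (inv p) (inv q) p q ⟩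
  inv p ℚ.* (inv q ℚ.* q) ℚ.- inv q ℚ.* (inv p ℚ.* p)
    ≡⟨ cong₂ (λ s t → inv p ℚ.* s ℚ.- inv q ℚ.* t) (inv-inverse q q≢0) (inv-inverse p p≢0) ⟩
  inv p ℚ.* 1ℚ ℚ.- inv q ℚ.* 1ℚ
    ≡⟨ cong₂ ℚ._-_ (ℚₚ.*-identityʳ (inv p)) (ℚₚ.*-identityʳ (inv q)) ⟩
  inv p ℚ.- inv q ∎)
  where
  open ≡-Reasoning
  open ℚ-Solver.+-*-Solver

-- The finitely many vanishing terms that x may have are inverted to 0.
reciprocal : (x : ℝ) → x #0 → ℝ
reciprocal (mkℝ a p) (δ , 0<δ , N₁ , δ≤) = mkℝ (λ n → inv (a n)) inv-cauchy
  where
  inv-cauchy : IsCauchy (λ n → inv (a n))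
  inv-cauchy ε 0<ε with p (ε ℚ.* (δ ℚ.* δ)) (0<p*q 0<ε (0<p*q 0<δ 0<δ))
  ... | N₂ , h = N₁ ℕ.⊔ N₂ , λ m n l₁ l₂ →
    ℚₚ.*-cancelʳ-<-nonNeg (δ ℚ.* δ) {{ℚ.nonNegative (ℚₚ.<⇒≤ (0<p*q 0<δ 0<δ))}}
      (bound m n (δ≤ m (ℕₚ.m⊔n≤o⇒m≤o N₁ N₂ l₁)) (δ≤ n (ℕₚ.m⊔n≤o⇒m≤o N₁ N₂ l₂))
             (h n m (ℕₚ.m⊔n≤o⇒n≤o N₁ N₂ l₂) (ℕₚ.m⊔n≤o⇒n≤o N₁ N₂ l₁)))
    where
    open ℚₚ.≤-Reasoning
    bound : ∀ m n → δ ℚ.≤ ∣ a m ∣ → δ ℚ.≤ ∣ a n ∣ → ∣ a n ℚ.- a m ∣ ℚ.< ε ℚ.* (δ ℚ.* δ) →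
            ∣ inv (a m) ℚ.- inv (a n) ∣ ℚ.* (δ ℚ.* δ) ℚ.< ε ℚ.* (δ ℚ.* δ)
    bound m n δ≤m δ≤n d< = begin-strict
      ∣ u ℚ.- v ∣ ℚ.* (δ ℚ.* δ)
        ≡⟨ cong (λ z → ∣ z ∣ ℚ.* (δ ℚ.* δ)) (inv-difference (a m) (a n) (∣∣≥⇒≢0 0<δ δ≤m) (∣∣≥⇒≢0 0<δ δ≤n)) ⟩
      ∣ (u ℚ.* v) ℚ.* d ∣ ℚ.* (δ ℚ.* δ)
        ≡⟨ cong (ℚ._* (δ ℚ.* δ)) (trans (ℚₚ.∣p*q∣≡∣p∣*∣q∣ (u ℚ.* v) d) (cong (ℚ._* ∣ d ∣) (ℚₚ.∣p*q∣≡∣p∣*∣q∣ u v))) ⟩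
      ((∣ u ∣ ℚ.* ∣ v ∣) ℚ.* ∣ d ∣) ℚ.* (δ ℚ.* δ)
        ≡⟨ rearrange (∣ u ∣) (∣ v ∣) (∣ d ∣) δ ⟩
      ((∣ u ∣ ℚ.* δ) ℚ.* (∣ v ∣ ℚ.* δ)) ℚ.* ∣ d ∣
        ≤⟨ *-mono-≤ (ℚₚ.nonNegative⁻¹ 1ℚ) (ℚₚ.0≤∣p∣ d)
             (*-mono-≤ {b = 1ℚ} {d = 1ℚ} (ℚₚ.nonNegative⁻¹ 1ℚ) 0≤vδ (∣inv∣-bound 0<δ δ≤m) (∣inv∣-bound 0<δ δ≤n))
             ℚₚ.≤-refl ⟩
      1ℚ ℚ.* ∣ d ∣                         ≡⟨ ℚₚ.*-identityˡ ∣ d ∣ ⟩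
      ∣ d ∣                                <⟨ d< ⟩
      ε ℚ.* (δ ℚ.* δ)                      ∎
      where
      u = inv (a m)
      v = inv (a n)
      d = a n ℚ.- a m
      0≤vδ : 0ℚ ℚ.≤ ∣ v ∣ ℚ.* δ
      0≤vδ = subst (ℚ._≤ ∣ v ∣ ℚ.* δ) (ℚₚ.*-zeroʳ ∣ v ∣) (*-monoˡ-≤ (ℚₚ.0≤∣p∣ v) (ℚₚ.<⇒≤ 0<δ))
      rearrange : ∀ u v d δ → ((u ℚ.* v) ℚ.* d) ℚ.* (δ ℚ.* δ) ≡ ((u ℚ.* δ) ℚ.* (v ℚ.* δ)) ℚ.* d
      rearrange = solve 4 (λ u v d δ → ((u :* v) :* d) :* (δ :* δ) := ((u :* δ) :* (v :* δ)) :* d) refl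
        where open ℚ-Solver.+-*-Solver

_÷_[_] : ℝ → (y : ℝ) → y #0 → ℝ
x ÷ y [ y#0 ] = x * reciprocal y y#0

*-#0 : ∀ {x y} → x #0 → y #0 → (x * y) #0
*-#0 {x} {y} (δ , 0<δ , M , h) (η , 0<η , N , k) = δ ℚ.* η , 0<p*q 0<δ 0<η , M ℕ.⊔ N , λ n l →
  subst (δ ℚ.* η ℚ.≤_) (sym (ℚₚ.∣p*q∣≡∣p∣*∣q∣ (seq x n) (seq y n)))
    (*-mono-≤ (ℚₚ.0≤∣p∣ (seq x n)) (ℚₚ.<⇒≤ 0<η)
      (h n (ℕₚ.m⊔n≤o⇒m≤o M N l)) (k n (ℕₚ.m⊔n≤o⇒n≤o M N l)))

^-#0 : ∀ {x} → x #0 → ∀ n → (x ^ n) #0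
^-#0 x#0 zero    = 1ℚ , ℚₚ.positive⁻¹ 1ℚ , 0 , λ _ _ → ℚₚ.≤-refl
^-#0 {x} x#0 (suc n) = *-#0 {x} {x ^ n} x#0 (^-#0 {x} x#0 n)

fromℕ-#0 : ∀ n .{{_ : NonZero n}} → fromℕ n #0
fromℕ-#0 (suc n) = 1ℚ , ℚₚ.positive⁻¹ 1ℚ , 0 , λ _ _ →
  subst (1ℚ ℚ.≤_) (sym (ℚₚ.0≤p⇒∣p∣≡p (frac-≥0 (suc n) 1)))
    (frac-≤ 1 1 (suc n) 1 (ℕ.s≤s ℕ.z≤n))

pos⇒#0 : ∀ {x} → 0ℝ < x → x #0
pos⇒#0 {x} (ε , 0<ε , N , h) = ε , 0<ε , N , λ n l →
  let ε≤x = subst (ℚ._≤ seq x n) (ℚₚ.+-identityˡ ε) (h n l) in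
  subst (ε ℚ.≤_) (sym (ℚₚ.0≤p⇒∣p∣≡p (ℚₚ.≤-trans (ℚₚ.<⇒≤ 0<ε) ε≤x))) ε≤x

infix 4 _⟶_

_⟶_ : (ℕ → ℝ) → ℝ → Set
f ⟶ L = ∀ ε → 0ℚ ℚ.< ε → ∃[ N ] (∀ n → N ℕ.≤ n → L - fromℚ ε < f n × f n < L + fromℚ ε)

partialSum : (ℕ → ℝ) → ℕ → ℝ
partialSum f zero    = 0ℝ
partialSum f (suc n) = partialSum f n + f n

∑[1≤j<_] : ∀ l → (∀ j → .(0 ℕ.< j) → .(j ℕ.< l) → ℝ) → ℝ
∑[1≤j< zero ]        f = 0ℝ
∑[1≤j< suc zero ]    f = 0ℝ
∑[1≤j< suc (suc n) ] f =
  ∑[1≤j< suc n ] (λ j 0<j j<l → f j 0<j (ℕₚ.m<n⇒m<1+n j<l)) + f (suc n) ℕ.z<s ℕₚ.≤-refl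

partialSumℚ : (ℕ → ℚ) → ℕ → ℚ
partialSumℚ a zero    = 0ℚ
partialSumℚ a (suc n) = partialSumℚ a n ℚ.+ a n

series : (a : ℕ → ℚ) → IsCauchy (partialSumℚ a) → ℝ
series a = mkℝ (partialSumℚ a)

cauchy-from-rate : ∀ {s} c →
  (∀ N d → ∣ s (N ℕ.+ d) ℚ.- s N ∣ ℚ.≤ + c / suc N) → IsCauchy s
cauchy-from-rate {s} c h = cauchy-from {s} λ ε 0<ε →
  let N , k = archimedean c ε 0<ε in N , λ n N≤n →
  ℚₚ.≤-<-trans (subst (λ z → ∣ s z ℚ.- s N ∣ ℚ.≤ + c / suc N) (ℕₚ.m+[n∸m]≡n N≤n) (h N (n ℕ.∸ N)))
               (k N ℕₚ.≤-refl)

≤⇒0≤- : ∀ {p q} → p ℚ.≤ q → 0ℚ ℚ.≤ q ℚ.- p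
≤⇒0≤- {p} {q} p≤q = subst (ℚ._≤ q ℚ.- p) (ℚₚ.+-inverseʳ p) (ℚₚ.+-monoˡ-≤ (ℚ.- p) p≤q)

telescoping-cauchy : ∀ {a : ℕ → ℚ} {c : ℕ} → (∀ k → 0ℚ ℚ.≤ a k) →
  (∀ k → a k ℚ.+ + c / suc (suc k) ℚ.≤ + c / suc k) → IsCauchy (partialSumℚ a)
telescoping-cauchy {a} {c} a≥0 step = cauchy-from-rate {partialSumℚ a} c λ N d → begin
  ∣ S (N ℕ.+ d) ℚ.- S N ∣   ≡⟨ ℚₚ.0≤p⇒∣p∣≡p (≤⇒0≤- (mono N d)) ⟩
  S (N ℕ.+ d) ℚ.- S N       ≤⟨ ℚₚ.+-monoˡ-≤ (ℚ.- S N) (upper N d) ⟩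
  (S N ℚ.+ u N) ℚ.- S N     ≡⟨ solve 2 (λ s u → (s :+ u) :- s := u) refl (S N) (u N) ⟩
  u N                       ∎
  where
  open ℚₚ.≤-Reasoning
  open ℚ-Solver.+-*-Solver
  S = partialSumℚ a
  u : ℕ → ℚ
  u k = + c / suc k
  mono : ∀ N d → S N ℚ.≤ S (N ℕ.+ d)
  mono N zero    = ℚₚ.≤-reflexive (cong S (sym (ℕₚ.+-identityʳ N)))
  mono N (suc d) = begin
    S N                            ≤⟨ mono N d ⟩
    S (N ℕ.+ d)                    ≡⟨ ℚₚ.+-identityʳ _ ⟨
    S (N ℕ.+ d) ℚ.+ 0ℚ             ≤⟨ ℚₚ.+-monoʳ-≤ (S (N ℕ.+ d)) (a≥0 (N ℕ.+ d)) ⟩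
    S (suc (N ℕ.+ d))              ≡⟨ cong S (ℕₚ.+-suc N d) ⟨
    S (N ℕ.+ suc d)                ∎
  total : ∀ N d → S (N ℕ.+ d) ℚ.+ u (N ℕ.+ d) ℚ.≤ S N ℚ.+ u N
  total N zero    = ℚₚ.≤-reflexive (cong (λ z → S z ℚ.+ u z) (ℕₚ.+-identityʳ N))
  total N (suc d) = begin
    S (N ℕ.+ suc d) ℚ.+ u (N ℕ.+ suc d)               ≡⟨ cong (λ z → S z ℚ.+ u z) (ℕₚ.+-suc N d) ⟩
    (S (N ℕ.+ d) ℚ.+ a (N ℕ.+ d)) ℚ.+ u (suc (N ℕ.+ d)) ≡⟨ ℚₚ.+-assoc (S (N ℕ.+ d)) (a (N ℕ.+ d)) (u (suc (N ℕ.+ d))) ⟩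
    S (N ℕ.+ d) ℚ.+ (a (N ℕ.+ d) ℚ.+ u (suc (N ℕ.+ d))) ≤⟨ ℚₚ.+-monoʳ-≤ (S (N ℕ.+ d)) (step (N ℕ.+ d)) ⟩
    S (N ℕ.+ d) ℚ.+ u (N ℕ.+ d)                       ≤⟨ total N d ⟩
    S N ℚ.+ u N                                       ∎
  upper : ∀ N d → S (N ℕ.+ d) ℚ.≤ S N ℚ.+ u N
  upper N d = begin
    S (N ℕ.+ d)                    ≡⟨ ℚₚ.+-identityʳ _ ⟨
    S (N ℕ.+ d) ℚ.+ 0ℚ             ≤⟨ ℚₚ.+-monoʳ-≤ (S (N ℕ.+ d)) (frac-≥0 c (suc (N ℕ.+ d))) ⟩
    S (N ℕ.+ d) ℚ.+ u (N ℕ.+ d)    ≤⟨ total N d ⟩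
    S N ℚ.+ u N                    ∎

sign : ℕ → ℚ
sign zero    = 1ℚ
sign (suc k) = ℚ.- sign k

∣sign∣≡1 : ∀ k → ∣ sign k ∣ ≡ 1ℚ
∣sign∣≡1 zero    = refl
∣sign∣≡1 (suc k) = trans (ℚₚ.∣-p∣≡∣p∣ (sign k)) (∣sign∣≡1 k)

sign-frac : ∀ k d .{{_ : NonZero d}} → (ℤ.-1ℤ ℤ.^ k) / d ≡ sign k ℚ.* (+ 1 / d)
sign-frac zero    d = sym (ℚₚ.*-identityˡ (+ 1 / d))
sign-frac (suc k) d = begin
  (ℤ.-1ℤ ℤ.* ℤ.-1ℤ ℤ.^ k) / d     ≡⟨ cong (_/ d) (ℤₚ.-1*i≡-i (ℤ.-1ℤ ℤ.^ k)) ⟩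
  (ℤ.- (ℤ.-1ℤ ℤ.^ k)) / d         ≡⟨ neg-frac (ℤ.-1ℤ ℤ.^ k) d ⟩
  ℚ.- ((ℤ.-1ℤ ℤ.^ k) / d)         ≡⟨ cong ℚ.-_ (sign-frac k d) ⟩
  ℚ.- (sign k ℚ.* (+ 1 / d))      ≡⟨ ℚₚ.neg-distribˡ-* (sign k) (+ 1 / d) ⟩
  ℚ.- sign k ℚ.* (+ 1 / d)        ∎
  where open ≡-Reasoning

alternating-cauchy : ∀ {a b : ℕ → ℚ} {c : ℕ} → (∀ k → a k ≡ sign k ℚ.* b k) →
  (∀ k → 0ℚ ℚ.≤ b k) → (∀ k → b (suc k) ℚ.≤ b k) → (∀ k → b k ℚ.≤ + c / suc k) →
  IsCauchy (partialSumℚ a)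
alternating-cauchy {a} {b} {c} a≡ b≥0 dec rate = cauchy-from-rate {partialSumℚ a} c λ N d → begin
  ∣ S (N ℕ.+ d) ℚ.- S N ∣                ≡⟨ cong (λ z → ∣ z ℚ.- S N ∣) (expand N d) ⟩
  ∣ (S N ℚ.+ sign N ℚ.* U N d) ℚ.- S N ∣ ≡⟨ cong ∣_∣ (solve 2 (λ s u → (s :+ u) :- s := u) refl (S N) (sign N ℚ.* U N d)) ⟩
  ∣ sign N ℚ.* U N d ∣                   ≡⟨ ℚₚ.∣p*q∣≡∣p∣*∣q∣ (sign N) (U N d) ⟩
  ∣ sign N ∣ ℚ.* ∣ U N d ∣               ≡⟨ cong₂ ℚ._*_ (∣sign∣≡1 N) (ℚₚ.0≤p⇒∣p∣≡p (U≥0 N d)) ⟩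
  1ℚ ℚ.* U N d                           ≡⟨ ℚₚ.*-identityˡ (U N d) ⟩
  U N d                                  ≤⟨ U≤b N d ⟩
  b N                                    ≤⟨ rate N ⟩
  + c / suc N                            ∎
  where
  open ℚₚ.≤-Reasoning
  open ℚ-Solver.+-*-Solver
  S = partialSumℚ a
  U : ℕ → ℕ → ℚ
  U N zero    = 0ℚ
  U N (suc d) = b N ℚ.- U (suc N) d
  U≥0 : ∀ N d → 0ℚ ℚ.≤ U N d
  U≤b : ∀ N d → U N d ℚ.≤ b N
  U≥0 N zero    = ℚₚ.≤-refl
  U≥0 N (suc d) = ≤⇒0≤- (ℚₚ.≤-trans (U≤b (suc N) d) (dec N))
  U≤b N zero    = b≥0 N
  U≤b N (suc d) = begin
    b N ℚ.- U (suc N) d    ≤⟨ ℚₚ.+-monoʳ-≤ (b N) (ℚₚ.neg-antimono-≤ (U≥0 (suc N) d)) ⟩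
    b N ℚ.+ 0ℚ             ≡⟨ ℚₚ.+-identityʳ (b N) ⟩
    b N                    ∎
  expand : ∀ N d → S (N ℕ.+ d) ≡ S N ℚ.+ sign N ℚ.* U N d
  expand N zero    = trans (cong S (ℕₚ.+-identityʳ N))
    (solve 2 (λ s t → s := s :+ t :* con 0ℚ) refl (S N) (sign N))
  expand N (suc d) = begin-equality
    S (N ℕ.+ suc d)                                        ≡⟨ cong S (ℕₚ.+-suc N d) ⟩
    S (suc N ℕ.+ d)                                        ≡⟨ expand (suc N) d ⟩
    (S N ℚ.+ a N) ℚ.+ ℚ.- sign N ℚ.* U (suc N) d           ≡⟨ cong (λ z → (S N ℚ.+ z) ℚ.+ ℚ.- sign N ℚ.* U (suc N) d) (a≡ N) ⟩
    (S N ℚ.+ sign N ℚ.* b N) ℚ.+ ℚ.- sign N ℚ.* U (suc N) d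
      ≡⟨ solve 4 (λ s t b u → (s :+ t :* b) :+ (:- t) :* u := s :+ t :* (b :- u)) refl (S N) (sign N) (b N) (U (suc N) d) ⟩
    S N ℚ.+ sign N ℚ.* (b N ℚ.- U (suc N) d)               ∎

inverse-square-step : ∀ k D .{{_ : NonZero D}} → suc k ℕ.* suc k ℕ.≤ D →
  (+ 1 / D) ℚ.+ (+ 2 / suc (suc k)) ℚ.≤ + 2 / suc k
inverse-square-step k D h = begin
  (+ 1 / D) ℚ.+ (+ 2 / suc (suc k))
    ≤⟨ ℚₚ.+-mono-≤ (frac-≤ 1 D 2 E small)
         (ℚₚ.≤-reflexive (frac-≡ 2 (suc (suc k)) (2 ℕ.* suc k) E (sym (ℕₚ.*-assoc 2 (suc k) (suc (suc k)))))) ⟩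
  (+ 2 / E) ℚ.+ (+ (2 ℕ.* suc k) / E)
    ≡⟨ frac-+ 2 (2 ℕ.* suc k) E ⟩
  + (2 ℕ.+ 2 ℕ.* suc k) / E
    ≡⟨ frac-≡ (2 ℕ.+ 2 ℕ.* suc k) E 2 (suc k)
         (solve 1 (λ m → (con 2 :+ con 2 :* m) :* m := con 2 :* (m :* (con 1 :+ m))) refl (suc k)) ⟩
  + 2 / suc k ∎
  where
  open ℚₚ.≤-Reasoning
  open +-*-Solver
  E = suc k ℕ.* suc (suc k)
  small : 1 ℕ.* E ℕ.≤ 2 ℕ.* D
  small = ℕₚ.≤-trans
    (subst₂ ℕ._≤_
      (solve 1 (λ m → m :* (con 1 :+ m) := con 1 :* (m :* (con 1 :+ m))) refl (suc k))
      (solve 1 (λ m → m :* (m :+ m) := con 2 :* (m :* m)) refl (suc k))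
      (ℕₚ.*-monoʳ-≤ (suc k) (ℕₚ.+-monoˡ-≤ (suc k) (ℕ.s≤s {0} {k} ℕ.z≤n))))
    (ℕₚ.*-monoʳ-≤ 2 h)

square≤power : ∀ {m n s} .{{_ : NonZero n}} → m ℕ.≤ n → 2 ℕ.≤ s → m ℕ.* m ℕ.≤ n ℕ.^ s
square≤power {m} {n} m≤n 2≤s = ℕₚ.≤-trans
  (subst (m ℕ.* m ℕ.≤_) (cong (n ℕ.*_) (sym (ℕₚ.*-identityʳ n))) (ℕₚ.*-mono-≤ m≤n m≤n))
  (ℕₚ.^-monoʳ-≤ n 2≤s)

k<2k+1 : ∀ k → suc k ℕ.≤ suc (2 ℕ.* k)
k<2k+1 k = ℕ.s≤s (ℕₚ.m≤m+n k (k ℕ.+ 0))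

-- ζ, λ and β at positive integers.  The index k below is n - 1.

ζ-term λ-term β-term : ℕ → ℕ → ℚ
ζ-term s k = _/_ (+ 1) (suc k ℕ.^ s) {{ℕₚ.m^n≢0 (suc k) s}}
λ-term s k = _/_ (+ 1) (suc (2 ℕ.* k) ℕ.^ s) {{ℕₚ.m^n≢0 (suc (2 ℕ.* k)) s}}
β-term s k = _/_ (ℤ.-1ℤ ℤ.^ k) (suc (2 ℕ.* k) ℕ.^ s) {{ℕₚ.m^n≢0 (suc (2 ℕ.* k)) s}}

ζ-cauchy : ∀ s .{{_ : NonTrivial s}} → IsCauchy (partialSumℚ (ζ-term s))
ζ-cauchy s = telescoping-cauchy {ζ-term s} {2}
  (λ k → frac-≥0 1 (suc k ℕ.^ s) {{ℕₚ.m^n≢0 (suc k) s}})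
  (λ k → inverse-square-step k (suc k ℕ.^ s) {{ℕₚ.m^n≢0 (suc k) s}}
           (square≤power {suc k} ℕₚ.≤-refl (ℕ.nonTrivial⇒n>1 s)))

λ-cauchy : ∀ s .{{_ : NonTrivial s}} → IsCauchy (partialSumℚ (λ-term s))
λ-cauchy s = telescoping-cauchy {λ-term s} {2}
  (λ k → frac-≥0 1 (suc (2 ℕ.* k) ℕ.^ s) {{ℕₚ.m^n≢0 (suc (2 ℕ.* k)) s}})
  (λ k → inverse-square-step k (suc (2 ℕ.* k) ℕ.^ s) {{ℕₚ.m^n≢0 (suc (2 ℕ.* k)) s}}
           (square≤power {suc k} (k<2k+1 k) (ℕ.nonTrivial⇒n>1 s)))

β-cauchy : ∀ s .{{_ : NonZero s}} → IsCauchy (partialSumℚ (β-term s))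
β-cauchy s = alternating-cauchy {β-term s} {λ-term s} {1}
  (λ k → sign-frac k (d k) {{nz k}})
  (λ k → frac-≥0 1 (d k) {{nz k}})
  (λ k → frac-≤ 1 (d (suc k)) 1 (d k) {{nz (suc k)}} {{nz k}}
           (ℕₚ.*-monoʳ-≤ 1 (ℕₚ.^-monoˡ-≤ s (ℕ.s≤s (ℕₚ.*-monoʳ-≤ 2 (ℕₚ.n≤1+n k))))))
  (λ k → frac-≤ 1 (d k) 1 (suc k) {{nz k}} (ℕₚ.*-monoʳ-≤ 1 (k<d k)))
  where
  d : ℕ → ℕ
  d k = suc (2 ℕ.* k) ℕ.^ s
  nz : ∀ k → NonZero (d k)
  nz k = ℕₚ.m^n≢0 (suc (2 ℕ.* k)) s
  k<d : ∀ k → suc k ℕ.≤ d k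
  k<d k = ℕₚ.≤-trans (k<2k+1 k)
    (subst (ℕ._≤ d k) (ℕₚ.*-identityʳ (suc (2 ℕ.* k)))
      (ℕₚ.^-monoʳ-≤ (suc (2 ℕ.* k)) (ℕ.>-nonZero⁻¹ s)))

ζ : (s : ℕ) .{{_ : NonTrivial s}} → ℝ
ζ s = series (ζ-term s) (ζ-cauchy s)

lambda : (s : ℕ) .{{_ : NonTrivial s}} → ℝ
lambda s = series (λ-term s) (λ-cauchy s)

β : (s : ℕ) .{{_ : NonZero s}} → ℝ
β s = series (β-term s) (β-cauchy s)

-- Γ at positive integers, as the Euler–Gauss limit
--   Γ(s) = lim_{n → ∞} n! n^s / (s (s + 1) ⋯ (s + n))

-- rising s n is s (s + 1) ⋯ (s + n), with n + 1 factors.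
rising : ℕ → ℕ → ℕ
rising s zero    = s
rising s (suc n) = rising s n ℕ.* (s ℕ.+ suc n)

rising≢0 : ∀ s n .{{_ : NonZero s}} → NonZero (rising s n)
rising≢0 (suc s) zero    = _
rising≢0 (suc s) (suc n) =
  ℕₚ.m*n≢0 (rising (suc s) n) (suc s ℕ.+ suc n) {{rising≢0 (suc s) n}}

gauss : (s : ℕ) .{{_ : NonZero s}} → ℕ → ℚ
gauss s n = _/_ (+ (n ! ℕ.* n ℕ.^ s)) (rising s n) {{rising≢0 s n}}

TendsTo : (ℕ → ℚ) → ℚ → Set
TendsTo a c = ∀ ε → 0ℚ ℚ.< ε → ∃[ N ] (∀ n → N ℕ.≤ n → ∣ a n ℚ.- c ∣ ℚ.< ε)

tends-const : ∀ c → TendsTo (λ _ → c) c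
tends-const c ε 0<ε = 0 , λ _ _ → subst (ℚ._< ε) (sym (cong ∣_∣ (ℚₚ.+-inverseʳ c))) 0<ε

tends-cauchy : ∀ {a} c → TendsTo a c → IsCauchy a
tends-cauchy {a} c t ε 0<ε = proj₁ t′ , λ m n l₁ l₂ →
  ∣∣-triangle-< {a m} {a n} {c} {ε} (proj₂ t′ m l₁)
    (subst (ℚ._< ½ ℚ.* ε) (∣-∣-sym (a n) c) (proj₂ t′ n l₂))
  where
  t′ : ∃[ N ] (∀ n → N ℕ.≤ n → ∣ a n ℚ.- c ∣ ℚ.< ½ ℚ.* ε)
  t′ = t (½ ℚ.* ε) (half>0 {ε} 0<ε)

tends-* : ∀ {a b} c d → TendsTo a c → TendsTo b d → TendsTo (λ n → a n ℚ.* b n) (c ℚ.* d)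
tends-* {a} {b} c d s t ε 0<ε =
  combine (common-bound {a} {λ _ → d} (tends-cauchy {a} c s) (cauchy (fromℚ d)))
  where
  combine : ∃[ M ] (0ℚ ℚ.< M × ∃[ N ] (EventuallyBoundedBy a M N × EventuallyBoundedBy (λ _ → d) M N)) →
            ∃[ N ] (∀ n → N ℕ.≤ n → ∣ a n ℚ.* b n ℚ.- c ℚ.* d ∣ ℚ.< ε)
  combine (M , 0<M , N₀ , a≤M , d≤M) =
    let ε′ = inv M ℚ.* (½ ℚ.* ε)
        0<ε′ = 0<p*q {inv M} {½ ℚ.* ε} (inv>0 {M} 0<M) (half>0 {ε} 0<ε)
        N₁ , h = s ε′ 0<ε′
        N₂ , k = t ε′ 0<ε′
    in N₀ ℕ.⊔ (N₁ ℕ.⊔ N₂) , λ n l →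
      product-close {a n} {b n} {c} {d} {M} {ε} 0<M
        (a≤M n (ℕₚ.m⊔n≤o⇒m≤o N₀ _ l)) (d≤M n (ℕₚ.m⊔n≤o⇒m≤o N₀ _ l))
        (k n (ℕₚ.m⊔n≤o⇒n≤o N₁ N₂ (ℕₚ.m⊔n≤o⇒n≤o N₀ _ l)))
        (h n (ℕₚ.m⊔n≤o⇒m≤o N₁ N₂ (ℕₚ.m⊔n≤o⇒n≤o N₀ _ l)))

tends-cong : ∀ {a b} c → (∀ n → a n ≡ b n) → TendsTo a c → TendsTo b c
tends-cong {a} {b} c a≡b t ε 0<ε with t ε 0<ε
... | N , h = N , λ n l → subst (λ z → ∣ z ℚ.- c ∣ ℚ.< ε) (a≡b n) (h n l)

tends-ratio : ∀ m → TendsTo (λ n → + n / suc (m ℕ.+ n)) 1ℚ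
tends-ratio m ε 0<ε with archimedean (suc m) ε 0<ε
... | N , h = N , λ n l → ℚₚ.≤-<-trans (bound n) (h n l)
  where
  open ℚₚ.≤-Reasoning
  bound : ∀ n → ∣ (+ n / suc (m ℕ.+ n)) ℚ.- 1ℚ ∣ ℚ.≤ + suc m / suc n
  bound n = begin
    ∣ x ℚ.- 1ℚ ∣               ≡⟨ cong (λ z → ∣ x ℚ.- z ∣) 1≡ ⟩
    ∣ x ℚ.- (x ℚ.+ y) ∣        ≡⟨ cong ∣_∣ (solve 2 (λ x y → x :- (x :+ y) := :- y) refl x y) ⟩
    ∣ ℚ.- y ∣                  ≡⟨ ℚₚ.∣-p∣≡∣p∣ y ⟩
    ∣ y ∣                      ≡⟨ ℚₚ.0≤p⇒∣p∣≡p (frac-≥0 (suc m) D) ⟩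
    y                          ≤⟨ frac-≤ (suc m) D (suc m) (suc n) (ℕₚ.*-monoʳ-≤ (suc m) (ℕ.s≤s (ℕₚ.m≤n+m n m))) ⟩
    + suc m / suc n            ∎
    where
    open ℚ-Solver.+-*-Solver
    D = suc (m ℕ.+ n)
    x = + n / D
    y = + suc m / D
    1≡ : 1ℚ ≡ x ℚ.+ y
    1≡ = sym (trans (frac-+ n (suc m) D)
      (frac-≡ (n ℕ.+ suc m) D 1 1
        (trans (ℕₚ.*-identityʳ _) (trans (ℕₚ.+-comm n (suc m)) (sym (ℕₚ.*-identityˡ D))))))

rising-shift : ∀ m n → m ℕ.* rising (suc m) n ≡ rising m n ℕ.* suc (m ℕ.+ n)
rising-shift m zero    = cong (λ z → m ℕ.* suc z) (sym (ℕₚ.+-identityʳ m))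
rising-shift m (suc n) = begin
  m ℕ.* (rising (suc m) n ℕ.* (suc m ℕ.+ suc n))      ≡⟨ ℕₚ.*-assoc m (rising (suc m) n) _ ⟨
  m ℕ.* rising (suc m) n ℕ.* (suc m ℕ.+ suc n)        ≡⟨ cong (ℕ._* (suc m ℕ.+ suc n)) (rising-shift m n) ⟩
  rising m n ℕ.* suc (m ℕ.+ n) ℕ.* (suc m ℕ.+ suc n)  ≡⟨ cong (λ z → rising m n ℕ.* z ℕ.* (suc m ℕ.+ suc n)) (sym (ℕₚ.+-suc m n)) ⟩
  rising m n ℕ.* (m ℕ.+ suc n) ℕ.* suc (m ℕ.+ suc n)  ∎
  where open ≡-Reasoning

rising-1 : ∀ n → rising 1 n ≡ suc n ℕ.* n !
rising-1 zero    = refl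
rising-1 (suc n) = trans (cong (ℕ._* suc (suc n)) (rising-1 n)) (ℕₚ.*-comm (suc n ℕ.* n !) (suc (suc n)))

gauss-step : ∀ p n →
  gauss (suc p) n ℚ.* ((+ suc p / 1) ℚ.* (+ n / suc (suc p ℕ.+ n))) ≡ gauss (suc (suc p)) n
gauss-step p n = begin
  gauss m n ℚ.* ((+ m / 1) ℚ.* (+ n / D))
    ≡⟨ cong (gauss m n ℚ.*_) (trans (frac-* m 1 n D) (ℚₚ./-cong {+ (m ℕ.* n)} {1 ℕ.* D} {+ (m ℕ.* n)} {D} refl (ℕₚ.*-identityˡ D))) ⟩
  gauss m n ℚ.* (+ (m ℕ.* n) / D)
    ≡⟨ frac-* (n ! ℕ.* n ℕ.^ m) R (m ℕ.* n) D {{rising≢0 m n}} ⟩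
  _/_ (+ ((n ! ℕ.* n ℕ.^ m) ℕ.* (m ℕ.* n))) (R ℕ.* D) {{RD≢0}}
    ≡⟨ frac-≡ ((n ! ℕ.* n ℕ.^ m) ℕ.* (m ℕ.* n)) (R ℕ.* D) (n ! ℕ.* (n ℕ.* n ℕ.^ m)) (rising (suc m) n) {{RD≢0}} {{rising≢0 (suc m) n}} cross ⟩
  gauss (suc m) n ∎
  where
  open ≡-Reasoning
  open +-*-Solver
  m = suc p
  D = suc (m ℕ.+ n)
  R = rising m n
  RD≢0 : NonZero (R ℕ.* D)
  RD≢0 = ℕₚ.m*n≢0 R D {{rising≢0 m n}}
  cross : (n ! ℕ.* n ℕ.^ m) ℕ.* (m ℕ.* n) ℕ.* rising (suc m) n ≡ n ! ℕ.* (n ℕ.* n ℕ.^ m) ℕ.* (R ℕ.* D)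
  cross = trans
    (solve 5 (λ f e m n r → (f :* e) :* (m :* n) :* r := f :* (n :* e) :* (m :* r)) refl
      (n !) (n ℕ.^ m) m n (rising (suc m) n))
    (cong (n ! ℕ.* (n ℕ.* n ℕ.^ m) ℕ.*_) (rising-shift m n))

gauss-tends : ∀ p → ∃[ c ] (0ℚ ℚ.< c × TendsTo (gauss (suc p)) c)
gauss-tends zero = 1ℚ , ℚₚ.positive⁻¹ 1ℚ , tends-cong {λ n → + n / suc n} {gauss 1} 1ℚ eq (tends-ratio 0)
  where
  open +-*-Solver
  eq : ∀ n → + n / suc n ≡ gauss 1 n
  eq n = frac-≡ n (suc n) (n ! ℕ.* n ℕ.^ 1) (rising 1 n) {{_}} {{rising≢0 1 n}}
    (trans (cong (n ℕ.*_) (rising-1 n))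
      (solve 2 (λ n f → n :* ((con 1 :+ n) :* f) := f :* (n :* con 1) :* (con 1 :+ n)) refl n (n !)))
gauss-tends (suc p) with gauss-tends p
... | c , 0<c , t = c ℚ.* ((+ suc p / 1) ℚ.* 1ℚ)
  , 0<p*q 0<c (0<p*q (ℚₚ.positive⁻¹ (+ suc p / 1) {{ℚₚ.normalize-pos (suc p) 1}}) (ℚₚ.positive⁻¹ 1ℚ))
  , tends-cong {λ n → gauss (suc p) n ℚ.* ((+ suc p / 1) ℚ.* (+ n / suc (suc p ℕ.+ n)))} {gauss (suc (suc p))} _ (gauss-step p)
      (tends-* {gauss (suc p)} {λ n → (+ suc p / 1) ℚ.* (+ n / suc (suc p ℕ.+ n))} c _ t
        (tends-* {λ _ → + suc p / 1} {λ n → + n / suc (suc p ℕ.+ n)} _ 1ℚ (tends-const (+ suc p / 1)) (tends-ratio (suc p))))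

gauss-cauchy : ∀ s .{{_ : NonZero s}} → IsCauchy (gauss s)
gauss-cauchy (suc p) = let c , _ , t = gauss-tends p in tends-cauchy {gauss (suc p)} c t

Γ : (s : ℕ) .{{_ : NonZero s}} → ℝ
Γ s = mkℝ (gauss s) (gauss-cauchy s)

Γ-#0 : ∀ s .{{_ : NonZero s}} → Γ s #0
Γ-#0 (suc p) with gauss-tends p
... | c , 0<c , t with t (½ ℚ.* c) (half>0 0<c)
...   | N , h = ½ ℚ.* c , half>0 0<c , N , λ n l → bound (gauss (suc p) n) (h n l)
  where
  open ℚₚ.≤-Reasoning
  open ℚ-Solver.+-*-Solver
  bound : ∀ g → ∣ g ℚ.- c ∣ ℚ.< ½ ℚ.* c → ½ ℚ.* c ℚ.≤ ∣ g ∣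
  bound g g≈c = begin
    ½ ℚ.* c                                    ≡⟨ solve 1 (λ c → con ½ :* c := c :- con ½ :* c) refl c ⟩
    c ℚ.- ½ ℚ.* c                              ≤⟨ ℚₚ.+-monoˡ-≤ (ℚ.- (½ ℚ.* c)) c≤ ⟩
    (∣ g ∣ ℚ.+ ½ ℚ.* c) ℚ.- ½ ℚ.* c            ≡⟨ solve 2 (λ g h → (g :+ h) :- h := g) refl (∣ g ∣) (½ ℚ.* c) ⟩
    ∣ g ∣                                      ∎
    where
    c≤ : c ℚ.≤ ∣ g ∣ ℚ.+ ½ ℚ.* c
    c≤ = begin
      c                                        ≡⟨ ℚₚ.0≤p⇒∣p∣≡p (ℚₚ.<⇒≤ 0<c) ⟨
      ∣ c ∣                                    ≡⟨ cong ∣_∣ (solve 2 (λ c g → c := g :- (g :- c)) refl c g) ⟩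
      ∣ g ℚ.- (g ℚ.- c) ∣                      ≤⟨ ℚₚ.∣p-q∣≤∣p∣+∣q∣ g (g ℚ.- c) ⟩
      ∣ g ∣ ℚ.+ ∣ g ℚ.- c ∣                    ≤⟨ ℚₚ.+-monoʳ-≤ (∣ g ∣) (ℚₚ.<⇒≤ g≈c) ⟩
      ∣ g ∣ ℚ.+ ½ ℚ.* c                        ∎

-- π: the least positive zero of sin

sin-term : ℝ → ℕ → ℝ
sin-term x k = ((- 1ℝ) ^ k * x ^ suc (2 ℕ.* k)) ÷ fromℕ (suc (2 ℕ.* k) !) [ fromℕ-#0 (suc (2 ℕ.* k) !) {{ℕₚ._!≢0 (suc (2 ℕ.* k))}} ]

-- Sin x y: the power series of sin at x converges to y.
Sin : ℝ → ℝ → Set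
Sin x y = partialSum (sin-term x) ⟶ y

IsPi : ℝ → Set
IsPi π = 0ℝ < π × Sin π 0ℝ × (∀ x → 0ℝ < x → x < π → ¬ Sin x 0ℝ)

IsPi⇒#0 : ∀ {π} → IsPi π → π #0
IsPi⇒#0 {π} (0<π , _) = pos⇒#0 {π} 0<π

-- Bernoulli numbers, by the identity of formal power series
--   (∑ B_n xⁿ / n!) (eˣ - 1) = x

1/_! : ℕ → ℚ
1/ n ! = _/_ (+ 1) (n !) {{ℕₚ._!≢0 n}}

-- The coefficient of xⁿ in a product of formal power series.
cauchyProduct : (ℕ → ℚ) → (ℕ → ℚ) → ℕ → ℚ
cauchyProduct f g n = partialSumℚ (λ k → f k ℚ.* g (n ℕ.∸ k)) (suc n)

exp-1 : ℕ → ℚ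
exp-1 zero    = 0ℚ
exp-1 (suc n) = 1/ suc n !

X : ℕ → ℚ
X 1 = 1ℚ
X _ = 0ℚ

IsBernoulli : (ℕ → ℚ) → Set
IsBernoulli B = ∀ n → cauchyProduct (λ k → B k ℚ.* 1/ k !) exp-1 n ≡ X n

2l-1≢0 : ∀ l .{{_ : NonZero l}} → NonZero (2 ℕ.* l ℕ.∸ 1)
2l-1≢0 (suc n) = subst NonZero (sym (ℕₚ.+-suc n (n ℕ.+ 0))) _

2l-2j≢0 : ∀ l j → .(j ℕ.< l) → NonZero (2 ℕ.* l ℕ.∸ 2 ℕ.* j)
2l-2j≢0 l j j<l =
  ℕ.>-nonZero (ℕₚ.m<n⇒0<n∸m (ℕₚ.*-monoʳ-< 2 (recompute (j ℕₚ.<? l) j<l)))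

2j+1≢0 : ∀ j → NonZero (2 ℕ.* j ℕ.+ 1)
2j+1≢0 j = subst NonZero (ℕₚ.+-comm 1 (2 ℕ.* j)) _

2j≢0,1 : ∀ j → .(0 ℕ.< j) → NonTrivial (2 ℕ.* j)
2j≢0,1 j 0<j = ℕ.n>1⇒nonTrivial (ℕₚ.*-monoʳ-≤ 2 (recompute (0 ℕₚ.<? j) 0<j))

2^≢0 : ∀ n → NonZero (2 ℕ.^ n)
2^≢0 n = ℕₚ.m^n≢0 2 n

prefactor : ℝ → ℕ → ℝ
prefactor π l =
  ((- 1ℝ) ^ (l ℕ.+ 1) * π ^ (2 ℕ.* l ℕ.∸ 1)) ÷ fromℕ (2 ℕ.^ (2 ℕ.* l)) [ fromℕ-#0 (2 ℕ.^ (2 ℕ.* l)) {{2^≢0 (2 ℕ.* l)}} ]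

1/Γ : (s : ℕ) .{{_ : NonZero s}} → ℝ
1/Γ s = 1ℝ ÷ Γ s [ Γ-#0 s ]

module _ (π : ℝ) (π#0 : π #0) (l j : ℕ) .(0<j : 0 ℕ.< j) .(j<l : j ℕ.< l) where
  private instance
    2j>1 : NonTrivial (2 ℕ.* j)
    2j>1 = 2j≢0,1 j 0<j
    2l-2j>0 : NonZero (2 ℕ.* l ℕ.∸ 2 ℕ.* j)
    2l-2j>0 = 2l-2j≢0 l j j<l
    2j+1>0 : NonZero (2 ℕ.* j ℕ.+ 1)
    2j+1>0 = 2j+1≢0 j

  λ-summand : ℝ
  λ-summand =
    ((- 1ℝ) ^ j * fromℕ (2 ℕ.^ (2 ℕ.* j)) * lambda (2 ℕ.* j))
      ÷ (Γ (2 ℕ.* l ℕ.∸ 2 ℕ.* j) * π ^ (2 ℕ.* j))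
      [ *-#0 {Γ (2 ℕ.* l ℕ.∸ 2 ℕ.* j)} {π ^ (2 ℕ.* j)} (Γ-#0 (2 ℕ.* l ℕ.∸ 2 ℕ.* j)) (^-#0 {π} π#0 (2 ℕ.* j)) ]

  ζ-summand : ℝ
  ζ-summand =
    ((- 1ℝ) ^ j * (fromℕ (2 ℕ.^ (2 ℕ.* j)) - 1ℝ) * ζ (2 ℕ.* j))
      ÷ (Γ (2 ℕ.* l ℕ.∸ 2 ℕ.* j) * π ^ (2 ℕ.* j))
      [ *-#0 {Γ (2 ℕ.* l ℕ.∸ 2 ℕ.* j)} {π ^ (2 ℕ.* j)} (Γ-#0 (2 ℕ.* l ℕ.∸ 2 ℕ.* j)) (^-#0 {π} π#0 (2 ℕ.* j)) ]

  B-summand : (ℕ → ℚ) → ℝ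
  B-summand B =
    (fromℕ (2 ℕ.^ (2 ℕ.* j)) * (fromℕ (2 ℕ.^ (2 ℕ.* j)) - 1ℝ) * fromℚ (B (2 ℕ.* j)))
      ÷ (Γ (2 ℕ.* l ℕ.∸ 2 ℕ.* j) * Γ (2 ℕ.* j ℕ.+ 1))
      [ *-#0 {Γ (2 ℕ.* l ℕ.∸ 2 ℕ.* j)} {Γ (2 ℕ.* j ℕ.+ 1)} (Γ-#0 (2 ℕ.* l ℕ.∸ 2 ℕ.* j)) (Γ-#0 (2 ℕ.* j ℕ.+ 1)) ]

module _ (π : ℝ) (π#0 : π #0) (l : ℕ) .{{l≢0 : NonZero l}} where
  private instance
    2l-1>0 : NonZero (2 ℕ.* l ℕ.∸ 1)
    2l-1>0 = 2l-1≢0 l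

  λ-expression : ℝ
  λ-expression = prefactor π l * (1/Γ (2 ℕ.* l ℕ.∸ 1) + fromℕ 2 * ∑[1≤j< l ] (λ-summand π π#0 l))

  ζ-expression : ℝ
  ζ-expression = prefactor π l * (1/Γ (2 ℕ.* l ℕ.∸ 1) + fromℕ 2 * ∑[1≤j< l ] (ζ-summand π π#0 l))

  B-expression : (ℕ → ℚ) → ℝ
  B-expression B = prefactor π l *
    (1/Γ (2 ℕ.* l ℕ.∸ 1) - ∑[1≤j< l ] (λ j 0<j j<l → B-summand π π#0 l j 0<j j<l B))

{-# OPTIONS --safe #-}

-- Put bₙ = β(2n+1), aₙ = λ(2n+2) and ϖ = 4β(1).  Decomposing the products of the two series into partial
-- fractions gives the convolutions
--   ∑_{i+j=n} bᵢ bⱼ = (n + 1/2) aₙ   and   ∑_{i+j=n} bᵢ aⱼ = (n + 1) bₙ₊₁,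
-- which are the equations tan′ = sec² and sec′ = sec tan.  Hence bₙ and aₙ are the Taylor coefficients of sec
-- and tan, rescaled by powers of ϖ, and the Bernoulli numbers and the formulas for β follow from the formal
-- identities tanh x = 2 coth 2x - coth x and sech = cosh - tanh sinh.
-- It remains to see that ϖ is the least positive zero of sin.  In sin 2x · tan′ x = 2 tan x the coefficients
-- of tan′, namely (2n+1) aₙ up to scaling, grow like 2n+1 since aₙ → 1, while those of tan stay bounded; so
-- the sine series vanishes at ϖ.  At 0 < p < ϖ the series of tan′ converges, and sin p = 0 would make
-- the series of tan vanish there although all its terms are positive.

module Submission where

open import Algebra.Bundles using (CommutativeRing)
import Algebra.Consequences.Setoid as Consequences
import Algebra.Solver.Ring as RingSolver
open import Algebra.Solver.Ring.AlmostCommutativeRing using (AlmostCommutativeRing; fromCommutativeRing; _-Raw-AlmostCommutative⟶_)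
open import Data.Empty using (⊥; ⊥-elim)
open import Data.Integer.Base as ℤ using (ℤ)
open import Data.Maybe.Base using (Maybe; just; nothing)
open import Data.Nat.Base as ℕ using (ℕ; zero; suc; _!; NonZero; NonTrivial)
import Data.Nat.Properties as ℕₚ
open import Data.Nat.Solver renaming (module +-*-Solver to ℕ-Solver)
open import Data.Product using (∃-syntax; _×_; _,_; proj₁; proj₂)
open import Data.Rational.Base as ℚ using (ℚ; 0ℚ; 1ℚ; ½; ∣_∣; _/_)
import Data.Rational.Properties as ℚₚ
import Data.Rational.Solver as ℚ-Solver
open import Data.Sum.Base using (inj₁; inj₂)
open import Data.Unit.Base using (tt)
open import Function.Base using (_∘_; case_of_)
open import Level using (0ℓ)
open import Relation.Binary.Bundles using (Setoid)
open import Relation.Binary.Definitions using (tri<; tri≈; tri>)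
open import Relation.Binary.PropositionalEquality
  using (_≡_; _≢_; _≗_; refl; sym; trans; cong; cong₂; subst; subst₂; module ≡-Reasoning)
import Relation.Binary.Reasoning.Setoid as SetoidReasoning
open import Relation.Nullary using (¬_; yes; no; recompute)

open import Defs hiding (_+_; _*_; -_; _-_; _^_; _<_; _≈_)

-- The series of β(1) converges only conditionally, so the double series cannot be rearranged
-- freely. The convolutions are therefore computed exactly, over the rationals, on the square 0 ≤ p,
-- q ≤ M. Inside a row of the square almost everything cancels, and what is left is at most twice
-- the sum of 1/((p+1)(q+1)) over p + q = M, which tends to 0. As the reals β and λ are given by
-- their partial sums, such an estimate already is the limit statement. No function of a real
-- variable is differentiated or integrated: derivatives act on coefficients. The series are those
-- of cosh and sinh in z = x², which have no signs; signs enter only through the value z = -(x/2)².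
-- The values are determined by β(1) alone, so they are first expressed through ϖ, and π replaces ϖ
-- at the end. The zero of sine at ϖ is a boundary effect: ϖ/2 lies on the circle of convergence of
-- tan, where the series cannot be evaluated. Hence sin 2x · tan′ x = 2 tan x is used coefficient by
-- coefficient there, and its partial sums only at smaller arguments.

module _ where
  open import Data.Rational.Base using (_+_; _*_; -_; _-_; _≤_; _<_)
  open ℚ-Solver.+-*-Solver using (solve; con; _:=_; _:+_; _:*_; _:-_; :-_)

  -- Rational arithmetic, finite sums and convolutions

  ⟦_⟧ : ℕ → ℚ
  ⟦ n ⟧ = ℤ.+ n / 1

  ⟦+⟧ : ∀ m n → ⟦ m ℕ.+ n ⟧ ≡ ⟦ m ⟧ + ⟦ n ⟧
  ⟦+⟧ m n = sym (frac-+ m n 1)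

  ⟦*⟧ : ∀ m n → ⟦ m ℕ.* n ⟧ ≡ ⟦ m ⟧ * ⟦ n ⟧
  ⟦*⟧ m n = sym (frac-* m 1 n 1)

  ⟦suc⟧ : ∀ n → ⟦ suc n ⟧ ≡ 1ℚ + ⟦ n ⟧
  ⟦suc⟧ = ⟦+⟧ 1

  ⟦⟧-mono-≤ : ∀ m n → m ℕ.≤ n → ⟦ m ⟧ ≤ ⟦ n ⟧
  ⟦⟧-mono-≤ m n m≤n = frac-≤ m 1 n 1 (ℕₚ.*-monoˡ-≤ 1 m≤n)

  0≤⟦⟧ : ∀ n → 0ℚ ≤ ⟦ n ⟧
  0≤⟦⟧ n = ⟦⟧-mono-≤ 0 n ℕ.z≤n

  0<1ℚ : 0ℚ < 1ℚ
  0<1ℚ = ℚₚ.positive⁻¹ 1ℚ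

  0<⟦suc⟧ : ∀ n → 0ℚ < ⟦ suc n ⟧
  0<⟦suc⟧ n = ℚₚ.<-≤-trans 0<1ℚ (⟦⟧-mono-≤ 1 (suc n) (ℕ.s≤s ℕ.z≤n))

  ⟦suc⟧≢0 : ∀ n → ⟦ suc n ⟧ ≢ 0ℚ
  ⟦suc⟧≢0 n = pos≢0 (0<⟦suc⟧ n)

  *-cancelˡ : ∀ {c x y} → c ≢ 0ℚ → c * x ≡ c * y → x ≡ y
  *-cancelˡ {c} {x} {y} c≢0 cx≡cy = begin
    x                ≡⟨ undo x ⟨
    inv c * (c * x)  ≡⟨ cong (inv c *_) cx≡cy ⟩
    inv c * (c * y)  ≡⟨ undo y ⟩
    y                ∎
    where
    open ≡-Reasoning
    undo : ∀ z → inv c * (c * z) ≡ z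
    undo z = trans (sym (ℚₚ.*-assoc (inv c) c z))
      (trans (cong (_* z) (inv-inverse c c≢0)) (ℚₚ.*-identityˡ z))

  inv-unique : ∀ {p q} → q * p ≡ 1ℚ → q ≡ inv p
  inv-unique {p} {q} qp≡1 = *-cancelˡ p≢0
    (trans (trans (ℚₚ.*-comm p q) qp≡1) (trans (sym (inv-inverse p p≢0)) (ℚₚ.*-comm (inv p) p)))
    where
    p≢0 : p ≢ 0ℚ
    p≢0 refl = case trans (sym (ℚₚ.*-zeroʳ q)) qp≡1 of λ ()

  inv-neg : ∀ p → inv (- p) ≡ - inv p
  inv-neg p with p ℚₚ.≟ 0ℚ
  ... | yes refl = refl
  ... | no p≢0 = sym (inv-unique { - p} (trans
    (solve 2 (λ p q → (:- q) :* (:- p) := q :* p) refl p (ℚ.1/_ p {{ℚ.≢-nonZero p≢0}}))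
    (ℚₚ.*-inverseˡ p {{ℚ.≢-nonZero p≢0}})))

  r : ℕ → ℚ
  r n = ℤ.+ 1 / suc n

  r-inverse : ∀ n → r n * ⟦ suc n ⟧ ≡ 1ℚ
  r-inverse n = trans (frac-* 1 (suc n) (suc n) 1)
    (frac-≡ (1 ℕ.* suc n) (suc n ℕ.* 1) 1 1 {{ℕₚ.m*n≢0 (suc n) 1}}
      (ℕ-Solver.solve 1 (λ n → (ℕ-Solver.con 1 ℕ-Solver.:* n) ℕ-Solver.:* ℕ-Solver.con 1 ℕ-Solver.:= ℕ-Solver.con 1 ℕ-Solver.:* (n ℕ-Solver.:* ℕ-Solver.con 1)) refl (suc n)))

  inv⟦suc⟧ : ∀ n → inv ⟦ suc n ⟧ ≡ r n
  inv⟦suc⟧ n = sym (inv-unique (r-inverse n))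

  0≤r : ∀ n → 0ℚ ≤ r n
  0≤r n = frac-≥0 1 (suc n)

  r-antitone : ∀ {m n} → m ℕ.≤ n → r n ≤ r m
  r-antitone {m} {n} m≤n = frac-≤ 1 (suc n) 1 (suc m) (ℕₚ.*-monoʳ-≤ 1 (ℕ.s≤s m≤n))

  r≤1 : ∀ n → r n ≤ 1ℚ
  r≤1 n = r-antitone {0} {n} ℕ.z≤n

  pow : ℚ → ℕ → ℚ
  pow x zero    = 1ℚ
  pow x (suc n) = x * pow x n

  pow-+ : ∀ x m n → pow x (m ℕ.+ n) ≡ pow x m * pow x n
  pow-+ x zero    n = sym (ℚₚ.*-identityˡ _)
  pow-+ x (suc m) n = trans (cong (x *_) (pow-+ x m n)) (sym (ℚₚ.*-assoc x _ _))

  pow-* : ∀ x y n → pow (x * y) n ≡ pow x n * pow y n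
  pow-* x y zero    = refl
  pow-* x y (suc n) = trans (cong ((x * y) *_) (pow-* x y n))
    (solve 4 (λ x y a b → x :* y :* (a :* b) := x :* a :* (y :* b)) refl x y (pow x n) (pow y n))

  pow-double : ∀ x n → pow x (2 ℕ.* n) ≡ pow (x * x) n
  pow-double x n = trans (cong (λ k → pow x (n ℕ.+ k)) (ℕₚ.+-identityʳ n))
    (trans (pow-+ x n n) (sym (pow-* x x n)))

  pow-⟦⟧ : ∀ b n → ⟦ b ℕ.^ n ⟧ ≡ pow ⟦ b ⟧ n
  pow-⟦⟧ b zero    = refl
  pow-⟦⟧ b (suc n) = trans (⟦*⟧ b (b ℕ.^ n)) (cong (⟦ b ⟧ *_) (pow-⟦⟧ b n))

  0≤* : ∀ {p q} → 0ℚ ≤ p → 0ℚ ≤ q → 0ℚ ≤ p * q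
  0≤* {p} {q} 0≤p 0≤q = subst (_≤ p * q) (ℚₚ.*-zeroʳ p) (*-monoˡ-≤ 0≤p 0≤q)

  0≤pow : ∀ {x} → 0ℚ ≤ x → ∀ n → 0ℚ ≤ pow x n
  0≤pow 0≤x zero    = ℚₚ.<⇒≤ 0<1ℚ
  0≤pow 0≤x (suc n) = 0≤* 0≤x (0≤pow 0≤x n)

  pow-mono : ∀ {x y} → 0ℚ ≤ x → x ≤ y → ∀ n → pow x n ≤ pow y n
  pow-mono 0≤x x≤y zero    = ℚₚ.≤-refl
  pow-mono {x} {y} 0≤x x≤y (suc n) =
    *-mono-≤ (ℚₚ.≤-trans 0≤x x≤y) (0≤pow 0≤x n) x≤y (pow-mono 0≤x x≤y n)

  pow-one : ∀ n → pow 1ℚ n ≡ 1ℚ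
  pow-one zero    = refl
  pow-one (suc n) = trans (ℚₚ.*-identityˡ _) (pow-one n)

  pow≤1 : ∀ {x} → 0ℚ ≤ x → x ≤ 1ℚ → ∀ n → pow x n ≤ 1ℚ
  pow≤1 {x} 0≤x x≤1 n = subst (pow x n ≤_) (pow-one n) (pow-mono 0≤x x≤1 n)

  sum : (ℕ → ℚ) → ℕ → ℚ
  sum = partialSumℚ

  sum-cong< : ∀ {f g} n → (∀ k → k ℕ.< n → f k ≡ g k) → sum f n ≡ sum g n
  sum-cong< zero    h = refl
  sum-cong< (suc n) h = cong₂ _+_ (sum-cong< n (λ k k<n → h k (ℕₚ.m<n⇒m<1+n k<n))) (h n ℕₚ.≤-refl)

  sum-cong : ∀ {f g} n → (∀ k → f k ≡ g k) → sum f n ≡ sum g n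
  sum-cong n h = sum-cong< n (λ k _ → h k)

  sum-+ : ∀ f g n → sum (λ k → f k + g k) n ≡ sum f n + sum g n
  sum-+ f g zero    = refl
  sum-+ f g (suc n) = trans (cong (_+ (f n + g n)) (sum-+ f g n))
    (solve 4 (λ a b c d → (a :+ b) :+ (c :+ d) := (a :+ c) :+ (b :+ d)) refl (sum f n) (sum g n) (f n) (g n))

  sum-scale : ∀ c f n → sum (λ k → c * f k) n ≡ c * sum f n
  sum-scale c f zero    = sym (ℚₚ.*-zeroʳ c)
  sum-scale c f (suc n) = trans (cong (_+ c * f n) (sum-scale c f n)) (sym (ℚₚ.*-distribˡ-+ c _ _))

  sum-neg : ∀ f n → sum (λ k → - f k) n ≡ - sum f n
  sum-neg f zero    = refl
  sum-neg f (suc n) = trans (cong (_+ - f n) (sum-neg f n)) (sym (ℚₚ.neg-distrib-+ (sum f n) (f n)))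

  sum-zero : ∀ n → sum (λ _ → 0ℚ) n ≡ 0ℚ
  sum-zero zero    = refl
  sum-zero (suc n) = trans (ℚₚ.+-identityʳ _) (sum-zero n)

  sum-head : ∀ f n → sum f (suc n) ≡ f 0 + sum (f ∘ suc) n
  sum-head f zero    = ℚₚ.+-comm 0ℚ (f 0)
  sum-head f (suc n) = trans (cong (_+ f (suc n)) (sum-head f n)) (ℚₚ.+-assoc (f 0) _ _)

  sum-split : ∀ f m n → sum f (m ℕ.+ n) ≡ sum f m + sum (λ k → f (m ℕ.+ k)) n
  sum-split f m zero    = trans (cong (sum f) (ℕₚ.+-identityʳ m)) (sym (ℚₚ.+-identityʳ _))
  sum-split f m (suc n) = trans (cong (sum f) (ℕₚ.+-suc m n))
    (trans (cong (_+ f (m ℕ.+ n)) (sum-split f m n)) (ℚₚ.+-assoc (sum f m) _ _))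

  sum-swap : ∀ (f : ℕ → ℕ → ℚ) m n → sum (λ i → sum (f i) n) m ≡ sum (λ j → sum (λ i → f i j) m) n
  sum-swap f zero    n = sym (sum-zero n)
  sum-swap f (suc m) n = trans (cong (_+ sum (f m) n) (sum-swap f m n))
    (sym (sum-+ (λ j → sum (λ i → f i j) m) (f m) n))

  sum-mono< : ∀ {f g} n → (∀ k → k ℕ.< n → f k ≤ g k) → sum f n ≤ sum g n
  sum-mono< zero    h = ℚₚ.≤-refl
  sum-mono< (suc n) h =
    ℚₚ.+-mono-≤ (sum-mono< n (λ k k<n → h k (ℕₚ.m<n⇒m<1+n k<n))) (h n ℕₚ.≤-refl)

  sum-mono : ∀ {f g} n → (∀ k → f k ≤ g k) → sum f n ≤ sum g n
  sum-mono n h = sum-mono< n (λ k _ → h k)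

  sum≥0 : ∀ {f} n → (∀ k → 0ℚ ≤ f k) → 0ℚ ≤ sum f n
  sum≥0 {f} n h = subst (_≤ sum f n) (sum-zero n) (sum-mono n h)

  ∣sum∣≤ : ∀ f n → ∣ sum f n ∣ ≤ sum (∣_∣ ∘ f) n
  ∣sum∣≤ f zero    = ℚₚ.≤-refl
  ∣sum∣≤ f (suc n) = ℚₚ.≤-trans (ℚₚ.∣p+q∣≤∣p∣+∣q∣ (sum f n) (f n)) (ℚₚ.+-monoˡ-≤ _ (∣sum∣≤ f n))

  sum-const : ∀ c n → sum (λ _ → c) n ≡ ⟦ n ⟧ * c
  sum-const c zero    = sym (ℚₚ.*-zeroˡ c)
  sum-const c (suc n) = trans (cong (_+ c) (sum-const c n))
    (trans (solve 2 (λ m c → m :* c :+ c := (con 1ℚ :+ m) :* c) refl ⟦ n ⟧ c) (cong (_* c) (sym (⟦suc⟧ n))))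

  δ : ℕ → ℕ → ℚ
  δ m n with m ℕₚ.≟ n
  ... | yes _ = 1ℚ
  ... | no  _ = 0ℚ

  δ-refl : ∀ n → δ n n ≡ 1ℚ
  δ-refl n with n ℕₚ.≟ n
  ... | yes _  = refl
  ... | no n≢n = ⊥-elim (n≢n refl)

  δ-≢ : ∀ {m n} → m ≢ n → δ m n ≡ 0ℚ
  δ-≢ {m} {n} m≢n with m ℕₚ.≟ n
  ... | yes m≡n = ⊥-elim (m≢n m≡n)
  ... | no _    = refl

  sum-δ-≥ : ∀ m n → n ℕ.≤ m → sum (δ m) n ≡ 0ℚ
  sum-δ-≥ m zero    _   = refl
  sum-δ-≥ m (suc n) n<m = cong₂ _+_ (sum-δ-≥ m n (ℕₚ.<⇒≤ n<m)) (δ-≢ (ℕₚ.>⇒≢ n<m))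

  sum-δ : ∀ m n → m ℕ.< n → sum (δ m) n ≡ 1ℚ
  sum-δ m (suc n) (ℕ.s≤s m≤n) with m ℕₚ.≟ n
  ... | yes refl = trans (cong (_+ 1ℚ) (sum-δ-≥ m n ℕₚ.≤-refl)) refl
  ... | no m≢n   = trans (ℚₚ.+-identityʳ _) (sum-δ m n (ℕₚ.≤∧≢⇒< m≤n m≢n))

  module _ {f : ℕ → ℚ} (f≥0 : ∀ k → 0ℚ ≤ f k) (f-dec : ∀ k → f (suc k) ≤ f k) where
    private
      shifted : ∀ m n → sum (λ k → sign k * f (m ℕ.+ k)) (suc n) ≡
                        f m - sum (λ k → sign k * f (suc m ℕ.+ k)) n
      shifted m n = trans (sum-head _ n) (cong₂ _+_
        (trans (ℚₚ.*-identityˡ _) (cong f (ℕₚ.+-identityʳ m)))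
        (trans (sum-cong n λ k → trans (sym (ℚₚ.neg-distribˡ-* (sign k) (f (m ℕ.+ suc k))))
                 (cong (λ z → - (sign k * f z)) (ℕₚ.+-suc m k)))
               (sum-neg _ n)))

    -- Leibniz estimate by mutual induction on the length: by `shifted`, the sum from m on is f m
    -- minus the sum from m + 1 on, so each bound follows from the other one for the tail.
    alternating-≥0 : ∀ m n → 0ℚ ≤ sum (λ k → sign k * f (m ℕ.+ k)) n
    alternating-≤  : ∀ m n → sum (λ k → sign k * f (m ℕ.+ k)) n ≤ f m
    alternating-≥0 m zero    = ℚₚ.≤-refl
    alternating-≥0 m (suc n) = subst (0ℚ ≤_) (sym (shifted m n))
      (≤⇒0≤- (ℚₚ.≤-trans (alternating-≤ (suc m) n) (f-dec m)))
    alternating-≤ m zero    = f≥0 m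
    alternating-≤ m (suc n) = subst (_≤ f m) (sym (shifted m n))
      (subst (f m - sum (λ k → sign k * f (suc m ℕ.+ k)) n ≤_) (ℚₚ.+-identityʳ (f m))
        (ℚₚ.+-monoʳ-≤ (f m) (ℚₚ.neg-antimono-≤ (alternating-≥0 (suc m) n))))

  -- Products of formal power series

  conv : (ℕ → ℚ) → (ℕ → ℚ) → ℕ → ℚ
  conv f g zero    = f 0 * g 0
  conv f g (suc n) = f 0 * g (suc n) + conv (f ∘ suc) g n

  -- The recursion of `conv` avoids the truncated subtraction in `cauchyProduct`, so that identities
  -- follow by induction with `f ∘ suc`. This lemma connects it with the definition of the Bernoulli
  -- numbers.
  conv≡cauchyProduct : ∀ f g n → conv f g n ≡ cauchyProduct f g n
  conv≡cauchyProduct f g zero    = sym (ℚₚ.+-identityˡ _)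
  conv≡cauchyProduct f g (suc n) = trans (cong ((f 0 * g (suc n)) +_) (conv≡cauchyProduct (f ∘ suc) g n))
    (sym (sum-head (λ k → f k * g (suc n ℕ.∸ k)) (suc n)))

  conv-cong≤ : ∀ {f f′ g g′} n → (∀ k → k ℕ.≤ n → f k ≡ f′ k) → (∀ k → k ℕ.≤ n → g k ≡ g′ k) →
    conv f g n ≡ conv f′ g′ n
  conv-cong≤ zero    p q = cong₂ _*_ (p 0 ℕ.z≤n) (q 0 ℕ.z≤n)
  conv-cong≤ (suc n) p q = cong₂ _+_ (cong₂ _*_ (p 0 ℕ.z≤n) (q (suc n) ℕₚ.≤-refl))
    (conv-cong≤ n (λ k k≤n → p (suc k) (ℕ.s≤s k≤n)) (λ k k≤n → q k (ℕₚ.m≤n⇒m≤1+n k≤n)))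

  conv-cong : ∀ {f f′ g g′} → (∀ k → f k ≡ f′ k) → (∀ k → g k ≡ g′ k) → ∀ n → conv f g n ≡ conv f′ g′ n
  conv-cong p q n = conv-cong≤ n (λ k _ → p k) (λ k _ → q k)

  conv-+ˡ : ∀ f f′ g n → conv (λ k → f k + f′ k) g n ≡ conv f g n + conv f′ g n
  conv-+ˡ f f′ g zero    = ℚₚ.*-distribʳ-+ (g 0) (f 0) (f′ 0)
  conv-+ˡ f f′ g (suc n) = trans (cong (((f 0 + f′ 0) * g (suc n)) +_) (conv-+ˡ (f ∘ suc) (f′ ∘ suc) g n))
    (solve 5 (λ a b c d e → (a :+ b) :* c :+ (d :+ e) := (a :* c :+ d) :+ (b :* c :+ e)) refl
      (f 0) (f′ 0) (g (suc n)) (conv (f ∘ suc) g n) (conv (f′ ∘ suc) g n))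

  conv-scaleˡ : ∀ c f g n → conv (λ k → c * f k) g n ≡ c * conv f g n
  conv-scaleˡ c f g zero    = ℚₚ.*-assoc c _ _
  conv-scaleˡ c f g (suc n) = trans (cong ((c * f 0 * g (suc n)) +_) (conv-scaleˡ c (f ∘ suc) g n))
    (solve 4 (λ c a b d → c :* a :* b :+ c :* d := c :* (a :* b :+ d)) refl c (f 0) (g (suc n)) _)

  conv-zeroˡ : ∀ g n → conv (λ _ → 0ℚ) g n ≡ 0ℚ
  conv-zeroˡ g zero    = ℚₚ.*-zeroˡ (g 0)
  conv-zeroˡ g (suc n) = cong₂ _+_ (ℚₚ.*-zeroˡ (g (suc n))) (conv-zeroˡ g n)

  conv-sumˡ : ∀ (f : ℕ → ℕ → ℚ) g n M → conv (λ i → sum (λ p → f p i) M) g n ≡ sum (λ p → conv (f p) g n) M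
  conv-sumˡ f g n zero    = conv-zeroˡ g n
  conv-sumˡ f g n (suc M) = trans (conv-+ˡ (λ i → sum (λ p → f p i) M) (f M) g n) (cong (_+ conv (f M) g n) (conv-sumˡ f g n M))

  conv-suc : ∀ f g n → conv f g (suc n) ≡ conv f (g ∘ suc) n + f (suc n) * g 0
  conv-suc f g zero    = refl
  conv-suc f g (suc n) = trans (cong ((f 0 * g (suc (suc n))) +_) (conv-suc (f ∘ suc) g n))
    (sym (ℚₚ.+-assoc (f 0 * g (suc (suc n))) _ _))

  conv-comm : ∀ f g n → conv f g n ≡ conv g f n
  conv-comm f g zero    = ℚₚ.*-comm (f 0) (g 0)
  conv-comm f g (suc n) = trans (cong₂ _+_ (ℚₚ.*-comm (f 0) (g (suc n))) (conv-comm (f ∘ suc) g n))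
    (trans (ℚₚ.+-comm (g (suc n) * f 0) _) (sym (conv-suc g f n)))

  conv-assoc : ∀ f g h n → conv (conv f g) h n ≡ conv f (conv g h) n
  conv-assoc f g h zero    = ℚₚ.*-assoc (f 0) (g 0) (h 0)
  conv-assoc f g h (suc n) = begin
    f 0 * g 0 * h (suc n) + conv (λ k → f 0 * g (suc k) + conv (f ∘ suc) g k) h n
      ≡⟨ cong ((f 0 * g 0 * h (suc n)) +_) (trans (conv-+ˡ (λ k → f 0 * g (suc k)) (conv (f ∘ suc) g) h n)
           (cong₂ _+_ (conv-scaleˡ (f 0) (g ∘ suc) h n) (conv-assoc (f ∘ suc) g h n))) ⟩
    f 0 * g 0 * h (suc n) + (f 0 * conv (g ∘ suc) h n + conv (f ∘ suc) (conv g h) n)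
      ≡⟨ solve 5 (λ a b c d e → a :* b :* c :+ (a :* d :+ e) := a :* (b :* c :+ d) :+ e) refl (f 0) (g 0) (h (suc n)) _ _ ⟩
    f 0 * (g 0 * h (suc n) + conv (g ∘ suc) h n) + conv (f ∘ suc) (conv g h) n ∎
    where open ≡-Reasoning

  conv-+ʳ : ∀ f g g′ n → conv f (λ k → g k + g′ k) n ≡ conv f g n + conv f g′ n
  conv-+ʳ f g g′ n = trans (conv-comm f _ n) (trans (conv-+ˡ g g′ f n) (cong₂ _+_ (conv-comm g f n) (conv-comm g′ f n)))

  conv-scaleʳ : ∀ c f g n → conv f (λ k → c * g k) n ≡ c * conv f g n
  conv-scaleʳ c f g n = trans (conv-comm f _ n) (trans (conv-scaleˡ c g f n) (cong (c *_) (conv-comm g f n)))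

  -- Rescaling the variable by w is multiplicative. This separates the powers of a real number from
  -- the rational coefficients, and it also gives the substitution x ↦ 2x.
  conv-pow : ∀ w f g n → conv (λ k → pow w k * f k) (λ k → pow w k * g k) n ≡ pow w n * conv f g n
  conv-pow w f g zero    = solve 2 (λ a b → con 1ℚ :* a :* (con 1ℚ :* b) := con 1ℚ :* (a :* b)) refl (f 0) (g 0)
  conv-pow w f g (suc n) = begin
    1ℚ * f 0 * (w * pow w n * g (suc n)) + conv (λ k → w * pow w k * f (suc k)) (λ k → pow w k * g k) n
      ≡⟨ cong ((1ℚ * f 0 * (w * pow w n * g (suc n))) +_) (trans
           (conv-cong {g = λ k → pow w k * g k} (λ k → ℚₚ.*-assoc w (pow w k) (f (suc k))) (λ _ → refl) n)
           (trans (conv-scaleˡ w (λ k → pow w k * f (suc k)) (λ k → pow w k * g k) n) (cong (w *_) (conv-pow w (f ∘ suc) g n)))) ⟩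
    1ℚ * f 0 * (w * pow w n * g (suc n)) + w * (pow w n * conv (f ∘ suc) g n)
      ≡⟨ solve 5 (λ a w p b c → con 1ℚ :* a :* (w :* p :* b) :+ w :* (p :* c) := w :* p :* (a :* b :+ c)) refl (f 0) w (pow w n) (g (suc n)) _ ⟩
    w * pow w n * (f 0 * g (suc n) + conv (f ∘ suc) g n) ∎
    where open ≡-Reasoning

  -- The Euler operator z d/dz. As x d/dx = 2θ for z = x², the derivative of x f(x²) with respect to
  -- x is f + 2θf; this is the origin of the recurring factors 1 + 2n.
  θ : (ℕ → ℚ) → ℕ → ℚ
  θ f n = ⟦ n ⟧ * f n

  θ-conv : ∀ f g n → θ (conv f g) n ≡ conv (θ f) g n + conv f (θ g) n
  θ-conv f g zero    = solve 2 (λ a b → con 0ℚ :* (a :* b) := con 0ℚ :* a :* b :+ a :* (con 0ℚ :* b)) refl (f 0) (g 0)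
  θ-conv f g (suc n) = sym (begin
    (0ℚ * f 0 * g (suc n) + conv (λ k → ⟦ suc k ⟧ * f (suc k)) g n) + (f 0 * (⟦ suc n ⟧ * g (suc n)) + conv (f ∘ suc) (θ g) n)
      ≡⟨ cong (λ z → (0ℚ * f 0 * g (suc n) + z) + (f 0 * (⟦ suc n ⟧ * g (suc n)) + conv (f ∘ suc) (θ g) n))
           (trans (conv-cong {g = g} (λ k → trans (cong (_* f (suc k)) (⟦suc⟧ k)) (solve 2 (λ m a → (con 1ℚ :+ m) :* a := a :+ m :* a) refl ⟦ k ⟧ (f (suc k)))) (λ _ → refl) n)
                  (conv-+ˡ (f ∘ suc) (θ (f ∘ suc)) g n)) ⟩
    (0ℚ * f 0 * g (suc n) + (conv (f ∘ suc) g n + conv (θ (f ∘ suc)) g n)) + (f 0 * (⟦ suc n ⟧ * g (suc n)) + conv (f ∘ suc) (θ g) n)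
      ≡⟨ solve 6 (λ a b m c d e → (con 0ℚ :* a :* b :+ (c :+ d)) :+ (a :* (m :* b) :+ e) := m :* (a :* b) :+ c :+ (d :+ e)) refl
           (f 0) (g (suc n)) ⟦ suc n ⟧ (conv (f ∘ suc) g n) (conv (θ (f ∘ suc)) g n) (conv (f ∘ suc) (θ g) n) ⟩
    ⟦ suc n ⟧ * (f 0 * g (suc n)) + conv (f ∘ suc) g n + (conv (θ (f ∘ suc)) g n + conv (f ∘ suc) (θ g) n)
      ≡⟨ cong₂ (λ m z → m * (f 0 * g (suc n)) + conv (f ∘ suc) g n + z) (⟦suc⟧ n) (sym (θ-conv (f ∘ suc) g n)) ⟩
    (1ℚ + ⟦ n ⟧) * (f 0 * g (suc n)) + conv (f ∘ suc) g n + ⟦ n ⟧ * conv (f ∘ suc) g n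
      ≡⟨ solve 3 (λ m a c → (con 1ℚ :+ m) :* a :+ c :+ m :* c := (con 1ℚ :+ m) :* (a :+ c)) refl ⟦ n ⟧ (f 0 * g (suc n)) _ ⟩
    (1ℚ + ⟦ n ⟧) * conv f g (suc n)
      ≡⟨ cong (_* conv f g (suc n)) (sym (⟦suc⟧ n)) ⟩
    ⟦ suc n ⟧ * conv f g (suc n) ∎)
    where open ≡-Reasoning

  conv-sum : ∀ (f g : ℕ → ℕ → ℚ) n M N → conv (λ i → sum (λ p → f p i) M) (λ i → sum (λ q → g q i) N) n ≡
             sum (λ p → sum (λ q → conv (f p) (g q) n) N) M
  conv-sum f g n M N = trans (conv-sumˡ f _ n M) (sum-cong M λ p →
    trans (conv-comm (f p) _ n) (trans (conv-sumˡ g (f p) n N) (sum-cong N λ q → conv-comm (g q) (f p) n)))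

  -- The constant sequence 1 is the series 1/(1 - z), and multiplying by it forms partial sums. In
  -- `conv-partialSums` associativity moves this factor from f to the whole product.
  conv-ones : ∀ f n → conv (λ _ → 1ℚ) f n ≡ sum f (suc n)
  conv-ones f zero    = trans (ℚₚ.*-identityˡ (f 0)) (sym (ℚₚ.+-identityˡ (f 0)))
  conv-ones f (suc n) = trans (cong₂ _+_ (ℚₚ.*-identityˡ (f (suc n))) (conv-ones f n)) (ℚₚ.+-comm (f (suc n)) (sum f (suc n)))

  conv-partialSums : ∀ f g n → conv (λ k → sum f (suc k)) g n ≡ sum (conv f g) (suc n)
  conv-partialSums f g n = trans (conv-cong {g = g} (λ k → sym (conv-ones f k)) (λ _ → refl) n)
    (trans (conv-assoc (λ _ → 1ℚ) f g n) (conv-ones (conv f g) n))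

  -- The sequence 1 + 2k is `one` plus twice θ `one`, and the product rule shifts θ from `one` to f.
  -- This isolates (1 + 2n) times a partial sum of f, the quantity whose boundedness makes the sine
  -- series vanish at ϖ.
  conv-1+2n : ∀ f n → conv f (λ k → 1ℚ + (⟦ k ⟧ + ⟦ k ⟧)) n ≡ (1ℚ + (⟦ n ⟧ + ⟦ n ⟧)) * sum f (suc n) - ⟦ 2 ⟧ * sum (θ f) (suc n)
  conv-1+2n f n = begin
    conv f (λ k → 1ℚ + (⟦ k ⟧ + ⟦ k ⟧)) n
      ≡⟨ conv-cong {f} (λ _ → refl) (λ k → solve 1 (λ k → con 1ℚ :+ (k :+ k) := con 1ℚ :+ (k :* con 1ℚ :+ k :* con 1ℚ)) refl ⟦ k ⟧) n ⟩
    conv f (λ k → 1ℚ + (θ one k + θ one k)) n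
      ≡⟨ trans (conv-+ʳ f one (λ k → θ one k + θ one k) n) (cong (conv f one n +_) (conv-+ʳ f (θ one) (θ one) n)) ⟩
    conv f one n + (conv f (θ one) n + conv f (θ one) n)
      ≡⟨ cong₂ (λ x y → x + (y + y)) (total f) shifted ⟩
    s + ((⟦ n ⟧ * s - t) + (⟦ n ⟧ * s - t))
      ≡⟨ solve 3 (λ m s t → s :+ ((m :* s :- t) :+ (m :* s :- t)) := (con 1ℚ :+ (m :+ m)) :* s :- con ⟦ 2 ⟧ :* t) refl ⟦ n ⟧ s t ⟩
    (1ℚ + (⟦ n ⟧ + ⟦ n ⟧)) * s - ⟦ 2 ⟧ * t ∎
    where
    open ≡-Reasoning
    one : ℕ → ℚ
    one _ = 1ℚ
    s t : ℚ
    s = sum f (suc n)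
    t = sum (θ f) (suc n)
    total : ∀ g → conv g one n ≡ sum g (suc n)
    total g = trans (conv-comm g one n) (conv-ones g n)
    shifted : conv f (θ one) n ≡ ⟦ n ⟧ * s - t
    shifted = trans (trans (solve 2 (λ x y → y := (x :+ y) :- x) refl (conv (θ f) one n) (conv f (θ one) n)) (cong (_- conv (θ f) one n) (sym (θ-conv f one n))))
      (cong₂ (λ x y → ⟦ n ⟧ * x - y) (total f) (total (θ f)))

-- Partial fractions in the truncated double sums

module _ where
  open import Data.Rational.Base using (_+_; _*_; -_; _-_; _≤_; _<_)
  open ℚ-Solver.+-*-Solver using (solve; con; _:=_; _:+_; _:*_; _:-_; :-_)

  -- The error term ∑_{p+q=M} 1/((p+1)(q+1)) of the double sums.

  harmonic²≤ : ∀ n → sum r n * sum r n ≤ ⟦ 4 ⟧ * ⟦ n ⟧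
  harmonic²≤ zero    = ℚₚ.≤-refl
  harmonic²≤ (suc n) = begin
    (H + r n) * (H + r n)                          ≡⟨ solve 2 (λ h r → (h :+ r) :* (h :+ r) := h :* h :+ (h :* r :+ h :* r) :+ r :* r) refl H (r n) ⟩
    H * H + (H * r n + H * r n) + r n * r n        ≤⟨ ℚₚ.+-mono-≤ (ℚₚ.+-mono-≤ (harmonic²≤ n) (ℚₚ.+-mono-≤ Hr≤1 Hr≤1)) (ℚₚ.≤-trans rr≤1 (ℚₚ.≤-trans (r≤1 0) 1≤2)) ⟩
    ⟦ 4 ⟧ * ⟦ n ⟧ + (1ℚ + 1ℚ) + ⟦ 2 ⟧              ≡⟨ solve 1 (λ n → con ⟦ 4 ⟧ :* n :+ (con 1ℚ :+ con 1ℚ) :+ con ⟦ 2 ⟧ := con ⟦ 4 ⟧ :* (con 1ℚ :+ n)) refl ⟦ n ⟧ ⟩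
    ⟦ 4 ⟧ * (1ℚ + ⟦ n ⟧)                           ≡⟨ cong (⟦ 4 ⟧ *_) (⟦suc⟧ n) ⟨
    ⟦ 4 ⟧ * ⟦ suc n ⟧                              ∎
    where
    open ℚₚ.≤-Reasoning
    H = sum r n
    1≤2 : 1ℚ ≤ ⟦ 2 ⟧
    1≤2 = ⟦⟧-mono-≤ 1 2 (ℕ.s≤s ℕ.z≤n)
    H≤ : H ≤ ⟦ suc n ⟧
    H≤ = ℚₚ.≤-trans (sum-mono n r≤1) (ℚₚ.≤-trans (ℚₚ.≤-reflexive (trans (sum-const 1ℚ n) (ℚₚ.*-identityʳ ⟦ n ⟧))) (⟦⟧-mono-≤ n (suc n) (ℕₚ.n≤1+n n)))
    Hr≤1 : H * r n ≤ 1ℚ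
    Hr≤1 = begin
      H * r n              ≤⟨ *-mono-≤ (0≤⟦⟧ (suc n)) (0≤r n) H≤ ℚₚ.≤-refl ⟩
      ⟦ suc n ⟧ * r n      ≡⟨ trans (ℚₚ.*-comm ⟦ suc n ⟧ (r n)) (r-inverse n) ⟩
      1ℚ                   ∎
    rr≤1 : r n * r n ≤ 1ℚ
    rr≤1 = *-mono-≤ {b = 1ℚ} {d = 1ℚ} (ℚₚ.<⇒≤ 0<1ℚ) (0≤r n) (r≤1 n) (r≤1 n)

  -- For p + q = M, (M+2)/((p+1)(q+1)) = 1/(p+1) + 1/(q+1). In terms of series: `r` + θ `r` is the
  -- series of ones, and the product rule distributes the factor M + 2 over the two factors.
  convolved-harmonic : ∀ M → ⟦ suc (suc M) ⟧ * conv r r M ≡ sum r (suc M) + sum r (suc M)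
  convolved-harmonic M = begin
    ⟦ suc (suc M) ⟧ * conv r r M
      ≡⟨ cong (_* conv r r M) (trans (⟦suc⟧ (suc M)) (cong (1ℚ +_) (⟦suc⟧ M))) ⟩
    (1ℚ + (1ℚ + ⟦ M ⟧)) * conv r r M
      ≡⟨ solve 2 (λ m c → (con 1ℚ :+ (con 1ℚ :+ m)) :* c := (c :+ c) :+ m :* c) refl ⟦ M ⟧ (conv r r M) ⟩
    (conv r r M + conv r r M) + θ (conv r r) M
      ≡⟨ cong ((conv r r M + conv r r M) +_) (θ-conv r r M) ⟩
    (conv r r M + conv r r M) + (conv (θ r) r M + conv r (θ r) M)
      ≡⟨ solve 3 (λ c a b → (c :+ c) :+ (a :+ b) := (c :+ a) :+ (c :+ b)) refl (conv r r M) _ _ ⟩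
    (conv r r M + conv (θ r) r M) + (conv r r M + conv r (θ r) M)
      ≡⟨ cong₂ _+_ (trans (sym (conv-+ˡ r (θ r) r M)) (conv-cong {g = r} one (λ _ → refl) M))
                   (trans (sym (conv-+ʳ r r (θ r) M)) (trans (conv-cong {r} (λ _ → refl) one M) (conv-comm r (λ _ → 1ℚ) M))) ⟩
    conv (λ _ → 1ℚ) r M + conv (λ _ → 1ℚ) r M
      ≡⟨ cong₂ _+_ (conv-ones r M) (conv-ones r M) ⟩
    sum r (suc M) + sum r (suc M) ∎
    where
    open ≡-Reasoning
    one : ∀ k → r k + ⟦ k ⟧ * r k ≡ 1ℚ
    one k = trans (solve 2 (λ k r → r :+ k :* r := r :* (con 1ℚ :+ k)) refl ⟦ k ⟧ (r k)) (trans (cong (r k *_) (sym (⟦suc⟧ k))) (r-inverse k))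

  conv≥0 : ∀ {f g} n → (∀ k → 0ℚ ≤ f k) → (∀ k → 0ℚ ≤ g k) → 0ℚ ≤ conv f g n
  conv≥0 zero    p q = 0≤* (p 0) (q 0)
  conv≥0 (suc n) p q = ℚₚ.+-mono-≤ (0≤* (p 0) (q (suc n))) (conv≥0 n (p ∘ suc) q)

  -- Squared because only H² has been bounded: E = 2H/(M+2) and H² ≤ 4(M+2) give E² ≤ 16/(M+2).
  conv-harmonic² : ∀ M → conv r r M * conv r r M ≤ ℤ.+ 16 / suc (suc M)
  conv-harmonic² M = begin
    E * E                                        ≡⟨ cong₂ _*_ E≡ E≡ ⟩
    (ρ * (H + H)) * (ρ * (H + H))                ≡⟨ solve 2 (λ ρ h → (ρ :* (h :+ h)) :* (ρ :* (h :+ h)) := con ⟦ 4 ⟧ :* (ρ :* ρ) :* (h :* h)) refl ρ H ⟩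
    ⟦ 4 ⟧ * (ρ * ρ) * (H * H)                    ≤⟨ *-monoˡ-≤ (0≤* (0≤⟦⟧ 4) (0≤* (0≤r (suc M)) (0≤r (suc M))))
                                                      (ℚₚ.≤-trans (harmonic²≤ (suc M)) (*-monoˡ-≤ (0≤⟦⟧ 4) (⟦⟧-mono-≤ (suc M) (suc (suc M)) (ℕₚ.n≤1+n (suc M))))) ⟩
    ⟦ 4 ⟧ * (ρ * ρ) * (⟦ 4 ⟧ * ⟦ suc (suc M) ⟧)  ≡⟨ solve 2 (λ ρ m → con ⟦ 4 ⟧ :* (ρ :* ρ) :* (con ⟦ 4 ⟧ :* m) := con ⟦ 16 ⟧ :* ρ :* (ρ :* m)) refl ρ ⟦ suc (suc M) ⟧ ⟩
    ⟦ 16 ⟧ * ρ * (ρ * ⟦ suc (suc M) ⟧)           ≡⟨ trans (cong (⟦ 16 ⟧ * ρ *_) (r-inverse (suc M))) (ℚₚ.*-identityʳ (⟦ 16 ⟧ * ρ)) ⟩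
    ⟦ 16 ⟧ * ρ                                   ≡⟨ trans (frac-* 16 1 1 (suc (suc M))) (ℚₚ./-cong {ℤ.+ 16} {1 ℕ.* suc (suc M)} {ℤ.+ 16} {suc (suc M)} refl (ℕₚ.*-identityˡ (suc (suc M)))) ⟩
    ℤ.+ 16 / suc (suc M)                         ∎
    where
    open ℚₚ.≤-Reasoning
    E ρ H : ℚ
    E = conv r r M
    ρ = r (suc M)
    H = sum r (suc M)
    E≡ : E ≡ ρ * (H + H)
    E≡ = trans (trans (sym (ℚₚ.*-identityˡ E)) (cong (_* E) (sym (r-inverse (suc M))))) (trans (ℚₚ.*-assoc ρ _ E) (cong (ρ *_) (convolved-harmonic M)))

  conv-harmonic→0 : ∀ ε → 0ℚ < ε → ∃[ N ] (∀ n → N ℕ.≤ n → ∣ conv r r n ∣ < ε)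
  conv-harmonic→0 ε 0<ε with archimedean 16 (ε * ε) (0<p*q 0<ε 0<ε)
  ... | N , h = N , λ n N≤n → ℚₚ.≰⇒> λ ε≤ → ℚₚ.<-irrefl refl (begin-strict
    ε * ε                         ≤⟨ *-mono-≤ (ℚₚ.0≤∣p∣ (conv r r n)) (ℚₚ.<⇒≤ 0<ε) ε≤ ε≤ ⟩
    ∣ conv r r n ∣ * ∣ conv r r n ∣   ≡⟨ cong₂ _*_ (E≥0 n) (E≥0 n) ⟩
    conv r r n * conv r r n       ≤⟨ conv-harmonic² n ⟩
    ℤ.+ 16 / suc (suc n)          <⟨ h (suc n) (ℕₚ.m≤n⇒m≤1+n N≤n) ⟩
    ε * ε                         ∎)
    where
    open ℚₚ.≤-Reasoning
    E≥0 : ∀ n → ∣ conv r r n ∣ ≡ conv r r n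
    E≥0 n = ℚₚ.0≤p⇒∣p∣≡p (conv≥0 n 0≤r 0≤r)

  -- For the odd numbers m = 2p+1 and n = 2q+1 these are 2/(n - m) and 2/(n + m).
  -- Since inv 0 = 0, the excluded term q = p contributes nothing to a sum of κ⁻.

  κ⁻ κ⁺ : ℕ → ℕ → ℚ
  κ⁻ p q = inv (⟦ q ⟧ - ⟦ p ⟧)
  κ⁺ p q = r (p ℕ.+ q)

  κ⁻-suc : ∀ p q → κ⁻ (suc p) (suc q) ≡ κ⁻ p q
  κ⁻-suc p q = cong inv (trans (cong₂ _-_ (⟦suc⟧ q) (⟦suc⟧ p)) (solve 2 (λ p q → (con 1ℚ :+ q) :- (con 1ℚ :+ p) := q :- p) refl ⟦ p ⟧ ⟦ q ⟧))

  κ⁻-anti : ∀ p q → κ⁻ q p ≡ - κ⁻ p q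
  κ⁻-anti p q = trans (cong inv (sub-swap ⟦ p ⟧ ⟦ q ⟧)) (inv-neg (⟦ q ⟧ - ⟦ p ⟧))

  κ⁻-diagonal : ∀ p → κ⁻ p p ≡ 0ℚ
  κ⁻-diagonal p = cong inv (ℚₚ.+-inverseʳ ⟦ p ⟧)

  module _ (c : ℚ) (c²≡1 : c * c ≡ 1ℚ) where
    private
      σ : ℕ → ℚ
      σ = pow c

      σ² : ∀ k → σ k * σ k ≡ 1ℚ
      σ² k = trans (sym (pow-* c c k)) (trans (cong (λ z → pow z k) c²≡1) (pow-one k))

      t : ℕ → ℚ
      t k = σ k * inv ⟦ k ⟧

      T : ℕ → ℚ
      T = sum t

      -- Induction on p: `κ⁻` is unchanged when both indices are shifted, so only the term q = 0 is
      -- new, and it supplies the last summand of T (suc (suc p)). The pole q = p costs nothing,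
      -- since `inv` 0 = 0.
      sum-κ⁻ : ∀ p d → sum (λ q → σ q * κ⁻ p q) (suc p ℕ.+ d) ≡ σ p * (T (suc d) - T (suc p))
      sum-κ⁻ zero d = begin
        sum (λ q → σ q * inv (⟦ q ⟧ - 0ℚ)) (suc d)
          ≡⟨ sum-cong (suc d) (λ q → cong (λ z → σ q * inv z) (ℚₚ.+-identityʳ ⟦ q ⟧)) ⟩
        T (suc d)
          ≡⟨ solve 1 (λ t → t := con 1ℚ :* (t :- con 0ℚ)) refl (T (suc d)) ⟩
        1ℚ * (T (suc d) - T 1) ∎
        where open ≡-Reasoning
      sum-κ⁻ (suc p) d = begin
        sum (λ q → σ q * κ⁻ (suc p) q) (suc (suc p ℕ.+ d))
          ≡⟨ sum-head (λ q → σ q * κ⁻ (suc p) q) (suc p ℕ.+ d) ⟩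
        1ℚ * inv (0ℚ - ⟦ suc p ⟧) + sum (λ q → c * σ q * κ⁻ (suc p) (suc q)) (suc p ℕ.+ d)
          ≡⟨ cong₂ _+_ (trans (ℚₚ.*-identityˡ _) (trans (cong inv (ℚₚ.+-identityˡ (- ⟦ suc p ⟧))) (inv-neg ⟦ suc p ⟧)))
               (trans (sum-cong (suc p ℕ.+ d) (λ q → trans (cong (c * σ q *_) (κ⁻-suc p q)) (ℚₚ.*-assoc c (σ q) (κ⁻ p q))))
                 (trans (sum-scale c (λ q → σ q * κ⁻ p q) (suc p ℕ.+ d)) (cong (c *_) (sum-κ⁻ p d)))) ⟩
        - i + c * (σ p * (T (suc d) - T (suc p)))
          ≡⟨ cong (λ z → z + c * (σ p * (T (suc d) - T (suc p)))) (trans (cong -_ (trans (sym (ℚₚ.*-identityˡ i)) (cong (_* i) (sym (σ² (suc p)))))) refl) ⟩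
        - (σ (suc p) * σ (suc p) * i) + c * (σ p * (T (suc d) - T (suc p)))
          ≡⟨ solve 5 (λ c s i a b → :- ((c :* s) :* (c :* s) :* i) :+ c :* (s :* (a :- b)) := c :* s :* (a :- (b :+ c :* s :* i))) refl c (σ p) i (T (suc d)) (T (suc p)) ⟩
        σ (suc p) * (T (suc d) - T (suc (suc p))) ∎
        where
        open ≡-Reasoning
        i = inv ⟦ suc p ⟧

      sum-κ⁺ : ∀ p n → sum (λ q → σ q * κ⁺ p q) n ≡ σ (suc p) * (T (suc p ℕ.+ n) - T (suc p))
      sum-κ⁺ p n = begin
        sum (λ q → σ q * κ⁺ p q) n
          ≡⟨ sum-cong n (λ q → trans (trans (cong (λ z → z * κ⁺ p q) (trans (sym (ℚₚ.*-identityˡ (σ q))) (cong (_* σ q) (sym (σ² (suc p))))))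
               (solve 3 (λ s t k → s :* s :* t :* k := s :* (s :* t :* k)) refl (σ (suc p)) (σ q) (κ⁺ p q)))
               (cong (σ (suc p) *_) (cong₂ _*_ (sym (pow-+ c (suc p) q)) (sym (inv⟦suc⟧ (p ℕ.+ q)))))) ⟩
        sum (λ q → σ (suc p) * t (suc p ℕ.+ q)) n
          ≡⟨ sum-scale (σ (suc p)) (λ q → t (suc p ℕ.+ q)) n ⟩
        σ (suc p) * sum (λ q → t (suc p ℕ.+ q)) n
          ≡⟨ cong (σ (suc p) *_) (trans (solve 2 (λ a b → a := (b :+ a) :- b) refl _ (T (suc p))) (cong (_- T (suc p)) (sym (sum-split t (suc p) n)))) ⟩
        σ (suc p) * (T (suc p ℕ.+ n) - T (suc p)) ∎
        where open ≡-Reasoning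

    -- Both rows are differences of partial sums T of c^k/k, and the factor c before `κ⁺` makes T
    -- (suc p) cancel. Only the 2p + 1 terms directly after T (suc d) survive. The cases c = -1 and
    -- c = 1 are the rows with and without alternating signs.
    kernel-sum : ∀ p d → sum (λ q → σ q * (κ⁻ p q - c * κ⁺ p q)) (suc p ℕ.+ d) ≡
                         - (σ p * (σ (suc d) * sum (λ k → σ k * r (d ℕ.+ k)) (suc (2 ℕ.* p))))
    kernel-sum p d = begin
      sum (λ q → σ q * (κ⁻ p q - c * κ⁺ p q)) N
        ≡⟨ sum-cong N (λ q → solve 4 (λ s a c b → s :* (a :- c :* b) := s :* a :+ (:- c) :* (s :* b)) refl (σ q) (κ⁻ p q) c (κ⁺ p q)) ⟩
      sum (λ q → σ q * κ⁻ p q + - c * (σ q * κ⁺ p q)) N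
        ≡⟨ trans (sum-+ (λ q → σ q * κ⁻ p q) (λ q → - c * (σ q * κ⁺ p q)) N)
             (cong₂ _+_ (sum-κ⁻ p d) (trans (sum-scale (- c) (λ q → σ q * κ⁺ p q) N) (cong (- c *_) (sum-κ⁺ p N)))) ⟩
      σ p * (T (suc d) - T (suc p)) + - c * (c * σ p * (T (suc p ℕ.+ N) - T (suc p)))
        ≡⟨ solve 5 (λ s c a b e → s :* (a :- b) :+ (:- c) :* (c :* s :* (e :- b)) := s :* (a :- b) :- (c :* c) :* (s :* (e :- b))) refl (σ p) c (T (suc d)) (T (suc p)) (T (suc p ℕ.+ N)) ⟩
      σ p * (T (suc d) - T (suc p)) - c * c * (σ p * (T (suc p ℕ.+ N) - T (suc p)))
        ≡⟨ cong₂ (λ z w → σ p * (T (suc d) - T (suc p)) - z * (σ p * (w - T (suc p)))) c²≡1 (trans (cong T index) (sum-split t (suc d) (suc (2 ℕ.* p)))) ⟩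
      σ p * (T (suc d) - T (suc p)) - 1ℚ * (σ p * ((T (suc d) + Q) - T (suc p)))
        ≡⟨ solve 4 (λ s a b e → s :* (a :- b) :- con 1ℚ :* (s :* ((a :+ e) :- b)) := :- (s :* e)) refl (σ p) (T (suc d)) (T (suc p)) Q ⟩
      - (σ p * Q)
        ≡⟨ cong (λ z → - (σ p * z)) (trans (sum-cong (suc (2 ℕ.* p)) (λ k → trans (cong₂ _*_ (pow-+ c (suc d) k) (inv⟦suc⟧ (d ℕ.+ k))) (ℚₚ.*-assoc (σ (suc d)) (σ k) _)))
             (sum-scale (σ (suc d)) (λ k → σ k * r (d ℕ.+ k)) (suc (2 ℕ.* p)))) ⟩
      - (σ p * (σ (suc d) * sum (λ k → σ k * r (d ℕ.+ k)) (suc (2 ℕ.* p)))) ∎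
      where
      open ≡-Reasoning
      N = suc p ℕ.+ d
      Q = sum (λ k → t (suc d ℕ.+ k)) (suc (2 ℕ.* p))
      index : suc p ℕ.+ N ≡ suc d ℕ.+ suc (2 ℕ.* p)
      index = ℕ-Solver.solve 2 (λ p d → (c1 :⊕ p) :⊕ ((c1 :⊕ p) :⊕ d) ℕ-Solver.:= (c1 :⊕ d) :⊕ (c1 :⊕ ℕ-Solver.con 2 ℕ-Solver.:* p)) refl p d
        where
        open ℕ-Solver using () renaming (_:+_ to _:⊕_)
        c1 = ℕ-Solver.con 1

    ∣pow∣≡1 : ∀ k → ∣ σ k ∣ ≡ 1ℚ
    ∣pow∣≡1 k = square-root (∣ σ k ∣) (ℚₚ.0≤∣p∣ (σ k)) (trans (sym (ℚₚ.∣p*q∣≡∣p∣*∣q∣ (σ k) (σ k))) (cong ∣_∣ (σ² k)))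
      where
      square-root : ∀ x → 0ℚ ≤ x → x * x ≡ 1ℚ → x ≡ 1ℚ
      square-root x 0≤x x²≡1 = *-cancelˡ {1ℚ + x} (pos≢0 (ℚₚ.+-mono-<-≤ 0<1ℚ 0≤x))
        (trans (trans (solve 1 (λ x → (con 1ℚ :+ x) :* x := x :+ x :* x) refl x) (cong (x +_) x²≡1))
          (solve 1 (λ x → x :+ con 1ℚ := (con 1ℚ :+ x) :* con 1ℚ) refl x))

    ∣kernel-sum∣ : ∀ p d → ∣ sum (λ q → σ q * (κ⁻ p q - c * κ⁺ p q)) (suc p ℕ.+ d) ∣ ≡ ∣ sum (λ k → σ k * r (d ℕ.+ k)) (suc (2 ℕ.* p)) ∣
    ∣kernel-sum∣ p d = begin
      ∣ sum (λ q → σ q * (κ⁻ p q - c * κ⁺ p q)) (suc p ℕ.+ d) ∣   ≡⟨ cong ∣_∣ (kernel-sum p d) ⟩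
      ∣ - (σ p * (σ (suc d) * Q)) ∣                                ≡⟨ trans (ℚₚ.∣-p∣≡∣p∣ (σ p * (σ (suc d) * Q))) (ℚₚ.∣p*q∣≡∣p∣*∣q∣ (σ p) (σ (suc d) * Q)) ⟩
      ∣ σ p ∣ * ∣ σ (suc d) * Q ∣                                  ≡⟨ trans (cong (_* ∣ σ (suc d) * Q ∣) (∣pow∣≡1 p)) (ℚₚ.*-identityˡ _) ⟩
      ∣ σ (suc d) * Q ∣                                            ≡⟨ ℚₚ.∣p*q∣≡∣p∣*∣q∣ (σ (suc d)) Q ⟩
      ∣ σ (suc d) ∣ * ∣ Q ∣                                        ≡⟨ trans (cong (_* ∣ Q ∣) (∣pow∣≡1 (suc d))) (ℚₚ.*-identityˡ _) ⟩
      ∣ Q ∣                                                        ∎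
      where
      open ≡-Reasoning
      Q = sum (λ k → σ k * r (d ℕ.+ k)) (suc (2 ℕ.* p))
  sign≡pow : ∀ k → sign k ≡ pow (- 1ℚ) k
  sign≡pow zero    = refl
  sign≡pow (suc k) = trans (cong -_ (sign≡pow k)) (solve 1 (λ s → :- s := con (- 1ℚ) :* s) refl (pow (- 1ℚ) k))

  sign² : ∀ k → sign k * sign k ≡ 1ℚ
  sign² zero    = refl
  sign² (suc k) = trans (solve 1 (λ s → (:- s) :* (:- s) := s :* s) refl (sign k)) (sign² k)

  -- p and d are the offsets in N = p + 1 + d.
  alternating-kernel : ∀ p d → ∣ sum (λ q → sign q * (κ⁻ p q + κ⁺ p q)) (suc p ℕ.+ d) ∣ ≤ r d
  alternating-kernel p d = begin
    ∣ sum (λ q → sign q * (κ⁻ p q + κ⁺ p q)) (suc p ℕ.+ d) ∣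
      ≡⟨ cong ∣_∣ (sum-cong (suc p ℕ.+ d) (λ q → cong₂ _*_ (sign≡pow q) (solve 2 (λ a b → a :+ b := a :- con (- 1ℚ) :* b) refl (κ⁻ p q) (κ⁺ p q)))) ⟩
    ∣ sum (λ q → pow (- 1ℚ) q * (κ⁻ p q - - 1ℚ * κ⁺ p q)) (suc p ℕ.+ d) ∣
      ≡⟨ ∣kernel-sum∣ (- 1ℚ) refl p d ⟩
    ∣ sum (λ k → pow (- 1ℚ) k * r (d ℕ.+ k)) (suc (2 ℕ.* p)) ∣
      ≡⟨ cong ∣_∣ (sum-cong (suc (2 ℕ.* p)) (λ k → cong (_* r (d ℕ.+ k)) (sym (sign≡pow k)))) ⟩
    ∣ sum (λ k → sign k * r (d ℕ.+ k)) (suc (2 ℕ.* p)) ∣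
      ≡⟨ ℚₚ.0≤p⇒∣p∣≡p (alternating-≥0 0≤r (λ k → r-antitone (ℕₚ.n≤1+n k)) d (suc (2 ℕ.* p))) ⟩
    sum (λ k → sign k * r (d ℕ.+ k)) (suc (2 ℕ.* p))
      ≤⟨ alternating-≤ 0≤r (λ k → r-antitone (ℕₚ.n≤1+n k)) d (suc (2 ℕ.* p)) ⟩
    r d ∎
    where open ℚₚ.≤-Reasoning

  -- Without alternation the 2p + 1 surviving terms are bounded one by one. The factor 2p + 1 does
  -- no harm: in `W₂≤` it is absorbed by a power of 1/(2p+1).
  plain-kernel : ∀ p d → ∣ sum (λ q → κ⁻ p q - κ⁺ p q) (suc p ℕ.+ d) ∣ ≤ ⟦ suc (2 ℕ.* p) ⟧ * r d
  plain-kernel p d = begin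
    ∣ sum (λ q → κ⁻ p q - κ⁺ p q) (suc p ℕ.+ d) ∣
      ≡⟨ cong ∣_∣ (sum-cong (suc p ℕ.+ d) (λ q → trans (solve 2 (λ a b → a :- b := con 1ℚ :* (a :- con 1ℚ :* b)) refl (κ⁻ p q) (κ⁺ p q))
           (cong (_* (κ⁻ p q - 1ℚ * κ⁺ p q)) (sym (pow-one q))))) ⟩
    ∣ sum (λ q → pow 1ℚ q * (κ⁻ p q - 1ℚ * κ⁺ p q)) (suc p ℕ.+ d) ∣
      ≡⟨ ∣kernel-sum∣ 1ℚ refl p d ⟩
    ∣ sum (λ k → pow 1ℚ k * r (d ℕ.+ k)) (suc (2 ℕ.* p)) ∣
      ≡⟨ cong ∣_∣ (sum-cong (suc (2 ℕ.* p)) (λ k → trans (cong (_* r (d ℕ.+ k)) (pow-one k)) (ℚₚ.*-identityˡ _))) ⟩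
    ∣ sum (λ k → r (d ℕ.+ k)) (suc (2 ℕ.* p)) ∣
      ≡⟨ ℚₚ.0≤p⇒∣p∣≡p (sum≥0 (suc (2 ℕ.* p)) (λ k → 0≤r (d ℕ.+ k))) ⟩
    sum (λ k → r (d ℕ.+ k)) (suc (2 ℕ.* p))
      ≤⟨ sum-mono (suc (2 ℕ.* p)) (λ k → r-antitone (ℕₚ.m≤m+n d k)) ⟩
    sum (λ _ → r d) (suc (2 ℕ.* p))
      ≡⟨ sum-const (r d) (suc (2 ℕ.* p)) ⟩
    ⟦ suc (2 ℕ.* p) ⟧ * r d ∎
    where open ℚₚ.≤-Reasoning

  geometric : ∀ n u v → (u - v) * conv (pow u) (pow v) n ≡ pow u (suc n) - pow v (suc n)
  geometric zero    u v = solve 2 (λ u v → (u :- v) :* (con 1ℚ :* con 1ℚ) := u :* con 1ℚ :- v :* con 1ℚ) refl u v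
  geometric (suc n) u v = begin
    (u - v) * (1ℚ * (v * V) + conv (λ k → u * pow u k) (pow v) n)
      ≡⟨ cong (λ z → (u - v) * (1ℚ * (v * V) + z)) (conv-scaleˡ u (pow u) (pow v) n) ⟩
    (u - v) * (1ℚ * (v * V) + u * h)
      ≡⟨ solve 4 (λ u v w h → (u :- v) :* (con 1ℚ :* (v :* w) :+ u :* h) := (u :- v) :* (v :* w) :+ u :* ((u :- v) :* h)) refl u v V h ⟩
    (u - v) * (v * V) + u * ((u - v) * h)
      ≡⟨ cong (λ z → (u - v) * (v * V) + u * z) (geometric n u v) ⟩
    (u - v) * (v * V) + u * (u * U - v * V)
      ≡⟨ solve 4 (λ u v a b → (u :- v) :* (v :* b) :+ u :* (u :* a :- v :* b) := u :* (u :* a) :- v :* (v :* b)) refl u v U V ⟩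
    u * (u * U) - v * (v * V) ∎
    where
    open ≡-Reasoning
    U = pow u n
    V = pow v n
    h = conv (pow u) (pow v) n

  geometric-diagonal : ∀ n u → conv (pow u) (pow u) n ≡ ⟦ suc n ⟧ * pow u n
  geometric-diagonal zero    u = refl
  geometric-diagonal (suc n) u = begin
    1ℚ * (u * pow u n) + conv (λ k → u * pow u k) (pow u) n
      ≡⟨ cong (1ℚ * (u * pow u n) +_) (trans (conv-scaleˡ u (pow u) (pow u) n) (cong (u *_) (geometric-diagonal n u))) ⟩
    1ℚ * (u * pow u n) + u * (⟦ suc n ⟧ * pow u n)
      ≡⟨ solve 3 (λ u a m → con 1ℚ :* (u :* a) :+ u :* (m :* a) := (con 1ℚ :+ m) :* (u :* a)) refl u (pow u n) ⟦ suc n ⟧ ⟩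
    (1ℚ + ⟦ suc n ⟧) * (u * pow u n)
      ≡⟨ cong (_* (u * pow u n)) (⟦suc⟧ (suc n)) ⟨
    ⟦ suc (suc n) ⟧ * (u * pow u n) ∎
    where open ≡-Reasoning

  -- Partial fractions, with m = 1/x, n = 1/y, n - m = 2d and n + m = 2e.
  module _ (x y m n d e D F h X Y : ℚ) (xm≡1 : x * m ≡ 1ℚ) (yn≡1 : y * n ≡ 1ℚ) (Dd≡1 : D * d ≡ 1ℚ) (Fe≡1 : F * e ≡ 1ℚ)
           (e+d≡n : e + d ≡ n) (e-d≡m : e - d ≡ m) (geom : (x * x - y * y) * h ≡ X - Y) where
    private
      four : ⟦ 4 ⟧ * (x * y * h) ≡ m * n * (D * F) * (X - Y)
      four = sym (begin
        m * n * (D * F) * (X - Y)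
          ≡⟨ cong (m * n * (D * F) *_) (sym geom) ⟩
        m * n * (D * F) * ((x * x - y * y) * h)
          ≡⟨ solve 7 (λ x y m n D F h → m :* n :* (D :* F) :* ((x :* x :- y :* y) :* h)
               := D :* F :* h :* ((x :* m) :* x :* n :- (y :* n) :* y :* m)) refl x y m n D F h ⟩
        D * F * h * ((x * m) * x * n - (y * n) * y * m)
          -- Exchanging the two factors that equal 1 turns xn - ym into xy(n² - m²), and n² - m² =
          -- 4de because n = e + d and m = e - d.
          ≡⟨ cong₂ (λ a b → D * F * h * (a * x * n - b * y * m)) (trans xm≡1 (sym yn≡1)) (trans yn≡1 (sym xm≡1)) ⟩
        D * F * h * ((y * n) * x * n - (x * m) * y * m)
          ≡⟨ cong₂ (λ a b → D * F * h * ((y * a) * x * a - (x * b) * y * b)) (sym e+d≡n) (sym e-d≡m) ⟩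
        D * F * h * ((y * (e + d)) * x * (e + d) - (x * (e - d)) * y * (e - d))
          ≡⟨ solve 7 (λ x y d e D F h → D :* F :* h :* ((y :* (e :+ d)) :* x :* (e :+ d) :- (x :* (e :- d)) :* y :* (e :- d))
               := con ⟦ 4 ⟧ :* (D :* d) :* (F :* e) :* (x :* y :* h)) refl x y d e D F h ⟩
        ⟦ 4 ⟧ * (D * d) * (F * e) * (x * y * h)
          ≡⟨ cong₂ (λ a b → ⟦ 4 ⟧ * a * b * (x * y * h)) Dd≡1 Fe≡1 ⟩
        ⟦ 4 ⟧ * 1ℚ * 1ℚ * (x * y * h)
          ≡⟨ solve 1 (λ z → con ⟦ 4 ⟧ :* con 1ℚ :* con 1ℚ :* z := con ⟦ 4 ⟧ :* z) refl (x * y * h) ⟩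
        ⟦ 4 ⟧ * (x * y * h) ∎)
        where open ≡-Reasoning

      D+F : D + F ≡ D * F * n
      D+F = trans (trans (solve 2 (λ D F → D :+ F := D :* con 1ℚ :+ F :* con 1ℚ) refl D F) (cong₂ (λ a b → D * a + F * b) (sym Fe≡1) (sym Dd≡1)))
        (trans (solve 4 (λ D F e d → D :* (F :* e) :+ F :* (D :* d) := D :* F :* (e :+ d)) refl D F e d) (cong (D * F *_) e+d≡n))

      D-F : D - F ≡ D * F * m
      D-F = trans (trans (solve 2 (λ D F → D :- F := D :* con 1ℚ :- F :* con 1ℚ) refl D F) (cong₂ (λ a b → D * a - F * b) (sym Fe≡1) (sym Dd≡1)))
        (trans (solve 4 (λ D F e d → D :* (F :* e) :- F :* (D :* d) := D :* F :* (e :- d)) refl D F e d) (cong (D * F *_) e-d≡m))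

    partial-fractions : ⟦ 4 ⟧ * (x * y * h) ≡ (D + F) * (m * X) + (- D + F) * (n * Y)
    partial-fractions = trans four (sym (trans
      (cong₂ (λ a b → a * (m * X) + b * (n * Y)) D+F (trans (solve 2 (λ D F → :- D :+ F := :- (D :- F)) refl D F) (cong -_ D-F)))
      (solve 6 (λ D F m n X Y → D :* F :* n :* (m :* X) :+ (:- (D :* F :* m)) :* (n :* Y) := m :* n :* (D :* F) :* (X :- Y)) refl D F m n X Y)))

    partial-fractions′ : ⟦ 4 ⟧ * (x * (y * y) * h) ≡ (D - F) * X + (- D + F) * Y
    partial-fractions′ = trans (solve 3 (λ x y h → con ⟦ 4 ⟧ :* (x :* (y :* y) :* h) := y :* (con ⟦ 4 ⟧ :* (x :* y :* h))) refl x y h)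
      (trans (cong (y *_) four) (trans
        (trans (solve 6 (λ y m n G X Y → y :* (m :* n :* G :* (X :- Y)) := (y :* n) :* (G :* m) :* (X :- Y)) refl y m n (D * F) X Y)
               (cong₂ (λ a b → a * b * (X - Y)) yn≡1 (sym D-F)))
        (solve 4 (λ D F X Y → con 1ℚ :* (D :- F) :* (X :- Y) := (D :- F) :* X :+ (:- D :+ F) :* Y) refl D F X Y)))

  ξ : ℕ → ℚ
  ξ p = r (2 ℕ.* p)

  ⟦odd⟧ : ∀ p → ⟦ suc (2 ℕ.* p) ⟧ ≡ 1ℚ + (⟦ p ⟧ + ⟦ p ⟧)
  ⟦odd⟧ p = trans (⟦suc⟧ (2 ℕ.* p)) (cong (1ℚ +_) (trans (cong ⟦_⟧ (cong (p ℕ.+_) (ℕₚ.+-identityʳ p))) (⟦+⟧ p p)))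

  -- The first N terms of λ(2k+2) and of β(2k+1), with `ξ` p = 1/(2p+1).
  odd-sum odd-alternating-sum : ℕ → ℕ → ℚ
  odd-sum k N = sum (λ p → ξ p * ξ p * pow (ξ p * ξ p) k) N
  odd-alternating-sum k N = sum (λ p → sign p * ξ p * pow (ξ p * ξ p) k) N

  module _ (n : ℕ) where
    private
      u : ℕ → ℚ
      u p = ξ p * ξ p

      h : ℕ → ℕ → ℚ
      h p q = conv (pow (u p)) (pow (u q)) n

      ¼ : ℚ
      ¼ = ℤ.+ 1 / 4

      quarter : ∀ {a b} → ⟦ 4 ⟧ * a ≡ b → a ≡ ¼ * b
      quarter {a} {b} eq = trans (solve 1 (λ a → a := con ¼ :* (con ⟦ 4 ⟧ :* a)) refl a) (cong (¼ *_) eq)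

      module Off (p q : ℕ) (p≢q : p ≢ q) where
        d≢0 : ⟦ q ⟧ - ⟦ p ⟧ ≢ 0ℚ
        d≢0 eq = case ℕₚ.<-cmp p q of λ
          { (tri< p<q _ _) → pos≢0 (≤-diff p q p<q) eq
          ; (tri≈ _ p≡q _) → p≢q p≡q
          ; (tri> _ _ q<p) → pos≢0 (≤-diff q p q<p) (trans (sub-swap ⟦ p ⟧ ⟦ q ⟧) (cong -_ eq)) }
          where
          open import Relation.Binary.Definitions using (tri<; tri≈; tri>)
          ≤-diff : ∀ a b → a ℕ.< b → 0ℚ < ⟦ b ⟧ - ⟦ a ⟧
          ≤-diff a b a<b = ℚₚ.<-≤-trans 0<1ℚ (subst (_≤ ⟦ b ⟧ - ⟦ a ⟧)
            (trans (cong (_- ⟦ a ⟧) (⟦suc⟧ a)) (solve 1 (λ a → (con 1ℚ :+ a) :- a := con 1ℚ) refl ⟦ a ⟧))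
            (ℚₚ.+-monoˡ-≤ (- ⟦ a ⟧) (⟦⟧-mono-≤ (suc a) b a<b)))

        e : ℚ
        e = ⟦ suc (p ℕ.+ q) ⟧

        e≡ : e ≡ 1ℚ + (⟦ p ⟧ + ⟦ q ⟧)
        e≡ = trans (⟦suc⟧ (p ℕ.+ q)) (cong (1ℚ +_) (⟦+⟧ p q))

        both : (⟦ 4 ⟧ * (ξ p * ξ q * h p q) ≡ (κ⁻ p q + κ⁺ p q) * (⟦ suc (2 ℕ.* p) ⟧ * pow (u p) (suc n)) + (- κ⁻ p q + κ⁺ p q) * (⟦ suc (2 ℕ.* q) ⟧ * pow (u q) (suc n)))
             × (⟦ 4 ⟧ * (ξ p * u q * h p q) ≡ (κ⁻ p q - κ⁺ p q) * pow (u p) (suc n) + (- κ⁻ p q + κ⁺ p q) * pow (u q) (suc n))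
        both = partial-fractions
                 (ξ p) (ξ q) ⟦ suc (2 ℕ.* p) ⟧ ⟦ suc (2 ℕ.* q) ⟧ (⟦ q ⟧ - ⟦ p ⟧) e (κ⁻ p q) (κ⁺ p q) (h p q) (pow (u p) (suc n)) (pow (u q) (suc n)) xm yn Dd Fe e+d e-d geom
             , partial-fractions′
                 (ξ p) (ξ q) ⟦ suc (2 ℕ.* p) ⟧ ⟦ suc (2 ℕ.* q) ⟧ (⟦ q ⟧ - ⟦ p ⟧) e (κ⁻ p q) (κ⁺ p q) (h p q) (pow (u p) (suc n)) (pow (u q) (suc n)) xm yn Dd Fe e+d e-d geom
          where
          xm = r-inverse (2 ℕ.* p)
          yn = r-inverse (2 ℕ.* q)
          Dd = inv-inverse (⟦ q ⟧ - ⟦ p ⟧) d≢0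
          Fe = r-inverse (p ℕ.+ q)
          geom = geometric n (u p) (u q)
          e+d : e + (⟦ q ⟧ - ⟦ p ⟧) ≡ ⟦ suc (2 ℕ.* q) ⟧
          e+d = trans (cong (_+ (⟦ q ⟧ - ⟦ p ⟧)) e≡) (trans (solve 2 (λ p q → (con 1ℚ :+ (p :+ q)) :+ (q :- p) := con 1ℚ :+ (q :+ q)) refl ⟦ p ⟧ ⟦ q ⟧) (sym (⟦odd⟧ q)))
          e-d : e - (⟦ q ⟧ - ⟦ p ⟧) ≡ ⟦ suc (2 ℕ.* p) ⟧
          e-d = trans (cong (_- (⟦ q ⟧ - ⟦ p ⟧)) e≡) (trans (solve 2 (λ p q → (con 1ℚ :+ (p :+ q)) :- (q :- p) := con 1ℚ :+ (p :+ p)) refl ⟦ p ⟧ ⟦ q ⟧) (sym (⟦odd⟧ p)))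

      odd·pow : ∀ p → ⟦ suc (2 ℕ.* p) ⟧ * pow (u p) (suc n) ≡ ξ p * pow (u p) n
      odd·pow p = trans (solve 3 (λ m x z → m :* (x :* x :* z) := (x :* m) :* (x :* z)) refl ⟦ suc (2 ℕ.* p) ⟧ (ξ p) (pow (u p) n))
        (trans (cong (_* (ξ p * pow (u p) n)) (r-inverse (2 ℕ.* p))) (ℚₚ.*-identityˡ _))

      κ⁺-diagonal : ∀ p → κ⁺ p p ≡ ξ p
      κ⁺-diagonal p = cong (λ z → r (p ℕ.+ z)) (sym (ℕₚ.+-identityʳ p))

      κ⁺-comm : ∀ p q → κ⁺ q p ≡ κ⁺ p q
      κ⁺-comm p q = cong r (ℕₚ.+-comm q p)

    -- The parts into which partial fractions split the contribution of a pair (p, q). Each carries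
    -- a power of `ξ` at its first index only, so that summing over the other index leaves a pure
    -- kernel sum.
    G₁ G₂ G₃ : ℕ → ℕ → ℚ
    G₁ p q = ¼ * (ξ p * pow (u p) n) * (κ⁻ p q + κ⁺ p q)
    G₂ p q = ¼ * pow (u p) (suc n) * (κ⁻ p q - κ⁺ p q)
    G₃ p q = ¼ * pow (u p) (suc n) * (κ⁻ p q + κ⁺ p q)

    -- Off the diagonal this is the partial fraction formula. On it the geometric sum has n + 1
    -- equal terms, and the two copies of `G₁` p p take away a quarter each since `κ⁺` p p = `ξ` p:
    -- hence the factor n + 1/2.
    pair₁ : ∀ p q → ξ p * ξ q * conv (pow (u p)) (pow (u q)) n ≡ G₁ p q + G₁ q p + δ p q * ((⟦ n ⟧ + ½) * (u p * pow (u p) n))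
    pair₁ p q = case p ℕₚ.≟ q of λ { (yes refl) → diagonal ; (no p≢q) → off-diagonal p≢q }
      where
      diagonal : ξ p * ξ p * conv (pow (u p)) (pow (u p)) n ≡ G₁ p p + G₁ p p + δ p p * ((⟦ n ⟧ + ½) * (u p * pow (u p) n))
      diagonal = begin
        ξ p * ξ p * h p p
          ≡⟨ cong (ξ p * ξ p *_) (trans (geometric-diagonal n (u p)) (cong (_* pow (u p) n) (⟦suc⟧ n))) ⟩
        ξ p * ξ p * ((1ℚ + ⟦ n ⟧) * U)
          ≡⟨ solve 3 (λ x m u → x :* x :* ((con 1ℚ :+ m) :* u) := (con ¼ :* (x :* u) :* (con 0ℚ :+ x)) :+ (con ¼ :* (x :* u) :* (con 0ℚ :+ x)) :+ con 1ℚ :* ((m :+ con ½) :* (x :* x :* u))) refl (ξ p) ⟦ n ⟧ U ⟩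
        (¼ * (ξ p * U) * (0ℚ + ξ p)) + (¼ * (ξ p * U) * (0ℚ + ξ p)) + 1ℚ * ((⟦ n ⟧ + ½) * (u p * U))
          ≡⟨ cong₂ (λ a b → (¼ * (ξ p * U) * (a + b)) + (¼ * (ξ p * U) * (a + b)) + 1ℚ * ((⟦ n ⟧ + ½) * (u p * U))) (sym (κ⁻-diagonal p)) (sym (κ⁺-diagonal p)) ⟩
        G₁ p p + G₁ p p + 1ℚ * ((⟦ n ⟧ + ½) * (u p * U))
          ≡⟨ cong (λ z → G₁ p p + G₁ p p + z * ((⟦ n ⟧ + ½) * (u p * U))) (sym (δ-refl p)) ⟩
        G₁ p p + G₁ p p + δ p p * ((⟦ n ⟧ + ½) * (u p * U)) ∎
        where
        open ≡-Reasoning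
        U = pow (u p) n
      off-diagonal : p ≢ q → ξ p * ξ q * conv (pow (u p)) (pow (u q)) n ≡ G₁ p q + G₁ q p + δ p q * ((⟦ n ⟧ + ½) * (u p * pow (u p) n))
      off-diagonal p≢q = begin
        ξ p * ξ q * h p q
          ≡⟨ quarter (trans (proj₁ (Off.both p q p≢q)) (cong₂ (λ a b → (κ⁻ p q + κ⁺ p q) * a + (- κ⁻ p q + κ⁺ p q) * b) (odd·pow p) (odd·pow q))) ⟩
        ¼ * ((κ⁻ p q + κ⁺ p q) * (ξ p * U) + (- κ⁻ p q + κ⁺ p q) * (ξ q * V))
          ≡⟨ cong₂ (λ a b → ¼ * ((κ⁻ p q + κ⁺ p q) * (ξ p * U) + (a + b) * (ξ q * V))) (sym (κ⁻-anti p q)) (sym (κ⁺-comm p q)) ⟩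
        ¼ * ((κ⁻ p q + κ⁺ p q) * (ξ p * U) + (κ⁻ q p + κ⁺ q p) * (ξ q * V))
          ≡⟨ solve 5 (λ a b c d e → con ¼ :* (a :* b :+ c :* d) := con ¼ :* b :* a :+ con ¼ :* d :* c :+ con 0ℚ :* e) refl (κ⁻ p q + κ⁺ p q) (ξ p * U) (κ⁻ q p + κ⁺ q p) (ξ q * V) ((⟦ n ⟧ + ½) * (u p * U)) ⟩
        G₁ p q + G₁ q p + 0ℚ * ((⟦ n ⟧ + ½) * (u p * U))
          ≡⟨ cong (λ z → G₁ p q + G₁ q p + z * ((⟦ n ⟧ + ½) * (u p * U))) (sym (δ-≢ p≢q)) ⟩
        G₁ p q + G₁ q p + δ p q * ((⟦ n ⟧ + ½) * (u p * U)) ∎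
        where
        open ≡-Reasoning
        U = pow (u p) n
        V = pow (u q) n

    -- On the diagonal `G₂` and `G₃` cancel each other because `κ⁻` vanishes there, so that here the
    -- full factor n + 1 remains.
    pair₂ : ∀ p q → ξ p * u q * conv (pow (u p)) (pow (u q)) n ≡ G₂ p q + G₃ q p + δ p q * (⟦ suc n ⟧ * (ξ p * pow (u p) (suc n)))
    pair₂ p q = case p ℕₚ.≟ q of λ { (yes refl) → diagonal ; (no p≢q) → off-diagonal p≢q }
      where
      diagonal : ξ p * u p * conv (pow (u p)) (pow (u p)) n ≡ G₂ p p + G₃ p p + δ p p * (⟦ suc n ⟧ * (ξ p * pow (u p) (suc n)))
      diagonal = begin
        ξ p * u p * h p p
          ≡⟨ cong (ξ p * u p *_) (geometric-diagonal n (u p)) ⟩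
        ξ p * u p * (⟦ suc n ⟧ * U)
          ≡⟨ solve 3 (λ x m u → x :* (x :* x) :* (m :* u) := (con ¼ :* (x :* x :* u) :* (con 0ℚ :- x)) :+ (con ¼ :* (x :* x :* u) :* (con 0ℚ :+ x)) :+ con 1ℚ :* (m :* (x :* (x :* x :* u)))) refl (ξ p) ⟦ suc n ⟧ U ⟩
        (¼ * (u p * U) * (0ℚ - ξ p)) + (¼ * (u p * U) * (0ℚ + ξ p)) + 1ℚ * (⟦ suc n ⟧ * (ξ p * (u p * U)))
          ≡⟨ cong₂ (λ a b → (¼ * (u p * U) * (a - b)) + (¼ * (u p * U) * (a + b)) + 1ℚ * (⟦ suc n ⟧ * (ξ p * (u p * U)))) (sym (κ⁻-diagonal p)) (sym (κ⁺-diagonal p)) ⟩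
        G₂ p p + G₃ p p + 1ℚ * (⟦ suc n ⟧ * (ξ p * (u p * U)))
          ≡⟨ cong (λ z → G₂ p p + G₃ p p + z * (⟦ suc n ⟧ * (ξ p * (u p * U)))) (sym (δ-refl p)) ⟩
        G₂ p p + G₃ p p + δ p p * (⟦ suc n ⟧ * (ξ p * (u p * U))) ∎
        where
        open ≡-Reasoning
        U = pow (u p) n
      off-diagonal : p ≢ q → ξ p * u q * conv (pow (u p)) (pow (u q)) n ≡ G₂ p q + G₃ q p + δ p q * (⟦ suc n ⟧ * (ξ p * pow (u p) (suc n)))
      off-diagonal p≢q = begin
        ξ p * u q * h p q
          ≡⟨ quarter (proj₂ (Off.both p q p≢q)) ⟩
        ¼ * ((κ⁻ p q - κ⁺ p q) * U + (- κ⁻ p q + κ⁺ p q) * V)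
          ≡⟨ cong₂ (λ a b → ¼ * ((κ⁻ p q - κ⁺ p q) * U + (a + b) * V)) (sym (κ⁻-anti p q)) (sym (κ⁺-comm p q)) ⟩
        ¼ * ((κ⁻ p q - κ⁺ p q) * U + (κ⁻ q p + κ⁺ q p) * V)
          ≡⟨ solve 5 (λ a b c d e → con ¼ :* (a :* b :+ c :* d) := con ¼ :* b :* a :+ con ¼ :* d :* c :+ con 0ℚ :* e) refl (κ⁻ p q - κ⁺ p q) U (κ⁻ q p + κ⁺ q p) V (⟦ suc n ⟧ * (ξ p * U)) ⟩
        G₂ p q + G₃ q p + 0ℚ * (⟦ suc n ⟧ * (ξ p * U))
          ≡⟨ cong (λ z → G₂ p q + G₃ q p + z * (⟦ suc n ⟧ * (ξ p * U))) (sym (δ-≢ p≢q)) ⟩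
        G₂ p q + G₃ q p + δ p q * (⟦ suc n ⟧ * (ξ p * U)) ∎
        where
        open ≡-Reasoning
        U = pow (u p) (suc n)
        V = pow (u q) (suc n)

    private
      sum² : (ℕ → ℕ → ℚ) → ℕ → ℚ
      sum² f N = sum (λ p → sum (f p) N) N

      sum²-cong : ∀ {f g} N → (∀ p q → f p q ≡ g p q) → sum² f N ≡ sum² g N
      sum²-cong N eq = sum-cong N λ p → sum-cong N (eq p)

      sum²-+ : ∀ f g N → sum² (λ p q → f p q + g p q) N ≡ sum² f N + sum² g N
      sum²-+ f g N = trans (sum-cong N λ p → sum-+ (f p) (g p) N) (sum-+ (λ p → sum (f p) N) (λ p → sum (g p) N) N)

      sum²-δ : ∀ (f : ℕ → ℕ → ℚ) N → sum² (λ p q → δ p q * f p q) N ≡ sum (λ p → f p p) N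
      sum²-δ f N = sum-cong< N λ p p<N → begin
        sum (λ q → δ p q * f p q) N    ≡⟨ sum-cong N (λ q → on-diagonal p q) ⟩
        sum (λ q → f p p * δ p q) N    ≡⟨ sum-scale (f p p) (δ p) N ⟩
        f p p * sum (δ p) N            ≡⟨ cong (f p p *_) (sum-δ p N p<N) ⟩
        f p p * 1ℚ                     ≡⟨ ℚₚ.*-identityʳ (f p p) ⟩
        f p p                          ∎
        where
        open ≡-Reasoning
        on-diagonal : ∀ p q → δ p q * f p q ≡ f p p * δ p q
        on-diagonal p q = case p ℕₚ.≟ q of λ
          { (yes refl) → ℚₚ.*-comm (δ p p) (f p p)
          ; (no p≢q) → trans (cong (_* f p q) (δ-≢ p≢q)) (trans (ℚₚ.*-zeroˡ (f p q))
              (trans (sym (ℚₚ.*-zeroʳ (f p p))) (cong (f p p *_) (sym (δ-≢ p≢q))))) }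

      conv-geometric : ∀ α β u v → conv (λ i → α * pow u i) (λ i → β * pow v i) n ≡ α * β * conv (pow u) (pow v) n
      conv-geometric α β u v = trans (conv-scaleˡ α (pow u) (λ i → β * pow v i) n)
        (trans (cong (α *_) (conv-scaleʳ β (pow u) (pow v) n)) (sym (ℚₚ.*-assoc α β _)))

      -- A row close to the edge of the square has a small d and a poor kernel estimate, but then p
      -- is large and the factor `r` p compensates. The rows together form the convolution of the
      -- harmonic sequence with itself.
      error-bound : ∀ (g : ℕ → ℚ) M → (∀ p d → p ℕ.+ d ≡ M → ∣ g p ∣ ≤ r p * r d) → ∣ sum g (suc M) ∣ ≤ conv r r M
      error-bound g M bound = begin
        ∣ sum g (suc M) ∣                            ≤⟨ ∣sum∣≤ g (suc M) ⟩
        sum (λ p → ∣ g p ∣) (suc M)                  ≤⟨ sum-mono< (suc M) (λ p p≤M → bound p (M ℕ.∸ p) (ℕₚ.m+[n∸m]≡n (ℕₚ.≤-pred p≤M))) ⟩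
        sum (λ p → r p * r (M ℕ.∸ p)) (suc M)        ≡⟨ conv≡cauchyProduct r r M ⟨
        conv r r M                                   ∎
        where open ℚₚ.≤-Reasoning

      0≤ξ : ∀ p → 0ℚ ≤ ξ p
      0≤ξ p = 0≤r (2 ℕ.* p)

      ξ≤r : ∀ p → ξ p ≤ r p
      ξ≤r p = r-antitone (ℕₚ.m≤m+n p (p ℕ.+ 0))

      u^≤1 : ∀ k p → pow (u p) k ≤ 1ℚ
      u^≤1 k p = pow≤1 (0≤* (0≤ξ p) (0≤ξ p)) (*-mono-≤ {b = 1ℚ} {d = 1ℚ} (ℚₚ.<⇒≤ 0<1ℚ) (0≤ξ p) (r≤1 (2 ℕ.* p)) (r≤1 (2 ℕ.* p))) k

      0≤u^ : ∀ k p → 0ℚ ≤ pow (u p) k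
      0≤u^ k p = 0≤pow (0≤* (0≤ξ p) (0≤ξ p)) k

      ξu^≤r : ∀ k p → ξ p * pow (u p) k ≤ r p
      ξu^≤r k p = ℚₚ.≤-trans (*-monoˡ-≤ (0≤ξ p) (u^≤1 k p)) (ℚₚ.≤-trans (ℚₚ.≤-reflexive (ℚₚ.*-identityʳ (ξ p))) (ξ≤r p))

      u^suc≤r : ∀ p → pow (u p) (suc n) ≤ r p
      u^suc≤r p = begin
        ξ p * ξ p * pow (u p) n      ≡⟨ ℚₚ.*-assoc (ξ p) (ξ p) (pow (u p) n) ⟩
        ξ p * (ξ p * pow (u p) n)    ≤⟨ *-mono-≤ {b = 1ℚ} (ℚₚ.<⇒≤ 0<1ℚ) (0≤* (0≤ξ p) (0≤u^ n p)) (r≤1 (2 ℕ.* p)) (ξu^≤r n p) ⟩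
        1ℚ * r p                     ≡⟨ ℚₚ.*-identityˡ (r p) ⟩
        r p                          ∎
        where open ℚₚ.≤-Reasoning

      ∣sign*∣ : ∀ k x → ∣ sign k * x ∣ ≡ ∣ x ∣
      ∣sign*∣ k x = trans (ℚₚ.∣p*q∣≡∣p∣*∣q∣ (sign k) x) (trans (cong (_* ∣ x ∣) (∣sign∣≡1 k)) (ℚₚ.*-identityˡ ∣ x ∣))

      ∣¼*∣ : ∀ x y → 0ℚ ≤ x → ∣ ¼ * x * y ∣ ≤ x * ∣ y ∣
      ∣¼*∣ x y 0≤x = begin
        ∣ ¼ * x * y ∣            ≡⟨ trans (ℚₚ.∣p*q∣≡∣p∣*∣q∣ (¼ * x) y) (cong (_* ∣ y ∣) (trans (ℚₚ.∣p*q∣≡∣p∣*∣q∣ ¼ x) (cong (¼ *_) (ℚₚ.0≤p⇒∣p∣≡p 0≤x)))) ⟩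
        ¼ * x * ∣ y ∣            ≤⟨ *-mono-≤ 0≤x (ℚₚ.0≤∣p∣ y) (ℚₚ.≤-trans (*-mono-≤ {b = 1ℚ} (ℚₚ.<⇒≤ 0<1ℚ) 0≤x (frac-≤ 1 4 1 1 (ℕ.s≤s ℕ.z≤n)) ℚₚ.≤-refl) (ℚₚ.≤-reflexive (ℚₚ.*-identityˡ x))) ℚₚ.≤-refl ⟩
        x * ∣ y ∣                ∎
        where open ℚₚ.≤-Reasoning

    private
      K L : ℕ → ℕ → ℚ
      K N p = sum (λ q → sign q * (κ⁻ p q + κ⁺ p q)) N
      L N p = sum (λ q → κ⁻ p q - κ⁺ p q) N

      W₁ W₂ W₃ : ℕ → ℚ
      W₁ N = sum (λ p → sign p * (¼ * (ξ p * pow (u p) n) * K N p)) N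
      W₂ N = sum (λ p → sign p * (¼ * pow (u p) (suc n) * L N p)) N
      W₃ N = sum (λ p → ¼ * pow (u p) (suc n) * K N p) N

      W₁-rows : ∀ N → sum² (λ p q → sign p * sign q * G₁ p q) N ≡ W₁ N
      W₁-rows N = sum-cong N λ p → trans
        (sum-cong N (λ q → solve 4 (λ s t a k → s :* t :* (a :* k) := s :* a :* (t :* k)) refl (sign p) (sign q) (¼ * (ξ p * pow (u p) n)) (κ⁻ p q + κ⁺ p q)))
        (trans (sum-scale (sign p * (¼ * (ξ p * pow (u p) n))) (λ q → sign q * (κ⁻ p q + κ⁺ p q)) N) (ℚₚ.*-assoc (sign p) _ (K N p)))

    -- Both parts of `pair₁` carry the symmetric sign of p and q, so after an exchange of the sums
    -- they give the same `W₁`; on the diagonal the signs square to 1, which turns β-terms into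
    -- λ-terms.
    conv-bb : ∀ N → conv (λ i → odd-alternating-sum i N) (λ i → odd-alternating-sum i N) n ≡
                    W₁ N + W₁ N + (⟦ n ⟧ + ½) * odd-sum n N
    conv-bb N = begin
      conv (λ i → odd-alternating-sum i N) (λ i → odd-alternating-sum i N) n
        ≡⟨ conv-sum b b n N N ⟩
      sum² (λ p q → conv (b p) (b q) n) N
        ≡⟨ sum²-cong N (λ p q → trans (conv-geometric (sign p * ξ p) (sign q * ξ q) (u p) (u q))
             (trans (solve 5 (λ s t x y h → s :* x :* (t :* y) :* h := s :* t :* (x :* y :* h)) refl (sign p) (sign q) (ξ p) (ξ q) (h p q))
             (trans (cong (sign p * sign q *_) (pair₁ p q))
               (solve 6 (λ s t a b d c → s :* t :* (a :+ b :+ d :* c) := s :* t :* a :+ t :* s :* b :+ d :* (s :* t :* c)) refl (sign p) (sign q) (G₁ p q) (G₁ q p) (δ p q) ((⟦ n ⟧ + ½) * (u p * pow (u p) n)))))) ⟩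
      sum² (λ p q → f p q + f q p + δ p q * (sign p * sign q * c p)) N
        ≡⟨ trans (sum²-+ (λ p q → f p q + f q p) (λ p q → δ p q * (sign p * sign q * c p)) N)
             (cong₂ _+_ (sum²-+ f (λ p q → f q p) N) (sum²-δ (λ p q → sign p * sign q * c p) N)) ⟩
      sum² f N + sum² (λ p q → f q p) N + sum (λ p → sign p * sign p * c p) N
        ≡⟨ cong₂ _+_ (cong₂ _+_ (W₁-rows N) (trans (sym (sum-swap f N N)) (W₁-rows N)))
             (trans (sum-cong N (λ p → trans (cong (_* c p) (sign² p)) (ℚₚ.*-identityˡ (c p)))) (sum-scale (⟦ n ⟧ + ½) (λ p → u p * pow (u p) n) N)) ⟩
      W₁ N + W₁ N + (⟦ n ⟧ + ½) * odd-sum n N ∎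
      where
      open ≡-Reasoning
      b : ℕ → ℕ → ℚ
      b p i = sign p * ξ p * pow (u p) i
      f : ℕ → ℕ → ℚ
      f p q = sign p * sign q * G₁ p q
      c : ℕ → ℚ
      c p = (⟦ n ⟧ + ½) * (u p * pow (u p) n)

    -- Only p carries a sign. Summing `G₂` over q therefore meets the plain kernel, and summing `G₃`
    -- over p the alternating one.
    conv-ba : ∀ N → conv (λ i → odd-alternating-sum i N) (λ i → odd-sum i N) n ≡
                    W₂ N + W₃ N + ⟦ suc n ⟧ * odd-alternating-sum (suc n) N
    conv-ba N = begin
      conv (λ i → odd-alternating-sum i N) (λ i → odd-sum i N) n
        ≡⟨ conv-sum b a n N N ⟩
      sum² (λ p q → conv (b p) (a q) n) N
        ≡⟨ sum²-cong N (λ p q → trans (conv-geometric (sign p * ξ p) (u q) (u p) (u q))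
             (trans (solve 4 (λ s x v h → s :* x :* v :* h := s :* (x :* v :* h)) refl (sign p) (ξ p) (u q) (h p q))
             (trans (cong (sign p *_) (pair₂ p q))
               (solve 5 (λ s a b d c → s :* (a :+ b :+ d :* c) := s :* a :+ s :* b :+ d :* (s :* c)) refl (sign p) (G₂ p q) (G₃ q p) (δ p q) (c p))))) ⟩
      sum² (λ p q → sign p * G₂ p q + sign p * G₃ q p + δ p q * (sign p * c p)) N
        ≡⟨ trans (sum²-+ (λ p q → sign p * G₂ p q + sign p * G₃ q p) (λ p q → δ p q * (sign p * c p)) N)
             (cong₂ _+_ (sum²-+ (λ p q → sign p * G₂ p q) (λ p q → sign p * G₃ q p) N) (sum²-δ (λ p q → sign p * c p) N)) ⟩
      sum² (λ p q → sign p * G₂ p q) N + sum² (λ p q → sign p * G₃ q p) N + sum (λ p → sign p * c p) N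
        ≡⟨ cong₂ _+_ (cong₂ _+_ rows columns) (trans (sum-cong N (λ p → solve 4 (λ s m x z → s :* (m :* (x :* z)) := m :* (s :* x :* z)) refl (sign p) ⟦ suc n ⟧ (ξ p) (pow (u p) (suc n))))
             (sum-scale ⟦ suc n ⟧ (λ p → sign p * ξ p * pow (u p) (suc n)) N)) ⟩
      W₂ N + W₃ N + ⟦ suc n ⟧ * odd-alternating-sum (suc n) N ∎
      where
      open ≡-Reasoning
      a b : ℕ → ℕ → ℚ
      a q i = u q * pow (u q) i
      b p i = sign p * ξ p * pow (u p) i
      c : ℕ → ℚ
      c p = ⟦ suc n ⟧ * (ξ p * pow (u p) (suc n))
      rows : sum² (λ p q → sign p * G₂ p q) N ≡ W₂ N
      rows = sum-cong N λ p → trans (sum-scale (sign p) (G₂ p) N) (cong (sign p *_) (sum-scale (¼ * pow (u p) (suc n)) (λ q → κ⁻ p q - κ⁺ p q) N))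
      columns : sum² (λ p q → sign p * G₃ q p) N ≡ W₃ N
      columns = trans (sum-swap (λ p q → sign p * G₃ q p) N N) (sum-cong N λ q → trans
        (sum-cong N (λ p → solve 3 (λ s a k → s :* (a :* k) := a :* (s :* k)) refl (sign p) (¼ * pow (u q) (suc n)) (κ⁻ q p + κ⁺ q p)))
        (sum-scale (¼ * pow (u q) (suc n)) (λ p → sign p * (κ⁻ q p + κ⁺ q p)) N))

    private
      K≤ : ∀ M p d → p ℕ.+ d ≡ M → ∣ K (suc M) p ∣ ≤ r d
      K≤ M p d refl = alternating-kernel p d

      W₁≤ : ∀ M → ∣ W₁ (suc M) ∣ ≤ conv r r M
      W₁≤ M = error-bound _ M λ p d eq → begin
        ∣ sign p * (¼ * (ξ p * pow (u p) n) * K (suc M) p) ∣   ≡⟨ ∣sign*∣ p _ ⟩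
        ∣ ¼ * (ξ p * pow (u p) n) * K (suc M) p ∣              ≤⟨ ∣¼*∣ (ξ p * pow (u p) n) (K (suc M) p) (0≤* (0≤ξ p) (0≤u^ n p)) ⟩
        ξ p * pow (u p) n * ∣ K (suc M) p ∣                    ≤⟨ *-mono-≤ (0≤r p) (ℚₚ.0≤∣p∣ (K (suc M) p)) (ξu^≤r n p) (K≤ M p d eq) ⟩
        r p * r d                                              ∎
        where open ℚₚ.≤-Reasoning

      W₃≤ : ∀ M → ∣ W₃ (suc M) ∣ ≤ conv r r M
      W₃≤ M = error-bound _ M λ p d eq → begin
        ∣ ¼ * pow (u p) (suc n) * K (suc M) p ∣   ≤⟨ ∣¼*∣ (pow (u p) (suc n)) (K (suc M) p) (0≤u^ (suc n) p) ⟩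
        pow (u p) (suc n) * ∣ K (suc M) p ∣       ≤⟨ *-mono-≤ (0≤r p) (ℚₚ.0≤∣p∣ (K (suc M) p)) (u^suc≤r p) (K≤ M p d eq) ⟩
        r p * r d                                 ∎
        where open ℚₚ.≤-Reasoning

      L≤ : ∀ M p d → p ℕ.+ d ≡ M → ∣ L (suc M) p ∣ ≤ ⟦ suc (2 ℕ.* p) ⟧ * r d
      L≤ M p d refl = plain-kernel p d

      W₂≤ : ∀ M → ∣ W₂ (suc M) ∣ ≤ conv r r M
      W₂≤ M = error-bound _ M λ p d eq → begin
        ∣ sign p * (¼ * pow (u p) (suc n) * L (suc M) p) ∣   ≡⟨ ∣sign*∣ p _ ⟩
        ∣ ¼ * pow (u p) (suc n) * L (suc M) p ∣              ≤⟨ ∣¼*∣ (pow (u p) (suc n)) (L (suc M) p) (0≤u^ (suc n) p) ⟩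
        pow (u p) (suc n) * ∣ L (suc M) p ∣                  ≤⟨ *-monoˡ-≤ (0≤u^ (suc n) p) (L≤ M p d eq) ⟩
        pow (u p) (suc n) * (⟦ suc (2 ℕ.* p) ⟧ * r d)        ≡⟨ solve 3 (λ a m r → a :* (m :* r) := m :* a :* r) refl (pow (u p) (suc n)) ⟦ suc (2 ℕ.* p) ⟧ (r d) ⟩
        ⟦ suc (2 ℕ.* p) ⟧ * pow (u p) (suc n) * r d          ≡⟨ cong (_* r d) (odd·pow p) ⟩
        ξ p * pow (u p) n * r d                              ≤⟨ *-mono-≤ (0≤r p) (0≤r d) (ξu^≤r n p) ℚₚ.≤-refl ⟩
        r p * r d                                            ∎
        where open ℚₚ.≤-Reasoning

      double : ∀ {a b e} → ∣ a ∣ ≤ e → ∣ b ∣ ≤ e → ∣ a + b ∣ ≤ e + e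
      double {a} {b} p q = ℚₚ.≤-trans (ℚₚ.∣p+q∣≤∣p∣+∣q∣ a b) (ℚₚ.+-mono-≤ p q)

      difference : ∀ {x y z} → x ≡ y + z → x - z ≡ y
      difference {x} {y} {z} eq = trans (cong (_- z) eq) (solve 2 (λ y z → (y :+ z) :- z := y) refl y z)

    conv-bb-error : ∀ M → ∣ conv (λ i → odd-alternating-sum i (suc M)) (λ i → odd-alternating-sum i (suc M)) n - (⟦ n ⟧ + ½) * odd-sum n (suc M) ∣
                        ≤ conv r r M + conv r r M
    conv-bb-error M = subst (λ z → ∣ z ∣ ≤ conv r r M + conv r r M) (sym (difference (conv-bb (suc M)))) (double (W₁≤ M) (W₁≤ M))

    conv-ba-error : ∀ M → ∣ conv (λ i → odd-alternating-sum i (suc M)) (λ i → odd-sum i (suc M)) n - ⟦ suc n ⟧ * odd-alternating-sum (suc n) (suc M) ∣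
                        ≤ conv r r M + conv r r M
    conv-ba-error M = subst (λ z → ∣ z ∣ ≤ conv r r M + conv r r M) (sym (difference (conv-ba (suc M)))) (double (W₂≤ M) (W₃≤ M))

-- The ring of formal power series and the hyperbolic functions

module _ where
  open import Data.Rational.Base using (_+_; _*_; -_; _-_; _≤_; _<_)
  open ℚ-Solver.+-*-Solver using (solve; con; _:=_; _:+_; _:*_; _:-_; :-_)

  infixl 6 _⊕_
  infixl 7 _⊛_
  infix  8 ⊝_

  _⊕_ _⊛_ : (ℕ → ℚ) → (ℕ → ℚ) → ℕ → ℚ
  (f ⊕ g) n = f n + g n
  _⊛_ = conv

  ⊝_ : (ℕ → ℚ) → ℕ → ℚ
  (⊝ f) n = - f n

  const : ℚ → ℕ → ℚ
  const c zero    = c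
  const c (suc _) = 0ℚ

  conv-const : ∀ c g n → conv (const c) g n ≡ c * g n
  conv-const c g zero    = refl
  conv-const c g (suc n) = trans (cong (c * g (suc n) +_) (conv-zeroˡ g n)) (ℚₚ.+-identityʳ _)

  conv-identityˡ : ∀ g n → conv (const 1ℚ) g n ≡ g n
  conv-identityˡ g n = trans (conv-const 1ℚ g n) (ℚₚ.*-identityˡ (g n))

  powerSeries : CommutativeRing 0ℓ 0ℓ
  powerSeries = record
    { Carrier = ℕ → ℚ ; _≈_ = _≗_ ; _+_ = _⊕_ ; _*_ = _⊛_ ; -_ = ⊝_ ; 0# = const 0ℚ ; 1# = const 1ℚ
    ; isCommutativeRing = record
      { isRing = record
        { +-isAbelianGroup = record
          { isGroup = record
            { isMonoid = record
              { isSemigroup = record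
                { isMagma = record
                  { isEquivalence = record { refl = λ _ → refl ; sym = λ p n → sym (p n) ; trans = λ p q n → trans (p n) (q n) }
                  ; ∙-cong = λ p q n → cong₂ _+_ (p n) (q n) }
                ; assoc = λ f g h n → ℚₚ.+-assoc (f n) (g n) (h n) }
              ; identity = (λ f n → trans (cong (_+ f n) (zeros n)) (ℚₚ.+-identityˡ (f n)))
                         , (λ f n → trans (cong (f n +_) (zeros n)) (ℚₚ.+-identityʳ (f n))) }
            ; inverse = (λ f n → trans (ℚₚ.+-inverseˡ (f n)) (sym (zeros n)))
                      , (λ f n → trans (ℚₚ.+-inverseʳ (f n)) (sym (zeros n)))
            ; ⁻¹-cong = λ p n → cong -_ (p n) }
          ; comm = λ f g n → ℚₚ.+-comm (f n) (g n) }
        ; *-cong = conv-cong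
        ; *-assoc = conv-assoc
        ; *-identity = conv-identityˡ , λ f n → trans (conv-comm f (const 1ℚ) n) (conv-identityˡ f n)
        ; distrib = conv-+ʳ , λ f g h → conv-+ˡ g h f }
      ; *-comm = conv-comm } }
    where
    zeros : ∀ n → const 0ℚ n ≡ 0ℚ
    zeros zero    = refl
    zeros (suc _) = refl

  module PS = CommutativeRing powerSeries

  const-homomorphism : AlmostCommutativeRing.rawRing (fromCommutativeRing ℚₚ.+-*-commutativeRing)
                         -Raw-AlmostCommutative⟶ fromCommutativeRing powerSeries
  const-homomorphism = record
    { ⟦_⟧ = const
    ; +-homo = λ { c d zero → refl ; c d (suc n) → refl }
    ; *-homo = λ { c d zero → refl ; c d (suc n) → sym (trans (conv-const c (const d) (suc n)) (ℚₚ.*-zeroʳ c)) }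
    ; -‿homo = λ { c zero → refl ; c (suc n) → refl }
    ; 0-homo = λ _ → refl
    ; 1-homo = λ _ → refl
    }

  const≟ : ∀ c d → Maybe (const c ≗ const d)
  const≟ c d with c ℚₚ.≟ d
  ... | yes c≡d = just (λ n → cong (λ e → const e n) c≡d)
  ... | no _    = nothing

  module PSSolver = RingSolver _ (fromCommutativeRing powerSeries) const-homomorphism const≟

  shift : (ℕ → ℚ) → ℕ → ℚ
  shift f zero    = 0ℚ
  shift f (suc n) = f n

  𝐳 : ℕ → ℚ
  𝐳 = shift (const 1ℚ)

  𝐳⊛ : ∀ f → 𝐳 ⊛ f ≗ shift f
  𝐳⊛ f zero    = ℚₚ.*-zeroˡ (f 0)
  𝐳⊛ f (suc n) = trans (cong₂ _+_ (ℚₚ.*-zeroˡ (f (suc n))) (conv-identityˡ f n)) (ℚₚ.+-identityˡ (f n))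

  𝐳-cancel : ∀ {f g} → 𝐳 ⊛ f ≗ 𝐳 ⊛ g → f ≗ g
  𝐳-cancel {f} {g} h n = trans (sym (𝐳⊛ f (suc n))) (trans (h (suc n)) (𝐳⊛ g (suc n)))

  -- Degree 0 forces f 0 = 0; then the same equation holds for `f ∘ suc`, and the induction
  -- continues with it.
  ⊛-cancel-0 : ∀ f g → g 0 ≢ 0ℚ → (∀ n → conv f g n ≡ 0ℚ) → ∀ n → f n ≡ 0ℚ
  ⊛-cancel-0 f g g₀≢0 h zero = *-cancelˡ g₀≢0 (trans (ℚₚ.*-comm (g 0) (f 0)) (trans (h 0) (sym (ℚₚ.*-zeroʳ (g 0)))))
  ⊛-cancel-0 f g g₀≢0 h (suc n) = ⊛-cancel-0 (f ∘ suc) g g₀≢0 tail n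
    where
    tail : ∀ n → conv (f ∘ suc) g n ≡ 0ℚ
    tail n = begin
      conv (f ∘ suc) g n                      ≡⟨ ℚₚ.+-identityˡ _ ⟨
      0ℚ + conv (f ∘ suc) g n                 ≡⟨ cong (_+ conv (f ∘ suc) g n) (sym (trans (cong (_* g (suc n)) (⊛-cancel-0 f g g₀≢0 h 0)) (ℚₚ.*-zeroˡ (g (suc n))))) ⟩
      f 0 * g (suc n) + conv (f ∘ suc) g n    ≡⟨ h (suc n) ⟩
      0ℚ                                      ∎
      where open ≡-Reasoning

  ⊛-cancelʳ : ∀ {f f′} g → g 0 ≢ 0ℚ → f ⊛ g ≗ f′ ⊛ g → f ≗ f′
  ⊛-cancelʳ {f} {f′} g g₀≢0 h n = begin
    f n                   ≡⟨ solve 2 (λ a b → a := (a :- b) :+ b) refl (f n) (f′ n) ⟩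
    (f n - f′ n) + f′ n   ≡⟨ cong (_+ f′ n) (⊛-cancel-0 (f ⊕ ⊝ f′) g g₀≢0 difference n) ⟩
    0ℚ + f′ n             ≡⟨ ℚₚ.+-identityˡ _ ⟩
    f′ n                  ∎
    where
    open ≡-Reasoning
    open PSSolver using () renaming (_:+_ to _:⊕_; _:*_ to _:⊛_; :-_ to :⊝_; _:=_ to _:≗_)
    difference : ∀ n → conv (f ⊕ ⊝ f′) g n ≡ 0ℚ
    difference n = begin
      ((f ⊕ ⊝ f′) ⊛ g) n                ≡⟨ PSSolver.solve 3 (λ f f′ g → (f :⊕ (:⊝ f′)) :⊛ g :≗ (f :⊛ g) :⊕ (:⊝ (f′ :⊛ g))) (λ _ → refl) f f′ g n ⟩
      (f ⊛ g) n - (f′ ⊛ g) n            ≡⟨ cong (_- (f′ ⊛ g) n) (h n) ⟩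
      (f′ ⊛ g) n - (f′ ⊛ g) n           ≡⟨ ℚₚ.+-inverseʳ ((f′ ⊛ g) n) ⟩
      0ℚ                                ∎
  open PSSolver using () renaming (_:+_ to _:⊕_; _:*_ to _:⊛_; :-_ to :⊝_; _:=_ to _:≗_; con to κ)

  -- The even and the odd part of a series, as series in z = x².

  even odd : (ℕ → ℚ) → ℕ → ℚ
  even f n = f (2 ℕ.* n)
  odd  f n = f (suc (2 ℕ.* n))

  2*suc : ∀ n → 2 ℕ.* suc n ≡ suc (suc (2 ℕ.* n))
  2*suc n = cong suc (ℕₚ.+-suc n (n ℕ.+ 0))

  even-suc : ∀ f n → even f (suc n) ≡ odd (f ∘ suc) n
  even-suc f n = cong f (2*suc n)

  -- Mutual induction: splitting off f 0 replaces f by `f ∘ suc`, whose even part is the odd part of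
  -- f and whose odd part is the even part of f without its first coefficient. The `shift` is the
  -- factor z = x · x from the product of two odd parts.
  even-conv : ∀ f g n → even (conv f g) n ≡ conv (even f) (even g) n + shift (conv (odd f) (odd g)) n
  odd-conv  : ∀ f g n → odd (conv f g) n ≡ conv (even f) (odd g) n + conv (odd f) (even g) n
  even-conv f g zero    = sym (ℚₚ.+-identityʳ _)
  even-conv f g (suc n) = begin
    even (conv f g) (suc n)
      ≡⟨ even-suc (conv f g) n ⟩
    f 0 * g (suc (suc (2 ℕ.* n))) + odd (conv (f ∘ suc) g) n
      ≡⟨ cong₂ (λ a b → f 0 * a + b) (sym (even-suc g n)) (odd-conv (f ∘ suc) g n) ⟩
    f 0 * even g (suc n) + (conv (odd f) (odd g) n + conv (odd (f ∘ suc)) (even g) n)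
      ≡⟨ cong (λ z → f 0 * even g (suc n) + (conv (odd f) (odd g) n + z))
           (conv-cong {g = even g} (λ k → sym (even-suc f k)) (λ _ → refl) n) ⟩
    f 0 * even g (suc n) + (conv (odd f) (odd g) n + conv (even f ∘ suc) (even g) n)
      ≡⟨ solve 3 (λ a b c → a :+ (b :+ c) := (a :+ c) :+ b) refl (f 0 * even g (suc n)) _ _ ⟩
    conv (even f) (even g) (suc n) + conv (odd f) (odd g) n ∎
    where open ≡-Reasoning
  odd-conv f g n = begin
    f 0 * odd g n + even (conv (f ∘ suc) g) n
      ≡⟨ cong (f 0 * odd g n +_) (even-conv (f ∘ suc) g n) ⟩
    f 0 * odd g n + (conv (odd f) (even g) n + shift (conv (odd (f ∘ suc)) (odd g)) n)
      ≡⟨ solve 3 (λ a b c → a :+ (b :+ c) := (a :+ c) :+ b) refl (f 0 * odd g n) _ _ ⟩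
    f 0 * odd g n + shift (conv (odd (f ∘ suc)) (odd g)) n + conv (odd f) (even g) n
      ≡⟨ cong (_+ conv (odd f) (even g) n) (unfold n) ⟩
    conv (even f) (odd g) n + conv (odd f) (even g) n ∎
    where
    open ≡-Reasoning
    unfold : ∀ n → f 0 * odd g n + shift (conv (odd (f ∘ suc)) (odd g)) n ≡ conv (even f) (odd g) n
    unfold zero    = ℚₚ.+-identityʳ _
    unfold (suc n) = cong (f 0 * odd g (suc n) +_)
      (conv-cong {g = odd g} (λ k → sym (even-suc f k)) (λ _ → refl) n)

  -- cosh x and (sinh x)/x as series in z = x²
  coshᶻ sinhᶻ : ℕ → ℚ
  coshᶻ n = 1/ 2 ℕ.* n !
  sinhᶻ n = 1/ suc (2 ℕ.* n) !

  1/!-suc : ∀ n → ⟦ suc n ⟧ * 1/ suc n ! ≡ 1/ n !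
  1/!-suc n = trans (frac-* (suc n) 1 1 (suc n !) {{_}} {{ℕₚ._!≢0 (suc n)}})
    (frac-≡ (suc n ℕ.* 1) (1 ℕ.* suc n !) 1 (n !) {{ℕₚ.m*n≢0 1 (suc n !) {{_}} {{ℕₚ._!≢0 (suc n)}}}} {{ℕₚ._!≢0 n}}
      (ℕ-Solver.solve 2 (λ m f → (m :× c1) :× f ℕ-Solver.:= c1 :× (c1 :× (m :× f))) refl (suc n) (n !)))
    where
    open ℕ-Solver using () renaming (_:*_ to _:×_)
    c1 = ℕ-Solver.con 1

  sinh-step : ∀ n → (1ℚ + (⟦ n ⟧ + ⟦ n ⟧)) * sinhᶻ n ≡ coshᶻ n
  sinh-step n = trans (cong (_* sinhᶻ n) (sym (trans (⟦suc⟧ (2 ℕ.* n)) (cong (1ℚ +_)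
    (trans (⟦+⟧ n (n ℕ.+ 0)) (cong (λ m → ⟦ n ⟧ + ⟦ m ⟧) (ℕₚ.+-identityʳ n)))))))
    (1/!-suc (2 ℕ.* n))

  cosh-step : ∀ n → ⟦ suc n ⟧ * coshᶻ (suc n) ≡ ½ * sinhᶻ n
  cosh-step n = *-cancelˡ {⟦ 2 ⟧} (⟦suc⟧≢0 1) (begin
    ⟦ 2 ⟧ * (⟦ suc n ⟧ * coshᶻ (suc n))                  ≡⟨ ℚₚ.*-assoc ⟦ 2 ⟧ ⟦ suc n ⟧ _ ⟨
    ⟦ 2 ⟧ * ⟦ suc n ⟧ * coshᶻ (suc n)                    ≡⟨ cong (_* coshᶻ (suc n)) (sym (⟦*⟧ 2 (suc n))) ⟩
    ⟦ 2 ℕ.* suc n ⟧ * coshᶻ (suc n)                      ≡⟨ cong (λ m → ⟦ m ⟧ * 1/ m !) (2*suc n) ⟩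
    ⟦ suc (suc (2 ℕ.* n)) ⟧ * 1/ suc (suc (2 ℕ.* n)) !   ≡⟨ 1/!-suc (suc (2 ℕ.* n)) ⟩
    sinhᶻ n                                              ≡⟨ solve 1 (λ s → s := con ⟦ 2 ⟧ :* (con ½ :* s)) refl (sinhᶻ n) ⟩
    ⟦ 2 ⟧ * (½ * sinhᶻ n)                                ∎)
    where open ≡-Reasoning

  -- This is cosh′ = sinh multiplied by x, in the form 2θ cosh = z · (sinh x)/x; `θ-sinh` is sinh′ =
  -- cosh.
  θ-cosh : θ coshᶻ ≗ const ½ ⊛ (𝐳 ⊛ sinhᶻ)
  θ-cosh n = trans (lemma n) (sym (trans (conv-const ½ (𝐳 ⊛ sinhᶻ) n) (cong (½ *_) (𝐳⊛ sinhᶻ n))))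
    where
    lemma : ∀ n → θ coshᶻ n ≡ ½ * shift sinhᶻ n
    lemma zero    = refl
    lemma (suc n) = cosh-step n

  θ-sinh : sinhᶻ ⊕ (θ sinhᶻ ⊕ θ sinhᶻ) ≗ coshᶻ
  θ-sinh n = trans (solve 2 (λ m s → s :+ (m :* s :+ m :* s) := (con 1ℚ :+ (m :+ m)) :* s) refl ⟦ n ⟧ (sinhᶻ n)) (sinh-step n)

  θ-⊕ : ∀ f g → θ (f ⊕ g) ≗ θ f ⊕ θ g
  θ-⊕ f g n = ℚₚ.*-distribˡ-+ ⟦ n ⟧ (f n) (g n)

  θ-⊝ : ∀ f → θ (⊝ f) ≗ ⊝ θ f
  θ-⊝ f n = sym (ℚₚ.neg-distribʳ-* ⟦ n ⟧ (f n))

  θ-cong : ∀ {f g} → f ≗ g → θ f ≗ θ g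
  θ-cong h n = cong (⟦ n ⟧ *_) (h n)

  θ-𝐳 : θ 𝐳 ≗ 𝐳
  θ-𝐳 zero          = refl
  θ-𝐳 (suc zero)    = refl
  θ-𝐳 (suc (suc n)) = ℚₚ.*-zeroʳ ⟦ suc (suc n) ⟧

  θ-const : ∀ c → θ (const c) ≗ const 0ℚ
  θ-const c zero    = ℚₚ.*-zeroˡ c
  θ-const c (suc n) = ℚₚ.*-zeroʳ ⟦ suc n ⟧

  θ≗0 : ∀ {f} → θ f ≗ const 0ℚ → f ≗ const (f 0)
  θ≗0 {f} h zero    = refl
  θ≗0 {f} h (suc n) = *-cancelˡ (⟦suc⟧≢0 n) (trans (h (suc n)) (sym (ℚₚ.*-zeroʳ ⟦ suc n ⟧)))

  module PS-Reasoning = SetoidReasoning PS.setoid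

  private
    C S : ℕ → ℚ
    C = coshᶻ
    S = sinhᶻ

  -- θ of the left side vanishes by the two differential equations, so only its constant coefficient
  -- is left.
  cosh²-sinh² : C ⊛ C ⊕ ⊝ (𝐳 ⊛ (S ⊛ S)) ≗ const 1ℚ
  cosh²-sinh² = θ≗0 (begin
    θ (C ⊛ C ⊕ ⊝ (𝐳 ⊛ (S ⊛ S)))
      ≈⟨ PS.trans (θ-⊕ (C ⊛ C) (⊝ (𝐳 ⊛ (S ⊛ S)))) (PS.+-cong (θ-conv C C)
           (PS.trans (θ-⊝ (𝐳 ⊛ (S ⊛ S))) (PS.-‿cong (PS.trans (θ-conv 𝐳 (S ⊛ S)) (PS.+-cong (PS.*-congʳ θ-𝐳) (PS.*-congˡ {𝐳} (θ-conv S S))))))) ⟩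
    (θ C ⊛ C ⊕ C ⊛ θ C) ⊕ ⊝ (𝐳 ⊛ (S ⊛ S) ⊕ 𝐳 ⊛ (θ S ⊛ S ⊕ S ⊛ θ S))
      ≈⟨ PSSolver.solve 5 (λ z c s dc ds →
           (dc :⊛ c :⊕ c :⊛ dc) :⊕ :⊝ (z :⊛ (s :⊛ s) :⊕ z :⊛ (ds :⊛ s :⊕ s :⊛ ds))
           :≗ (κ ⟦ 2 ⟧ :⊛ c) :⊛ dc :⊕ :⊝ ((z :⊛ s) :⊛ (s :⊕ (ds :⊕ ds)))) (λ _ → refl) 𝐳 C S (θ C) (θ S) ⟩
    (const ⟦ 2 ⟧ ⊛ C) ⊛ θ C ⊕ ⊝ ((𝐳 ⊛ S) ⊛ (S ⊕ (θ S ⊕ θ S)))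
      ≈⟨ PS.+-cong (PS.*-congˡ {const ⟦ 2 ⟧ ⊛ C} θ-cosh) (PS.-‿cong (PS.*-congˡ {𝐳 ⊛ S} θ-sinh)) ⟩
    (const ⟦ 2 ⟧ ⊛ C) ⊛ (const ½ ⊛ (𝐳 ⊛ S)) ⊕ ⊝ ((𝐳 ⊛ S) ⊛ C)
      ≈⟨ PSSolver.solve 3 (λ z c s → (κ ⟦ 2 ⟧ :⊛ c) :⊛ (κ ½ :⊛ (z :⊛ s)) :⊕ :⊝ ((z :⊛ s) :⊛ c) :≗ κ 0ℚ) (λ _ → refl) 𝐳 C S ⟩
    const 0ℚ ∎)
    where open PS-Reasoning

  -- The substitution z ↦ 4z, that is x ↦ 2x.
  dilate : (ℕ → ℚ) → ℕ → ℚ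
  dilate f n = pow ⟦ 4 ⟧ n * f n

  dilate-⊛ : ∀ f g → dilate (f ⊛ g) ≗ dilate f ⊛ dilate g
  dilate-⊛ f g n = sym (conv-pow ⟦ 4 ⟧ f g n)

  dilate-⊕ : ∀ f g → dilate (f ⊕ g) ≗ dilate f ⊕ dilate g
  dilate-⊕ f g n = ℚₚ.*-distribˡ-+ (pow ⟦ 4 ⟧ n) (f n) (g n)

  dilate-cong : ∀ {f g} → f ≗ g → dilate f ≗ dilate g
  dilate-cong h n = cong (pow ⟦ 4 ⟧ n *_) (h n)

  dilate-const : ∀ c → dilate (const c) ≗ const c
  dilate-const c zero    = ℚₚ.*-identityˡ c
  dilate-const c (suc n) = ℚₚ.*-zeroʳ (pow ⟦ 4 ⟧ (suc n))

  dilate-𝐳 : dilate 𝐳 ≗ const ⟦ 4 ⟧ ⊛ 𝐳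
  dilate-𝐳 n = trans (lemma n) (sym (conv-const ⟦ 4 ⟧ 𝐳 n))
    where
    lemma : ∀ n → dilate 𝐳 n ≡ ⟦ 4 ⟧ * 𝐳 n
    lemma zero          = refl
    lemma (suc zero)    = refl
    lemma (suc (suc n)) = trans (ℚₚ.*-zeroʳ (pow ⟦ 4 ⟧ (suc (suc n)))) (sym (ℚₚ.*-zeroʳ ⟦ 4 ⟧))

  private
    -- The candidates (sinh x cosh x)/x for (sinh 2x)/(2x) and cosh² x + sinh² x for cosh 2x. The
    -- addition formulas are replaced by a comparison of differential equations.
    U V : ℕ → ℚ
    U = S ⊛ C
    V = C ⊛ C ⊕ 𝐳 ⊛ (S ⊛ S)

    U-ode : U ⊕ (θ U ⊕ θ U) ≗ V
    U-ode = begin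
      U ⊕ (θ U ⊕ θ U)
        ≈⟨ PS.+-congˡ {U} (PS.+-cong (θ-conv S C) (θ-conv S C)) ⟩
      S ⊛ C ⊕ ((θ S ⊛ C ⊕ S ⊛ θ C) ⊕ (θ S ⊛ C ⊕ S ⊛ θ C))
        ≈⟨ PSSolver.solve 4 (λ c s dc ds → s :⊛ c :⊕ ((ds :⊛ c :⊕ s :⊛ dc) :⊕ (ds :⊛ c :⊕ s :⊛ dc))
             :≗ c :⊛ (s :⊕ (ds :⊕ ds)) :⊕ (κ ⟦ 2 ⟧ :⊛ s) :⊛ dc) (λ _ → refl) C S (θ C) (θ S) ⟩
      C ⊛ (S ⊕ (θ S ⊕ θ S)) ⊕ (const ⟦ 2 ⟧ ⊛ S) ⊛ θ C
        ≈⟨ PS.+-cong (PS.*-congˡ {C} θ-sinh) (PS.*-congˡ {const ⟦ 2 ⟧ ⊛ S} θ-cosh) ⟩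
      C ⊛ C ⊕ (const ⟦ 2 ⟧ ⊛ S) ⊛ (const ½ ⊛ (𝐳 ⊛ S))
        ≈⟨ PSSolver.solve 3 (λ z c s → c :⊛ c :⊕ (κ ⟦ 2 ⟧ :⊛ s) :⊛ (κ ½ :⊛ (z :⊛ s)) :≗ c :⊛ c :⊕ z :⊛ (s :⊛ s)) (λ _ → refl) 𝐳 C S ⟩
      V ∎
      where open PS-Reasoning

    V-ode : θ V ≗ const ⟦ 2 ⟧ ⊛ (𝐳 ⊛ U)
    V-ode = begin
      θ V
        ≈⟨ PS.trans (θ-⊕ (C ⊛ C) (𝐳 ⊛ (S ⊛ S))) (PS.+-cong (θ-conv C C)
             (PS.trans (θ-conv 𝐳 (S ⊛ S)) (PS.+-cong (PS.*-congʳ θ-𝐳) (PS.*-congˡ {𝐳} (θ-conv S S))))) ⟩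
      (θ C ⊛ C ⊕ C ⊛ θ C) ⊕ (𝐳 ⊛ (S ⊛ S) ⊕ 𝐳 ⊛ (θ S ⊛ S ⊕ S ⊛ θ S))
        ≈⟨ PSSolver.solve 5 (λ z c s dc ds →
             (dc :⊛ c :⊕ c :⊛ dc) :⊕ (z :⊛ (s :⊛ s) :⊕ z :⊛ (ds :⊛ s :⊕ s :⊛ ds))
             :≗ (κ ⟦ 2 ⟧ :⊛ c) :⊛ dc :⊕ (z :⊛ s) :⊛ (s :⊕ (ds :⊕ ds))) (λ _ → refl) 𝐳 C S (θ C) (θ S) ⟩
      (const ⟦ 2 ⟧ ⊛ C) ⊛ θ C ⊕ (𝐳 ⊛ S) ⊛ (S ⊕ (θ S ⊕ θ S))
        ≈⟨ PS.+-cong (PS.*-congˡ {const ⟦ 2 ⟧ ⊛ C} θ-cosh) (PS.*-congˡ {𝐳 ⊛ S} θ-sinh) ⟩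
      (const ⟦ 2 ⟧ ⊛ C) ⊛ (const ½ ⊛ (𝐳 ⊛ S)) ⊕ (𝐳 ⊛ S) ⊛ C
        ≈⟨ PSSolver.solve 3 (λ z c s → (κ ⟦ 2 ⟧ :⊛ c) :⊛ (κ ½ :⊛ (z :⊛ s)) :⊕ (z :⊛ s) :⊛ c :≗ κ ⟦ 2 ⟧ :⊛ (z :⊛ (s :⊛ c))) (λ _ → refl) 𝐳 C S ⟩
      const ⟦ 2 ⟧ ⊛ (𝐳 ⊛ U) ∎
      where open PS-Reasoning

    1+2n≢0 : ∀ n → 1ℚ + (⟦ n ⟧ + ⟦ n ⟧) ≢ 0ℚ
    1+2n≢0 n eq = ⟦suc⟧≢0 (n ℕ.+ n) (trans (⟦suc⟧ (n ℕ.+ n)) (trans (cong (1ℚ +_) (⟦+⟧ n n)) eq))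

    -- (U , V) and the dilations of (S , C) solve the same recursion.
    doubling : ∀ n → U n ≡ dilate S n × V n ≡ dilate C n
    V≡ : ∀ n → V n ≡ dilate C n
    doubling n = *-cancelˡ (1+2n≢0 n) (begin
      (1ℚ + (m + m)) * U n                   ≡⟨ solve 2 (λ m u → (con 1ℚ :+ (m :+ m)) :* u := u :+ (m :* u :+ m :* u)) refl m (U n) ⟩
      (U ⊕ (θ U ⊕ θ U)) n                    ≡⟨ U-ode n ⟩
      V n                                    ≡⟨ V≡ n ⟩
      pow ⟦ 4 ⟧ n * C n                      ≡⟨ cong (pow ⟦ 4 ⟧ n *_) (sinh-step n) ⟨
      pow ⟦ 4 ⟧ n * ((1ℚ + (m + m)) * S n)   ≡⟨ solve 3 (λ p m s → p :* (m :* s) := m :* (p :* s)) refl (pow ⟦ 4 ⟧ n) (1ℚ + (m + m)) (S n) ⟩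
      (1ℚ + (m + m)) * dilate S n            ∎) , V≡ n
      where
      m = ⟦ n ⟧
      open ≡-Reasoning
    V≡ zero    = refl
    V≡ (suc n) = *-cancelˡ (⟦suc⟧≢0 n) (begin
      θ V (suc n)                                           ≡⟨ V-ode (suc n) ⟩
      (const ⟦ 2 ⟧ ⊛ (𝐳 ⊛ U)) (suc n)                       ≡⟨ trans (conv-const ⟦ 2 ⟧ (𝐳 ⊛ U) (suc n)) (cong (⟦ 2 ⟧ *_) (𝐳⊛ U (suc n))) ⟩
      ⟦ 2 ⟧ * U n                                           ≡⟨ cong (⟦ 2 ⟧ *_) (proj₁ (doubling n)) ⟩
      ⟦ 2 ⟧ * (pow ⟦ 4 ⟧ n * S n)                           ≡⟨ solve 2 (λ p s → con ⟦ 2 ⟧ :* (p :* s) := con ⟦ 4 ⟧ :* p :* (con ½ :* s)) refl (pow ⟦ 4 ⟧ n) (S n) ⟩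
      ⟦ 4 ⟧ * pow ⟦ 4 ⟧ n * (½ * S n)                       ≡⟨ cong (⟦ 4 ⟧ * pow ⟦ 4 ⟧ n *_) (cosh-step n) ⟨
      ⟦ 4 ⟧ * pow ⟦ 4 ⟧ n * (⟦ suc n ⟧ * C (suc n))         ≡⟨ solve 3 (λ p m c → p :* (m :* c) := m :* (p :* c)) refl (⟦ 4 ⟧ * pow ⟦ 4 ⟧ n) ⟦ suc n ⟧ (C (suc n)) ⟩
      ⟦ suc n ⟧ * dilate C (suc n)                          ∎)
      where open ≡-Reasoning

  dilate-sinh : dilate S ≗ S ⊛ C
  dilate-sinh n = sym (proj₁ (doubling n))

  dilate-cosh : dilate C ≗ C ⊛ C ⊕ 𝐳 ⊛ (S ⊛ S)
  dilate-cosh n = sym (V≡ n)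

  -- Bernoulli numbers as coefficients of x coth x, tanh and sech

  module Bernoulli (B : ℕ → ℚ) (isBernoulli : IsBernoulli B) where

    B/! fᵉ fᵒ P : ℕ → ℚ
    B/! k = B k * 1/ k !
    fᵉ = even B/!
    fᵒ = odd B/!
    P = dilate fᵉ

    private
      generating : ∀ n → conv B/! exp-1 n ≡ X n
      generating n = trans (conv≡cauchyProduct B/! exp-1 n) (isBernoulli n)

      even-exp-1 : even exp-1 ≗ C ⊕ ⊝ const 1ℚ
      even-exp-1 zero    = refl
      even-exp-1 (suc n) = trans (cong exp-1 (2*suc n))
        (trans (cong 1/_! (sym (2*suc n))) (sym (ℚₚ.+-identityʳ (C (suc n)))))

      even-X : even X ≗ const 0ℚ
      even-X zero    = refl
      even-X (suc n) = cong X (2*suc n)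

      odd-X : odd X ≗ const 1ℚ
      odd-X zero    = refl
      odd-X (suc n) = cong (X ∘ suc) (2*suc n)

      -- With eˣ - 1 = (cosh x - 1) + sinh x, the generating identity of the Bernoulli numbers
      -- splits into its even part, this equation, and its odd part divided by x, `equationᵒ`.
      equationᵉ : fᵉ ⊛ (C ⊕ ⊝ const 1ℚ) ⊕ 𝐳 ⊛ (fᵒ ⊛ S) ≗ const 0ℚ
      equationᵉ n = begin
        (fᵉ ⊛ (C ⊕ ⊝ const 1ℚ)) n + (𝐳 ⊛ (fᵒ ⊛ S)) n
          ≡⟨ cong₂ _+_ (conv-cong {fᵉ} (λ _ → refl) (λ k → sym (even-exp-1 k)) n) (𝐳⊛ (fᵒ ⊛ S) n) ⟩
        conv fᵉ (even exp-1) n + shift (conv fᵒ S) n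
          ≡⟨ even-conv B/! exp-1 n ⟨
        even (conv B/! exp-1) n
          ≡⟨ generating (2 ℕ.* n) ⟩
        even X n
          ≡⟨ even-X n ⟩
        const 0ℚ n ∎
        where open ≡-Reasoning

      equationᵒ : fᵉ ⊛ S ⊕ fᵒ ⊛ (C ⊕ ⊝ const 1ℚ) ≗ const 1ℚ
      equationᵒ n = begin
        (fᵉ ⊛ S) n + (fᵒ ⊛ (C ⊕ ⊝ const 1ℚ)) n
          ≡⟨ cong ((fᵉ ⊛ S) n +_) (conv-cong {fᵒ} (λ _ → refl) (λ k → sym (even-exp-1 k)) n) ⟩
        conv fᵉ S n + conv fᵒ (even exp-1) n
          ≡⟨ odd-conv B/! exp-1 n ⟨
        odd (conv B/! exp-1) n
          ≡⟨ generating (suc (2 ℕ.* n)) ⟩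
        odd X n
          ≡⟨ odd-X n ⟩
        const 1ℚ n ∎
        where open ≡-Reasoning

      -- the even part of x/(eˣ - 1) is (x/2) sinh x/(cosh x - 1)
      half-angle : (const ⟦ 2 ⟧ ⊛ fᵉ) ⊛ (C ⊕ ⊝ const 1ℚ) ≗ 𝐳 ⊛ S
      half-angle = begin
        (const ⟦ 2 ⟧ ⊛ fᵉ) ⊛ (C ⊕ ⊝ const 1ℚ)
          -- zS times the odd equation minus C - 1 times the even one eliminates `fᵒ`; by C² - zS² =
          -- 1 the remaining factor zS² - (C - 1)² becomes 2(C - 1).
          ≈⟨ PSSolver.solve 5 (λ z c s e o →
               (κ ⟦ 2 ⟧ :⊛ e) :⊛ (c :⊕ :⊝ κ 1ℚ)
               :≗ (z :⊛ s) :⊛ (e :⊛ s :⊕ o :⊛ (c :⊕ :⊝ κ 1ℚ)) :⊕ (:⊝ ((c :⊕ :⊝ κ 1ℚ) :⊛ (e :⊛ (c :⊕ :⊝ κ 1ℚ) :⊕ z :⊛ (o :⊛ s)))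
                    :⊕ e :⊛ ((c :⊛ c :⊕ :⊝ (z :⊛ (s :⊛ s))) :⊕ :⊝ κ 1ℚ))) (λ _ → refl) 𝐳 C S fᵉ fᵒ ⟩
        (𝐳 ⊛ S) ⊛ (fᵉ ⊛ S ⊕ fᵒ ⊛ (C ⊕ ⊝ const 1ℚ)) ⊕ (⊝ ((C ⊕ ⊝ const 1ℚ) ⊛ (fᵉ ⊛ (C ⊕ ⊝ const 1ℚ) ⊕ 𝐳 ⊛ (fᵒ ⊛ S)))
          ⊕ fᵉ ⊛ ((C ⊛ C ⊕ ⊝ (𝐳 ⊛ (S ⊛ S))) ⊕ ⊝ const 1ℚ))
          ≈⟨ PS.+-cong (PS.*-congˡ {𝐳 ⊛ S} equationᵒ) (PS.+-cong (PS.-‿cong (PS.*-congˡ {C ⊕ ⊝ const 1ℚ} equationᵉ))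
               (PS.*-congˡ {fᵉ} (PS.+-congʳ {⊝ const 1ℚ} cosh²-sinh²))) ⟩
        (𝐳 ⊛ S) ⊛ const 1ℚ ⊕ (⊝ ((C ⊕ ⊝ const 1ℚ) ⊛ const 0ℚ) ⊕ fᵉ ⊛ (const 1ℚ ⊕ ⊝ const 1ℚ))
          ≈⟨ PSSolver.solve 4 (λ z c s e → (z :⊛ s) :⊛ κ 1ℚ :⊕ (:⊝ ((c :⊕ :⊝ κ 1ℚ) :⊛ κ 0ℚ) :⊕ e :⊛ (κ 1ℚ :⊕ :⊝ κ 1ℚ)) :≗ z :⊛ s) (λ _ → refl) 𝐳 C S fᵉ ⟩
        𝐳 ⊛ S ∎
        where open PS-Reasoning

      S₀≢0 : S 0 ≢ 0ℚ
      S₀≢0 ()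

    private
      ¼ : ℚ
      ¼ = ℤ.+ 1 / 4

    -- P is x coth x
    coth : P ⊛ S ≗ C
    coth = ⊛-cancelʳ S S₀≢0 (𝐳-cancel (begin
      𝐳 ⊛ ((P ⊛ S) ⊛ S)
        -- 2zS² is written as (C² + zS² - 1) - (C² - zS² - 1), so that it can be replaced by cosh 2x
        -- - 1; the dilated `half-angle` then applies.
        ≈⟨ PSSolver.solve 4 (λ z c s p → z :⊛ ((p :⊛ s) :⊛ s)
             :≗ κ ¼ :⊛ ((κ ⟦ 2 ⟧ :⊛ p) :⊛ (((c :⊛ c :⊕ z :⊛ (s :⊛ s)) :⊕ :⊝ κ 1ℚ) :⊕ :⊝ ((c :⊛ c :⊕ :⊝ (z :⊛ (s :⊛ s))) :⊕ :⊝ κ 1ℚ))))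
             (λ _ → refl) 𝐳 C S P ⟩
      const ¼ ⊛ ((const ⟦ 2 ⟧ ⊛ P) ⊛ (((C ⊛ C ⊕ 𝐳 ⊛ (S ⊛ S)) ⊕ ⊝ const 1ℚ) ⊕ ⊝ ((C ⊛ C ⊕ ⊝ (𝐳 ⊛ (S ⊛ S))) ⊕ ⊝ const 1ℚ)))
        ≈⟨ PS.*-congˡ {const ¼} (PS.*-congˡ {const ⟦ 2 ⟧ ⊛ P} (PS.+-cong {(C ⊛ C ⊕ 𝐳 ⊛ (S ⊛ S)) ⊕ ⊝ const 1ℚ}
             (PS.+-congʳ {⊝ const 1ℚ} (PS.sym dilate-cosh)) (PS.-‿cong (PS.+-congʳ {⊝ const 1ℚ} cosh²-sinh²)))) ⟩
      const ¼ ⊛ ((const ⟦ 2 ⟧ ⊛ P) ⊛ ((dilate C ⊕ ⊝ const 1ℚ) ⊕ ⊝ (const 1ℚ ⊕ ⊝ const 1ℚ)))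
        ≈⟨ PSSolver.solve 2 (λ p c → κ ¼ :⊛ ((κ ⟦ 2 ⟧ :⊛ p) :⊛ ((c :⊕ :⊝ κ 1ℚ) :⊕ :⊝ (κ 1ℚ :⊕ :⊝ κ 1ℚ)))
             :≗ κ ¼ :⊛ ((κ ⟦ 2 ⟧ :⊛ p) :⊛ (c :⊕ :⊝ κ 1ℚ))) (λ _ → refl) P (dilate C) ⟩
      const ¼ ⊛ ((const ⟦ 2 ⟧ ⊛ P) ⊛ (dilate C ⊕ ⊝ const 1ℚ))
        ≈⟨ PS.*-congˡ {const ¼} dilated ⟩
      const ¼ ⊛ ((const ⟦ 4 ⟧ ⊛ 𝐳) ⊛ (S ⊛ C))
        ≈⟨ PSSolver.solve 3 (λ z c s → κ ¼ :⊛ ((κ ⟦ 4 ⟧ :⊛ z) :⊛ (s :⊛ c)) :≗ z :⊛ (c :⊛ s)) (λ _ → refl) 𝐳 C S ⟩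
      𝐳 ⊛ (C ⊛ S) ∎))
      where
      open PS-Reasoning
      dilated : (const ⟦ 2 ⟧ ⊛ P) ⊛ (dilate C ⊕ ⊝ const 1ℚ) ≗ (const ⟦ 4 ⟧ ⊛ 𝐳) ⊛ (S ⊛ C)
      dilated = begin
        (const ⟦ 2 ⟧ ⊛ P) ⊛ (dilate C ⊕ ⊝ const 1ℚ)
          ≈⟨ PS.*-cong (PS.trans (PS.*-congʳ {P} (PS.sym (dilate-const ⟦ 2 ⟧))) (PS.sym (dilate-⊛ (const ⟦ 2 ⟧) fᵉ)))
               (PS.trans (PS.+-congˡ {dilate C} (λ n → trans (cong -_ (sym (dilate-const 1ℚ n))) (ℚₚ.neg-distribʳ-* (pow ⟦ 4 ⟧ n) (const 1ℚ n)))) (PS.sym (dilate-⊕ C (⊝ const 1ℚ)))) ⟩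
        dilate (const ⟦ 2 ⟧ ⊛ fᵉ) ⊛ dilate (C ⊕ ⊝ const 1ℚ)
          ≈⟨ dilate-⊛ (const ⟦ 2 ⟧ ⊛ fᵉ) (C ⊕ ⊝ const 1ℚ) ⟨
        dilate ((const ⟦ 2 ⟧ ⊛ fᵉ) ⊛ (C ⊕ ⊝ const 1ℚ))
          ≈⟨ dilate-cong half-angle ⟩
        dilate (𝐳 ⊛ S)
          ≈⟨ dilate-⊛ 𝐳 S ⟩
        dilate 𝐳 ⊛ dilate S
          ≈⟨ PS.*-cong dilate-𝐳 dilate-sinh ⟩
        (const ⟦ 4 ⟧ ⊛ 𝐳) ⊛ (S ⊛ C) ∎

    -- (tanh x)/x and sech x, as series in z = x²
    τ ρ : ℕ → ℚ
    τ n = dilate P (suc n) - P (suc n)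
    ρ n = C n - shift (conv τ S) n

    private
      𝐳τ : 𝐳 ⊛ τ ≗ dilate P ⊕ ⊝ P
      𝐳τ n = trans (𝐳⊛ τ n) (lemma n)
        where
        lemma : ∀ n → shift τ n ≡ dilate P n - P n
        lemma zero    = solve 1 (λ p → con 0ℚ := con 1ℚ :* p :- p) refl (P 0)
        lemma (suc n) = refl

    tanh·cosh : τ ⊛ C ≗ S
    tanh·cosh = 𝐳-cancel (⊛-cancelʳ S S₀≢0 (begin
      (𝐳 ⊛ (τ ⊛ C)) ⊛ S
        ≈⟨ PSSolver.solve 4 (λ z t c s → (z :⊛ (t :⊛ c)) :⊛ s :≗ (z :⊛ t) :⊛ (s :⊛ c)) (λ _ → refl) 𝐳 τ C S ⟩
      (𝐳 ⊛ τ) ⊛ (S ⊛ C)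
        ≈⟨ PS.*-congʳ {S ⊛ C} 𝐳τ ⟩
      (dilate P ⊕ ⊝ P) ⊛ (S ⊛ C)
        ≈⟨ PSSolver.solve 4 (λ q p c s → (q :⊕ :⊝ p) :⊛ (s :⊛ c) :≗ q :⊛ (s :⊛ c) :⊕ :⊝ ((p :⊛ s) :⊛ c)) (λ _ → refl) (dilate P) P C S ⟩
      dilate P ⊛ (S ⊛ C) ⊕ ⊝ ((P ⊛ S) ⊛ C)
        ≈⟨ PS.+-cong (PS.trans (PS.*-congˡ {dilate P} (PS.sym dilate-sinh)) (PS.trans (PS.sym (dilate-⊛ P S)) (PS.trans (dilate-cong coth) dilate-cosh)))
             (PS.-‿cong (PS.*-congʳ {C} coth)) ⟩
      (C ⊛ C ⊕ 𝐳 ⊛ (S ⊛ S)) ⊕ ⊝ (C ⊛ C)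
        ≈⟨ PSSolver.solve 3 (λ z c s → (c :⊛ c :⊕ z :⊛ (s :⊛ s)) :⊕ :⊝ (c :⊛ c) :≗ (z :⊛ s) :⊛ s) (λ _ → refl) 𝐳 C S ⟩
      (𝐳 ⊛ S) ⊛ S ∎))
      where open PS-Reasoning

    sech·cosh : ρ ⊛ C ≗ const 1ℚ
    sech·cosh = begin
      ρ ⊛ C
        ≈⟨ PS.*-congʳ {C} (λ n → cong (λ z → C n - z) (sym (𝐳⊛ (τ ⊛ S) n))) ⟩
      (C ⊕ ⊝ (𝐳 ⊛ (τ ⊛ S))) ⊛ C
        ≈⟨ PSSolver.solve 4 (λ z t c s → (c :⊕ :⊝ (z :⊛ (t :⊛ s))) :⊛ c :≗ c :⊛ c :⊕ :⊝ (z :⊛ ((t :⊛ c) :⊛ s))) (λ _ → refl) 𝐳 τ C S ⟩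
      C ⊛ C ⊕ ⊝ (𝐳 ⊛ ((τ ⊛ C) ⊛ S))
        ≈⟨ PS.+-congˡ {C ⊛ C} (PS.-‿cong (PS.*-congˡ {𝐳} (PS.*-congʳ {S} tanh·cosh))) ⟩
      C ⊛ C ⊕ ⊝ (𝐳 ⊛ (S ⊛ S))
        ≈⟨ cosh²-sinh² ⟩
      const 1ℚ ∎
      where open PS-Reasoning

    sech·sinh : ρ ⊛ S ≗ τ
    sech·sinh = begin
      ρ ⊛ S               ≈⟨ PS.*-congˡ {ρ} (PS.sym tanh·cosh) ⟩
      ρ ⊛ (τ ⊛ C)         ≈⟨ PSSolver.solve 3 (λ r t c → r :⊛ (t :⊛ c) :≗ t :⊛ (r :⊛ c)) (λ _ → refl) ρ τ C ⟩
      τ ⊛ (ρ ⊛ C)         ≈⟨ PS.*-congˡ {τ} sech·cosh ⟩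
      τ ⊛ const 1ℚ        ≈⟨ PS.*-identityʳ τ ⟩
      τ ∎
      where open PS-Reasoning

    -- sech′ = - sech tanh: differentiating ρC = 1 and multiplying by ρ gives θρ = - ρ² θC, where θC
    -- is half of zS and ρS = τ.
    θ-sech : θ ρ ≗ const (- ½) ⊛ (𝐳 ⊛ (ρ ⊛ τ))
    θ-sech = begin
      θ ρ
        ≈⟨ PSSolver.solve 4 (λ r c dr dc → dr :≗ (:⊝ (dr :⊛ (r :⊛ c :⊕ :⊝ κ 1ℚ)) :⊕ r :⊛ (dr :⊛ c :⊕ r :⊛ dc)) :⊕ :⊝ (r :⊛ r :⊛ dc)) (λ _ → refl) ρ C (θ ρ) (θ C) ⟩
      (⊝ (θ ρ ⊛ (ρ ⊛ C ⊕ ⊝ const 1ℚ)) ⊕ ρ ⊛ (θ ρ ⊛ C ⊕ ρ ⊛ θ C)) ⊕ ⊝ (ρ ⊛ ρ ⊛ θ C)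
        ≈⟨ PS.+-cong (PS.+-cong (PS.-‿cong (PS.*-congˡ {θ ρ} (PS.+-congʳ {⊝ const 1ℚ} sech·cosh)))
             (PS.*-congˡ {ρ} (PS.trans (PS.sym (θ-conv ρ C)) (PS.trans (θ-cong sech·cosh) (θ-const 1ℚ)))))
             (PS.-‿cong (PS.*-congˡ {ρ ⊛ ρ} θ-cosh)) ⟩
      (⊝ (θ ρ ⊛ (const 1ℚ ⊕ ⊝ const 1ℚ)) ⊕ ρ ⊛ const 0ℚ) ⊕ ⊝ (ρ ⊛ ρ ⊛ (const ½ ⊛ (𝐳 ⊛ S)))
        ≈⟨ PSSolver.solve 4 (λ z r s dr → (:⊝ (dr :⊛ (κ 1ℚ :⊕ :⊝ κ 1ℚ)) :⊕ r :⊛ κ 0ℚ) :⊕ :⊝ (r :⊛ r :⊛ (κ ½ :⊛ (z :⊛ s)))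
             :≗ κ (- ½) :⊛ (z :⊛ (r :⊛ (r :⊛ s)))) (λ _ → refl) 𝐳 ρ S (θ ρ) ⟩
      const (- ½) ⊛ (𝐳 ⊛ (ρ ⊛ (ρ ⊛ S)))
        ≈⟨ PS.*-congˡ {const (- ½)} (PS.*-congˡ {𝐳} (PS.*-congˡ {ρ} sech·sinh)) ⟩
      const (- ½) ⊛ (𝐳 ⊛ (ρ ⊛ τ)) ∎
      where open PS-Reasoning

    -- tanh′ = sech². Coefficient by coefficient, this equation and `θ-sech` are `tanh-step` and
    -- `sech-step`, which have the shape of the two convolutions of β and λ and thus identify the
    -- sequences.
    θ-tanh : τ ⊕ (θ τ ⊕ θ τ) ≗ ρ ⊛ ρ
    θ-tanh = begin
      τ ⊕ (θ τ ⊕ θ τ)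
        ≈⟨ PS.+-cong (PS.sym sech·sinh) (PS.+-cong θτ θτ) ⟩
      ρ ⊛ S ⊕ ((θ ρ ⊛ S ⊕ ρ ⊛ θ S) ⊕ (θ ρ ⊛ S ⊕ ρ ⊛ θ S))
        ≈⟨ PSSolver.solve 4 (λ r s dr ds → r :⊛ s :⊕ ((dr :⊛ s :⊕ r :⊛ ds) :⊕ (dr :⊛ s :⊕ r :⊛ ds))
             :≗ r :⊛ (s :⊕ (ds :⊕ ds)) :⊕ (κ ⟦ 2 ⟧ :⊛ s) :⊛ dr) (λ _ → refl) ρ S (θ ρ) (θ S) ⟩
      ρ ⊛ (S ⊕ (θ S ⊕ θ S)) ⊕ (const ⟦ 2 ⟧ ⊛ S) ⊛ θ ρ
        ≈⟨ PS.+-cong (PS.trans (PS.*-congˡ {ρ} θ-sinh) sech·cosh) (PS.*-congˡ {const ⟦ 2 ⟧ ⊛ S}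
             (PS.trans θ-sech (PS.*-congˡ {const (- ½)} (PS.*-congˡ {𝐳} (PS.*-congˡ {ρ} (PS.sym sech·sinh)))))) ⟩
      const 1ℚ ⊕ (const ⟦ 2 ⟧ ⊛ S) ⊛ (const (- ½) ⊛ (𝐳 ⊛ (ρ ⊛ (ρ ⊛ S))))
        ≈⟨ PS.+-congʳ {(const ⟦ 2 ⟧ ⊛ S) ⊛ (const (- ½) ⊛ (𝐳 ⊛ (ρ ⊛ (ρ ⊛ S))))} one ⟩
      (ρ ⊛ C) ⊛ (ρ ⊛ C) ⊕ (const ⟦ 2 ⟧ ⊛ S) ⊛ (const (- ½) ⊛ (𝐳 ⊛ (ρ ⊛ (ρ ⊛ S))))
        ≈⟨ PSSolver.solve 4 (λ z r c s → (r :⊛ c) :⊛ (r :⊛ c) :⊕ (κ ⟦ 2 ⟧ :⊛ s) :⊛ (κ (- ½) :⊛ (z :⊛ (r :⊛ (r :⊛ s))))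
             :≗ (r :⊛ r) :⊛ (c :⊛ c :⊕ :⊝ (z :⊛ (s :⊛ s)))) (λ _ → refl) 𝐳 ρ C S ⟩
      (ρ ⊛ ρ) ⊛ (C ⊛ C ⊕ ⊝ (𝐳 ⊛ (S ⊛ S)))
        ≈⟨ PS.trans (PS.*-congˡ {ρ ⊛ ρ} cosh²-sinh²) (PS.*-identityʳ (ρ ⊛ ρ)) ⟩
      ρ ⊛ ρ ∎
      where
      open PS-Reasoning
      θτ : θ τ ≗ θ ρ ⊛ S ⊕ ρ ⊛ θ S
      θτ = PS.trans (θ-cong (PS.sym sech·sinh)) (θ-conv ρ S)
      one : const 1ℚ ≗ (ρ ⊛ C) ⊛ (ρ ⊛ C)
      one = PS.sym (PS.trans (PS.*-cong sech·cosh sech·cosh) (PS.*-identityˡ (const 1ℚ)))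

    -- sinh 2x · tanh′ x = 2 tanh x
    sinh2·tanh′ : dilate S ⊛ (τ ⊕ (θ τ ⊕ θ τ)) ≗ τ
    sinh2·tanh′ = begin
      dilate S ⊛ (τ ⊕ (θ τ ⊕ θ τ))   ≈⟨ PS.*-cong dilate-sinh θ-tanh ⟩
      (S ⊛ C) ⊛ (ρ ⊛ ρ)              ≈⟨ PSSolver.solve 3 (λ r c s → (s :⊛ c) :⊛ (r :⊛ r) :≗ (r :⊛ s) :⊛ (r :⊛ c)) (λ _ → refl) ρ C S ⟩
      (ρ ⊛ S) ⊛ (ρ ⊛ C)              ≈⟨ PS.*-cong sech·sinh sech·cosh ⟩
      τ ⊛ const 1ℚ                   ≈⟨ PS.*-identityʳ τ ⟩
      τ ∎
      where open PS-Reasoning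

    sech-step : ∀ n → ⟦ suc n ⟧ * ρ (suc n) ≡ - ½ * conv ρ τ n
    sech-step n = trans (θ-sech (suc n)) (trans (conv-const (- ½) (𝐳 ⊛ (ρ ⊛ τ)) (suc n)) (cong (- ½ *_) (𝐳⊛ (ρ ⊛ τ) (suc n))))

    tanh-step : ∀ n → (1ℚ + (⟦ n ⟧ + ⟦ n ⟧)) * τ n ≡ conv ρ ρ n
    tanh-step n = trans (solve 2 (λ m s → (con 1ℚ :+ (m :+ m)) :* s := s :+ (m :* s :+ m :* s)) refl ⟦ n ⟧ (τ n)) (θ-tanh n)

    ρ₀ : ρ 0 ≡ 1ℚ
    ρ₀ = trans (sym (ℚₚ.*-identityʳ (ρ 0))) (sech·cosh 0)

open Defs using (_+_; _*_; -_; _-_; _^_; _<_; _≈_)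

-- The reals as a commutative ring with a weak order

module _ where
  open ℚ-Solver.+-*-Solver using (solve; con; _:=_; _:+_; _:*_; _:-_; :-_)

  ∣p∣-∣q∣≤∣p-q∣ : ∀ p q → ∣ p ∣ ℚ.- ∣ q ∣ ℚ.≤ ∣ p ℚ.- q ∣
  ∣p∣-∣q∣≤∣p-q∣ p q = subst (∣ p ∣ ℚ.- ∣ q ∣ ℚ.≤_)
    (solve 2 (λ d q → (d :+ q) :- q := d) refl ∣ p ℚ.- q ∣ ∣ q ∣)
    (ℚₚ.+-monoˡ-≤ (ℚ.- ∣ q ∣) (subst (λ z → ∣ z ∣ ℚ.≤ ∣ p ℚ.- q ∣ ℚ.+ ∣ q ∣)
      (sym (add-sub p q)) (ℚₚ.∣p+q∣≤∣p∣+∣q∣ (p ℚ.- q) q)))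

  ∣∣-∣∣-≤ : ∀ p q → ∣ ∣ p ∣ ℚ.- ∣ q ∣ ∣ ℚ.≤ ∣ p ℚ.- q ∣
  ∣∣-∣∣-≤ p q with ℚₚ.∣p∣≡p∨∣p∣≡-p (∣ p ∣ ℚ.- ∣ q ∣)
  ... | inj₁ eq = subst (ℚ._≤ ∣ p ℚ.- q ∣) (sym eq) (∣p∣-∣q∣≤∣p-q∣ p q)
  ... | inj₂ eq = subst₂ ℚ._≤_ (sym (trans eq (sym (sub-swap ∣ q ∣ ∣ p ∣)))) (∣-∣-sym q p) (∣p∣-∣q∣≤∣p-q∣ q p)

  -- Records rather than definitions, so that their arguments can be inferred.

  record Null (a : ℕ → ℚ) : Set where
    constructor mkNull
    field tends : ∀ ε → 0ℚ ℚ.< ε → ∃[ N ] (∀ n → N ℕ.≤ n → ∣ a n ∣ ℚ.< ε)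
  open Null

  null-squeeze : ∀ {a b} N → (∀ n → N ℕ.≤ n → ∣ a n ∣ ℚ.≤ ∣ b n ∣) → Null b → Null a
  null-squeeze {a} {b} N h b→0 = mkNull λ ε 0<ε → let M , k = tends b→0 ε 0<ε in
    N ℕ.⊔ M , λ n l → ℚₚ.≤-<-trans (h n (ℕₚ.m⊔n≤o⇒m≤o N M l)) (k n (ℕₚ.m⊔n≤o⇒n≤o N M l))

  null-cong : ∀ {a b} → (∀ n → b n ≡ a n) → Null a → Null b
  null-cong h = null-squeeze 0 λ n _ → ℚₚ.≤-reflexive (cong ∣_∣ (h n))

  null-0 : Null (λ _ → 0ℚ)
  null-0 = mkNull λ ε 0<ε → 0 , λ _ _ → 0<ε

  null-+ : ∀ {a b} → Null a → Null b → Null (λ n → a n ℚ.+ b n)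
  null-+ {a} {b} a→0 b→0 = mkNull λ ε 0<ε →
    let M , h = tends a→0 (½ ℚ.* ε) (half>0 0<ε)
        N , k = tends b→0 (½ ℚ.* ε) (half>0 0<ε)
    in M ℕ.⊔ N , λ n l → ℚₚ.≤-<-trans (ℚₚ.∣p+q∣≤∣p∣+∣q∣ (a n) (b n))
    (subst (∣ a n ∣ ℚ.+ ∣ b n ∣ ℚ.<_) (½+½ ε) (ℚₚ.+-mono-< (h n (ℕₚ.m⊔n≤o⇒m≤o M N l)) (k n (ℕₚ.m⊔n≤o⇒n≤o M N l))))

  null-scale : ∀ (a : ℕ → ℚ) {b} M N → 0ℚ ℚ.< M → (∀ n → N ℕ.≤ n → ∣ a n ∣ ℚ.≤ M) → Null b → Null (λ n → a n ℚ.* b n)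
  null-scale a {b} M N 0<M a≤M b→0 = mkNull λ ε 0<ε →
    let K , h = tends b→0 (inv M ℚ.* ε) (0<p*q (inv>0 0<M) 0<ε)
    in N ℕ.⊔ K , λ n l → bound ε n (ℕₚ.m⊔n≤o⇒m≤o N K l) (h n (ℕₚ.m⊔n≤o⇒n≤o N K l))
    where
    open ℚₚ.≤-Reasoning
    bound : ∀ ε n → N ℕ.≤ n → ∣ b n ∣ ℚ.< inv M ℚ.* ε → ∣ a n ℚ.* b n ∣ ℚ.< ε
    bound ε n N≤n b< = begin-strict
      ∣ a n ℚ.* b n ∣          ≡⟨ ℚₚ.∣p*q∣≡∣p∣*∣q∣ (a n) (b n) ⟩
      ∣ a n ∣ ℚ.* ∣ b n ∣      ≤⟨ *-mono-≤ (ℚₚ.<⇒≤ 0<M) (ℚₚ.0≤∣p∣ (b n)) (a≤M n N≤n) ℚₚ.≤-refl ⟩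
      M ℚ.* ∣ b n ∣            <⟨ ℚₚ.*-monoʳ-<-pos M {{ℚ.positive 0<M}} b< ⟩
      M ℚ.* (inv M ℚ.* ε)      ≡⟨ ℚₚ.*-assoc M (inv M) ε ⟨
      M ℚ.* inv M ℚ.* ε        ≡⟨ cong (ℚ._* ε) (trans (ℚₚ.*-comm M (inv M)) (inv-inverse M (pos≢0 0<M))) ⟩
      1ℚ ℚ.* ε                 ≡⟨ ℚₚ.*-identityˡ ε ⟩
      ε                        ∎

  null-const-scale : ∀ c {b : ℕ → ℚ} → Null b → Null (λ n → c ℚ.* b n)
  null-const-scale c = null-scale (λ _ → c) (1ℚ ℚ.+ ∣ c ∣) 0 (ℚₚ.<-≤-trans 0<1ℚ (subst (ℚ._≤ 1ℚ ℚ.+ ∣ c ∣) (ℚₚ.+-identityʳ 1ℚ) (ℚₚ.+-monoʳ-≤ 1ℚ (ℚₚ.0≤∣p∣ c))))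
    (λ _ _ → subst (ℚ._≤ 1ℚ ℚ.+ ∣ c ∣) (ℚₚ.+-identityˡ ∣ c ∣) (ℚₚ.+-monoˡ-≤ ∣ c ∣ (ℚₚ.<⇒≤ 0<1ℚ)))

  infix 4 _≃_
  record _≃_ (x y : ℝ) : Set where
    constructor mk≃
    field null : Null (λ n → seq x n ℚ.- seq y n)
  open _≃_

  ≃⇒≈ : ∀ x y → x ≃ y → x ≈ y
  ≃⇒≈ x y p = tends (null p)

  pointwise-from : ∀ {x y} N → (∀ n → N ℕ.≤ n → seq x n ≡ seq y n) → x ≃ y
  pointwise-from {x} {y} N h = mk≃ (null-squeeze N (λ n l → ℚₚ.≤-reflexive (cong ∣_∣
    (trans (cong (ℚ._- seq y n) (h n l)) (ℚₚ.+-inverseʳ (seq y n))))) null-0)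

  pointwise : ∀ {x y} → (∀ n → seq x n ≡ seq y n) → x ≃ y
  pointwise h = pointwise-from 0 (λ n _ → h n)

  ≃-refl : ∀ {x} → x ≃ x
  ≃-refl = pointwise λ _ → refl

  ≃-sym : ∀ {x y} → x ≃ y → y ≃ x
  ≃-sym {x} {y} p = mk≃ (null-squeeze 0 (λ n _ → ℚₚ.≤-reflexive (∣-∣-sym (seq y n) (seq x n))) (null p))

  ≃-trans : ∀ {x y z} → x ≃ y → y ≃ z → x ≃ z
  ≃-trans {x} {y} {z} p q = mk≃ (null-cong (λ n → sub-split (seq x n) (seq z n) (seq y n)) (null-+ (null p) (null q)))

  -- The operations are made opaque, because unification must not unfold them.

  infixl 6 _⊞_
  infixl 7 _⊠_
  infix  8 ⊟_

  opaque
    _⊞_ _⊠_ : ℝ → ℝ → ℝ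
    _⊞_ = _+_
    _⊠_ = _*_

    ⊟_ abs : ℝ → ℝ
    ⊟_ = -_
    abs x = mkℝ (λ n → ∣ seq x n ∣) λ ε 0<ε → let N , h = cauchy x ε 0<ε in
      N , λ m n l₁ l₂ → ℚₚ.≤-<-trans (∣∣-∣∣-≤ (seq x m) (seq x n)) (h m n l₁ l₂)

    ι : ℚ → ℝ
    ι = fromℚ

  opaque
    unfolding _⊞_

    seq-⊞ : ∀ x y n → seq (x ⊞ y) n ≡ seq x n ℚ.+ seq y n
    seq-⊞ x y n = refl

    seq-⊠ : ∀ x y n → seq (x ⊠ y) n ≡ seq x n ℚ.* seq y n
    seq-⊠ x y n = refl

    seq-⊟ : ∀ x n → seq (⊟ x) n ≡ ℚ.- seq x n
    seq-⊟ x n = refl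

    seq-abs : ∀ x n → seq (abs x) n ≡ ∣ seq x n ∣
    seq-abs x n = refl

    seq-ι : ∀ q n → seq (ι q) n ≡ q
    seq-ι q n = refl

    ⊞-cong : ∀ {x y u v} → x ≃ y → u ≃ v → x ⊞ u ≃ y ⊞ v
    ⊞-cong {x} {y} {u} {v} p q = mk≃ (null-cong (λ n → sub-+ (seq x n) (seq u n) (seq y n) (seq v n)) (null-+ (null p) (null q)))

    ⊠-cong : ∀ {x y u v} → x ≃ y → u ≃ v → x ⊠ u ≃ y ⊠ v
    ⊠-cong {x} {y} {u} {v} p q =
      let Mx , 0<Mx , Nx , hx = eventually-bounded {seq x} (cauchy x)
          Mv , 0<Mv , Nv , hv = eventually-bounded {seq v} (cauchy v)
      in mk≃ (null-cong (λ n → sub-* (seq x n) (seq u n) (seq y n) (seq v n))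
           (null-+ (null-scale (seq x) Mx Nx 0<Mx hx (null q)) (null-scale (seq v) Mv Nv 0<Mv hv (null p))))

    ⊟-cong : ∀ {x y} → x ≃ y → ⊟ x ≃ ⊟ y
    ⊟-cong {x} {y} p = mk≃ (null-squeeze 0 (λ n _ → ℚₚ.≤-reflexive
      (trans (cong ∣_∣ (sub-neg (seq x n) (seq y n))) (ℚₚ.∣-p∣≡∣p∣ (seq x n ℚ.- seq y n)))) (null p))

    abs-cong : ∀ {x y} → x ≃ y → abs x ≃ abs y
    abs-cong {x} {y} p = mk≃ (null-squeeze 0 (λ n _ → ∣∣-∣∣-≤ (seq x n) (seq y n)) (null p))

    ⊞-assoc : ∀ x y z → (x ⊞ y) ⊞ z ≃ x ⊞ (y ⊞ z)
    ⊞-assoc x y z = pointwise λ n → ℚₚ.+-assoc (seq x n) (seq y n) (seq z n)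

    ⊞-comm : ∀ x y → x ⊞ y ≃ y ⊞ x
    ⊞-comm x y = pointwise λ n → ℚₚ.+-comm (seq x n) (seq y n)

    ⊞-identityˡ : ∀ x → ι 0ℚ ⊞ x ≃ x
    ⊞-identityˡ x = pointwise λ n → ℚₚ.+-identityˡ (seq x n)

    ⊟-inverseˡ : ∀ x → ⊟ x ⊞ x ≃ ι 0ℚ
    ⊟-inverseˡ x = pointwise λ n → ℚₚ.+-inverseˡ (seq x n)

    ⊠-assoc : ∀ x y z → (x ⊠ y) ⊠ z ≃ x ⊠ (y ⊠ z)
    ⊠-assoc x y z = pointwise λ n → ℚₚ.*-assoc (seq x n) (seq y n) (seq z n)

    ⊠-comm : ∀ x y → x ⊠ y ≃ y ⊠ x
    ⊠-comm x y = pointwise λ n → ℚₚ.*-comm (seq x n) (seq y n)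

    ⊠-identityˡ : ∀ x → ι 1ℚ ⊠ x ≃ x
    ⊠-identityˡ x = pointwise λ n → ℚₚ.*-identityˡ (seq x n)

    ⊠-distribˡ-⊞ : ∀ x y z → x ⊠ (y ⊞ z) ≃ x ⊠ y ⊞ x ⊠ z
    ⊠-distribˡ-⊞ x y z = pointwise λ n → ℚₚ.*-distribˡ-+ (seq x n) (seq y n) (seq z n)

    ι-+ : ∀ p q → ι (p ℚ.+ q) ≃ ι p ⊞ ι q
    ι-+ p q = pointwise λ _ → refl

    ι-* : ∀ p q → ι (p ℚ.* q) ≃ ι p ⊠ ι q
    ι-* p q = pointwise λ _ → refl

    ι-neg : ∀ p → ι (ℚ.- p) ≃ ⊟ ι p
    ι-neg p = pointwise λ _ → refl

  ≃-setoid : Setoid 0ℓ 0ℓ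
  ≃-setoid = record { Carrier = ℝ ; _≈_ = _≃_ ; isEquivalence = record { refl = ≃-refl ; sym = ≃-sym ; trans = ≃-trans } }

  realRing : CommutativeRing 0ℓ 0ℓ
  realRing = record
    { Carrier = ℝ ; _≈_ = _≃_ ; _+_ = _⊞_ ; _*_ = _⊠_ ; -_ = ⊟_ ; 0# = ι 0ℚ ; 1# = ι 1ℚ
    ; isCommutativeRing = record
      { isRing = record
        { +-isAbelianGroup = record
          { isGroup = record
            { isMonoid = record
              { isSemigroup = record
                { isMagma = record { isEquivalence = Setoid.isEquivalence ≃-setoid ; ∙-cong = ⊞-cong }
                ; assoc = ⊞-assoc }
              ; identity = comm∧idˡ⇒id ⊞-comm ⊞-identityˡ }
            ; inverse = comm∧invˡ⇒inv ⊞-comm ⊟-inverseˡ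
            ; ⁻¹-cong = ⊟-cong }
          ; comm = ⊞-comm }
        ; *-cong = ⊠-cong
        ; *-assoc = ⊠-assoc
        ; *-identity = comm∧idˡ⇒id ⊠-comm ⊠-identityˡ
        ; distrib = comm∧distrˡ⇒distr ⊞-cong ⊠-comm ⊠-distribˡ-⊞ }
      ; *-comm = ⊠-comm } }
    where open Consequences ≃-setoid

  module R = CommutativeRing realRing
  module ℝ-Reasoning = SetoidReasoning R.setoid

  ι-homomorphism : AlmostCommutativeRing.rawRing (fromCommutativeRing ℚₚ.+-*-commutativeRing)
                     -Raw-AlmostCommutative⟶ fromCommutativeRing realRing
  ι-homomorphism = record
    { ⟦_⟧ = ι ; +-homo = ι-+ ; *-homo = ι-* ; -‿homo = ι-neg ; 0-homo = ≃-refl ; 1-homo = ≃-refl }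

  ι≟ : ∀ p q → Maybe (ι p ≃ ι q)
  ι≟ p q with p ℚₚ.≟ q
  ... | yes p≡q = just (R.reflexive (cong ι p≡q))
  ... | no _    = nothing

  module ℝSolver = RingSolver _ (fromCommutativeRing realRing) ι-homomorphism ι≟
  open ℝSolver using () renaming (_:+_ to _:⊞_; _:*_ to _:⊠_; :-_ to :⊟_; _:=_ to _:≃_; con to κ; solve to solveᴿ)

  infixr 8 _⊡_
  _⊡_ : ℝ → ℕ → ℝ
  x ⊡ zero  = ι 1ℚ
  x ⊡ suc n = x ⊠ x ⊡ n

  ∑ : (ℕ → ℝ) → ℕ → ℝ
  ∑ f zero    = ι 0ℚ
  ∑ f (suc n) = ∑ f n ⊞ f n

  convᴿ : (ℕ → ℝ) → (ℕ → ℝ) → ℕ → ℝ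
  convᴿ f g zero    = f 0 ⊠ g 0
  convᴿ f g (suc n) = f 0 ⊠ g (suc n) ⊞ convᴿ (f ∘ suc) g n

  seq-⊡ : ∀ x n N → seq (x ⊡ n) N ≡ pow (seq x N) n
  seq-⊡ x zero    N = seq-ι 1ℚ N
  seq-⊡ x (suc n) N = trans (seq-⊠ x (x ⊡ n) N) (cong (seq x N ℚ.*_) (seq-⊡ x n N))

  seq-∑ : ∀ f n N → seq (∑ f n) N ≡ sum (λ k → seq (f k) N) n
  seq-∑ f zero    N = seq-ι 0ℚ N
  seq-∑ f (suc n) N = trans (seq-⊞ (∑ f n) (f n) N) (cong (ℚ._+ seq (f n) N) (seq-∑ f n N))

  seq-conv : ∀ f g n N → seq (convᴿ f g n) N ≡ conv (λ k → seq (f k) N) (λ k → seq (g k) N) n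
  seq-conv f g zero    N = seq-⊠ (f 0) (g 0) N
  seq-conv f g (suc n) N = trans (seq-⊞ (f 0 ⊠ g (suc n)) (convᴿ (f ∘ suc) g n) N)
    (cong₂ ℚ._+_ (seq-⊠ (f 0) (g (suc n)) N) (seq-conv (f ∘ suc) g n N))

  ⊡-cong : ∀ {x y} → x ≃ y → ∀ n → x ⊡ n ≃ y ⊡ n
  ⊡-cong p zero    = ≃-refl
  ⊡-cong p (suc n) = ⊠-cong p (⊡-cong p n)

  ⊡-+ : ∀ x m n → x ⊡ (m ℕ.+ n) ≃ x ⊡ m ⊠ x ⊡ n
  ⊡-+ x zero    n = R.sym (⊠-identityˡ (x ⊡ n))
  ⊡-+ x (suc m) n = R.trans (R.*-congˡ {x} (⊡-+ x m n)) (R.sym (⊠-assoc x (x ⊡ m) (x ⊡ n)))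

  ⊡-⊠ : ∀ x y n → (x ⊠ y) ⊡ n ≃ x ⊡ n ⊠ y ⊡ n
  ⊡-⊠ x y zero    = R.sym (⊠-identityˡ (ι 1ℚ))
  ⊡-⊠ x y (suc n) = R.trans (R.*-congˡ {x ⊠ y} (⊡-⊠ x y n))
    (solveᴿ 4 (λ x y a b → (x :⊠ y) :⊠ (a :⊠ b) :≃ (x :⊠ a) :⊠ (y :⊠ b)) ≃-refl x y (x ⊡ n) (y ⊡ n))

  ⊡-double : ∀ x n → x ⊡ (2 ℕ.* n) ≃ (x ⊠ x) ⊡ n
  ⊡-double x n = R.trans (R.reflexive (cong (λ k → x ⊡ (n ℕ.+ k)) (ℕₚ.+-identityʳ n))) (R.trans (⊡-+ x n n) (R.sym (⊡-⊠ x x n)))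

  ι-pow : ∀ p n → ι (pow p n) ≃ ι p ⊡ n
  ι-pow p zero    = ≃-refl
  ι-pow p (suc n) = R.trans (ι-* p (pow p n)) (R.*-congˡ {ι p} (ι-pow p n))

  ∑-cong : ∀ {f g} n → (∀ k → f k ≃ g k) → ∑ f n ≃ ∑ g n
  ∑-cong zero    h = ≃-refl
  ∑-cong (suc n) h = ⊞-cong (∑-cong n h) (h n)

  ∑-ι : ∀ f n → ∑ (λ k → ι (f k)) n ≃ ι (sum f n)
  ∑-ι f zero    = ≃-refl
  ∑-ι f (suc n) = R.trans (R.+-congʳ {ι (f n)} (∑-ι f n)) (R.sym (ι-+ (sum f n) (f n)))

  convᴿ-cong≤ : ∀ {f f′ g g′} n → (∀ k → k ℕ.≤ n → f k ≃ f′ k) → (∀ k → k ℕ.≤ n → g k ≃ g′ k) → convᴿ f g n ≃ convᴿ f′ g′ n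
  convᴿ-cong≤ zero    p q = ⊠-cong (p 0 ℕ.z≤n) (q 0 ℕ.z≤n)
  convᴿ-cong≤ (suc n) p q = ⊞-cong (⊠-cong (p 0 ℕ.z≤n) (q (suc n) ℕₚ.≤-refl))
    (convᴿ-cong≤ n (λ k k≤n → p (suc k) (ℕ.s≤s k≤n)) (λ k k≤n → q k (ℕₚ.m≤n⇒m≤1+n k≤n)))

  convᴿ-cong : ∀ {f f′ g g′} → (∀ k → f k ≃ f′ k) → (∀ k → g k ≃ g′ k) → ∀ n → convᴿ f g n ≃ convᴿ f′ g′ n
  convᴿ-cong p q n = convᴿ-cong≤ n (λ k _ → p k) (λ k _ → q k)

  opaque
    unfolding _⊞_

    recip : (x : ℝ) → x #0 → ℝ
    recip = reciprocal

    recip-inverse : ∀ x (x#0 : x #0) → recip x x#0 ⊠ x ≃ ι 1ℚ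
    recip-inverse x (δ , 0<δ , N , h) = pointwise-from N λ n l → inv-inverse (seq x n) (∣∣≥⇒≢0 0<δ (h n l))

    ÷-def : ∀ x y (y#0 : y #0) → x ÷ y [ y#0 ] ≃ x ⊠ recip y y#0
    ÷-def x y y#0 = pointwise λ _ → refl

  quotient-unique : ∀ {x y z} (y#0 : y #0) → z ⊠ y ≃ x → x ⊠ recip y y#0 ≃ z
  quotient-unique {x} {y} {z} y#0 zy≃x = begin
    x ⊠ i                         ≈⟨ R.*-congʳ {i} (R.sym zy≃x) ⟩
    z ⊠ y ⊠ i                     ≈⟨ solveᴿ 3 (λ z y i → z :⊠ y :⊠ i :≃ z :⊠ (i :⊠ y)) ≃-refl z y i ⟩
    z ⊠ (i ⊠ y)                   ≈⟨ R.*-congˡ {z} (recip-inverse y y#0) ⟩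
    z ⊠ ι 1ℚ                      ≈⟨ R.*-identityʳ z ⟩
    z                             ∎
    where
    open ℝ-Reasoning
    i = recip y y#0

  ÷-unique : ∀ {x y z} (y#0 : y #0) → z ⊠ y ≃ x → x ÷ y [ y#0 ] ≃ z
  ÷-unique {x} {y} y#0 zy≃x = R.trans (÷-def x y y#0) (quotient-unique y#0 zy≃x)

  opaque
    unfolding _⊞_

    +⇒⊞ : ∀ x y → x + y ≃ x ⊞ y
    +⇒⊞ x y = pointwise λ _ → refl

    *⇒⊠ : ∀ x y → x * y ≃ x ⊠ y
    *⇒⊠ x y = pointwise λ _ → refl

    -⇒⊟ : ∀ x → - x ≃ ⊟ x
    -⇒⊟ x = pointwise λ _ → refl

    fromℚ⇒ι : ∀ q → fromℚ q ≃ ι q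
    fromℚ⇒ι q = pointwise λ _ → refl

  -- Order

  opaque
    unfolding _⊞_

    abs-⊠ : ∀ x y → abs (x ⊠ y) ≃ abs x ⊠ abs y
    abs-⊠ x y = pointwise λ n → ℚₚ.∣p*q∣≡∣p∣*∣q∣ (seq x n) (seq y n)

  -- As an equation, nonnegativity is invariant under `≃` at once, and closure under sums and
  -- products follows by replacing each operand by its absolute value, whose terms are all
  -- nonnegative.
  NonNeg : ℝ → Set
  NonNeg x = abs x ≃ x

  infix 4 _≼_
  record _≼_ (x y : ℝ) : Set where
    constructor mk≼
    field nonNeg : NonNeg (y ⊞ ⊟ x)
  open _≼_

  nonNeg-cong : ∀ {x y} → x ≃ y → NonNeg x → NonNeg y
  nonNeg-cong x≃y p = R.trans (abs-cong (R.sym x≃y)) (R.trans p x≃y)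

  opaque
    unfolding _⊞_

    nonNeg-from : ∀ {x} N → (∀ n → N ℕ.≤ n → 0ℚ ℚ.≤ seq x n) → NonNeg x
    nonNeg-from N h = pointwise-from N λ n l → ℚₚ.0≤p⇒∣p∣≡p (h n l)

    nonNeg-⊞ : ∀ {x y} → NonNeg x → NonNeg y → NonNeg (x ⊞ y)
    nonNeg-⊞ {x} {y} p q = nonNeg-cong {abs x ⊞ abs y} {x ⊞ y} (⊞-cong {abs x} {x} {abs y} {y} p q)
      (nonNeg-from {abs x ⊞ abs y} 0 λ n _ → ℚₚ.+-mono-≤ (ℚₚ.0≤∣p∣ (seq x n)) (ℚₚ.0≤∣p∣ (seq y n)))

    nonNeg-⊠ : ∀ {x y} → NonNeg x → NonNeg y → NonNeg (x ⊠ y)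
    nonNeg-⊠ {x} {y} p q = nonNeg-cong {abs x ⊠ abs y} {x ⊠ y} (⊠-cong {abs x} {x} {abs y} {y} p q)
      (nonNeg-from {abs x ⊠ abs y} 0 λ n _ → 0≤* (ℚₚ.0≤∣p∣ (seq x n)) (ℚₚ.0≤∣p∣ (seq y n)))

    ≼-from : ∀ {x y} N → (∀ n → N ℕ.≤ n → seq x n ℚ.≤ seq y n) → x ≼ y
    ≼-from {x} {y} N h = mk≼ (nonNeg-from {y ⊞ ⊟ x} N λ n l → ≤⇒0≤- (h n l))

  ≼-pointwise : ∀ {x y} → (∀ n → seq x n ℚ.≤ seq y n) → x ≼ y
  ≼-pointwise h = ≼-from 0 λ n _ → h n

  ≼-resp : ∀ {x x′ y y′} → x ≃ x′ → y ≃ y′ → x ≼ y → x′ ≼ y′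
  ≼-resp p q h = mk≼ (nonNeg-cong (⊞-cong q (⊟-cong p)) (nonNeg h))

  ≼-refl : ∀ {x} → x ≼ x
  ≼-refl = ≼-pointwise λ _ → ℚₚ.≤-refl

  ≃⇒≼ : ∀ {x y} → x ≃ y → x ≼ y
  ≃⇒≼ {x} {y} p = ≼-resp {x} {x} {x} {y} ≃-refl p ≼-refl

  ≼-trans : ∀ {x y z} → x ≼ y → y ≼ z → x ≼ z
  ≼-trans {x} {y} {z} p q = mk≼ (nonNeg-cong
    (solveᴿ 3 (λ x y z → (y :⊞ :⊟ x) :⊞ (z :⊞ :⊟ y) :≃ z :⊞ :⊟ x) ≃-refl x y z)
    (nonNeg-⊞ (nonNeg p) (nonNeg q)))

  ⊞-mono : ∀ {x y u v} → x ≼ y → u ≼ v → x ⊞ u ≼ y ⊞ v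
  ⊞-mono {x} {y} {u} {v} p q = mk≼ (nonNeg-cong
    (solveᴿ 4 (λ x y u v → (y :⊞ :⊟ x) :⊞ (v :⊞ :⊟ u) :≃ (y :⊞ v) :⊞ :⊟ (x :⊞ u)) ≃-refl x y u v)
    (nonNeg-⊞ (nonNeg p) (nonNeg q)))

  0≼⇒nonNeg : ∀ {x} → ι 0ℚ ≼ x → NonNeg x
  0≼⇒nonNeg {x} h = nonNeg-cong (solveᴿ 1 (λ x → x :⊞ :⊟ κ 0ℚ :≃ x) ≃-refl x) (nonNeg h)

  ι-mono : ∀ {p q} → p ℚ.≤ q → ι p ≼ ι q
  ι-mono {p} {q} p≤q = ≼-pointwise λ n → subst₂ ℚ._≤_ (sym (seq-ι p n)) (sym (seq-ι q n)) p≤q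

  0≼abs : ∀ x → ι 0ℚ ≼ abs x
  0≼abs x = ≼-pointwise λ n → subst₂ ℚ._≤_ (sym (seq-ι 0ℚ n)) (sym (seq-abs x n)) (ℚₚ.0≤∣p∣ (seq x n))

  ⊠-monoʳ : ∀ {c x y} → ι 0ℚ ≼ c → x ≼ y → c ⊠ x ≼ c ⊠ y
  ⊠-monoʳ {c} {x} {y} 0≼c h = mk≼ (nonNeg-cong
    (solveᴿ 3 (λ c x y → c :⊠ (y :⊞ :⊟ x) :≃ c :⊠ y :⊞ :⊟ (c :⊠ x)) ≃-refl c x y)
    (nonNeg-⊠ (0≼⇒nonNeg 0≼c) (nonNeg h)))

  ⊠-mono : ∀ {x y u v} → ι 0ℚ ≼ y → ι 0ℚ ≼ u → x ≼ y → u ≼ v → x ⊠ u ≼ y ⊠ v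
  ⊠-mono {x} {y} {u} {v} 0≼y 0≼u x≼y u≼v =
    ≼-trans (≼-resp (⊠-comm u x) (⊠-comm u y) (⊠-monoʳ 0≼u x≼y)) (⊠-monoʳ 0≼y u≼v)

  0≼⊠ : ∀ {x y} → ι 0ℚ ≼ x → ι 0ℚ ≼ y → ι 0ℚ ≼ x ⊠ y
  0≼⊠ {x} {y} 0≼x 0≼y = ≼-resp (solveᴿ 1 (λ x → x :⊠ κ 0ℚ :≃ κ 0ℚ) ≃-refl x) ≃-refl (⊠-monoʳ 0≼x 0≼y)

  0≼⊡ : ∀ {x} → ι 0ℚ ≼ x → ∀ n → ι 0ℚ ≼ x ⊡ n
  0≼⊡ 0≼x zero    = ι-mono (ℚₚ.<⇒≤ 0<1ℚ)
  0≼⊡ 0≼x (suc n) = 0≼⊠ 0≼x (0≼⊡ 0≼x n)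

  opaque
    unfolding _⊞_

    abs-⊞ : ∀ x y → abs (x ⊞ y) ≼ abs x ⊞ abs y
    abs-⊞ x y = ≼-pointwise {abs (x ⊞ y)} {abs x ⊞ abs y} λ n → ℚₚ.∣p+q∣≤∣p∣+∣q∣ (seq x n) (seq y n)

    abs-⊟ : ∀ x → abs (⊟ x) ≃ abs x
    abs-⊟ x = pointwise {abs (⊟ x)} {abs x} λ n → ℚₚ.∣-p∣≡∣p∣ (seq x n)

    abs-ι : ∀ q → abs (ι q) ≃ ι ∣ q ∣
    abs-ι q = pointwise λ _ → refl

  abs≼⊞ : ∀ {x y c d} → abs x ≼ c → abs y ≼ d → abs (x ⊞ y) ≼ c ⊞ d
  abs≼⊞ {x} {y} p q = ≼-trans (abs-⊞ x y) (⊞-mono p q)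

  abs≼⊠ : ∀ {x y c d} → abs x ≼ c → abs y ≼ d → abs (x ⊠ y) ≼ c ⊠ d
  abs≼⊠ {x} {y} p q = ≼-trans (≃⇒≼ (abs-⊠ x y)) (⊠-mono (≼-trans (0≼abs x) p) (0≼abs y) p q)

  abs≼⊟ : ∀ {x c} → abs x ≼ c → abs (⊟ x) ≼ c
  abs≼⊟ {x} p = ≼-resp (R.sym (abs-⊟ x)) ≃-refl p

  abs≼-resp : ∀ {x y c} → x ≃ y → abs x ≼ c → abs y ≼ c
  abs≼-resp p h = ≼-resp (abs-cong p) ≃-refl h

  nonNeg⇒abs≼ : ∀ {x c} → ι 0ℚ ≼ x → x ≼ c → abs x ≼ c
  nonNeg⇒abs≼ 0≼x x≼c = ≼-resp (R.sym (0≼⇒nonNeg 0≼x)) ≃-refl x≼c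

  p≤∣p∣ : ∀ p → p ℚ.≤ ∣ p ∣
  p≤∣p∣ p with ℚₚ.≤-total 0ℚ p
  ... | inj₁ 0≤p = ℚₚ.≤-reflexive (sym (ℚₚ.0≤p⇒∣p∣≡p 0≤p))
  ... | inj₂ p≤0 = ℚₚ.≤-trans p≤0 (ℚₚ.0≤∣p∣ p)

  ≼abs : ∀ x → x ≼ abs x
  ≼abs x = ≼-pointwise λ n → subst (seq x n ℚ.≤_) (sym (seq-abs x n)) (p≤∣p∣ (seq x n))

  0≼square : ∀ x → ι 0ℚ ≼ x ⊠ x
  0≼square x = ≼-pointwise λ n → subst₂ ℚ._≤_ (sym (seq-ι 0ℚ n)) (sym (seq-⊠ x x n)) (0≤square (seq x n))
    where
    0≤square : ∀ p → 0ℚ ℚ.≤ p ℚ.* p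
    0≤square p with ℚₚ.∣p∣≡p∨∣p∣≡-p p
    ... | inj₁ eq = subst (0ℚ ℚ.≤_) (cong₂ ℚ._*_ eq eq) (0≤* (ℚₚ.0≤∣p∣ p) (ℚₚ.0≤∣p∣ p))
    ... | inj₂ eq = subst (0ℚ ℚ.≤_) (trans (cong₂ ℚ._*_ eq eq) (solve 1 (λ p → (:- p) :* (:- p) := p :* p) refl p)) (0≤* (ℚₚ.0≤∣p∣ p) (ℚₚ.0≤∣p∣ p))

  ι-cancelˡ-≼ : ∀ {c x y} → 0ℚ ℚ.< c → ι c ⊠ x ≼ ι c ⊠ y → x ≼ y
  ι-cancelˡ-≼ {c} {x} {y} 0<c h = ≼-resp (undo x) (undo y) (⊠-monoʳ (ι-mono (ℚₚ.<⇒≤ (inv>0 0<c))) h)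
    where
    undo : ∀ z → ι (inv c) ⊠ (ι c ⊠ z) ≃ z
    undo z = R.trans (R.sym (⊠-assoc (ι (inv c)) (ι c) z))
      (R.trans (R.*-congʳ {z} (R.trans (R.sym (ι-* (inv c) c)) (R.reflexive (cong ι (inv-inverse c (pos≢0 0<c)))))) (⊠-identityˡ z))

  -- If b ≤ a, the distance of b - a from its absolute value is 2(a - b), so closeness of the two
  -- bounds a - b.
  almost-≤ : ∀ {a b ε} → 0ℚ ℚ.< ε → ∣ ∣ b ℚ.- a ∣ ℚ.- (b ℚ.- a) ∣ ℚ.< ε → a ℚ.< b ℚ.+ ε
  almost-≤ {a} {b} {ε} 0<ε near with ℚₚ.≤-total a b
  ... | inj₁ a≤b = ℚₚ.≤-<-trans a≤b (subst (ℚ._< b ℚ.+ ε) (ℚₚ.+-identityʳ b) (ℚₚ.+-monoʳ-< b 0<ε))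
  ... | inj₂ b≤a = begin-strict
    a                                     ≡⟨ solve 2 (λ a b → a := b :+ (a :- b)) refl a b ⟩
    b ℚ.+ (a ℚ.- b)                       ≤⟨ ℚₚ.+-monoʳ-≤ b a-b≤ ⟩
    b ℚ.+ ∣ ∣ b ℚ.- a ∣ ℚ.- (b ℚ.- a) ∣   <⟨ ℚₚ.+-monoʳ-< b near ⟩
    b ℚ.+ ε                               ∎
    where
    open ℚₚ.≤-Reasoning
    d : ℚ
    d = a ℚ.- b
    0≤d : 0ℚ ℚ.≤ d
    0≤d = ≤⇒0≤- b≤a
    a-b≤ : d ℚ.≤ ∣ ∣ b ℚ.- a ∣ ℚ.- (b ℚ.- a) ∣
    a-b≤ = begin
      d                               ≡⟨ ℚₚ.+-identityʳ d ⟨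
      d ℚ.+ 0ℚ                        ≤⟨ ℚₚ.+-monoʳ-≤ d 0≤d ⟩
      d ℚ.+ d                         ≡⟨ ℚₚ.0≤p⇒∣p∣≡p (ℚₚ.+-mono-≤ 0≤d 0≤d) ⟨
      ∣ d ℚ.+ d ∣                     ≡⟨ cong ∣_∣ (cong₂ ℚ._+_ (trans (sym (ℚₚ.0≤p⇒∣p∣≡p 0≤d)) (∣-∣-sym a b)) (sub-swap a b)) ⟩
      ∣ ∣ b ℚ.- a ∣ ℚ.- (b ℚ.- a) ∣   ∎

  opaque
    unfolding _⊞_

    ≼⇒eventually : ∀ {x y} → x ≼ y → ∀ ε → 0ℚ ℚ.< ε → ∃[ N ] (∀ n → N ℕ.≤ n → seq x n ℚ.< seq y n ℚ.+ ε)
    ≼⇒eventually {x} {y} h ε 0<ε = let N , k = tends (null (nonNeg h)) ε 0<ε in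
      N , λ n l → almost-≤ {seq x n} {seq y n} 0<ε (k n l)

  ι-cancel-≼ : ∀ {p q} → ι p ≼ ι q → p ℚ.≤ q
  ι-cancel-≼ {p} {q} h = ℚₚ.≮⇒≥ λ q<p →
    let N , k = ≼⇒eventually h (p ℚ.- q) (subst (ℚ._< p ℚ.- q) (ℚₚ.+-inverseʳ q) (ℚₚ.+-monoˡ-< (ℚ.- q) q<p))
    in ℚₚ.<-irrefl (solve 2 (λ p q → p := q :+ (p :- q)) refl p q) (subst₂ (λ a b → a ℚ.< b ℚ.+ (p ℚ.- q)) (seq-ι p N) (seq-ι q N) (k N ℕₚ.≤-refl))

  -- Constructively valid because rational approximations can be compared up to any margin.
  ≮⇒≃ : ∀ {x y} → ¬ (x < y) → ¬ (y < x) → x ≃ y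
  ≮⇒≃ {x} {y} x≮y y≮x = mk≃ (mkNull λ ε 0<ε →
    -- Half of ε is spent on the oscillation of x - y: a gap of ε at one late index leaves a gap of
    -- ε/2 at every later index, which is a strict inequality.
    let ε′ = ½ ℚ.* ε
        N , h = cauchy (x - y) ε′ (half>0 0<ε)
    in N , λ n l → ℚₚ.≰⇒> λ ε≤ → case ℚₚ.∣p∣≡p∨∣p∣≡-p (seq x n ℚ.- seq y n) of λ
      { (inj₁ eq) → y≮x (apart x y n h l (subst (ε ℚ.≤_) eq ε≤) 0<ε)
      ; (inj₂ eq) → x≮y (apart y x n (λ a b la lb → subst (ℚ._< ε′) (flip a b) (h a b la lb)) l
          (subst (ε ℚ.≤_) (trans eq (sym (sub-swap (seq y n) (seq x n)))) ε≤) 0<ε) })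
    where
    flip : ∀ a b → ∣ (seq x a ℚ.- seq y a) ℚ.- (seq x b ℚ.- seq y b) ∣ ≡ ∣ (seq y a ℚ.- seq x a) ℚ.- (seq y b ℚ.- seq x b) ∣
    flip a b = trans (cong ∣_∣ (solve 4 (λ p q r s → (p :- q) :- (r :- s) := :- ((q :- p) :- (s :- r))) refl (seq x a) (seq y a) (seq x b) (seq y b)))
      (ℚₚ.∣-p∣≡∣p∣ ((seq y a ℚ.- seq x a) ℚ.- (seq y b ℚ.- seq x b)))
    apart : ∀ x y {N ε} n → (∀ a b → N ℕ.≤ a → N ℕ.≤ b → ∣ (seq x a ℚ.- seq y a) ℚ.- (seq x b ℚ.- seq y b) ∣ ℚ.< ½ ℚ.* ε) →
      N ℕ.≤ n → ε ℚ.≤ seq x n ℚ.- seq y n → 0ℚ ℚ.< ε → y < x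
    apart x y {N} {ε} n h l ε≤ 0<ε = ½ ℚ.* ε , half>0 0<ε , N , λ m lm → begin
      seq y m ℚ.+ ½ ℚ.* ε
        ≡⟨ solve 2 (λ y e → y :+ con ½ :* e := (y :+ e) :- con ½ :* e) refl (seq y m) ε ⟩
      (seq y m ℚ.+ ε) ℚ.- ½ ℚ.* ε
        ≤⟨ ℚₚ.+-mono-≤ (ℚₚ.+-monoʳ-≤ (seq y m) ε≤) (ℚₚ.neg-antimono-≤ (ℚₚ.<⇒≤ (ℚₚ.≤-<-trans (p≤∣p∣ _) (h n m l lm)))) ⟩
      (seq y m ℚ.+ (seq x n ℚ.- seq y n)) ℚ.- ((seq x n ℚ.- seq y n) ℚ.- (seq x m ℚ.- seq y m))
        ≡⟨ solve 3 (λ x y d → (y :+ d) :- (d :- (x :- y)) := x) refl (seq x m) (seq y m) (seq x n ℚ.- seq y n) ⟩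
      seq x m ∎
      where
      open ℚₚ.≤-Reasoning

-- The values of β and λ in terms of ϖ, and their bounds

module _ where
  open ℚ-Solver.+-*-Solver using (solve; con; _:=_; _:+_; _:*_; _:-_; :-_)
  open ℝSolver using () renaming (_:+_ to _:⊞_; _:*_ to _:⊠_; :-_ to :⊟_; _:=_ to _:≃_; con to κ; solve to solveᴿ)
  open _≃_
  open Null

  -- Finite sums and products of series of reals

  ∑-⊞ : ∀ f m n → ∑ f (m ℕ.+ n) ≃ ∑ f m ⊞ ∑ (λ k → f (m ℕ.+ k)) n
  ∑-⊞ f m zero    = R.trans (R.reflexive (cong (∑ f) (ℕₚ.+-identityʳ m))) (R.sym (R.+-identityʳ (∑ f m)))
  ∑-⊞ f m (suc n) = R.trans (R.reflexive (cong (∑ f) (ℕₚ.+-suc m n)))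
    (R.trans (R.+-congʳ {f (m ℕ.+ n)} (∑-⊞ f m n)) (⊞-assoc (∑ f m) _ _))

  abs-∑ : ∀ {f c} n → (∀ k → abs (f k) ≼ ι (c k)) → abs (∑ f n) ≼ ι (sum c n)
  abs-∑ zero    h = ≃⇒≼ (abs-ι 0ℚ)
  abs-∑ {f} {c} (suc n) h = ≼-trans (abs≼⊞ (abs-∑ n h) (h n)) (≃⇒≼ (R.sym (ι-+ (sum c n) (c n))))

  abs-convᴿ : ∀ {f g c d} n → (∀ k → abs (f k) ≼ ι (c k)) → (∀ k → abs (g k) ≼ ι (d k)) → abs (convᴿ f g n) ≼ ι (conv c d n)
  abs-convᴿ {c = c} {d} zero p q = ≼-trans (abs≼⊠ (p 0) (q 0)) (≃⇒≼ (R.sym (ι-* (c 0) (d 0))))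
  abs-convᴿ {c = c} {d} (suc n) p q =
    ≼-trans (abs≼⊞ (≼-trans (abs≼⊠ (p 0) (q (suc n))) (≃⇒≼ (R.sym (ι-* (c 0) (d (suc n)))))) (abs-convᴿ n (p ∘ suc) q))
      (≃⇒≼ (R.sym (ι-+ (c 0 ℚ.* d (suc n)) (conv (c ∘ suc) d n))))

  convᴿ-⊞ʳ : ∀ f g h n → convᴿ f (λ k → g k ⊞ h k) n ≃ convᴿ f g n ⊞ convᴿ f h n
  convᴿ-⊞ʳ f g h n = pointwise λ N → trans (seq-conv f (λ k → g k ⊞ h k) n N)
    (trans (conv-cong {λ k → seq (f k) N} (λ _ → refl) (λ k → seq-⊞ (g k) (h k) N) n)
    (trans (conv-+ʳ (λ k → seq (f k) N) (λ k → seq (g k) N) (λ k → seq (h k) N) n)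
    (sym (trans (seq-⊞ (convᴿ f g n) (convᴿ f h n) N) (cong₂ ℚ._+_ (seq-conv f g n N) (seq-conv f h n N))))))

  -- The common shape of all values below: a real prefactor, powers of one real number, and rational
  -- coefficients. By `convᴿ-scaled`, convolutions of such sequences reduce to convolutions of the
  -- coefficients.
  scaled : ℝ → ℝ → (ℕ → ℚ) → ℕ → ℝ
  scaled c w f k = c ⊠ (w ⊡ k ⊠ ι (f k))

  convᴿ-scaled : ∀ c d w f g n → convᴿ (scaled c w f) (scaled d w g) n ≃ scaled (c ⊠ d) w (conv f g) n
  convᴿ-scaled c d w f g n = pointwise λ N → begin
    seq (convᴿ (scaled c w f) (scaled d w g) n) N
      ≡⟨ seq-conv (scaled c w f) (scaled d w g) n N ⟩
    conv (λ k → seq (scaled c w f k) N) (λ k → seq (scaled d w g k) N) n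
      ≡⟨ conv-cong (λ k → seq-scaled c f k N) (λ k → seq-scaled d g k N) n ⟩
    conv (λ k → seq c N ℚ.* (pow (seq w N) k ℚ.* f k)) (λ k → seq d N ℚ.* (pow (seq w N) k ℚ.* g k)) n
      ≡⟨ trans (conv-scaleˡ (seq c N) _ _ n) (cong (seq c N ℚ.*_) (conv-scaleʳ (seq d N) (λ k → pow (seq w N) k ℚ.* f k) (λ k → pow (seq w N) k ℚ.* g k) n)) ⟩
    seq c N ℚ.* (seq d N ℚ.* conv (λ k → pow (seq w N) k ℚ.* f k) (λ k → pow (seq w N) k ℚ.* g k) n)
      ≡⟨ cong (λ z → seq c N ℚ.* (seq d N ℚ.* z)) (conv-pow (seq w N) f g n) ⟩
    seq c N ℚ.* (seq d N ℚ.* (pow (seq w N) n ℚ.* conv f g n))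
      ≡⟨ trans (sym (ℚₚ.*-assoc (seq c N) (seq d N) _)) (cong (ℚ._* (pow (seq w N) n ℚ.* conv f g n)) (sym (seq-⊠ c d N))) ⟩
    seq (c ⊠ d) N ℚ.* (pow (seq w N) n ℚ.* conv f g n)
      ≡⟨ seq-scaled (c ⊠ d) (conv f g) n N ⟨
    seq (scaled (c ⊠ d) w (conv f g) n) N ∎
    where
    open ≡-Reasoning
    seq-scaled : ∀ c f k N → seq (scaled c w f k) N ≡ seq c N ℚ.* (pow (seq w N) k ℚ.* f k)
    seq-scaled c f k N = trans (seq-⊠ c (w ⊡ k ⊠ ι (f k)) N) (cong (seq c N ℚ.*_)
      (trans (seq-⊠ (w ⊡ k) (ι (f k)) N) (cong₂ ℚ._*_ (seq-⊡ w k N) (seq-ι (f k) N))))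

  ι-cancel : ∀ c {x y} → c ≢ 0ℚ → ι c ⊠ x ≃ ι c ⊠ y → x ≃ y
  ι-cancel c {x} {y} c≢0 h = begin
    x                       ≈⟨ undo x ⟨
    ι (inv c) ⊠ (ι c ⊠ x)   ≈⟨ R.*-congˡ {ι (inv c)} h ⟩
    ι (inv c) ⊠ (ι c ⊠ y)   ≈⟨ undo y ⟩
    y                       ∎
    where
    open ℝ-Reasoning
    undo : ∀ z → ι (inv c) ⊠ (ι c ⊠ z) ≃ z
    undo z = R.trans (R.sym (⊠-assoc (ι (inv c)) (ι c) z))
      (R.trans (R.*-congʳ {z} (R.trans (R.sym (ι-* (inv c) c)) (R.reflexive (cong ι (inv-inverse c c≢0))))) (⊠-identityˡ z))

  -- β(2n+1) and λ(2n+2)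

  reciprocal-power : ∀ m s → _/_ (ℤ.+ 1) (suc m ℕ.^ s) {{ℕₚ.m^n≢0 (suc m) s}} ≡ pow (r m) s
  reciprocal-power m zero    = refl
  reciprocal-power m (suc s) = trans
    (sym (trans (frac-* 1 (suc m) 1 (suc m ℕ.^ s) {{_}} {{ℕₚ.m^n≢0 (suc m) s}})
      (ℚₚ./-cong {ℤ.+ 1} {suc m ℕ.* suc m ℕ.^ s} {ℤ.+ 1} {suc m ℕ.* suc m ℕ.^ s} {{ℕₚ.m*n≢0 (suc m) (suc m ℕ.^ s) {{_}} {{ℕₚ.m^n≢0 (suc m) s}}}} {{ℕₚ.m^n≢0 (suc m) (suc s)}} refl refl)))
    (cong (r m ℚ.*_) (reciprocal-power m s))

  opaque
    β-odd λ-even : ℕ → ℝ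
    β-odd n  = β (suc (2 ℕ.* n))
    λ-even n = lambda (2 ℕ.* suc n) {{2j≢0,1 (suc n) ℕ.z<s}}

  opaque
    unfolding β-odd

    seq-β-odd : ∀ n N → seq (β-odd n) N ≡ odd-alternating-sum n N
    seq-β-odd n N = sum-cong N λ p → trans (sign-frac p (suc (2 ℕ.* p) ℕ.^ suc (2 ℕ.* n)) {{ℕₚ.m^n≢0 (suc (2 ℕ.* p)) (suc (2 ℕ.* n))}})
      (trans (cong (sign p ℚ.*_) (trans (reciprocal-power (2 ℕ.* p) (suc (2 ℕ.* n))) (cong (ξ p ℚ.*_) (pow-double (ξ p) n))))
        (sym (ℚₚ.*-assoc (sign p) (ξ p) _)))

    seq-λ-even : ∀ n N → seq (λ-even n) N ≡ odd-sum n N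
    seq-λ-even n N = sum-cong N λ p → trans (reciprocal-power (2 ℕ.* p) (2 ℕ.* suc n)) (pow-double (ξ p) (suc n))

  null-pred : ∀ {a} → Null a → Null (λ N → a (N ℕ.∸ 1))
  null-pred h = mkNull λ ε 0<ε → let N , k = tends h ε 0<ε in
    suc N , λ n l → k (n ℕ.∸ 1) (ℕₚ.∸-monoˡ-≤ 1 l)

  convolution-limit : ∀ {x y} → (∀ M → ∣ seq x (suc M) ℚ.- seq y (suc M) ∣ ℚ.≤ conv r r M ℚ.+ conv r r M) → x ≃ y
  convolution-limit {x} {y} h = mk≃ (null-squeeze 1 bound (null-pred (null-+ harmonic→0 harmonic→0)))
    where
    harmonic→0 : Null (conv r r)
    harmonic→0 = mkNull conv-harmonic→0
    bound : ∀ n → 1 ℕ.≤ n → ∣ seq x n ℚ.- seq y n ∣ ℚ.≤ ∣ conv r r (n ℕ.∸ 1) ℚ.+ conv r r (n ℕ.∸ 1) ∣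
    bound (suc M) _ = ℚₚ.≤-trans (h M) (ℚₚ.≤-reflexive (sym (ℚₚ.0≤p⇒∣p∣≡p (ℚₚ.+-mono-≤ (conv≥0 M 0≤r 0≤r) (conv≥0 M 0≤r 0≤r)))))

  -- The N-th approximation of β and of λ is the partial sum of N terms, so the N-th approximation
  -- of the left side is exactly the truncated double sum, and its error estimate is the claim.
  ββ-convolution : ∀ n → convᴿ β-odd β-odd n ≃ ι (⟦ n ⟧ ℚ.+ ½) ⊠ λ-even n
  ββ-convolution n = convolution-limit λ M → subst₂ (λ a b → ∣ a ℚ.- b ∣ ℚ.≤ conv r r M ℚ.+ conv r r M)
    (sym (trans (seq-conv β-odd β-odd n (suc M)) (conv-cong (λ k → seq-β-odd k (suc M)) (λ k → seq-β-odd k (suc M)) n)))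
    (sym (trans (seq-⊠ (ι (⟦ n ⟧ ℚ.+ ½)) (λ-even n) (suc M)) (cong₂ ℚ._*_ (seq-ι (⟦ n ⟧ ℚ.+ ½) (suc M)) (seq-λ-even n (suc M)))))
    (conv-bb-error n M)

  βλ-convolution : ∀ n → convᴿ β-odd λ-even n ≃ ι ⟦ suc n ⟧ ⊠ β-odd (suc n)
  βλ-convolution n = convolution-limit λ M → subst₂ (λ a b → ∣ a ℚ.- b ∣ ℚ.≤ conv r r M ℚ.+ conv r r M)
    (sym (trans (seq-conv β-odd λ-even n (suc M)) (conv-cong (λ k → seq-β-odd k (suc M)) (λ k → seq-λ-even k (suc M)) n)))
    (sym (trans (seq-⊠ (ι ⟦ suc n ⟧) (β-odd (suc n)) (suc M)) (cong₂ ℚ._*_ (seq-ι ⟦ suc n ⟧ (suc M)) (seq-β-odd (suc n) (suc M)))))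
    (conv-ba-error n M)

  -- ϖ = 4β(1) will turn out to be π.

  ϖ : ℝ
  ϖ = ι ⟦ 4 ⟧ ⊠ β-odd 0

  -- The value of z = y² at y = ix/2, where hyperbolic series become trigonometric series at x/2.
  -[_/2]² : ℝ → ℝ
  -[ x /2]² = ⊟ (ι (ℤ.+ 1 / 4) ⊠ (x ⊠ x))

  module Values (B : ℕ → ℚ) (isBernoulli : IsBernoulli B) where
    open Bernoulli B isBernoulli using (τ; ρ; ρ₀; sech-step; tanh-step)

    private
      ¼ ⅛ : ℚ
      ¼ = ℤ.+ 1 / 4
      ⅛ = ℤ.+ 1 / 8
      w = -[ ϖ /2]²

    -- The coefficients of (ϖ/4) sec(ϖy/2) and of (ϖ/(4y)) tan(ϖy/2) in powers of y².
    βᶠ λᶠ : ℕ → ℝ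
    βᶠ = scaled (ι ¼ ⊠ ϖ) w ρ
    λᶠ = scaled (ι ⅛ ⊠ (ϖ ⊠ ϖ)) w τ

    private
      Valueβ Valueλ : ℕ → Set
      Valueβ k = β-odd k ≃ βᶠ k
      Valueλ k = λ-even k ≃ λᶠ k

      β-start : Valueβ zero
      β-start = R.trans (solveᴿ 1 (λ b → b :≃ (κ ¼ :⊠ (κ ⟦ 4 ⟧ :⊠ b)) :⊠ (κ 1ℚ :⊠ κ 1ℚ)) ≃-refl (β-odd 0))
        (R.reflexive (cong (λ z → (ι ¼ ⊠ ϖ) ⊠ (ι 1ℚ ⊠ ι z)) (sym ρ₀)))

      -- The recursions alternate: β-values up to index n determine the λ-value of index n by
      -- `ββ-convolution`, and both determine the β-value of index n + 1 by `βλ-convolution`. The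
      -- closed forms obey the same recursions by `tanh-step` and `sech-step`.
      λ-step : ∀ n → (∀ k → k ℕ.≤ n → β-odd k ≃ βᶠ k) → λ-even n ≃ λᶠ n
      λ-step n ih = ι-cancel (⟦ n ⟧ ℚ.+ ½) (pos≢0 (ℚₚ.<-≤-trans 0<½ (subst (ℚ._≤ ⟦ n ⟧ ℚ.+ ½) (ℚₚ.+-identityˡ ½) (ℚₚ.+-monoˡ-≤ ½ (0≤⟦⟧ n))))) (begin
        ι (⟦ n ⟧ ℚ.+ ½) ⊠ λ-even n
          ≈⟨ ββ-convolution n ⟨
        convᴿ β-odd β-odd n
          ≈⟨ convᴿ-cong≤ n ih ih ⟩
        convᴿ βᶠ βᶠ n
          ≈⟨ convᴿ-scaled (ι ¼ ⊠ ϖ) (ι ¼ ⊠ ϖ) w ρ ρ n ⟩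
        scaled ((ι ¼ ⊠ ϖ) ⊠ (ι ¼ ⊠ ϖ)) w (conv ρ ρ) n
          ≈⟨ R.*-congˡ {(ι ¼ ⊠ ϖ) ⊠ (ι ¼ ⊠ ϖ)} (R.*-congˡ {w ⊡ n} (R.trans (R.reflexive (cong ι
               (trans (sym (tanh-step n)) (solve 2 (λ m t → (con 1ℚ :+ (m :+ m)) :* t := con ⟦ 2 ⟧ :* ((m :+ con ½) :* t)) refl ⟦ n ⟧ (τ n)))))
               (R.trans (ι-* ⟦ 2 ⟧ ((⟦ n ⟧ ℚ.+ ½) ℚ.* τ n)) (R.*-congˡ {ι ⟦ 2 ⟧} (ι-* (⟦ n ⟧ ℚ.+ ½) (τ n)))))) ⟩
        ((ι ¼ ⊠ ϖ) ⊠ (ι ¼ ⊠ ϖ)) ⊠ (w ⊡ n ⊠ (ι ⟦ 2 ⟧ ⊠ (ι (⟦ n ⟧ ℚ.+ ½) ⊠ ι (τ n))))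
          ≈⟨ solveᴿ 4 (λ q w m t → ((κ ¼ :⊠ q) :⊠ (κ ¼ :⊠ q)) :⊠ (w :⊠ (κ ⟦ 2 ⟧ :⊠ (m :⊠ t))) :≃ m :⊠ ((κ ⅛ :⊠ (q :⊠ q)) :⊠ (w :⊠ t)))
               ≃-refl ϖ (w ⊡ n) (ι (⟦ n ⟧ ℚ.+ ½)) (ι (τ n)) ⟩
        ι (⟦ n ⟧ ℚ.+ ½) ⊠ λᶠ n ∎)
        where open ℝ-Reasoning

      β-step : ∀ n → (∀ k → k ℕ.≤ n → β-odd k ≃ βᶠ k) → (∀ k → k ℕ.≤ n → λ-even k ≃ λᶠ k) → β-odd (suc n) ≃ βᶠ (suc n)
      β-step n ihβ ihλ = ι-cancel ⟦ suc n ⟧ (⟦suc⟧≢0 n) (begin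
        ι ⟦ suc n ⟧ ⊠ β-odd (suc n)
          ≈⟨ βλ-convolution n ⟨
        convᴿ β-odd λ-even n
          ≈⟨ convᴿ-cong≤ n ihβ ihλ ⟩
        convᴿ βᶠ λᶠ n
          ≈⟨ convᴿ-scaled (ι ¼ ⊠ ϖ) (ι ⅛ ⊠ (ϖ ⊠ ϖ)) w ρ τ n ⟩
        scaled ((ι ¼ ⊠ ϖ) ⊠ (ι ⅛ ⊠ (ϖ ⊠ ϖ))) w (conv ρ τ) n
          ≈⟨ R.*-congˡ {(ι ¼ ⊠ ϖ) ⊠ (ι ⅛ ⊠ (ϖ ⊠ ϖ))} (R.*-congˡ {w ⊡ n} (R.trans (R.reflexive (cong ι
               (trans (solve 1 (λ c → c := con (ℚ.- ⟦ 2 ⟧) :* (con (ℚ.- ½) :* c)) refl (conv ρ τ n)) (cong (ℚ.- ⟦ 2 ⟧ ℚ.*_) (sym (sech-step n))))))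
               (R.trans (ι-* (ℚ.- ⟦ 2 ⟧) (⟦ suc n ⟧ ℚ.* ρ (suc n))) (R.*-congˡ {ι (ℚ.- ⟦ 2 ⟧)} (ι-* ⟦ suc n ⟧ (ρ (suc n))))))) ⟩
        ((ι ¼ ⊠ ϖ) ⊠ (ι ⅛ ⊠ (ϖ ⊠ ϖ))) ⊠ (w ⊡ n ⊠ (ι (ℚ.- ⟦ 2 ⟧) ⊠ (ι ⟦ suc n ⟧ ⊠ ι (ρ (suc n)))))
          ≈⟨ solveᴿ 4 (λ q v m t → ((κ ¼ :⊠ q) :⊠ (κ ⅛ :⊠ (q :⊠ q))) :⊠ (v :⊠ (κ (ℚ.- ⟦ 2 ⟧) :⊠ (m :⊠ t)))
               :≃ m :⊠ ((κ ¼ :⊠ q) :⊠ ((:⊟ (κ ¼ :⊠ (q :⊠ q)) :⊠ v) :⊠ t)))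
               ≃-refl ϖ (w ⊡ n) (ι ⟦ suc n ⟧) (ι (ρ (suc n))) ⟩
        ι ⟦ suc n ⟧ ⊠ βᶠ (suc n) ∎)
        where open ℝ-Reasoning

      extend : ∀ (P : ℕ → Set) n → (∀ k → k ℕ.≤ n → P k) → P (suc n) → ∀ k → k ℕ.≤ suc n → P k
      extend P n p q k k≤ with ℕₚ.m≤n⇒m<n∨m≡n k≤
      ... | inj₁ k<   = p k (ℕₚ.≤-pred k<)
      ... | inj₂ refl = q

      values-β : ∀ n k → k ℕ.≤ n → Valueβ k
      values-λ : ∀ n k → k ℕ.≤ n → Valueλ k
      values-β zero    zero ℕ.z≤n = β-start
      values-β (suc n) = extend Valueβ n (values-β n) (β-step n (values-β n) (values-λ n))
      values-λ zero    zero ℕ.z≤n = λ-step zero (values-β zero)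
      values-λ (suc n) = extend Valueλ n (values-λ n) (λ-step (suc n) (values-β (suc n)))

    β-value : ∀ n → β-odd n ≃ βᶠ n
    β-value n = values-β n n ℕₚ.≤-refl

    λ-value : ∀ n → λ-even n ≃ λᶠ n
    λ-value n = values-λ n n ℕₚ.≤-refl

  -- Equal to 1/((k+1)(k+2)), the majorant for the estimates of series below: it telescopes, and its
  -- sums from n on are at most `r` n.
  ĉ : ℕ → ℚ
  ĉ k = r k ℚ.- r (suc k)

  r-difference : ∀ k → ĉ k ≡ r k ℚ.* r (suc k)
  r-difference k = begin
    r k ℚ.- r (suc k)
      ≡⟨ solve 2 (λ a b → a :- b := a :* con 1ℚ :- con 1ℚ :* b) refl (r k) (r (suc k)) ⟩
    r k ℚ.* 1ℚ ℚ.- 1ℚ ℚ.* r (suc k)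
      ≡⟨ cong₂ (λ u v → r k ℚ.* u ℚ.- v ℚ.* r (suc k)) (sym (r-inverse (suc k))) (sym (r-inverse k)) ⟩
    r k ℚ.* (r (suc k) ℚ.* ⟦ suc (suc k) ⟧) ℚ.- r k ℚ.* ⟦ suc k ⟧ ℚ.* r (suc k)
      ≡⟨ cong (λ z → r k ℚ.* (r (suc k) ℚ.* z) ℚ.- r k ℚ.* ⟦ suc k ⟧ ℚ.* r (suc k)) (⟦suc⟧ (suc k)) ⟩
    r k ℚ.* (r (suc k) ℚ.* (1ℚ ℚ.+ ⟦ suc k ⟧)) ℚ.- r k ℚ.* ⟦ suc k ⟧ ℚ.* r (suc k)
      ≡⟨ solve 3 (λ a b m → a :* (b :* (con 1ℚ :+ m)) :- a :* m :* b := a :* b) refl (r k) (r (suc k)) ⟦ suc k ⟧ ⟩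
    r k ℚ.* r (suc k) ∎
    where open ≡-Reasoning

  sum-telescope : ∀ n d → sum (λ k → ĉ (n ℕ.+ k)) d ≡ r n ℚ.- r (n ℕ.+ d)
  sum-telescope n zero    = sym (trans (cong (λ z → r n ℚ.- r z) (ℕₚ.+-identityʳ n)) (ℚₚ.+-inverseʳ (r n)))
  sum-telescope n (suc d) = trans (cong (ℚ._+ ĉ (n ℕ.+ d)) (sum-telescope n d))
    (trans (solve 3 (λ a b c → (a :- b) :+ (b :- c) := a :- c) refl (r n) (r (n ℕ.+ d)) (r (suc (n ℕ.+ d))))
      (cong (λ z → r n ℚ.- r z) (sym (ℕₚ.+-suc n d))))

  p-q≤p : ∀ p q → 0ℚ ℚ.≤ q → p ℚ.- q ℚ.≤ p
  p-q≤p p q 0≤q = subst (p ℚ.- q ℚ.≤_) (ℚₚ.+-identityʳ p) (ℚₚ.+-monoʳ-≤ p (ℚₚ.neg-antimono-≤ 0≤q))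

  sum-telescope-≤ : ∀ n d → sum (λ k → ĉ (n ℕ.+ k)) d ℚ.≤ r n
  sum-telescope-≤ n d = subst (ℚ._≤ r n) (sym (sum-telescope n d)) (p-q≤p (r n) (r (n ℕ.+ d)) (0≤r (n ℕ.+ d)))

  odd-sum-1 : ∀ n M → odd-sum n (suc M) ℚ.- 1ℚ ≡ sum (λ p → ξ (suc p) ℚ.* ξ (suc p) ℚ.* pow (ξ (suc p) ℚ.* ξ (suc p)) n) M
  odd-sum-1 n M = trans (cong (ℚ._- 1ℚ) (sum-head (λ p → ξ p ℚ.* ξ p ℚ.* pow (ξ p ℚ.* ξ p) n) M))
    (trans (cong (λ z → z ℚ.+ s ℚ.- 1ℚ) (cong (1ℚ ℚ.* 1ℚ ℚ.*_) (pow-one n))) (solve 1 (λ s → con 1ℚ :+ s :- con 1ℚ := s) refl s))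
    where
    s : ℚ
    s = sum (λ p → ξ (suc p) ℚ.* ξ (suc p) ℚ.* pow (ξ (suc p) ℚ.* ξ (suc p)) n) M

  1+2* : ℕ → ℚ
  1+2* n = 1ℚ ℚ.+ (⟦ n ⟧ ℚ.+ ⟦ n ⟧)

  0≤1+2* : ∀ n → 0ℚ ℚ.≤ 1+2* n
  0≤1+2* n = ℚₚ.+-mono-≤ (ℚₚ.<⇒≤ 0<1ℚ) (ℚₚ.+-mono-≤ (0≤⟦⟧ n) (0≤⟦⟧ n))

  private
    -- 1/9 bounds the squares of 1/3, 1/5, ... that remain in λ - 1. From n to n + 1 the first
    -- factor grows at most threefold while the power shrinks at least ninefold.
    ninth : ∀ {v} n → 0ℚ ℚ.≤ v → v ℚ.≤ ℤ.+ 1 / 9 → 1+2* n ℚ.* pow v n ℚ.≤ 1ℚ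
    ninth zero    0≤v v≤ = ℚₚ.≤-refl
    ninth {v} (suc n) 0≤v v≤ = begin
      1+2* (suc n) ℚ.* (v ℚ.* pow v n)
        ≤⟨ *-monoˡ-≤ (0≤1+2* (suc n)) (*-mono-≤ (frac-≥0 1 9) (0≤pow 0≤v n) v≤ ℚₚ.≤-refl) ⟩
      1+2* (suc n) ℚ.* ((ℤ.+ 1 / 9) ℚ.* pow v n)
        ≡⟨ cong (λ z → (1ℚ ℚ.+ (z ℚ.+ z)) ℚ.* ((ℤ.+ 1 / 9) ℚ.* pow v n)) (⟦suc⟧ n) ⟩
      (1ℚ ℚ.+ ((1ℚ ℚ.+ ⟦ n ⟧) ℚ.+ (1ℚ ℚ.+ ⟦ n ⟧))) ℚ.* ((ℤ.+ 1 / 9) ℚ.* pow v n)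
        ≡⟨ solve 2 (λ m p → (con 1ℚ :+ ((con 1ℚ :+ m) :+ (con 1ℚ :+ m))) :* (con (ℤ.+ 1 / 9) :* p)
             := (con 1ℚ :+ (m :+ m)) :* p :- (con (ℤ.+ 2 / 3) :+ con (ℤ.+ 16 / 9) :* m) :* p) refl ⟦ n ⟧ (pow v n) ⟩
      1+2* n ℚ.* pow v n ℚ.- ((ℤ.+ 2 / 3) ℚ.+ (ℤ.+ 16 / 9) ℚ.* ⟦ n ⟧) ℚ.* pow v n
        ≤⟨ p-q≤p (1+2* n ℚ.* pow v n) _ (0≤* (ℚₚ.+-mono-≤ (frac-≥0 2 3) (0≤* (frac-≥0 16 9) (0≤⟦⟧ n))) (0≤pow 0≤v n)) ⟩
      1+2* n ℚ.* pow v n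
        ≤⟨ ninth n 0≤v v≤ ⟩
      1ℚ ∎
      where open ℚₚ.≤-Reasoning

    υ : ℕ → ℚ
    υ p = ξ (suc p) ℚ.* ξ (suc p)

    0≤υ : ∀ p → 0ℚ ℚ.≤ υ p
    0≤υ p = 0≤* (0≤r (2 ℕ.* suc p)) (0≤r (2 ℕ.* suc p))

    υ≤1/9 : ∀ p → υ p ℚ.≤ ℤ.+ 1 / 9
    υ≤1/9 p = ℚₚ.≤-trans (*-mono-≤ (0≤r 2) (0≤r (2 ℕ.* suc p)) third third) (ℚₚ.≤-reflexive refl)
      where
      third : r (2 ℕ.* suc p) ℚ.≤ r 2
      third = r-antitone (ℕₚ.*-monoʳ-≤ 2 (ℕ.s≤s {0} {p} ℕ.z≤n))

    υ≤ĉ : ∀ p → υ p ℚ.≤ ĉ p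
    υ≤ĉ p = ℚₚ.≤-trans
      (*-mono-≤ (0≤r p) (0≤r (2 ℕ.* suc p)) (r-antitone (ℕₚ.≤-trans (ℕₚ.n≤1+n p) (ℕₚ.m≤m+n (suc p) _))) (r-antitone (ℕₚ.m≤m+n (suc p) _)))
      (ℚₚ.≤-reflexive (sym (r-difference p)))

    excess : ∀ n M → 1+2* n ℚ.* (odd-sum n (suc M) ℚ.- 1ℚ) ℚ.≤ 1ℚ
    excess n M = begin
      1+2* n ℚ.* (odd-sum n (suc M) ℚ.- 1ℚ)
        ≡⟨ trans (cong (1+2* n ℚ.*_) (odd-sum-1 n M)) (sym (sum-scale (1+2* n) (λ p → υ p ℚ.* pow (υ p) n) M)) ⟩
      sum (λ p → 1+2* n ℚ.* (υ p ℚ.* pow (υ p) n)) M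
        ≤⟨ sum-mono M (λ p → ℚₚ.≤-trans (ℚₚ.≤-reflexive (solve 3 (λ m u v → m :* (u :* v) := u :* (m :* v)) refl (1+2* n) (υ p) (pow (υ p) n)))
             (ℚₚ.≤-trans (*-mono-≤ (ℚₚ.≤-trans (0≤υ p) (υ≤ĉ p)) (0≤* (0≤1+2* n) (0≤pow (0≤υ p) n)) (υ≤ĉ p) (ninth n (0≤υ p) (υ≤1/9 p))) (ℚₚ.≤-reflexive (ℚₚ.*-identityʳ (ĉ p))))) ⟩
      sum ĉ M
        ≤⟨ sum-telescope-≤ 0 M ⟩
      1ℚ ∎
      where open ℚₚ.≤-Reasoning

    0≤excess : ∀ n M → 0ℚ ℚ.≤ odd-sum n (suc M) ℚ.- 1ℚ
    0≤excess n M = subst (0ℚ ℚ.≤_) (sym (odd-sum-1 n M)) (sum≥0 M (λ p → 0≤* (0≤υ p) (0≤pow (0≤υ p) n)))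

    seq-excess : ∀ n N → seq (λ-even n ⊞ ⊟ ι 1ℚ) N ≡ odd-sum n N ℚ.- 1ℚ
    seq-excess n N = trans (seq-⊞ (λ-even n) (⊟ ι 1ℚ) N) (cong₂ ℚ._+_ (seq-λ-even n N) (trans (seq-⊟ (ι 1ℚ) N) (cong ℚ.-_ (seq-ι 1ℚ N))))

  -- The amount by which the coefficient (2n+1) λ(2n+2) of tan′ exceeds 2n + 1. It is bounded
  -- uniformly in n, so in the convolution with the sine series it can only contribute a bounded
  -- error.
  λ-excess : ℕ → ℝ
  λ-excess n = ι (1+2* n) ⊠ (λ-even n ⊞ ⊟ ι 1ℚ)

  0≼λ-1 : ∀ n → ι 0ℚ ≼ λ-even n ⊞ ⊟ ι 1ℚ
  0≼λ-1 n = ≼-from 1 λ { (suc M) _ → subst₂ ℚ._≤_ (sym (seq-ι 0ℚ (suc M))) (sym (seq-excess n (suc M))) (0≤excess n M) }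

  λ-excess≼1 : ∀ n → λ-excess n ≼ ι 1ℚ
  λ-excess≼1 n = ≼-from 1 λ { (suc M) _ → subst₂ ℚ._≤_
    (sym (trans (seq-⊠ (ι (1+2* n)) (λ-even n ⊞ ⊟ ι 1ℚ) (suc M)) (cong₂ ℚ._*_ (seq-ι (1+2* n) (suc M)) (seq-excess n (suc M)))))
    (sym (seq-ι 1ℚ (suc M))) (excess n M) }

  abs-λ-excess : ∀ n → abs (λ-excess n) ≼ ι 1ℚ
  abs-λ-excess n = nonNeg⇒abs≼ (0≼⊠ (ι-mono (0≤1+2* n)) (0≼λ-1 n)) (λ-excess≼1 n)

  1≼λ : ∀ n → ι 1ℚ ≼ λ-even n
  1≼λ n = ≼-resp (solveᴿ 1 (λ l → κ 1ℚ :⊞ κ 0ℚ :≃ κ 1ℚ) ≃-refl (λ-even n)) (solveᴿ 1 (λ l → κ 1ℚ :⊞ (l :⊞ :⊟ κ 1ℚ) :≃ l) ≃-refl (λ-even n))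
    (⊞-mono (≼-refl {ι 1ℚ}) (0≼λ-1 n))

  0≼λ : ∀ n → ι 0ℚ ≼ λ-even n
  0≼λ n = ≼-trans (ι-mono (ℚₚ.<⇒≤ 0<1ℚ)) (1≼λ n)

  λ≼2 : ∀ n → λ-even n ≼ ι ⟦ 2 ⟧
  λ≼2 n = ≼-resp (solveᴿ 1 (λ l → κ 1ℚ :⊞ (l :⊞ :⊟ κ 1ℚ) :≃ l) ≃-refl (λ-even n)) (solveᴿ 1 (λ l → κ 1ℚ :⊞ κ 1ℚ :≃ κ ⟦ 2 ⟧) ≃-refl (λ-even n))
    (⊞-mono (≼-refl {ι 1ℚ}) (≼-trans (≼-resp (⊠-identityˡ d) ≃-refl (⊠-mono (ι-mono (0≤1+2* n)) (0≼λ-1 n) (ι-mono 1≤1+2*) (≼-refl {d}))) (λ-excess≼1 n)))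
    where
    d : ℝ
    d = λ-even n ⊞ ⊟ ι 1ℚ
    1≤1+2* : 1ℚ ℚ.≤ 1+2* n
    1≤1+2* = ℚₚ.+-monoʳ-≤ 1ℚ (ℚₚ.+-mono-≤ (0≤⟦⟧ n) (0≤⟦⟧ n))

  private
    seq-ϖ : ∀ N → seq ϖ N ≡ ⟦ 4 ⟧ ℚ.* sum (λ p → sign p ℚ.* ξ p) N
    seq-ϖ N = trans (seq-⊠ (ι ⟦ 4 ⟧) (β-odd 0) N) (cong₂ ℚ._*_ (seq-ι ⟦ 4 ⟧ N) (trans (seq-β-odd 0 N) (sum-cong N λ p → ℚₚ.*-identityʳ (sign p ℚ.* ξ p))))

    ξ-dec : ∀ k → ξ (suc k) ℚ.≤ ξ k
    ξ-dec k = r-antitone (ℕₚ.*-monoʳ-≤ 2 (ℕₚ.n≤1+n k))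

  -- Gives |-(ϖ/2)²| ≤ 4, the range in which the majorant of the sine coefficients is established.
  ϖ≼4 : ϖ ≼ ι ⟦ 4 ⟧
  ϖ≼4 = ≼-pointwise λ N → subst₂ ℚ._≤_ (sym (seq-ϖ N)) (sym (seq-ι ⟦ 4 ⟧ N))
    (ℚₚ.≤-trans (*-monoˡ-≤ (0≤⟦⟧ 4) (alternating-≤ (λ k → 0≤r (2 ℕ.* k)) ξ-dec 0 N)) (ℚₚ.≤-reflexive (ℚₚ.*-identityʳ ⟦ 4 ⟧)))

  0<ϖ : 0ℝ < ϖ
  0<ϖ = 1ℚ , 0<1ℚ , 1 , λ { (suc M) _ → subst (0ℚ ℚ.+ 1ℚ ℚ.≤_) (sym (seq-ϖ (suc M))) (bound M) }
    where
    open ℚₚ.≤-Reasoning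
    bound : ∀ M → 0ℚ ℚ.+ 1ℚ ℚ.≤ ⟦ 4 ⟧ ℚ.* sum (λ p → sign p ℚ.* ξ p) (suc M)
    bound M = begin
      -- The first two terms give 4(1 - 1/3) = 8/3, and 1 is a convenient smaller bound.
      0ℚ ℚ.+ 1ℚ                                            ≤⟨ frac-≤ 1 1 8 3 (ℕₚ.≤ᵇ⇒≤ 3 8 tt) ⟩
      ⟦ 4 ⟧ ℚ.* (1ℚ ℚ.- ξ 1)                               ≤⟨ *-monoˡ-≤ (0≤⟦⟧ 4) (ℚₚ.+-monoʳ-≤ 1ℚ (ℚₚ.neg-antimono-≤ (alternating-≤ (λ k → 0≤r (2 ℕ.* k)) ξ-dec 1 M))) ⟩
      ⟦ 4 ⟧ ℚ.* (1ℚ ℚ.- sum (λ p → sign p ℚ.* ξ (suc p)) M)  ≡⟨ cong (λ z → ⟦ 4 ⟧ ℚ.* (1ℚ ℚ.+ z)) (trans (sym (sum-neg (λ p → sign p ℚ.* ξ (suc p)) M)) (sum-cong M λ p → ℚₚ.neg-distribˡ-* (sign p) (ξ (suc p)))) ⟩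
      ⟦ 4 ⟧ ℚ.* (1ℚ ℚ.+ sum (λ p → sign (suc p) ℚ.* ξ (suc p)) M)  ≡⟨ cong (⟦ 4 ⟧ ℚ.*_) (sum-head (λ p → sign p ℚ.* ξ p) M) ⟨
      ⟦ 4 ⟧ ℚ.* sum (λ p → sign p ℚ.* ξ p) (suc M)         ∎

  0≼ϖ : ι 0ℚ ≼ ϖ
  0≼ϖ = ≼-from 1 λ { n@(suc _) l → subst (ℚ._≤ seq ϖ n) (sym (seq-ι 0ℚ n))
    (ℚₚ.≤-trans (p≤p+q 0ℚ 1ℚ 0<1ℚ) (proj₂ (proj₂ (proj₂ 0<ϖ)) n l)) }

-- The sine series and its majorant

module _ where
  open ℚ-Solver.+-*-Solver using (solve; con; _:=_; _:+_; _:*_; _:-_; :-_)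
  open ℝSolver using () renaming (_:+_ to _:⊞_; _:*_ to _:⊠_; :-_ to :⊟_; _:=_ to _:≃_; con to κ; solve to solveᴿ)
  open _≃_
  open Null

  -- The sine series: σ t k is the coefficient 4^k t^k/(2k+1)!, and sin x = x ∑ₖ σ(-(x/2)²) k.

  σ : ℝ → ℕ → ℝ
  σ t k = t ⊡ k ⊠ ι (dilate sinhᶻ k)

  private
    -- Amounts to (k+1) 16^k/(2k+1)! ≤ 100 `ĉ` k. The induction step needs 16(k+2)(k+3) ≤
    -- (k+1)²(2k+3)(2k+2), which starts to hold at k = 2; hence three base cases, the last of which
    -- fixes the size of 100.
    growth : ∀ k → 16 ℕ.^ k ℕ.* (suc k ℕ.* suc k ℕ.* suc (suc k)) ℕ.≤ 100 ℕ.* suc (2 ℕ.* k) !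
    growth 0 = ℕₚ.≤ᵇ⇒≤ 2 100 tt
    growth 1 = ℕₚ.≤ᵇ⇒≤ 192 600 tt
    growth 2 = ℕₚ.≤ᵇ⇒≤ 9216 12000 tt
    growth (suc k@(suc (suc j))) = begin
      16 ℕ.^ suc k ℕ.* (suc (suc k) ℕ.* suc (suc k) ℕ.* suc (suc (suc k)))
        ≡⟨ ℕ-Solver.solve 2 (λ e k → (c 16 :× e) :× ((c 1 :⊕ k) :× (c 1 :⊕ k) :× (c 2 :⊕ k)) ℕ-Solver.:= e :× (c 1 :⊕ k) :× (c 16 :× ((c 1 :⊕ k) :× (c 2 :⊕ k)))) refl (16 ℕ.^ k) (suc k) ⟩
      16 ℕ.^ k ℕ.* suc (suc k) ℕ.* (16 ℕ.* (suc (suc k) ℕ.* suc (suc (suc k))))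
        ≤⟨ ℕₚ.*-monoʳ-≤ (16 ℕ.^ k ℕ.* suc (suc k)) quartic ⟩
      16 ℕ.^ k ℕ.* suc (suc k) ℕ.* (suc k ℕ.* suc k ℕ.* (suc (suc (suc (2 ℕ.* k))) ℕ.* suc (suc (2 ℕ.* k))))
        ≡⟨ ℕ-Solver.solve 4 (λ e b a f → e :× b :× (a :× a :× f) ℕ-Solver.:= e :× (a :× a :× b) :× f) refl (16 ℕ.^ k) (suc (suc k)) (suc k) (suc (suc (suc (2 ℕ.* k))) ℕ.* suc (suc (2 ℕ.* k))) ⟩
      16 ℕ.^ k ℕ.* (suc k ℕ.* suc k ℕ.* suc (suc k)) ℕ.* (suc (suc (suc (2 ℕ.* k))) ℕ.* suc (suc (2 ℕ.* k)))
        ≤⟨ ℕₚ.*-monoˡ-≤ (suc (suc (suc (2 ℕ.* k))) ℕ.* suc (suc (2 ℕ.* k))) (growth k) ⟩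
      100 ℕ.* suc (2 ℕ.* k) ! ℕ.* (suc (suc (suc (2 ℕ.* k))) ℕ.* suc (suc (2 ℕ.* k)))
        ≡⟨ ℕ-Solver.solve 3 (λ f a b → c 100 :× f :× (a :× b) ℕ-Solver.:= c 100 :× (a :× (b :× f))) refl (suc (2 ℕ.* k) !) (suc (suc (suc (2 ℕ.* k)))) (suc (suc (2 ℕ.* k))) ⟩
      100 ℕ.* suc (suc (suc (2 ℕ.* k))) !
        ≡⟨ cong (λ m → 100 ℕ.* suc m !) (2*suc k) ⟨
      100 ℕ.* suc (2 ℕ.* suc k) ! ∎
      where
      open ℕₚ.≤-Reasoning
      open ℕ-Solver using () renaming (_:+_ to _:⊕_; _:*_ to _:×_; con to c)
      quartic : 16 ℕ.* (suc (suc k) ℕ.* suc (suc (suc k))) ℕ.≤ suc k ℕ.* suc k ℕ.* (suc (suc (suc (2 ℕ.* k))) ℕ.* suc (suc (2 ℕ.* k)))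
      quartic = subst (16 ℕ.* (suc (suc k) ℕ.* suc (suc (suc k))) ℕ.≤_)
        -- The difference of the two sides is a polynomial in j = k - 2 with positive coefficients.
        (ℕ-Solver.solve 1 (λ j → c 16 :× ((c 4 :⊕ j) :× (c 5 :⊕ j)) :⊕ (c 58 :⊕ j :× (c 342 :⊕ j :× (c 218 :⊕ j :× (c 50 :⊕ c 4 :× j))))
          ℕ-Solver.:= (c 3 :⊕ j) :× (c 3 :⊕ j) :× ((c 3 :⊕ c 2 :× (c 2 :⊕ j)) :× (c 2 :⊕ c 2 :× (c 2 :⊕ j)))) refl j)
        (ℕₚ.m≤m+n _ _)

  !-inverse : ∀ n → ⟦ n ! ⟧ ℚ.* 1/ n ! ≡ 1ℚ
  !-inverse n = trans (frac-* (n !) 1 1 (n !) {{_}} {{ℕₚ._!≢0 n}})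
    (frac-≡ (n ! ℕ.* 1) (1 ℕ.* n !) 1 1 {{ℕₚ.m*n≢0 1 (n !) {{_}} {{ℕₚ._!≢0 n}}}}
      (ℕ-Solver.solve 1 (λ f → f :× c1 :× c1 ℕ-Solver.:= c1 :× (c1 :× f)) refl (n !)))
    where
    open ℕ-Solver using () renaming (_:*_ to _:×_)
    c1 = ℕ-Solver.con 1

  private
    -- 16^k/(2k+1)!
    e : ℕ → ℚ
    e k = pow ⟦ 4 ⟧ k ℚ.* dilate sinhᶻ k

    0≤1/! : ∀ n → 0ℚ ℚ.≤ 1/ n !
    0≤1/! n = frac-≥0 1 (n !) {{ℕₚ._!≢0 n}}

    0≤dilate : ∀ k → 0ℚ ℚ.≤ dilate sinhᶻ k
    0≤dilate k = 0≤* (0≤pow (0≤⟦⟧ 4) k) (0≤1/! (suc (2 ℕ.* k)))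

    e≤ : ∀ k → ⟦ suc k ⟧ ℚ.* e k ℚ.≤ ⟦ 100 ⟧ ℚ.* ĉ k
    e≤ k = begin
      ⟦ suc k ⟧ ℚ.* (pow ⟦ 4 ⟧ k ℚ.* (pow ⟦ 4 ⟧ k ℚ.* s))
        ≡⟨ cong (⟦ suc k ⟧ ℚ.*_) (trans (sym (ℚₚ.*-assoc (pow ⟦ 4 ⟧ k) (pow ⟦ 4 ⟧ k) s)) (cong (ℚ._* s) (trans (sym (pow-* ⟦ 4 ⟧ ⟦ 4 ⟧ k)) (sym (pow-⟦⟧ 16 k))))) ⟩
      ⟦ suc k ⟧ ℚ.* (⟦ 16 ℕ.^ k ⟧ ℚ.* s)
        ≡⟨ solve 3 (λ m p s → m :* (p :* s) := p :* m :* con 1ℚ :* con 1ℚ :* s) refl ⟦ suc k ⟧ ⟦ 16 ℕ.^ k ⟧ s ⟩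
      ⟦ 16 ℕ.^ k ⟧ ℚ.* ⟦ suc k ⟧ ℚ.* 1ℚ ℚ.* 1ℚ ℚ.* s
        ≡⟨ cong₂ (λ a b → ⟦ 16 ℕ.^ k ⟧ ℚ.* ⟦ suc k ⟧ ℚ.* a ℚ.* b ℚ.* s) (sym (r-inverse k)) (sym (r-inverse (suc k))) ⟩
      ⟦ 16 ℕ.^ k ⟧ ℚ.* ⟦ suc k ⟧ ℚ.* (r k ℚ.* ⟦ suc k ⟧) ℚ.* (r (suc k) ℚ.* ⟦ suc (suc k) ⟧) ℚ.* s
        ≡⟨ solve 6 (λ p m n a b s → p :* m :* (a :* m) :* (b :* n) :* s := p :* (m :* m :* n) :* (s :* (a :* b))) refl ⟦ 16 ℕ.^ k ⟧ ⟦ suc k ⟧ ⟦ suc (suc k) ⟧ (r k) (r (suc k)) s ⟩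
      ⟦ 16 ℕ.^ k ⟧ ℚ.* (⟦ suc k ⟧ ℚ.* ⟦ suc k ⟧ ℚ.* ⟦ suc (suc k) ⟧) ℚ.* (s ℚ.* (r k ℚ.* r (suc k)))
        ≡⟨ cong (ℚ._* (s ℚ.* (r k ℚ.* r (suc k)))) (sym (trans (⟦*⟧ (16 ℕ.^ k) (suc k ℕ.* suc k ℕ.* suc (suc k))) (cong (⟦ 16 ℕ.^ k ⟧ ℚ.*_)
             (trans (⟦*⟧ (suc k ℕ.* suc k) (suc (suc k))) (cong (ℚ._* ⟦ suc (suc k) ⟧) (⟦*⟧ (suc k) (suc k))))))) ⟩
      ⟦ 16 ℕ.^ k ℕ.* (suc k ℕ.* suc k ℕ.* suc (suc k)) ⟧ ℚ.* (s ℚ.* (r k ℚ.* r (suc k)))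
        ≤⟨ *-mono-≤ (0≤⟦⟧ (100 ℕ.* suc (2 ℕ.* k) !)) (0≤* (0≤1/! (suc (2 ℕ.* k))) (0≤* (0≤r k) (0≤r (suc k)))) (⟦⟧-mono-≤ _ (100 ℕ.* suc (2 ℕ.* k) !) (growth k)) ℚₚ.≤-refl ⟩
      ⟦ 100 ℕ.* suc (2 ℕ.* k) ! ⟧ ℚ.* (s ℚ.* (r k ℚ.* r (suc k)))
        ≡⟨ trans (cong (ℚ._* (s ℚ.* (r k ℚ.* r (suc k)))) (⟦*⟧ 100 (suc (2 ℕ.* k) !))) (solve 4 (λ h f s x → h :* f :* (s :* x) := h :* ((f :* s) :* x)) refl ⟦ 100 ⟧ ⟦ suc (2 ℕ.* k) ! ⟧ s (r k ℚ.* r (suc k))) ⟩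
      ⟦ 100 ⟧ ℚ.* ((⟦ suc (2 ℕ.* k) ! ⟧ ℚ.* s) ℚ.* (r k ℚ.* r (suc k)))
        ≡⟨ cong (⟦ 100 ⟧ ℚ.*_) (trans (cong (ℚ._* (r k ℚ.* r (suc k))) (!-inverse (suc (2 ℕ.* k)))) (trans (ℚₚ.*-identityˡ _) (sym (r-difference k)))) ⟩
      ⟦ 100 ⟧ ℚ.* ĉ k ∎
      where
      open ℚₚ.≤-Reasoning
      s = sinhᶻ k

    0≤e : ∀ k → 0ℚ ℚ.≤ e k
    0≤e k = 0≤* (0≤pow (0≤⟦⟧ 4) k) (0≤dilate k)

  abs≼⊡ : ∀ {x c} → 0ℚ ℚ.≤ c → abs x ≼ ι c → ∀ n → abs (x ⊡ n) ≼ ι (pow c n)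
  abs≼⊡ 0≤c h zero    = ≃⇒≼ (abs-ι 1ℚ)
  abs≼⊡ {x} {c} 0≤c h (suc n) = ≼-trans (abs≼⊠ h (abs≼⊡ 0≤c h n)) (≃⇒≼ (R.sym (ι-* c (pow c n))))

  module _ {t : ℝ} (∣t∣≼4 : abs t ≼ ι ⟦ 4 ⟧) where
    private
      abs-σ≼e : ∀ k → abs (σ t k) ≼ ι (e k)
      abs-σ≼e k = ≼-trans (abs≼⊠ (abs≼⊡ (0≤⟦⟧ 4) ∣t∣≼4 k) (≃⇒≼ (R.trans (abs-ι (dilate sinhᶻ k)) (R.reflexive (cong ι (ℚₚ.0≤p⇒∣p∣≡p (0≤dilate k)))))))
        (≃⇒≼ (R.sym (ι-* (pow ⟦ 4 ⟧ k) (dilate sinhᶻ k))))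

    abs-σ : ∀ k → abs (σ t k) ≼ ι (⟦ 100 ⟧ ℚ.* ĉ k)
    abs-σ k = ≼-trans (abs-σ≼e k) (ι-mono (ℚₚ.≤-trans (ℚₚ.≤-trans (ℚₚ.≤-reflexive (sym (ℚₚ.*-identityˡ (e k))))
      (*-mono-≤ (0≤⟦⟧ (suc k)) (0≤e k) (⟦⟧-mono-≤ 1 (suc k) (ℕ.s≤s ℕ.z≤n)) ℚₚ.≤-refl)) (e≤ k)))

    abs-kσ : ∀ k → abs (ι ⟦ k ⟧ ⊠ σ t k) ≼ ι (⟦ 100 ⟧ ℚ.* ĉ k)
    abs-kσ k = ≼-trans (abs≼⊠ (≃⇒≼ (R.trans (abs-ι ⟦ k ⟧) (R.reflexive (cong ι (ℚₚ.0≤p⇒∣p∣≡p (0≤⟦⟧ k)))))) (abs-σ≼e k))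
      (≼-trans (≃⇒≼ (R.sym (ι-* ⟦ k ⟧ (e k)))) (ι-mono (ℚₚ.≤-trans (*-mono-≤ (0≤⟦⟧ (suc k)) (0≤e k) (⟦⟧-mono-≤ k (suc k) (ℕₚ.n≤1+n k)) ℚₚ.≤-refl) (e≤ k))))

  ∑-bound : ∀ {f : ℕ → ℝ} n d → (∀ k → abs (f k) ≼ ι (⟦ 100 ⟧ ℚ.* ĉ k)) → abs (∑ (λ k → f (n ℕ.+ k)) d) ≼ ι (⟦ 100 ⟧ ℚ.* r n)
  ∑-bound n d h = ≼-trans (abs-∑ d (λ k → h (n ℕ.+ k))) (ι-mono (ℚₚ.≤-trans (ℚₚ.≤-reflexive (sum-scale ⟦ 100 ⟧ (λ k → ĉ (n ℕ.+ k)) d))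
    (*-monoˡ-≤ (0≤⟦⟧ 100) (sum-telescope-≤ n d))))

  private
    within : ∀ {a c ε} → c ℚ.< ε → ∣ a ∣ ℚ.< c ℚ.+ ½ ℚ.* (ε ℚ.- c) → (0ℚ ℚ.- ε ℚ.+ ½ ℚ.* (ε ℚ.- c) ℚ.≤ a) × (a ℚ.+ ½ ℚ.* (ε ℚ.- c) ℚ.≤ 0ℚ ℚ.+ ε)
    within {a} {c} {ε} c<ε h = lower , upper
      where
      open ℚₚ.≤-Reasoning
      η : ℚ
      η = ½ ℚ.* (ε ℚ.- c)
      upper : a ℚ.+ η ℚ.≤ 0ℚ ℚ.+ ε
      upper = begin
        a ℚ.+ η              ≤⟨ ℚₚ.+-monoˡ-≤ η (ℚₚ.≤-trans (p≤∣p∣ a) (ℚₚ.<⇒≤ h)) ⟩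
        c ℚ.+ η ℚ.+ η        ≡⟨ solve 2 (λ c ε → c :+ con ½ :* (ε :- c) :+ con ½ :* (ε :- c) := con 0ℚ :+ ε) refl c ε ⟩
        0ℚ ℚ.+ ε             ∎
      lower : 0ℚ ℚ.- ε ℚ.+ η ℚ.≤ a
      lower = begin
        0ℚ ℚ.- ε ℚ.+ η       ≡⟨ solve 2 (λ c ε → con 0ℚ :- ε :+ con ½ :* (ε :- c) := :- (c :+ con ½ :* (ε :- c))) refl c ε ⟩
        ℚ.- (c ℚ.+ η)        ≤⟨ ℚₚ.neg-antimono-≤ (ℚₚ.≤-trans (p≤∣p∣ (ℚ.- a)) (ℚₚ.≤-trans (ℚₚ.≤-reflexive (ℚₚ.∣-p∣≡∣p∣ a)) (ℚₚ.<⇒≤ h))) ⟩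
        ℚ.- (ℚ.- a)          ≡⟨ solve 1 (λ a → :- (:- a) := a) refl a ⟩
        a                    ∎

  -- A strict inequality carries a rational gap as its witness. Half of ε - c serves as this gap,
  -- and the other half absorbs the margin that `≼` leaves at a finite index.
  abs≼⇒between : ∀ {x c ε} → c ℚ.< ε → abs x ≼ ι c → (0ℝ - fromℚ ε < x) × (x < 0ℝ + fromℚ ε)
  abs≼⇒between {x} {c} {ε} c<ε h =
    let η   = ½ ℚ.* (ε ℚ.- c)
        0<η = half>0 (subst (ℚ._< ε ℚ.- c) (ℚₚ.+-inverseʳ c) (ℚₚ.+-monoˡ-< (ℚ.- c) c<ε))
        N , k = ≼⇒eventually h η 0<η
        near : ∀ n → N ℕ.≤ n → ∣ seq x n ∣ ℚ.< c ℚ.+ η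
        near n l = subst₂ (λ a b → a ℚ.< b ℚ.+ η) (seq-abs x n) (seq-ι c n) (k n l)
    in (η , 0<η , N , λ n l → proj₁ (within {seq x n} c<ε (near n l)))
     , (η , 0<η , N , λ n l → proj₂ (within {seq x n} c<ε (near n l)))

  between⇒abs≼ : ∀ {x ε} → (0ℝ - fromℚ ε < x) × (x < 0ℝ + fromℚ ε) → abs x ≼ ι ε
  between⇒abs≼ {x} {ε} ((η , 0<η , M , h) , (η′ , 0<η′ , N , k)) = ≼-from (M ℕ.⊔ N) λ n l →
    subst₂ ℚ._≤_ (sym (seq-abs x n)) (sym (seq-ι ε n))
      (bound (seq x n) (ℚₚ.≤-trans (p≤p+q (0ℚ ℚ.- ε) η 0<η) (h n (ℕₚ.m⊔n≤o⇒m≤o M N l))) (ℚₚ.≤-trans (p≤p+q (seq x n) η′ 0<η′) (k n (ℕₚ.m⊔n≤o⇒n≤o M N l))))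
    where
    bound : ∀ a → 0ℚ ℚ.- ε ℚ.≤ a → a ℚ.≤ 0ℚ ℚ.+ ε → ∣ a ∣ ℚ.≤ ε
    bound a lo hi with ℚₚ.∣p∣≡p∨∣p∣≡-p a
    ... | inj₁ eq = subst (ℚ._≤ ε) (sym eq) (subst (a ℚ.≤_) (ℚₚ.+-identityˡ ε) hi)
    ... | inj₂ eq = subst₂ ℚ._≤_ (sym eq) (solve 1 (λ e → :- (con 0ℚ :- e) := e) refl ε) (ℚₚ.neg-antimono-≤ lo)

  private
    seq-^ : ∀ x n N → seq (x ^ n) N ≡ pow (seq x N) n
    seq-^ x zero    N = refl
    seq-^ x (suc n) N = cong (seq x N ℚ.*_) (seq-^ x n N)

    sine-coefficient : ∀ x k → pow (ℚ.- 1ℚ) k ℚ.* pow x (suc (2 ℕ.* k)) ℚ.* inv ⟦ suc (2 ℕ.* k) ! ⟧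
                               ≡ x ℚ.* (pow (ℚ.- ((ℤ.+ 1 / 4) ℚ.* (x ℚ.* x))) k ℚ.* dilate sinhᶻ k)
    sine-coefficient x k = begin
      pow (ℚ.- 1ℚ) k ℚ.* (x ℚ.* pow x (2 ℕ.* k)) ℚ.* inv ⟦ suc (2 ℕ.* k) ! ⟧
        ≡⟨ cong₂ (λ a b → pow (ℚ.- 1ℚ) k ℚ.* (x ℚ.* a) ℚ.* b) (pow-double x k)
             (sym (inv-unique (trans (ℚₚ.*-comm (sinhᶻ k) ⟦ suc (2 ℕ.* k) ! ⟧) (!-inverse (suc (2 ℕ.* k)))))) ⟩
      pow (ℚ.- 1ℚ) k ℚ.* (x ℚ.* pow (x ℚ.* x) k) ℚ.* sinhᶻ k
        ≡⟨ solve 4 (λ m x p s → m :* (x :* p) :* s := x :* ((m :* p) :* s)) refl (pow (ℚ.- 1ℚ) k) x (pow (x ℚ.* x) k) (sinhᶻ k) ⟩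
      x ℚ.* ((pow (ℚ.- 1ℚ) k ℚ.* pow (x ℚ.* x) k) ℚ.* sinhᶻ k)
        ≡⟨ cong (λ z → x ℚ.* (z ℚ.* sinhᶻ k)) (trans (sym (pow-* (ℚ.- 1ℚ) (x ℚ.* x) k)) (trans
             (cong (λ z → pow z k) (solve 1 (λ y → con (ℚ.- 1ℚ) :* y := (:- (con (ℤ.+ 1 / 4) :* y)) :* con ⟦ 4 ⟧) refl (x ℚ.* x)))
             (pow-* (ℚ.- ((ℤ.+ 1 / 4) ℚ.* (x ℚ.* x))) ⟦ 4 ⟧ k))) ⟩
      x ℚ.* ((pow (ℚ.- ((ℤ.+ 1 / 4) ℚ.* (x ℚ.* x))) k ℚ.* pow ⟦ 4 ⟧ k) ℚ.* sinhᶻ k)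
        ≡⟨ cong (x ℚ.*_) (ℚₚ.*-assoc (pow (ℚ.- ((ℤ.+ 1 / 4) ℚ.* (x ℚ.* x))) k) (pow ⟦ 4 ⟧ k) (sinhᶻ k)) ⟩
      x ℚ.* (pow (ℚ.- ((ℤ.+ 1 / 4) ℚ.* (x ℚ.* x))) k ℚ.* dilate sinhᶻ k) ∎
      where open ≡-Reasoning

  sin-term≃ : ∀ x k → sin-term x k ≃ x ⊠ σ -[ x /2]² k
  sin-term≃ x k = pointwise λ N → trans
    (cong (ℚ._* inv ⟦ suc (2 ℕ.* k) ! ⟧) (cong₂ ℚ._*_ (seq-^ (- 1ℝ) k N) (seq-^ x (suc (2 ℕ.* k)) N)))
    (trans (sine-coefficient (seq x N) k) (sym (trans (seq-⊠ x (σ t k) N) (cong (seq x N ℚ.*_)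
      (trans (seq-⊠ (t ⊡ k) (ι (dilate sinhᶻ k)) N) (cong₂ ℚ._*_ (trans (seq-⊡ t k N) (cong (λ z → pow z k) (seq-t N))) (seq-ι (dilate sinhᶻ k) N)))))))
    where
    t = -[ x /2]²
    seq-t : ∀ N → seq t N ≡ ℚ.- ((ℤ.+ 1 / 4) ℚ.* (seq x N ℚ.* seq x N))
    seq-t N = trans (seq-⊟ _ N) (cong ℚ.-_ (trans (seq-⊠ (ι (ℤ.+ 1 / 4)) (x ⊠ x) N) (cong₂ ℚ._*_ (seq-ι (ℤ.+ 1 / 4) N) (seq-⊠ x x N))))

  sin-partialSum : ∀ x n → partialSum (sin-term x) n ≃ x ⊠ ∑ (σ -[ x /2]²) n
  sin-partialSum x zero    = R.trans (fromℚ⇒ι 0ℚ) (solveᴿ 1 (λ x → κ 0ℚ :≃ x :⊠ κ 0ℚ) ≃-refl x)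
  sin-partialSum x (suc n) = R.trans (+⇒⊞ (partialSum (sin-term x) n) (sin-term x n))
    (R.trans (⊞-cong (sin-partialSum x n) (sin-term≃ x n)) (R.sym (⊠-distribˡ-⊞ x (∑ (σ -[ x /2]²) n) (σ -[ x /2]² n))))

  abs-[/2]² : ∀ {x} → abs x ≼ ι ⟦ 4 ⟧ → abs -[ x /2]² ≼ ι ⟦ 4 ⟧
  abs-[/2]² {x} h = abs≼⊟ (≼-trans (abs≼⊠ (≃⇒≼ (abs-ι (ℤ.+ 1 / 4))) (abs≼⊠ h h))
    (≃⇒≼ (solveᴿ 1 (λ x → κ (ℤ.+ 1 / 4) :⊠ (κ ⟦ 4 ⟧ :⊠ κ ⟦ 4 ⟧) :≃ κ ⟦ 4 ⟧) ≃-refl x)))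

  convᴿ-partialSums : ∀ f g n → convᴿ (λ k → ∑ f (suc k)) g n ≃ ∑ (convᴿ f g) (suc n)
  convᴿ-partialSums f g n = pointwise λ N → trans (seq-conv (λ k → ∑ f (suc k)) g n N)
    (trans (conv-cong {g = λ k → seq (g k) N} (λ k → seq-∑ f (suc k) N) (λ _ → refl) n)
    (trans (conv-partialSums (λ k → seq (f k) N) (λ k → seq (g k) N) n)
    (sym (trans (seq-∑ (convᴿ f g) (suc n) N) (sum-cong (suc n) (λ k → seq-conv f g k N))))))

  convᴿ-1+2* : ∀ f n → convᴿ f (ι ∘ 1+2*) n ≃ ι (1+2* n) ⊠ ∑ f (suc n) ⊞ ⊟ (ι ⟦ 2 ⟧ ⊠ ∑ (λ k → ι ⟦ k ⟧ ⊠ f k) (suc n))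
  convᴿ-1+2* f n = pointwise λ N → trans (seq-conv f (ι ∘ 1+2*) n N)
    (trans (conv-cong {λ k → seq (f k) N} (λ _ → refl) (λ k → seq-ι (1+2* k) N) n)
    (trans (conv-1+2n (λ k → seq (f k) N) n)
    (sym (trans (seq-⊞ (ι (1+2* n) ⊠ ∑ f (suc n)) _ N) (cong₂ ℚ._+_
      (trans (seq-⊠ (ι (1+2* n)) (∑ f (suc n)) N) (cong₂ ℚ._*_ (seq-ι (1+2* n) N) (seq-∑ f (suc n) N)))
      (trans (seq-⊟ (ι ⟦ 2 ⟧ ⊠ ∑ (λ k → ι ⟦ k ⟧ ⊠ f k) (suc n)) N) (cong ℚ.-_ (trans (seq-⊠ (ι ⟦ 2 ⟧) (∑ (λ k → ι ⟦ k ⟧ ⊠ f k) (suc n)) N)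
        (cong₂ ℚ._*_ (seq-ι ⟦ 2 ⟧ N) (trans (seq-∑ (λ k → ι ⟦ k ⟧ ⊠ f k) (suc n) N)
          (sum-cong (suc n) (λ k → trans (seq-⊠ (ι ⟦ k ⟧) (f k) N) (cong (ℚ._* seq (f k) N) (seq-ι ⟦ k ⟧ N))))))))))))))

  abs-ι≥0 : ∀ {q} → 0ℚ ℚ.≤ q → abs (ι q) ≼ ι q
  abs-ι≥0 {q} 0≤q = ≃⇒≼ (R.trans (abs-ι q) (R.reflexive (cong ι (ℚₚ.0≤p⇒∣p∣≡p 0≤q))))

  ι-≼* : ∀ {p q x y} → x ≼ ι p → y ≼ ι q → ι 0ℚ ≼ ι p → ι 0ℚ ≼ y → x ⊠ y ≼ ι (p ℚ.* q)
  ι-≼* {p} {q} h k 0≼p 0≼y = ≼-trans (⊠-mono 0≼p 0≼y h k) (≃⇒≼ (R.sym (ι-* p q)))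

  -- ϖ as the least positive zero of the sine series

  module Zeros (B : ℕ → ℚ) (isBernoulli : IsBernoulli B) where
    open Bernoulli B isBernoulli using (τ; sinh2·tanh′)
    open Values B isBernoulli

    private
      w : ℝ
      w = -[ ϖ /2]²

      c : ℝ
      c = ι (ℤ.+ 1 / 8) ⊠ (ϖ ⊠ ϖ)

      A : ℝ → ℕ → ℝ
      A t = scaled c t τ

    -- sin 2x · tan′ x = 2 tan x
    sine-identity : ∀ t n → convᴿ (σ t) (λ m → ι (1+2* m) ⊠ A t m) n ≃ A t n
    sine-identity t n = begin
      convᴿ (σ t) (λ m → ι (1+2* m) ⊠ A t m) n
        ≈⟨ convᴿ-cong (λ k → R.sym (⊠-identityˡ (σ t k))) (λ m → R.trans
             (solveᴿ 4 (λ m c t s → m :⊠ (c :⊠ (t :⊠ s)) :≃ c :⊠ (t :⊠ (m :⊠ s))) ≃-refl (ι (1+2* m)) c (t ⊡ m) (ι (τ m)))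
             (R.*-congˡ {c} (R.*-congˡ {t ⊡ m} (R.sym (ι-* (1+2* m) (τ m)))))) n ⟩
      convᴿ (scaled (ι 1ℚ) t (dilate sinhᶻ)) (scaled c t (λ m → 1+2* m ℚ.* τ m)) n
        ≈⟨ convᴿ-scaled (ι 1ℚ) c t (dilate sinhᶻ) (λ m → 1+2* m ℚ.* τ m) n ⟩
      scaled (ι 1ℚ ⊠ c) t (conv (dilate sinhᶻ) (λ m → 1+2* m ℚ.* τ m)) n
        ≈⟨ ⊠-cong (⊠-identityˡ c) (R.*-congˡ {t ⊡ n} (R.reflexive (cong ι (trans
             (conv-cong {dilate sinhᶻ} (λ _ → refl) (λ m → solve 2 (λ m s → (con 1ℚ :+ (m :+ m)) :* s := s :+ (m :* s :+ m :* s)) refl ⟦ m ⟧ (τ m)) n)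
             (sinh2·tanh′ n))))) ⟩
      A t n ∎
      where open ℝ-Reasoning

    private
      ∣w∣≼4 : abs w ≼ ι ⟦ 4 ⟧
      ∣w∣≼4 = abs-[/2]² (nonNeg⇒abs≼ 0≼ϖ ϖ≼4)

      -- By `sine-identity` at w, convolving the sine coefficients with (1+2k) λ(2k+2) returns λ.
      -- Splitting this weight into 1 + 2k and `λ-excess` produces the left side, and every term on
      -- the right is bounded.
      sine-tail : ∀ n → ι (1+2* n) ⊠ ∑ (σ w) (suc n) ≃
        λ-even n ⊞ (ι ⟦ 2 ⟧ ⊠ ∑ (λ k → ι ⟦ k ⟧ ⊠ σ w k) (suc n) ⊞ ⊟ convᴿ (σ w) λ-excess n)
      sine-tail n = begin
        m ⊠ P
          ≈⟨ solveᴿ 4 (λ m p q e → m :⊠ p :≃ ((m :⊠ p :⊞ :⊟ q) :⊞ e) :⊞ (q :⊞ :⊟ e)) ≃-refl m P Q E ⟩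
        ((m ⊠ P ⊞ ⊟ Q) ⊞ E) ⊞ (Q ⊞ ⊟ E)
          ≈⟨ R.+-congʳ {Q ⊞ ⊟ E} (R.trans (R.+-congʳ {E} (R.sym (convᴿ-1+2* (σ w) n))) (R.sym (convᴿ-⊞ʳ (σ w) (ι ∘ 1+2*) λ-excess n))) ⟩
        convᴿ (σ w) (λ k → ι (1+2* k) ⊞ λ-excess k) n ⊞ (Q ⊞ ⊟ E)
          ≈⟨ R.+-congʳ {Q ⊞ ⊟ E} (convᴿ-cong {σ w} (λ _ → ≃-refl) (λ k → R.trans
               (solveᴿ 2 (λ m l → m :⊞ m :⊠ (l :⊞ :⊟ κ 1ℚ) :≃ m :⊠ l) ≃-refl (ι (1+2* k)) (λ-even k))
               (R.*-congˡ {ι (1+2* k)} (λ-value k))) n) ⟩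
        convᴿ (σ w) (λ k → ι (1+2* k) ⊠ A w k) n ⊞ (Q ⊞ ⊟ E)
          ≈⟨ R.+-congʳ {Q ⊞ ⊟ E} (R.trans (sine-identity w n) (R.sym (λ-value n))) ⟩
        λ-even n ⊞ (Q ⊞ ⊟ E) ∎
        where
        open ℝ-Reasoning
        m P Q E : ℝ
        m = ι (1+2* n)
        P = ∑ (σ w) (suc n)
        Q = ι ⟦ 2 ⟧ ⊠ ∑ (λ k → ι ⟦ k ⟧ ⊠ σ w k) (suc n)
        E = convᴿ (σ w) λ-excess n

      conv-ĉ : ∀ n → conv (λ k → ⟦ 100 ⟧ ℚ.* ĉ k) (λ _ → 1ℚ) n ℚ.≤ ⟦ 100 ⟧
      conv-ĉ n = ℚₚ.≤-trans (ℚₚ.≤-reflexive (trans (conv-comm (λ k → ⟦ 100 ⟧ ℚ.* ĉ k) (λ _ → 1ℚ) n) (trans (conv-ones (λ k → ⟦ 100 ⟧ ℚ.* ĉ k) n) (sum-scale ⟦ 100 ⟧ ĉ (suc n)))))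
        (ℚₚ.≤-trans (*-monoˡ-≤ (0≤⟦⟧ 100) (sum-telescope-≤ 0 (suc n))) (ℚₚ.≤-reflexive (ℚₚ.*-identityʳ ⟦ 100 ⟧)))

      partial-sums≼ : ∀ n → abs (∑ (σ w) (suc n)) ≼ ι (⟦ 302 ⟧ ℚ.* r n)
      partial-sums≼ n = abs≼-resp {ι (ξ n) ⊠ (ι (1+2* n) ⊠ ∑ (σ w) (suc n))} unscale
        (≼-trans (abs≼⊠ (≼-trans (abs-ι≥0 (0≤r (2 ℕ.* n))) (ι-mono (r-antitone (ℕₚ.m≤m+n n (n ℕ.+ 0))))) (abs≼-resp (R.sym (sine-tail n)) tail≼))
          (≃⇒≼ (R.trans (⊠-comm (ι (r n)) (ι ⟦ 302 ⟧)) (R.sym (ι-* ⟦ 302 ⟧ (r n))))))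
        where
        unscale : ι (ξ n) ⊠ (ι (1+2* n) ⊠ ∑ (σ w) (suc n)) ≃ ∑ (σ w) (suc n)
        unscale = R.trans (R.sym (⊠-assoc (ι (ξ n)) (ι (1+2* n)) (∑ (σ w) (suc n))))
          (R.trans (R.*-congʳ {∑ (σ w) (suc n)} (R.trans (R.sym (ι-* (ξ n) (1+2* n))) (R.reflexive (cong ι
            (trans (cong (ξ n ℚ.*_) (sym (⟦odd⟧ n))) (r-inverse (2 ℕ.* n))))))) (⊠-identityˡ (∑ (σ w) (suc n))))
        -- 302 = 2 + 2 · 100 + 100: the bounds of λ, of twice the sum of kσₖ, and of the convolution
        -- with the excess.
        tail≼ : abs (λ-even n ⊞ (ι ⟦ 2 ⟧ ⊠ ∑ (λ k → ι ⟦ k ⟧ ⊠ σ w k) (suc n) ⊞ ⊟ convᴿ (σ w) λ-excess n)) ≼ ι ⟦ 302 ⟧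
        tail≼ = ≼-resp ≃-refl (solveᴿ 1 (λ x → κ ⟦ 2 ⟧ :⊞ (κ ⟦ 2 ⟧ :⊠ κ (⟦ 100 ⟧ ℚ.* r 0) :⊞ κ ⟦ 100 ⟧) :≃ κ ⟦ 302 ⟧) ≃-refl w)
          (abs≼⊞ (nonNeg⇒abs≼ (0≼λ n) (λ≼2 n)) (abs≼⊞ (abs≼⊠ (abs-ι≥0 (0≤⟦⟧ 2)) (∑-bound {λ k → ι ⟦ k ⟧ ⊠ σ w k} 0 (suc n) (abs-kσ ∣w∣≼4)))
            (abs≼⊟ (≼-trans (abs-convᴿ n (abs-σ ∣w∣≼4) abs-λ-excess) (ι-mono (conv-ĉ n))))))

    -- (2n+1) ∑ₖ≤ₙ σₖ stays bounded, so the sum tends to 0.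
    sin-ϖ : Sin ϖ 0ℝ
    sin-ϖ ε 0<ε = let N , h = archimedean 1208 ε 0<ε in suc N , λ { (suc n) (ℕ.s≤s N≤n) →
      abs≼⇒between (h n N≤n) (abs≼-resp (R.sym (sin-partialSum ϖ (suc n)))
        (≼-trans (abs≼⊠ (nonNeg⇒abs≼ 0≼ϖ ϖ≼4) (partial-sums≼ n)) (≃⇒≼ (R.trans (R.sym (ι-* ⟦ 4 ⟧ (⟦ 302 ⟧ ℚ.* r n))) (R.reflexive (cong ι (constant n))))))) }
      where
      -- 1208 = 4 · 302, where 4 bounds the factor ϖ in front of the sine series.
      constant : ∀ n → ⟦ 4 ⟧ ℚ.* (⟦ 302 ⟧ ℚ.* r n) ≡ ℤ.+ 1208 / suc n
      constant n = trans (solve 1 (λ r → con ⟦ 4 ⟧ :* (con ⟦ 302 ⟧ :* r) := con ⟦ 1208 ⟧ :* r) refl (r n))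
        (trans (frac-* 1208 1 1 (suc n)) (ℚₚ./-cong {ℤ.+ 1208} {1 ℕ.* suc n} {ℤ.+ 1208} {suc n} refl (ℕₚ.*-identityˡ (suc n))))

    private
      ϖ#0 : ϖ #0
      ϖ#0 = pos⇒#0 {ϖ} 0<ϖ

      1/ϖ : ℝ
      1/ϖ = recip ϖ ϖ#0

      -- 1/ϖ = (1/ϖ)² ϖ is a square times a nonnegative number.
      0≼1/ϖ : ι 0ℚ ≼ 1/ϖ
      0≼1/ϖ = ≼-resp ≃-refl (R.trans (⊠-assoc 1/ϖ 1/ϖ ϖ) (R.trans (R.*-congˡ {1/ϖ} (recip-inverse ϖ ϖ#0)) (R.*-identityʳ 1/ϖ)))
        (0≼⊠ (0≼square 1/ϖ) 0≼ϖ)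

    module _ (p : ℝ) (0<p : 0ℝ < p) (p<ϖ : p < ϖ) where
      private
        ε₀ ε₁ η D : ℚ
        ε₀ = proj₁ 0<p
        ε₁ = proj₁ p<ϖ
        -- Since p ≤ 4, ηp ≤ ε₁ and therefore (1 + η)p ≤ p + ε₁ ≤ ϖ: this keeps y = p/ϖ away from 1
        -- by a rational margin.
        η  = (ℤ.+ 1 / 4) ℚ.* ε₁
        D  = inv η ℚ.* (1ℚ ℚ.+ η)

        0<ε₀ : 0ℚ ℚ.< ε₀
        0<ε₀ = proj₁ (proj₂ 0<p)

        0<η : 0ℚ ℚ.< η
        0<η = 0<p*q {ℤ.+ 1 / 4} (ℚₚ.positive⁻¹ (ℤ.+ 1 / 4)) (proj₁ (proj₂ p<ϖ))

        0≤η : 0ℚ ℚ.≤ η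
        0≤η = ℚₚ.<⇒≤ 0<η

        0<1+η : 0ℚ ℚ.< 1ℚ ℚ.+ η
        0<1+η = ℚₚ.+-mono-<-≤ {0ℚ} {1ℚ} {0ℚ} {η} 0<1ℚ 0≤η

        0<D : 0ℚ ℚ.< D
        0<D = 0<p*q {inv η} {1ℚ ℚ.+ η} (inv>0 {η} 0<η) 0<1+η

        ε₀≼p : ι ε₀ ≼ p
        ε₀≼p = let N , h = proj₂ (proj₂ 0<p) in ≼-from N λ n l →
          subst (ℚ._≤ seq p n) (trans (ℚₚ.+-identityˡ ε₀) (sym (seq-ι ε₀ n))) (h n l)

        p+ε₁≼ϖ : p ⊞ ι ε₁ ≼ ϖ
        p+ε₁≼ϖ = let N , h = proj₂ (proj₂ p<ϖ) in ≼-from N λ n l →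
          subst (ℚ._≤ seq ϖ n) (sym (trans (seq-⊞ p (ι ε₁) n) (cong (seq p n ℚ.+_) (seq-ι ε₁ n)))) (h n l)

        0≼p : ι 0ℚ ≼ p
        0≼p = ≼-trans (ι-mono (ℚₚ.<⇒≤ 0<ε₀)) ε₀≼p

        p≼4 : p ≼ ι ⟦ 4 ⟧
        p≼4 = ≼-trans (≼-trans (≼-resp (R.+-identityʳ p) ≃-refl (⊞-mono (≼-refl {p}) (ι-mono (ℚₚ.<⇒≤ (proj₁ (proj₂ p<ϖ)))))) p+ε₁≼ϖ) ϖ≼4

        t y : ℝ
        t = -[ p /2]²
        y = p ⊠ 1/ϖ

        ∣t∣≼4 : abs t ≼ ι ⟦ 4 ⟧
        ∣t∣≼4 = abs-[/2]² (nonNeg⇒abs≼ 0≼p p≼4)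

        y·ϖ : y ⊠ ϖ ≃ p
        y·ϖ = R.trans (⊠-assoc p 1/ϖ ϖ) (R.trans (R.*-congˡ {p} (recip-inverse ϖ ϖ#0)) (R.*-identityʳ p))

        0≼y : ι 0ℚ ≼ y
        0≼y = 0≼⊠ 0≼p 0≼1/ϖ

        [1+η]y≼1 : ι (1ℚ ℚ.+ η) ⊠ y ≼ ι 1ℚ
        [1+η]y≼1 = ≼-resp (solveᴿ 3 (λ i d p → i :⊠ (p :⊞ d :⊠ p) :≃ (κ 1ℚ :⊞ d) :⊠ (p :⊠ i)) ≃-refl 1/ϖ (ι η) p ⟫ R.*-congʳ {y} (R.sym (ι-+ 1ℚ η)))
          (recip-inverse ϖ ϖ#0)
          (⊠-monoʳ 0≼1/ϖ (≼-trans (⊞-mono (≼-refl {p}) (≼-resp ≃-refl four (⊠-monoʳ (ι-mono 0≤η) p≼4))) p+ε₁≼ϖ))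
          where
          _⟫_ : ∀ {x y z} → x ≃ y → y ≃ z → x ≃ z
          _⟫_ = R.trans
          four : ι η ⊠ ι ⟦ 4 ⟧ ≃ ι ε₁
          four = R.trans (R.sym (ι-* η ⟦ 4 ⟧)) (R.reflexive (cong ι (solve 1 (λ e → con (ℤ.+ 1 / 4) :* e :* con ⟦ 4 ⟧ := e) refl ε₁)))

        -- Decay of order 1/m for the powers of y is enough below, and it follows from (1 + η)y ≤ 1
        -- by comparing 1 + (m+1)η with (1 + mη)(1 + η).
        bernoulli-inequality : ∀ m → ι (1ℚ ℚ.+ ⟦ m ⟧ ℚ.* η) ⊠ y ⊡ m ≼ ι 1ℚ
        bernoulli-inequality zero    = ≃⇒≼ (R.trans (R.*-identityʳ _) (R.reflexive (cong ι (solve 1 (λ d → con 1ℚ :+ con 0ℚ :* d := con 1ℚ) refl η))))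
        bernoulli-inequality (suc m) = ≼-trans (⊠-mono (ι-mono (0≤* (1+mη m) (ℚₚ.<⇒≤ 0<1+η))) (0≼⊡ 0≼y (suc m)) (ι-mono expand) (≼-refl {y ⊡ suc m}))
          (≼-resp (R.trans (solveᴿ 4 (λ a b y z → (a :⊠ y) :⊠ (b :⊠ z) :≃ (b :⊠ a) :⊠ (y :⊠ z)) ≃-refl (ι (1ℚ ℚ.+ η)) (ι (1ℚ ℚ.+ ⟦ m ⟧ ℚ.* η)) y (y ⊡ m))
                    (R.*-congʳ {y ⊡ suc m} (R.sym (ι-* (1ℚ ℚ.+ ⟦ m ⟧ ℚ.* η) (1ℚ ℚ.+ η)))))
            (⊠-identityˡ (ι 1ℚ))
            (⊠-mono (ι-mono (ℚₚ.<⇒≤ 0<1ℚ)) (0≼⊠ (ι-mono (1+mη m)) (0≼⊡ 0≼y m)) [1+η]y≼1 (bernoulli-inequality m)))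
          where
          1+mη : ∀ m → 0ℚ ℚ.≤ 1ℚ ℚ.+ ⟦ m ⟧ ℚ.* η
          1+mη m = ℚₚ.+-mono-≤ (ℚₚ.<⇒≤ 0<1ℚ) (0≤* (0≤⟦⟧ m) 0≤η)
          expand : 1ℚ ℚ.+ ⟦ suc m ⟧ ℚ.* η ℚ.≤ (1ℚ ℚ.+ ⟦ m ⟧ ℚ.* η) ℚ.* (1ℚ ℚ.+ η)
          expand = subst₂ ℚ._≤_ (trans (ℚₚ.+-identityʳ _) (cong (λ z → 1ℚ ℚ.+ z ℚ.* η) (sym (⟦suc⟧ m))))
            (solve 2 (λ m d → (con 1ℚ :+ (con 1ℚ :+ m) :* d) :+ m :* (d :* d) := (con 1ℚ :+ m :* d) :* (con 1ℚ :+ d)) refl ⟦ m ⟧ η)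
            (ℚₚ.+-monoʳ-≤ (1ℚ ℚ.+ (1ℚ ℚ.+ ⟦ m ⟧) ℚ.* η) (0≤* (0≤⟦⟧ m) (0≤* 0≤η 0≤η)))

        -- η(m+1) ≤ (1 + η)(1 + mη) turns Bernoulli's inequality into a bound by 1/(m+1); the
        -- constant D = (1 + η)/η is what remains after dividing by η.
        y^≼ : ∀ m → y ⊡ m ≼ ι (D ℚ.* r m)
        y^≼ m = ≼-resp undo (≃-refl {ι (D ℚ.* r m)}) (≼-trans
          (⊠-monoʳ (ι-mono 0≤i) (⊠-mono (ι-mono (0≤* (ℚₚ.<⇒≤ 0<1+η) 0≤1+mη)) (0≼⊡ 0≼y m) (ι-mono η[m+1]≤) (≼-refl {y ⊡ m})))
          (≼-resp regroup (R.trans (R.*-identityʳ (ι (D ℚ.* r m))) ≃-refl) (⊠-monoʳ (ι-mono (0≤* (ℚₚ.<⇒≤ 0<D) (0≤r m))) (bernoulli-inequality m))))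
          where
          i : ℚ
          i = inv η ℚ.* r m
          0≤i : 0ℚ ℚ.≤ i
          0≤i = 0≤* (ℚₚ.<⇒≤ (inv>0 {η} 0<η)) (0≤r m)
          0≤1+mη : 0ℚ ℚ.≤ 1ℚ ℚ.+ ⟦ m ⟧ ℚ.* η
          0≤1+mη = ℚₚ.+-mono-≤ (ℚₚ.<⇒≤ 0<1ℚ) (0≤* (0≤⟦⟧ m) 0≤η)
          η[m+1]≤ : η ℚ.* ⟦ suc m ⟧ ℚ.≤ (1ℚ ℚ.+ η) ℚ.* (1ℚ ℚ.+ ⟦ m ⟧ ℚ.* η)
          η[m+1]≤ = subst₂ ℚ._≤_ (trans (ℚₚ.+-identityʳ _) (cong (η ℚ.*_) (sym (⟦suc⟧ m))))
            (solve 2 (λ m d → d :* (con 1ℚ :+ m) :+ (con 1ℚ :+ m :* (d :* d)) := (con 1ℚ :+ d) :* (con 1ℚ :+ m :* d)) refl ⟦ m ⟧ η)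
            (ℚₚ.+-monoʳ-≤ (η ℚ.* (1ℚ ℚ.+ ⟦ m ⟧)) (ℚₚ.+-mono-≤ (ℚₚ.<⇒≤ 0<1ℚ) (0≤* (0≤⟦⟧ m) (0≤* 0≤η 0≤η))))
          undo : ι i ⊠ (ι (η ℚ.* ⟦ suc m ⟧) ⊠ y ⊡ m) ≃ y ⊡ m
          undo = R.trans (R.sym (⊠-assoc (ι i) (ι (η ℚ.* ⟦ suc m ⟧)) (y ⊡ m))) (R.trans (R.*-congʳ {y ⊡ m} (R.trans (R.sym (ι-* i (η ℚ.* ⟦ suc m ⟧)))
            (R.reflexive (cong ι (trans (solve 4 (λ a b c d → a :* b :* (c :* d) := (a :* c) :* (b :* d)) refl (inv η) (r m) η ⟦ suc m ⟧)
              (cong₂ ℚ._*_ (inv-inverse η (pos≢0 0<η)) (r-inverse m))))))) (⊠-identityˡ (y ⊡ m)))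
          regroup : ι (D ℚ.* r m) ⊠ (ι (1ℚ ℚ.+ ⟦ m ⟧ ℚ.* η) ⊠ y ⊡ m) ≃ ι i ⊠ (ι ((1ℚ ℚ.+ η) ℚ.* (1ℚ ℚ.+ ⟦ m ⟧ ℚ.* η)) ⊠ y ⊡ m)
          regroup = R.trans (R.sym (⊠-assoc _ _ _)) (R.trans (R.*-congʳ {y ⊡ m} (R.trans (R.sym (ι-* (D ℚ.* r m) (1ℚ ℚ.+ ⟦ m ⟧ ℚ.* η))) (R.trans (R.reflexive (cong ι
            (solve 4 (λ a b r c → a :* b :* r :* c := a :* r :* (b :* c)) refl (inv η) (1ℚ ℚ.+ η) (r m) (1ℚ ℚ.+ ⟦ m ⟧ ℚ.* η))))
            (ι-* i ((1ℚ ℚ.+ η) ℚ.* (1ℚ ℚ.+ ⟦ m ⟧ ℚ.* η)))))) (⊠-assoc _ _ _))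

        -- p = yϖ gives t = y²w, so passing from w to t multiplies the known values λ by powers of
        -- y². This makes the terms of the tangent series visibly nonnegative.
        A≃ : ∀ m → A t m ≃ (y ⊡ m ⊠ y ⊡ m) ⊠ λ-even m
        A≃ m = begin
          c ⊠ (t ⊡ m ⊠ ι (τ m))
            ≈⟨ R.*-congˡ {c} (R.*-congʳ {ι (τ m)} (R.trans (⊡-cong t≃ m) (R.trans (⊡-⊠ (y ⊠ y) w m) (R.*-congʳ {w ⊡ m} (⊡-⊠ y y m))))) ⟩
          c ⊠ (((y ⊡ m ⊠ y ⊡ m) ⊠ w ⊡ m) ⊠ ι (τ m))
            ≈⟨ solveᴿ 4 (λ c y w s → c :⊠ ((y :⊠ w) :⊠ s) :≃ y :⊠ (c :⊠ (w :⊠ s))) ≃-refl c (y ⊡ m ⊠ y ⊡ m) (w ⊡ m) (ι (τ m)) ⟩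
          (y ⊡ m ⊠ y ⊡ m) ⊠ A w m
            ≈⟨ R.*-congˡ {y ⊡ m ⊠ y ⊡ m} (R.sym (λ-value m)) ⟩
          (y ⊡ m ⊠ y ⊡ m) ⊠ λ-even m ∎
          where
          open ℝ-Reasoning
          t≃ : t ≃ (y ⊠ y) ⊠ w
          t≃ = R.trans (⊟-cong (R.*-congˡ {ι (ℤ.+ 1 / 4)} (⊠-cong (R.sym y·ϖ) (R.sym y·ϖ))))
            (solveᴿ 2 (λ y q → :⊟ (κ (ℤ.+ 1 / 4) :⊠ ((y :⊠ q) :⊠ (y :⊠ q))) :≃ (y :⊠ y) :⊠ :⊟ (κ (ℤ.+ 1 / 4) :⊠ (q :⊠ q))) ≃-refl y ϖ)

        0≼A : ∀ m → ι 0ℚ ≼ A t m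
        0≼A m = ≼-resp ≃-refl (R.sym (A≃ m)) (0≼⊠ (0≼⊠ (0≼⊡ 0≼y m) (0≼⊡ 0≼y m)) (0≼λ m))

        C : ℚ
        C = ⟦ 4 ⟧ ℚ.* (D ℚ.* D)

        -- 1 + 2m ≤ 2(m+1), y²ᵐ ≤ (D `r` m)² and λ ≤ 2. One of the two factors `r` m cancels m + 1,
        -- which leaves the constant C = 4D².
        derivative≼ : ∀ m → abs (ι (1+2* m) ⊠ A t m) ≼ ι (C ℚ.* r m)
        derivative≼ m = nonNeg⇒abs≼ (0≼⊠ (ι-mono (0≤1+2* m)) (0≼A m)) (≼-trans
          (⊠-monoʳ (ι-mono (0≤1+2* m)) (≼-resp (R.sym (A≃ m)) ≃-refl
            (ι-≼* (ι-≼* (y^≼ m) (y^≼ m) (ι-mono 0≤Dr) (0≼⊡ 0≼y m)) (λ≼2 m) (ι-mono (0≤* 0≤Dr 0≤Dr)) (0≼λ m))))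
          (≼-trans (≃⇒≼ (R.sym (ι-* (1+2* m) (D ℚ.* r m ℚ.* (D ℚ.* r m) ℚ.* ⟦ 2 ⟧)))) (ι-mono bound)))
          where
          0≤Dr : 0ℚ ℚ.≤ D ℚ.* r m
          0≤Dr = 0≤* (ℚₚ.<⇒≤ 0<D) (0≤r m)
          open ℚₚ.≤-Reasoning
          bound : 1+2* m ℚ.* (D ℚ.* r m ℚ.* (D ℚ.* r m) ℚ.* ⟦ 2 ⟧) ℚ.≤ C ℚ.* r m
          bound = begin
            1+2* m ℚ.* (D ℚ.* r m ℚ.* (D ℚ.* r m) ℚ.* ⟦ 2 ⟧)
              ≤⟨ *-mono-≤ (0≤* (0≤⟦⟧ 2) (0≤⟦⟧ (suc m))) (0≤* (0≤* 0≤Dr 0≤Dr) (0≤⟦⟧ 2)) 1+2m≤ ℚₚ.≤-refl ⟩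
            ⟦ 2 ⟧ ℚ.* ⟦ suc m ⟧ ℚ.* (D ℚ.* r m ℚ.* (D ℚ.* r m) ℚ.* ⟦ 2 ⟧)
              ≡⟨ solve 3 (λ n d r → con ⟦ 2 ⟧ :* n :* (d :* r :* (d :* r) :* con ⟦ 2 ⟧) := con ⟦ 4 ⟧ :* (d :* d) :* r :* (r :* n)) refl ⟦ suc m ⟧ D (r m) ⟩
            C ℚ.* r m ℚ.* (r m ℚ.* ⟦ suc m ⟧)
              ≡⟨ trans (cong (C ℚ.* r m ℚ.*_) (r-inverse m)) (ℚₚ.*-identityʳ (C ℚ.* r m)) ⟩
            C ℚ.* r m ∎
            where
            1+2m≤ : 1+2* m ℚ.≤ ⟦ 2 ⟧ ℚ.* ⟦ suc m ⟧
            1+2m≤ = subst₂ ℚ._≤_ (ℚₚ.+-identityʳ (1+2* m)) (trans (solve 1 (λ m → (con 1ℚ :+ (m :+ m)) :+ con 1ℚ := con ⟦ 2 ⟧ :* (con 1ℚ :+ m)) refl ⟦ m ⟧) (cong (⟦ 2 ⟧ ℚ.*_) (sym (⟦suc⟧ m))))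
              (ℚₚ.+-monoʳ-≤ (1+2* m) (ℚₚ.<⇒≤ 0<1ℚ))

        -- The term of index 0 is λ(2) ≥ 1, and no later term is negative.
        1≼∑A : ∀ M → ι 1ℚ ≼ ∑ (A t) (suc M)
        1≼∑A zero    = ≼-resp ≃-refl (R.trans (solveᴿ 1 (λ l → l :≃ (κ 1ℚ :⊠ κ 1ℚ) :⊠ l) ≃-refl (λ-even 0)) (R.trans (R.sym (A≃ 0)) (R.sym (R.+-identityˡ (A t 0))))) (1≼λ 0)
        1≼∑A (suc M) = ≼-resp (R.+-identityʳ (ι 1ℚ)) ≃-refl (⊞-mono (1≼∑A M) (0≼A (suc M)))

        module _ (sin-p : Sin p 0ℝ) where
          small : ∀ ε → 0ℚ ℚ.< ε → ∃[ N ] (∀ n → N ℕ.≤ n → abs (∑ (σ t) n) ≼ ι ε)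
          small ε 0<ε = let N , h = sin-p (ε₀ ℚ.* ε) (0<p*q 0<ε₀ 0<ε) in N , λ n l →
            ι-cancelˡ-≼ 0<ε₀ (≼-trans (⊠-mono (0≼abs p) (0≼abs (∑ (σ t) n)) (≼-trans ε₀≼p (≼abs p)) (≼-refl {abs (∑ (σ t) n)}))
              (≼-resp (R.trans (abs-cong (sin-partialSum p n)) (abs-⊠ p (∑ (σ t) n))) (ι-* ε₀ ε) (between⇒abs≼ (h n l))))

          -- If the whole series vanishes, a partial sum is as small as its tail: it equals a late
          -- partial sum, made at most `r` n, minus the block in between, at most 100 `r` n.
          partial-sum≼ : ∀ n → abs (∑ (σ t) (suc n)) ≼ ι (⟦ 101 ⟧ ℚ.* r n)
          partial-sum≼ n = let N , h = small (r n) (ℚₚ.positive⁻¹ (r n) {{ℚₚ.normalize-pos 1 (suc n)}})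
                               T = ∑ (λ k → σ t (suc n ℕ.+ k)) N in
            abs≼-resp (R.trans (R.+-congʳ {⊟ T} (∑-⊞ (σ t) (suc n) N)) (solveᴿ 2 (λ a b → (a :⊞ b) :⊞ :⊟ b :≃ a) ≃-refl (∑ (σ t) (suc n)) T))
              (≼-trans (abs≼⊞ (h (suc n ℕ.+ N) (ℕₚ.m≤n+m N (suc n))) (abs≼⊟ (∑-bound {σ t} (suc n) N (abs-σ ∣t∣≼4))))
                (≼-trans (≃⇒≼ (R.sym (ι-+ (r n) (⟦ 100 ⟧ ℚ.* r (suc n))))) (ι-mono (ℚₚ.≤-trans (ℚₚ.+-monoʳ-≤ (r n) (*-monoˡ-≤ (0≤⟦⟧ 100) (r-antitone (ℕₚ.n≤1+n n))))
                  (ℚₚ.≤-reflexive (solve 1 (λ r → r :+ con ⟦ 100 ⟧ :* r := con ⟦ 101 ⟧ :* r) refl (r n)))))))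

          -- Summing `sine-identity` up to M turns its right side into the partial sum of the
          -- tangent series, at least 1, and its left side into partial sums of sine convolved with
          -- the coefficients of tan′. Both factors are of order 1/n, and such a convolution tends
          -- to 0.
          1≤ : ∀ M → 1ℚ ℚ.≤ ⟦ 101 ⟧ ℚ.* C ℚ.* conv r r M
          1≤ M = ι-cancel-≼ (≼-trans (1≼∑A M) (≼-trans (≃⇒≼ (R.trans (∑-cong (suc M) (λ n → R.sym (sine-identity t n))) (R.sym (convᴿ-partialSums (σ t) (λ m → ι (1+2* m) ⊠ A t m) M))))
            (≼-trans (≼abs _) (≼-trans (abs-convᴿ M partial-sum≼ derivative≼) (≃⇒≼ (R.reflexive (cong ι
              (trans (conv-scaleˡ ⟦ 101 ⟧ r (λ k → C ℚ.* r k) M) (trans (cong (⟦ 101 ⟧ ℚ.*_) (conv-scaleʳ C r r M)) (sym (ℚₚ.*-assoc ⟦ 101 ⟧ C (conv r r M))))))))))))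

          impossible : ⊥
          impossible = let K = ⟦ 101 ⟧ ℚ.* C
                           0<K = 0<p*q {⟦ 101 ⟧} {C} (0<⟦suc⟧ 100) (0<p*q {⟦ 4 ⟧} {D ℚ.* D} (0<⟦suc⟧ 3) (0<p*q {D} {D} 0<D 0<D))
                           M , h = conv-harmonic→0 (inv K) (inv>0 0<K) in
            ℚₚ.<-irrefl refl (ℚₚ.≤-<-trans (1≤ M) (subst (K ℚ.* conv r r M ℚ.<_) (trans (ℚₚ.*-comm K (inv K)) (inv-inverse K (pos≢0 0<K)))
              (ℚₚ.*-monoʳ-<-pos K {{ℚ.positive 0<K}} (ℚₚ.≤-<-trans (p≤∣p∣ (conv r r M)) (h M ℕₚ.≤-refl)))))

      no-zero : ¬ Sin p 0ℝ
      no-zero = impossible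

    -- The order of these reals is not decided, so both strict inequalities are refuted: π < ϖ by
    -- `no-zero`, and ϖ < π by the minimality of π.
    π≃ϖ : ∀ {π} → IsPi π → π ≃ ϖ
    π≃ϖ {π} (0<π , sin-π , least) = ≮⇒≃ (λ π<ϖ → no-zero π 0<π π<ϖ sin-π) (λ ϖ<π → least ϖ 0<ϖ ϖ<π sin-ϖ)

-- Gamma values, the relation of ζ and λ, and the summands

module _ where
  open ℚ-Solver.+-*-Solver using (solve; con; _:=_; _:+_; _:*_; _:-_; :-_)
  open ℝSolver using () renaming (_:+_ to _:⊞_; _:*_ to _:⊠_; :-_ to :⊟_; _:=_ to _:≃_; con to κ; solve to solveᴿ)
  open _≃_
  open Null

  -- `gauss-tends` hides its limit behind an existential, so its induction is repeated with the
  -- limit p! named.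
  gauss-! : ∀ p → TendsTo (gauss (suc p)) ⟦ p ! ⟧
  gauss-! zero = tends-cong {λ n → ℤ.+ n / suc n} {gauss 1} 1ℚ eq (tends-ratio 0)
    where
    eq : ∀ n → ℤ.+ n / suc n ≡ gauss 1 n
    eq n = frac-≡ n (suc n) (n ! ℕ.* n ℕ.^ 1) (rising 1 n) {{_}} {{rising≢0 1 n}}
      (trans (cong (n ℕ.*_) (rising-1 n))
        (ℕ-Solver.solve 2 (λ n f → n :× ((c1 :⊕ n) :× f) ℕ-Solver.:= f :× (n :× c1) :× (c1 :⊕ n)) refl n (n !)))
      where
      open ℕ-Solver using () renaming (_:+_ to _:⊕_; _:*_ to _:×_)
      c1 = ℕ-Solver.con 1
  gauss-! (suc p) = subst (TendsTo (gauss (suc (suc p)))) value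
    (tends-cong {λ n → gauss (suc p) n ℚ.* (⟦ suc p ⟧ ℚ.* (ℤ.+ n / suc (suc p ℕ.+ n)))} {gauss (suc (suc p))} _ (gauss-step p)
      (tends-* {gauss (suc p)} {λ n → ⟦ suc p ⟧ ℚ.* (ℤ.+ n / suc (suc p ℕ.+ n))} ⟦ p ! ⟧ _ (gauss-! p)
        (tends-* {λ _ → ⟦ suc p ⟧} {λ n → ℤ.+ n / suc (suc p ℕ.+ n)} ⟦ suc p ⟧ 1ℚ (tends-const ⟦ suc p ⟧) (tends-ratio (suc p)))))
    where
    value : ⟦ p ! ⟧ ℚ.* (⟦ suc p ⟧ ℚ.* 1ℚ) ≡ ⟦ suc p ! ⟧
    value = trans (solve 2 (λ f m → f :* (m :* con 1ℚ) := m :* f) refl ⟦ p ! ⟧ ⟦ suc p ⟧) (sym (⟦*⟧ (suc p) (p !)))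

  opaque
    unfolding _⊞_

    Γ≃! : ∀ s p .{{_ : NonZero s}} → s ≡ suc p → Γ s ≃ ι ⟦ p ! ⟧
    Γ≃! .(suc p) p refl = mk≃ (mkNull (gauss-! p))

  sum-pairs : ∀ g N → sum g (2 ℕ.* N) ≡ sum (λ p → g (2 ℕ.* p)) N ℚ.+ sum (λ p → g (suc (2 ℕ.* p))) N
  sum-pairs g zero    = refl
  sum-pairs g (suc N) = trans (cong (sum g) (2*suc N)) (trans (cong (λ z → z ℚ.+ g (2 ℕ.* N) ℚ.+ g (suc (2 ℕ.* N))) (sum-pairs g N))
    (solve 4 (λ a b c d → a :+ b :+ c :+ d := (a :+ c) :+ (b :+ d)) refl (sum (λ p → g (2 ℕ.* p)) N) (sum (λ p → g (suc (2 ℕ.* p))) N) (g (2 ℕ.* N)) (g (suc (2 ℕ.* N)))))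

  r-even : ∀ p → r (suc (2 ℕ.* p)) ≡ ½ ℚ.* r p
  r-even p = sym (trans (frac-* 1 2 1 (suc p)) (frac-≡ 1 (2 ℕ.* suc p) 1 (suc (suc (2 ℕ.* p))) (cong (1 ℕ.*_) (sym (2*suc p)))))

  ζ-doubling : ∀ s N → sum (ζ-term s) (2 ℕ.* N) ≡ sum (λ-term s) N ℚ.+ pow ½ s ℚ.* sum (ζ-term s) N
  ζ-doubling s N = trans (sum-pairs (ζ-term s) N) (cong (sum (λ-term s) N ℚ.+_)
    (trans (sum-cong N (λ p → trans (reciprocal-power (suc (2 ℕ.* p)) s) (trans (cong (λ z → pow z s) (r-even p))
      (trans (pow-* ½ (r p) s) (cong (pow ½ s ℚ.*_) (sym (reciprocal-power p s))))))) (sum-scale (pow ½ s) (ζ-term s) N)))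

  -- Splitting the first 2n terms of ζ by parity shows that the n-th approximations of both sides
  -- differ by 2^s (Zₙ - Z₂ₙ), which tends to 0 because the partial sums of ζ are Cauchy.
  ζ-λ : ∀ s .{{_ : NonTrivial s}} → (ι ⟦ 2 ℕ.^ s ⟧ ⊞ ⊟ ι 1ℚ) ⊠ ζ s ≃ ι ⟦ 2 ℕ.^ s ⟧ ⊠ lambda s
  ζ-λ s = mk≃ (null-cong difference (null-const-scale T (mkNull λ ε 0<ε → let N , h = ζ-cauchy s ε 0<ε in
      N , λ n N≤n → h n (2 ℕ.* n) N≤n (ℕₚ.≤-trans N≤n (ℕₚ.m≤m+n n (n ℕ.+ 0))))))
    where
    T : ℚ
    T = ⟦ 2 ℕ.^ s ⟧
    Z : ℕ → ℚ
    Z = sum (ζ-term s)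
    T·½ : T ℚ.* pow ½ s ≡ 1ℚ
    T·½ = trans (cong (ℚ._* pow ½ s) (pow-⟦⟧ 2 s)) (trans (sym (pow-* ⟦ 2 ⟧ ½ s)) (pow-one s))
    difference : ∀ n → seq ((ι T ⊞ ⊟ ι 1ℚ) ⊠ ζ s) n ℚ.- seq (ι T ⊠ lambda s) n ≡ T ℚ.* (Z n ℚ.- Z (2 ℕ.* n))
    difference n = begin
      seq ((ι T ⊞ ⊟ ι 1ℚ) ⊠ ζ s) n ℚ.- seq (ι T ⊠ lambda s) n
        ≡⟨ cong₂ ℚ._-_ (trans (seq-⊠ (ι T ⊞ ⊟ ι 1ℚ) (ζ s) n) (cong (ℚ._* Z n) (trans (seq-⊞ (ι T) (⊟ ι 1ℚ) n) (cong₂ ℚ._+_ (seq-ι T n) (trans (seq-⊟ (ι 1ℚ) n) (cong ℚ.-_ (seq-ι 1ℚ n)))))))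
             (trans (seq-⊠ (ι T) (lambda s) n) (cong (ℚ._* Λ) (seq-ι T n))) ⟩
      (T ℚ.- 1ℚ) ℚ.* Z n ℚ.- T ℚ.* Λ
        ≡⟨ cong (λ z → (T ℚ.- z) ℚ.* Z n ℚ.- T ℚ.* Λ) (sym T·½) ⟩
      (T ℚ.- T ℚ.* pow ½ s) ℚ.* Z n ℚ.- T ℚ.* Λ
        ≡⟨ solve 4 (λ t h z l → (t :- t :* h) :* z :- t :* l := t :* (z :- (l :+ h :* z))) refl T (pow ½ s) (Z n) Λ ⟩
      T ℚ.* (Z n ℚ.- (Λ ℚ.+ pow ½ s ℚ.* Z n))
        ≡⟨ cong (λ z → T ℚ.* (Z n ℚ.- z)) (sym (ζ-doubling s n)) ⟩
      T ℚ.* (Z n ℚ.- Z (2 ℕ.* n)) ∎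
      where
      open ≡-Reasoning
      Λ = sum (λ-term s) n

  ^⇒⊡ : ∀ x n → x ^ n ≃ x ⊡ n
  ^⇒⊡ x zero    = fromℚ⇒ι 1ℚ
  ^⇒⊡ x (suc n) = R.trans (*⇒⊠ x (x ^ n)) (R.*-congˡ {x} (^⇒⊡ x n))

  sign-power : ∀ n → (- 1ℝ) ^ n ≃ ι (pow (ℚ.- 1ℚ) n)
  sign-power n = R.trans (^⇒⊡ (- 1ℝ) n) (R.trans (⊡-cong (R.trans (-⇒⊟ 1ℝ) (R.trans (⊟-cong (fromℚ⇒ι 1ℚ)) (R.sym (ι-neg 1ℚ)))) n) (R.sym (ι-pow (ℚ.- 1ℚ) n)))

  power-of-2 : ∀ n → fromℕ (2 ℕ.^ (2 ℕ.* n)) ≃ ι (pow ⟦ 4 ⟧ n)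
  power-of-2 n = R.trans (fromℚ⇒ι ⟦ 2 ℕ.^ (2 ℕ.* n) ⟧) (R.reflexive (cong ι (trans (pow-⟦⟧ 2 (2 ℕ.* n)) (pow-double ⟦ 2 ⟧ n))))

  ∑[1≤j<]≃ : ∀ m (f : ∀ j → .(0 ℕ.< j) → .(j ℕ.< suc m) → ℝ) (g : ℕ → ℝ) →
    (∀ k .(0<j : 0 ℕ.< suc k) .(j<l : suc k ℕ.< suc m) → f (suc k) 0<j j<l ≃ g k) → ∑[1≤j< suc m ] f ≃ ∑ g m
  ∑[1≤j<]≃ zero    f g h = fromℚ⇒ι 0ℚ
  ∑[1≤j<]≃ (suc m) f g h = R.trans (+⇒⊞ (∑[1≤j< suc m ] (λ j 0<j j<l → f j 0<j (ℕₚ.m<n⇒m<1+n j<l))) (f (suc m) ℕ.z<s ℕₚ.≤-refl))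
    (⊞-cong (∑[1≤j<]≃ m (λ j 0<j j<l → f j 0<j (ℕₚ.m<n⇒m<1+n j<l)) g (λ k 0<j j<l → h k 0<j (ℕₚ.m<n⇒m<1+n j<l))) (h m ℕ.z<s ℕₚ.≤-refl))

  module _ (m k : ℕ) .(j<l : suc k ℕ.< suc m) where
    private
      k<m : k ℕ.< m
      k<m = ℕₚ.≤-pred (recompute (suc k ℕₚ.<? suc m) j<l)

    2l-2j : 2 ℕ.* suc m ℕ.∸ 2 ℕ.* suc k ≡ suc (suc (2 ℕ.* (m ℕ.∸ suc k)))
    2l-2j = begin
      2 ℕ.* suc m ℕ.∸ 2 ℕ.* suc k          ≡⟨ ℕₚ.*-distribˡ-∸ 2 (suc m) (suc k) ⟨
      2 ℕ.* (m ℕ.∸ k)                      ≡⟨ cong (2 ℕ.*_) (sym (ℕₚ.suc-pred (m ℕ.∸ k) {{ℕ.>-nonZero (ℕₚ.m<n⇒0<n∸m k<m)}})) ⟩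
      2 ℕ.* suc (ℕ.pred (m ℕ.∸ k))         ≡⟨ cong (λ z → 2 ℕ.* suc z) (ℕₚ.pred[m∸n]≡m∸[1+n] m k) ⟩
      2 ℕ.* suc (m ℕ.∸ suc k)              ≡⟨ 2*suc (m ℕ.∸ suc k) ⟩
      suc (suc (2 ℕ.* (m ℕ.∸ suc k)))      ∎
      where open ≡-Reasoning

  2l-1 : ∀ m → 2 ℕ.* suc m ℕ.∸ 1 ≡ suc (2 ℕ.* m)
  2l-1 m = cong (ℕ._∸ 1) (2*suc m)

  opaque
    unfolding β-odd

    β-odd≃ : ∀ s m .{{_ : NonZero s}} → s ≡ suc (2 ℕ.* m) → β s ≃ β-odd m
    β-odd≃ .(suc (2 ℕ.* m)) m refl = pointwise λ _ → refl

    λ-even≃ : ∀ m .{{_ : NonTrivial (2 ℕ.* suc m)}} → lambda (2 ℕ.* suc m) ≃ λ-even m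
    λ-even≃ m = pointwise λ _ → refl

  #0-cancel : ∀ {a b x} → x #0 → a ⊠ x ≃ b ⊠ x → a ≃ b
  #0-cancel {a} {b} {x} x#0 h = R.trans (R.sym (undo a)) (R.trans (R.*-congʳ {recip x x#0} h) (undo b))
    where
    undo : ∀ z → z ⊠ x ⊠ recip x x#0 ≃ z
    undo z = R.trans (solveᴿ 3 (λ z x i → z :⊠ x :⊠ i :≃ z :⊠ (i :⊠ x)) ≃-refl z x (recip x x#0))
      (R.trans (R.*-congˡ {z} (recip-inverse x x#0)) (R.*-identityʳ z))

  ⊡-cancel : ∀ {a b x} → x #0 → ∀ n → a ⊠ x ⊡ n ≃ b ⊠ x ⊡ n → a ≃ b
  ⊡-cancel {a} {b} {x} x#0 zero    h = R.trans (R.sym (R.*-identityʳ a)) (R.trans h (R.*-identityʳ b))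
  ⊡-cancel {a} {b} {x} x#0 (suc n) h = ⊡-cancel {x = x} x#0 n (#0-cancel {x = x} x#0
    (R.trans (regroup a) (R.trans h (R.sym (regroup b)))))
    where
    regroup : ∀ z → z ⊠ x ⊡ n ⊠ x ≃ z ⊠ (x ⊠ x ⊡ n)
    regroup z = solveᴿ 3 (λ z x p → z :⊠ p :⊠ x :≃ z :⊠ (x :⊠ p)) ≃-refl z x (x ⊡ n)

  module _ {π : ℝ} (π#0 : π #0) (m k : ℕ) .(0<j : 0 ℕ.< suc k) .(j<l : suc k ℕ.< suc m) where
    private
      instance
        2j>1 : NonTrivial (2 ℕ.* suc k)
        2j>1 = 2j≢0,1 (suc k) 0<j
        2l-2j>0 : NonZero (2 ℕ.* suc m ℕ.∸ 2 ℕ.* suc k)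
        2l-2j>0 = 2l-2j≢0 (suc m) (suc k) j<l
        2j+1>0 : NonZero (2 ℕ.* suc k ℕ.+ 1)
        2j+1>0 = 2j+1≢0 (suc k)

      undo : ∀ x y → y ≢ 0ℚ → x ℚ.* inv y ℚ.* y ≡ x
      undo x y y≢0 = trans (ℚₚ.*-assoc x (inv y) y) (trans (cong (x ℚ.*_) (inv-inverse y y≢0)) (ℚₚ.*-identityʳ x))

      Γ≃ : Γ (2 ℕ.* suc m ℕ.∸ 2 ℕ.* suc k) ≃ ι ⟦ suc (2 ℕ.* (m ℕ.∸ suc k)) ! ⟧
      Γ≃ = Γ≃! (2 ℕ.* suc m ℕ.∸ 2 ℕ.* suc k) (suc (2 ℕ.* (m ℕ.∸ suc k))) (2l-2j m k j<l)

    opaque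
      unfolding _⊞_

      -- The terms are compared only from the index on at which the denominator is bounded away from
      -- 0; earlier terms of the reciprocal may be the default value 0 of `inv`.
      λ-summand-Γ : λ-summand π π#0 (suc m) (suc k) 0<j j<l ⊠ (Γ (2 ℕ.* suc m ℕ.∸ 2 ℕ.* suc k) ⊠ π ^ (2 ℕ.* suc k)) ≃
        (- 1ℝ) ^ suc k ⊠ (ι ⟦ 2 ℕ.^ (2 ℕ.* suc k) ⟧ ⊠ lambda (2 ℕ.* suc k))
      λ-summand-Γ =
        let δ , 0<δ , N , h = *-#0 {Γ (2 ℕ.* suc m ℕ.∸ 2 ℕ.* suc k)} {π ^ (2 ℕ.* suc k)} (Γ-#0 (2 ℕ.* suc m ℕ.∸ 2 ℕ.* suc k)) (^-#0 {π} π#0 (2 ℕ.* suc k))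
        in pointwise-from N λ n N≤n → trans
          (undo (seq ((- 1ℝ) ^ suc k) n ℚ.* ⟦ 2 ℕ.^ (2 ℕ.* suc k) ⟧ ℚ.* seq (lambda (2 ℕ.* suc k)) n)
            (seq (Γ (2 ℕ.* suc m ℕ.∸ 2 ℕ.* suc k)) n ℚ.* seq (π ^ (2 ℕ.* suc k)) n) (∣∣≥⇒≢0 0<δ (h n N≤n)))
          (ℚₚ.*-assoc (seq ((- 1ℝ) ^ suc k) n) ⟦ 2 ℕ.^ (2 ℕ.* suc k) ⟧ (seq (lambda (2 ℕ.* suc k)) n))

      ζ-summand-Γ : ζ-summand π π#0 (suc m) (suc k) 0<j j<l ⊠ (Γ (2 ℕ.* suc m ℕ.∸ 2 ℕ.* suc k) ⊠ π ^ (2 ℕ.* suc k)) ≃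
        (- 1ℝ) ^ suc k ⊠ ((ι ⟦ 2 ℕ.^ (2 ℕ.* suc k) ⟧ ⊞ ⊟ ι 1ℚ) ⊠ ζ (2 ℕ.* suc k))
      ζ-summand-Γ =
        let δ , 0<δ , N , h = *-#0 {Γ (2 ℕ.* suc m ℕ.∸ 2 ℕ.* suc k)} {π ^ (2 ℕ.* suc k)} (Γ-#0 (2 ℕ.* suc m ℕ.∸ 2 ℕ.* suc k)) (^-#0 {π} π#0 (2 ℕ.* suc k))
        in pointwise-from N λ n N≤n → trans
          (undo (seq ((- 1ℝ) ^ suc k) n ℚ.* (⟦ 2 ℕ.^ (2 ℕ.* suc k) ⟧ ℚ.- 1ℚ) ℚ.* seq (ζ (2 ℕ.* suc k)) n)
            (seq (Γ (2 ℕ.* suc m ℕ.∸ 2 ℕ.* suc k)) n ℚ.* seq (π ^ (2 ℕ.* suc k)) n) (∣∣≥⇒≢0 0<δ (h n N≤n)))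
          (ℚₚ.*-assoc (seq ((- 1ℝ) ^ suc k) n) (⟦ 2 ℕ.^ (2 ℕ.* suc k) ⟧ ℚ.- 1ℚ) (seq (ζ (2 ℕ.* suc k)) n))

      B-summand-Γ : ∀ (B : ℕ → ℚ) → B-summand π π#0 (suc m) (suc k) 0<j j<l B ⊠ (Γ (2 ℕ.* suc m ℕ.∸ 2 ℕ.* suc k) ⊠ Γ (2 ℕ.* suc k ℕ.+ 1)) ≃
        ι ⟦ 2 ℕ.^ (2 ℕ.* suc k) ⟧ ⊠ (ι ⟦ 2 ℕ.^ (2 ℕ.* suc k) ⟧ ⊞ ⊟ ι 1ℚ) ⊠ ι (B (2 ℕ.* suc k))
      B-summand-Γ B =
        let δ , 0<δ , N , h = *-#0 {Γ (2 ℕ.* suc m ℕ.∸ 2 ℕ.* suc k)} {Γ (2 ℕ.* suc k ℕ.+ 1)} (Γ-#0 (2 ℕ.* suc m ℕ.∸ 2 ℕ.* suc k)) (Γ-#0 (2 ℕ.* suc k ℕ.+ 1))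
        in pointwise-from N λ n N≤n → undo (⟦ 2 ℕ.^ (2 ℕ.* suc k) ⟧ ℚ.* (⟦ 2 ℕ.^ (2 ℕ.* suc k) ⟧ ℚ.- 1ℚ) ℚ.* B (2 ℕ.* suc k))
             (seq (Γ (2 ℕ.* suc m ℕ.∸ 2 ℕ.* suc k)) n ℚ.* seq (Γ (2 ℕ.* suc k ℕ.+ 1)) n) (∣∣≥⇒≢0 0<δ (h n N≤n))

    λ-summand-* : λ-summand π π#0 (suc m) (suc k) 0<j j<l ⊠ (ι ⟦ suc (2 ℕ.* (m ℕ.∸ suc k)) ! ⟧ ⊠ π ⊡ (2 ℕ.* suc k)) ≃
      (- 1ℝ) ^ suc k ⊠ (ι ⟦ 2 ℕ.^ (2 ℕ.* suc k) ⟧ ⊠ λ-even k)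
    λ-summand-* = R.trans (R.*-congˡ {λ-summand π π#0 (suc m) (suc k) 0<j j<l} (⊠-cong (R.sym Γ≃) (R.sym (^⇒⊡ π (2 ℕ.* suc k)))))
      (R.trans λ-summand-Γ (R.*-congˡ {(- 1ℝ) ^ suc k} (R.*-congˡ {ι ⟦ 2 ℕ.^ (2 ℕ.* suc k) ⟧} (λ-even≃ k))))

    ζ-summand-* : ζ-summand π π#0 (suc m) (suc k) 0<j j<l ⊠ (ι ⟦ suc (2 ℕ.* (m ℕ.∸ suc k)) ! ⟧ ⊠ π ⊡ (2 ℕ.* suc k)) ≃
      (- 1ℝ) ^ suc k ⊠ (ι ⟦ 2 ℕ.^ (2 ℕ.* suc k) ⟧ ⊠ λ-even k)
    ζ-summand-* = R.trans (R.*-congˡ {ζ-summand π π#0 (suc m) (suc k) 0<j j<l} (⊠-cong (R.sym Γ≃) (R.sym (^⇒⊡ π (2 ℕ.* suc k)))))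
      (R.trans ζ-summand-Γ (R.*-congˡ {(- 1ℝ) ^ suc k} (R.trans (ζ-λ (2 ℕ.* suc k)) (R.*-congˡ {ι ⟦ 2 ℕ.^ (2 ℕ.* suc k) ⟧} (λ-even≃ k)))))

    B-summand-* : ∀ (B : ℕ → ℚ) → B-summand π π#0 (suc m) (suc k) 0<j j<l B ⊠ (ι ⟦ suc (2 ℕ.* (m ℕ.∸ suc k)) ! ⟧ ⊠ ι ⟦ (2 ℕ.* suc k) ! ⟧) ≃
      ι ⟦ 2 ℕ.^ (2 ℕ.* suc k) ⟧ ⊠ (ι ⟦ 2 ℕ.^ (2 ℕ.* suc k) ⟧ ⊞ ⊟ ι 1ℚ) ⊠ ι (B (2 ℕ.* suc k))
    B-summand-* B = R.trans (R.*-congˡ {B-summand π π#0 (suc m) (suc k) 0<j j<l B} (⊠-cong (R.sym Γ≃) (R.sym (Γ≃! (2 ℕ.* suc k ℕ.+ 1) (2 ℕ.* suc k) (ℕₚ.+-comm (2 ℕ.* suc k) 1)))))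
      (B-summand-Γ B)

  -- The three expressions and the first values of β

  module Formulas (B : ℕ → ℚ) (isBernoulli : IsBernoulli B) (π : ℝ) (π#0 : π #0) (π≃ : π ≃ ϖ) where
    open Bernoulli B isBernoulli using (τ; ρ; ρ₀; sech·cosh)
    open Values B isBernoulli using (β-value; λ-value)

    private
      ϖ² : ℝ
      ϖ² = ϖ ⊠ ϖ

      -¼ : ℚ
      -¼ = ℚ.- (ℤ.+ 1 / 4)

      w^ : ∀ k → -[ ϖ /2]² ⊡ k ≃ ι (pow -¼ k) ⊠ ϖ² ⊡ k
      w^ k = R.trans (⊡-cong (solveᴿ 1 (λ q → :⊟ (κ (ℤ.+ 1 / 4) :⊠ (q :⊠ q)) :≃ κ -¼ :⊠ (q :⊠ q)) ≃-refl ϖ) k)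
        (R.trans (⊡-⊠ (ι -¼) ϖ² k) (R.*-congʳ {ϖ² ⊡ k} (R.sym (ι-pow -¼ k))))

      π^ : ∀ k → π ⊡ (2 ℕ.* k) ≃ ϖ² ⊡ k
      π^ k = R.trans (⊡-cong π≃ (2 ℕ.* k)) (⊡-double ϖ k)

      signs : ∀ k → pow (ℚ.- 1ℚ) k ℚ.* pow ⟦ 4 ⟧ k ℚ.* pow -¼ k ≡ 1ℚ
      signs k = trans (cong (ℚ._* pow -¼ k) (sym (pow-* (ℚ.- 1ℚ) ⟦ 4 ⟧ k))) (trans (sym (pow-* (ℚ.- 1ℚ ℚ.* ⟦ 4 ⟧) -¼ k)) (pow-one k))

      2^2j : ∀ j → ⟦ 2 ℕ.^ (2 ℕ.* j) ⟧ ≡ pow ⟦ 4 ⟧ j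
      2^2j j = trans (pow-⟦⟧ 2 (2 ℕ.* j)) (pow-double ⟦ 2 ⟧ j)

    module _ (m k : ℕ) .(0<j : 0 ℕ.< suc k) .(j<l : suc k ℕ.< suc m) where
      private
        s f T : ℚ
        s = sinhᶻ (m ℕ.∸ suc k)
        f = ⟦ suc (2 ℕ.* (m ℕ.∸ suc k)) ! ⟧
        T = pow ⟦ 4 ⟧ (suc k)

        sf≡1 : s ℚ.* f ≡ 1ℚ
        sf≡1 = trans (ℚₚ.*-comm s f) (!-inverse (suc (2 ℕ.* (m ℕ.∸ suc k))))

        f≢0 : f ≢ 0ℚ
        f≢0 f≡0 = case trans (sym (ℚₚ.*-zeroʳ s)) (trans (cong (s ℚ.*_) (sym f≡0)) sf≡1) of λ ()

        λ-quotient : ι (ℚ.- ½ ℚ.* (τ k ℚ.* s)) ⊠ (ι f ⊠ π ⊡ (2 ℕ.* suc k)) ≃ (- 1ℝ) ^ suc k ⊠ (ι ⟦ 2 ℕ.^ (2 ℕ.* suc k) ⟧ ⊠ λ-even k)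
        λ-quotient = begin
          ι (ℚ.- ½ ℚ.* (τ k ℚ.* s)) ⊠ (ι f ⊠ π ⊡ (2 ℕ.* suc k))
            ≈⟨ R.*-congˡ {ι (ℚ.- ½ ℚ.* (τ k ℚ.* s))} (R.*-congˡ {ι f} (π^ (suc k))) ⟩
          ι (ℚ.- ½ ℚ.* (τ k ℚ.* s)) ⊠ (ι f ⊠ (ϖ² ⊠ ϖ² ⊡ k))
            ≈⟨ R.trans (R.sym (⊠-assoc _ (ι f) (ϖ² ⊠ ϖ² ⊡ k))) (R.*-congʳ {ϖ² ⊠ ϖ² ⊡ k} (R.trans (R.sym (ι-* (ℚ.- ½ ℚ.* (τ k ℚ.* s)) f)) (R.reflexive (cong ι left)))) ⟩
          ι (N ℚ.* (T ℚ.* ((ℤ.+ 1 / 8) ℚ.* (pow -¼ k ℚ.* τ k)))) ⊠ (ϖ² ⊠ ϖ² ⊡ k)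
            ≈⟨ R.*-congʳ {ϖ² ⊠ ϖ² ⊡ k} (R.trans (ι-* N _) (R.*-congˡ {ι N} (R.trans (ι-* T _) (R.*-congˡ {ι T} (R.trans (ι-* (ℤ.+ 1 / 8) _) (R.*-congˡ {ι (ℤ.+ 1 / 8)} (ι-* (pow -¼ k) (τ k)))))))) ⟩
          (ι N ⊠ (ι T ⊠ (ι (ℤ.+ 1 / 8) ⊠ (ι (pow -¼ k) ⊠ ι (τ k))))) ⊠ (ϖ² ⊠ ϖ² ⊡ k)
            ≈⟨ solveᴿ 6 (λ n t p s q v → (n :⊠ (t :⊠ (κ (ℤ.+ 1 / 8) :⊠ (p :⊠ s)))) :⊠ (q :⊠ v) :≃ n :⊠ (t :⊠ ((κ (ℤ.+ 1 / 8) :⊠ q) :⊠ ((p :⊠ v) :⊠ s))))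
                 ≃-refl (ι N) (ι T) (ι (pow -¼ k)) (ι (τ k)) ϖ² (ϖ² ⊡ k) ⟩
          ι N ⊠ (ι T ⊠ ((ι (ℤ.+ 1 / 8) ⊠ ϖ²) ⊠ ((ι (pow -¼ k) ⊠ ϖ² ⊡ k) ⊠ ι (τ k))))
            ≈⟨ ⊠-cong (R.sym (sign-power (suc k))) (⊠-cong (R.reflexive (cong ι (sym (2^2j (suc k)))))
                 (R.trans (R.*-congˡ {ι (ℤ.+ 1 / 8) ⊠ ϖ²} (R.*-congʳ {ι (τ k)} (R.sym (w^ k)))) (R.sym (λ-value k)))) ⟩
          (- 1ℝ) ^ suc k ⊠ (ι ⟦ 2 ℕ.^ (2 ℕ.* suc k) ⟧ ⊠ λ-even k) ∎
          where
          open ℝ-Reasoning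
          N : ℚ
          N = pow (ℚ.- 1ℚ) (suc k)
          left : ℚ.- ½ ℚ.* (τ k ℚ.* s) ℚ.* f ≡ N ℚ.* (T ℚ.* ((ℤ.+ 1 / 8) ℚ.* (pow -¼ k ℚ.* τ k)))
          left = trans (solve 3 (λ t s f → con (ℚ.- ½) :* (t :* s) :* f := con (ℚ.- ½) :* t :* (s :* f)) refl (τ k) s f)
            (trans (cong (ℚ.- ½ ℚ.* τ k ℚ.*_) (trans sf≡1 (sym (signs k))))
              (solve 4 (λ t a b c → con (ℚ.- ½) :* t :* (a :* b :* c) := con (ℚ.- 1ℚ) :* a :* (con ⟦ 4 ⟧ :* b :* (con (ℤ.+ 1 / 8) :* (c :* t)))) refl (τ k) (pow (ℚ.- 1ℚ) k) (pow ⟦ 4 ⟧ k) (pow -¼ k)))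

        cancel : ∀ {a b} → a ⊠ (ι f ⊠ π ⊡ (2 ℕ.* suc k)) ≃ b ⊠ (ι f ⊠ π ⊡ (2 ℕ.* suc k)) → a ≃ b
        cancel {a} {b} h = ι-cancel f f≢0 (R.trans (⊠-comm (ι f) a) (R.trans
          (⊡-cancel {x = π} π#0 (2 ℕ.* suc k) (R.trans (⊠-assoc a (ι f) (π ⊡ (2 ℕ.* suc k))) (R.trans h (R.sym (⊠-assoc b (ι f) (π ⊡ (2 ℕ.* suc k))))))) (⊠-comm b (ι f))))

      -- By `λ-value` the even powers of π cancel and the signs combine to 1, so the summand is
      -- rational: up to the factor -1/2 it is a term of the product tanh · sinh.
      λ-summand≃ : λ-summand π π#0 (suc m) (suc k) 0<j j<l ≃ ι (ℚ.- ½ ℚ.* (τ k ℚ.* sinhᶻ (m ℕ.∸ suc k)))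
      λ-summand≃ = cancel (R.trans (λ-summand-* {π} π#0 m k 0<j j<l) (R.sym λ-quotient))

      -- `ζ-λ` gives this summand the same product with its denominator as the λ-summand, so the
      -- same quotient serves.
      ζ-summand≃ : ζ-summand π π#0 (suc m) (suc k) 0<j j<l ≃ ι (ℚ.- ½ ℚ.* (τ k ℚ.* sinhᶻ (m ℕ.∸ suc k)))
      ζ-summand≃ = cancel (R.trans (ζ-summand-* {π} π#0 m k 0<j j<l) (R.sym λ-quotient))

      -- With T = 4^j and j = k + 1, the definition of `τ` through two dilations unfolds to T(T - 1)
      -- B₂ⱼ/(2j)!, which is the summand apart from 1/(2l-2j-1)!.
      B-summand≃ : B-summand π π#0 (suc m) (suc k) 0<j j<l B ≃ ι (τ k ℚ.* sinhᶻ (m ℕ.∸ suc k))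
      B-summand≃ = ι-cancel (f ℚ.* g) fg≢0 (begin
        ι (f ℚ.* g) ⊠ Y
          ≈⟨ ⊠-comm (ι (f ℚ.* g)) Y ⟩
        Y ⊠ ι (f ℚ.* g)
          ≈⟨ R.*-congˡ {Y} (ι-* f g) ⟩
        Y ⊠ (ι f ⊠ ι g)
          ≈⟨ B-summand-* {π} π#0 m k 0<j j<l B ⟩
        ι ⟦ 2 ℕ.^ (2 ℕ.* suc k) ⟧ ⊠ (ι ⟦ 2 ℕ.^ (2 ℕ.* suc k) ⟧ ⊞ ⊟ ι 1ℚ) ⊠ ι b
          ≈⟨ R.reflexive (cong (λ z → ι z ⊠ (ι z ⊞ ⊟ ι 1ℚ) ⊠ ι b) (2^2j (suc k))) ⟩
        ι T ⊠ (ι T ⊞ ⊟ ι 1ℚ) ⊠ ι b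
          ≈⟨ R.trans (ι-* (T ℚ.* (T ℚ.- 1ℚ)) b) (R.*-congʳ {ι b} (R.trans (ι-* T (T ℚ.- 1ℚ)) (R.*-congˡ {ι T} (R.trans (ι-+ T (ℚ.- 1ℚ)) (R.+-congˡ {ι T} (ι-neg 1ℚ)))))) ⟨
        ι (T ℚ.* (T ℚ.- 1ℚ) ℚ.* b)
          ≈⟨ R.trans (R.reflexive (cong ι value)) (ι-* (f ℚ.* g) (τ k ℚ.* s)) ⟩
        ι (f ℚ.* g) ⊠ ι (τ k ℚ.* s) ∎)
        where
        open ℝ-Reasoning
        g b h : ℚ
        g = ⟦ (2 ℕ.* suc k) ! ⟧
        b = B (2 ℕ.* suc k)
        h = 1/ 2 ℕ.* suc k !
        Y : ℝ
        Y = B-summand π π#0 (suc m) (suc k) 0<j j<l B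
        gh≡1 : g ℚ.* h ≡ 1ℚ
        gh≡1 = !-inverse (2 ℕ.* suc k)
        fg≢0 : f ℚ.* g ≢ 0ℚ
        fg≢0 fg≡0 = case trans (sym (ℚₚ.*-zeroˡ (s ℚ.* h))) (trans (cong (ℚ._* (s ℚ.* h)) (sym fg≡0))
          (trans (solve 4 (λ f g s h → f :* g :* (s :* h) := (s :* f) :* (g :* h)) refl f g s h) (cong₂ ℚ._*_ sf≡1 gh≡1))) of λ ()
        value : T ℚ.* (T ℚ.- 1ℚ) ℚ.* b ≡ f ℚ.* g ℚ.* (τ k ℚ.* s)
        value = trans (sym (ℚₚ.*-identityʳ _)) (trans (cong₂ (λ u v → T ℚ.* (T ℚ.- 1ℚ) ℚ.* b ℚ.* (u ℚ.* v)) (sym sf≡1) (sym gh≡1))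
          (solve 6 (λ t b h s f g → t :* (t :- con 1ℚ) :* b :* ((s :* f) :* (g :* h)) := f :* g :* ((t :* (t :* (b :* h)) :- t :* (b :* h)) :* s)) refl T b h s f g))

    -- For l = m + 1 this is the bracket of the theorem: `coshᶻ` m = 1/(2m)! is 1/Γ(2l-1), and the
    -- sum over j = k + 1 is the coefficient of tanh · sinh in sech = cosh - tanh sinh.
    sech-coefficient : ∀ m → ρ m ≡ coshᶻ m ℚ.- sum (λ k → τ k ℚ.* sinhᶻ (m ℕ.∸ suc k)) m
    sech-coefficient zero    = refl
    sech-coefficient (suc m) = cong (λ z → coshᶻ (suc m) ℚ.- z) (conv≡cauchyProduct τ sinhᶻ m)

    private
      leading : ℕ → ℝ
      leading m = (ι (ℤ.+ 1 / 4) ⊠ ϖ) ⊠ -[ ϖ /2]² ⊡ m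

      β≃ : ∀ m → β-odd m ≃ leading m ⊠ ι (ρ m)
      β≃ m = R.trans (β-value m) (R.sym (⊠-assoc (ι (ℤ.+ 1 / 4) ⊠ ϖ) (-[ ϖ /2]² ⊡ m) (ι (ρ m))))

      prefactor≃ : ∀ m → prefactor π (suc m) ≃ leading m
      prefactor≃ m = ÷-unique {(- 1ℝ) ^ (suc m ℕ.+ 1) * π ^ (2 ℕ.* suc m ℕ.∸ 1)} {fromℕ (2 ℕ.^ (2 ℕ.* suc m))} (fromℕ-#0 (2 ℕ.^ (2 ℕ.* suc m)) {{2^≢0 (2 ℕ.* suc m)}}) (begin
        leading m ⊠ fromℕ (2 ℕ.^ (2 ℕ.* suc m))
          ≈⟨ ⊠-cong (R.*-congˡ {ι (ℤ.+ 1 / 4) ⊠ ϖ} (w^ m)) (R.trans (power-of-2 (suc m)) (ι-* ⟦ 4 ⟧ (pow ⟦ 4 ⟧ m))) ⟩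
        ((ι (ℤ.+ 1 / 4) ⊠ ϖ) ⊠ (ι (pow -¼ m) ⊠ ϖ² ⊡ m)) ⊠ (ι ⟦ 4 ⟧ ⊠ ι (pow ⟦ 4 ⟧ m))
          ≈⟨ solveᴿ 4 (λ q p v t → ((κ (ℤ.+ 1 / 4) :⊠ q) :⊠ (p :⊠ v)) :⊠ (κ ⟦ 4 ⟧ :⊠ t) :≃ (p :⊠ t) :⊠ (q :⊠ v)) ≃-refl ϖ (ι (pow -¼ m)) (ϖ² ⊡ m) (ι (pow ⟦ 4 ⟧ m)) ⟩
        (ι (pow -¼ m) ⊠ ι (pow ⟦ 4 ⟧ m)) ⊠ (ϖ ⊠ ϖ² ⊡ m)
          ≈⟨ ⊠-cong (R.trans (R.sym (ι-* (pow -¼ m) (pow ⟦ 4 ⟧ m))) (R.trans (R.reflexive (cong ι sign≡)) (R.sym (sign-power (suc m ℕ.+ 1)))))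
               (⊠-cong (R.sym π≃) (R.sym (π^ m))) ⟩
        (- 1ℝ) ^ (suc m ℕ.+ 1) ⊠ (π ⊡ suc (2 ℕ.* m))
          ≈⟨ R.*-congˡ {(- 1ℝ) ^ (suc m ℕ.+ 1)} (R.trans (R.reflexive (cong (π ⊡_) (sym (2l-1 m)))) (R.sym (^⇒⊡ π (2 ℕ.* suc m ℕ.∸ 1)))) ⟩
        (- 1ℝ) ^ (suc m ℕ.+ 1) ⊠ π ^ (2 ℕ.* suc m ℕ.∸ 1)
          ≈⟨ *⇒⊠ ((- 1ℝ) ^ (suc m ℕ.+ 1)) (π ^ (2 ℕ.* suc m ℕ.∸ 1)) ⟨
        (- 1ℝ) ^ (suc m ℕ.+ 1) * π ^ (2 ℕ.* suc m ℕ.∸ 1) ∎)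
        where
        open ℝ-Reasoning
        sign≡ : pow -¼ m ℚ.* pow ⟦ 4 ⟧ m ≡ pow (ℚ.- 1ℚ) (suc m ℕ.+ 1)
        sign≡ = trans (sym (pow-* -¼ ⟦ 4 ⟧ m)) (trans (solve 1 (λ p → p := con (ℚ.- 1ℚ) :* (con (ℚ.- 1ℚ) :* p)) refl (pow (ℚ.- 1ℚ) m)) (cong (pow (ℚ.- 1ℚ)) (ℕₚ.+-comm 1 (suc m))))

      1/Γ≃ : ∀ m → 1/Γ (2 ℕ.* suc m ℕ.∸ 1) {{2l-1≢0 (suc m)}} ≃ ι (coshᶻ m)
      1/Γ≃ m = ÷-unique {1ℝ} {Γ (2 ℕ.* suc m ℕ.∸ 1) {{2l-1≢0 (suc m)}}} (Γ-#0 (2 ℕ.* suc m ℕ.∸ 1) {{2l-1≢0 (suc m)}})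
        (R.trans (R.*-congˡ {ι (coshᶻ m)} (Γ≃! (2 ℕ.* suc m ℕ.∸ 1) (2 ℕ.* m) {{2l-1≢0 (suc m)}} (2l-1 m)))
          (R.trans (R.sym (ι-* (coshᶻ m) ⟦ (2 ℕ.* m) ! ⟧)) (R.trans (R.reflexive (cong ι (trans (ℚₚ.*-comm (coshᶻ m) ⟦ (2 ℕ.* m) ! ⟧) (!-inverse (2 ℕ.* m))))) (R.sym (fromℚ⇒ι 1ℚ)))))

      t : ℕ → ℕ → ℚ
      t m k = τ k ℚ.* sinhᶻ (m ℕ.∸ suc k)

      double : ∀ m {x y} → x ≃ ι (coshᶻ m) → y ≃ ∑ (λ k → ι (ℚ.- ½ ℚ.* t m k)) m → x + fromℕ 2 * y ≃ ι (ρ m)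
      double m {x} {y} p q = begin
        x + fromℕ 2 * y
          ≈⟨ R.trans (+⇒⊞ x (fromℕ 2 * y)) (R.+-congˡ {x} (R.trans (*⇒⊠ (fromℕ 2) y) (R.*-congʳ {y} (fromℚ⇒ι ⟦ 2 ⟧)))) ⟩
        x ⊞ ι ⟦ 2 ⟧ ⊠ y
          ≈⟨ ⊞-cong p (R.*-congˡ {ι ⟦ 2 ⟧} (R.trans q (R.trans (∑-ι (λ k → ℚ.- ½ ℚ.* t m k) m) (R.reflexive (cong ι (sum-scale (ℚ.- ½) (t m) m)))))) ⟩
        ι (coshᶻ m) ⊞ ι ⟦ 2 ⟧ ⊠ ι (ℚ.- ½ ℚ.* sum (t m) m)
          ≈⟨ R.trans (ι-+ (coshᶻ m) _) (R.+-congˡ {ι (coshᶻ m)} (ι-* ⟦ 2 ⟧ (ℚ.- ½ ℚ.* sum (t m) m))) ⟨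
        ι (coshᶻ m ℚ.+ ⟦ 2 ⟧ ℚ.* (ℚ.- ½ ℚ.* sum (t m) m))
          ≈⟨ R.reflexive (cong ι (trans (solve 2 (λ c s → c :+ con ⟦ 2 ⟧ :* (con (ℚ.- ½) :* s) := c :- s) refl (coshᶻ m) (sum (t m) m)) (sym (sech-coefficient m)))) ⟩
        ι (ρ m) ∎
        where open ℝ-Reasoning

    λ-expression≃ : ∀ m → λ-expression π π#0 (suc m) ≃ leading m ⊠ ι (ρ m)
    λ-expression≃ m = R.trans (*⇒⊠ (prefactor π (suc m)) _) (⊠-cong (prefactor≃ m)
      (double m (1/Γ≃ m) (∑[1≤j<]≃ m (λ-summand π π#0 (suc m)) (λ k → ι (ℚ.- ½ ℚ.* t m k)) (λ k 0<j j<l → λ-summand≃ m k 0<j j<l))))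

    ζ-expression≃ : ∀ m → ζ-expression π π#0 (suc m) ≃ leading m ⊠ ι (ρ m)
    ζ-expression≃ m = R.trans (*⇒⊠ (prefactor π (suc m)) _) (⊠-cong (prefactor≃ m)
      (double m (1/Γ≃ m) (∑[1≤j<]≃ m (ζ-summand π π#0 (suc m)) (λ k → ι (ℚ.- ½ ℚ.* t m k)) (λ k 0<j j<l → ζ-summand≃ m k 0<j j<l))))

    private
      single : ∀ m {x y} → x ≃ ι (coshᶻ m) → y ≃ ∑ (λ k → ι (t m k)) m → x - y ≃ ι (ρ m)
      single m {x} {y} p q = R.trans (R.trans (+⇒⊞ x (- y)) (R.+-congˡ {x} (-⇒⊟ y)))
        (R.trans (⊞-cong p (⊟-cong (R.trans q (∑-ι (t m) m))))
        (R.trans (R.+-congˡ {ι (coshᶻ m)} (R.sym (ι-neg (sum (t m) m)))) (R.trans (R.sym (ι-+ (coshᶻ m) (ℚ.- sum (t m) m))) (R.reflexive (cong ι (sym (sech-coefficient m)))))))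

    B-expression≃ : ∀ m → B-expression π π#0 (suc m) B ≃ leading m ⊠ ι (ρ m)
    B-expression≃ m = R.trans (*⇒⊠ (prefactor π (suc m)) _) (⊠-cong (prefactor≃ m)
      (single m (1/Γ≃ m) (∑[1≤j<]≃ m (λ j 0<j j<l → B-summand π π#0 (suc m) j 0<j j<l B) (λ k → ι (t m k)) (λ k 0<j j<l → B-summand≃ m k 0<j j<l))))

    private
      -- The coefficients of ρC = 1 in degrees 1 and 2 are linear equations for `ρ` 1 and `ρ` 2;
      -- they give sech x = 1 - x²/2 + 5x⁴/24 - ..., hence β(3) and β(5).
      ρ₁ : ρ 1 ≡ ℚ.- ½
      ρ₁ = trans (solve 1 (λ x → x := (con 1ℚ :* con ½ :+ x :* con 1ℚ) :- con ½) refl (ρ 1))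
        (cong (ℚ._- ½) (trans (cong (λ z → z ℚ.* ½ ℚ.+ ρ 1 ℚ.* 1ℚ) (sym ρ₀)) (sech·cosh 1)))

      ρ₂ : ρ 2 ≡ ℤ.+ 5 / 24
      ρ₂ = trans (solve 1 (λ x → x := (con 1ℚ :* con (ℤ.+ 1 / 24) :+ (con (ℚ.- ½) :* con ½ :+ x :* con 1ℚ)) :+ con (ℤ.+ 5 / 24)) refl (ρ 2))
        (cong (ℚ._+ (ℤ.+ 5 / 24)) (trans (cong₂ (λ y z → y ℚ.* (ℤ.+ 1 / 24) ℚ.+ (z ℚ.* ½ ℚ.+ ρ 2 ℚ.* 1ℚ)) (sym ρ₀) (sym ρ₁)) (sech·cosh 2)))

    β1 : β 1 ≃ π ÷ fromℕ 4 [ fromℕ-#0 4 ]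
    β1 = R.trans (β-odd≃ 1 0 refl) (R.sym (÷-unique {π} {fromℕ 4} {β-odd 0} (fromℕ-#0 4)
      (R.trans (R.*-congˡ {β-odd 0} (fromℚ⇒ι ⟦ 4 ⟧)) (R.trans (⊠-comm (β-odd 0) (ι ⟦ 4 ⟧)) (R.sym π≃)))))

    β3 : β 3 ≃ π ^ 3 ÷ fromℕ 32 [ fromℕ-#0 32 ]
    β3 = R.trans (R.trans (β-odd≃ 3 1 refl) (R.trans (β≃ 1) (R.*-congˡ {leading 1} (R.reflexive (cong ι ρ₁)))))
      (R.sym (÷-unique {π ^ 3} {fromℕ 32} {leading 1 ⊠ ι (ℚ.- ½)} (fromℕ-#0 32)
        (R.trans (R.*-congˡ {leading 1 ⊠ ι (ℚ.- ½)} (fromℚ⇒ι ⟦ 32 ⟧))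
          (R.trans (solveᴿ 1 (λ q → ((κ (ℤ.+ 1 / 4) :⊠ q) :⊠ ((:⊟ (κ (ℤ.+ 1 / 4) :⊠ (q :⊠ q))) :⊠ κ 1ℚ)) :⊠ κ (ℚ.- ½) :⊠ κ ⟦ 32 ⟧ :≃ q :⊠ (q :⊠ (q :⊠ κ 1ℚ))) ≃-refl ϖ)
            (R.sym (R.trans (^⇒⊡ π 3) (⊡-cong π≃ 3)))))))

    β5 : β 5 ≃ (fromℕ 5 * π ^ 5) ÷ fromℕ 1536 [ fromℕ-#0 1536 ]
    β5 = R.trans (R.trans (β-odd≃ 5 2 refl) (R.trans (β≃ 2) (R.*-congˡ {leading 2} (R.reflexive (cong ι ρ₂)))))
      (R.sym (÷-unique {fromℕ 5 * π ^ 5} {fromℕ 1536} {leading 2 ⊠ ι (ℤ.+ 5 / 24)} (fromℕ-#0 1536)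
        (R.trans (R.*-congˡ {leading 2 ⊠ ι (ℤ.+ 5 / 24)} (fromℚ⇒ι ⟦ 1536 ⟧))
          (R.trans (solveᴿ 1 (λ q → ((κ (ℤ.+ 1 / 4) :⊠ q) :⊠ ((:⊟ (κ (ℤ.+ 1 / 4) :⊠ (q :⊠ q))) :⊠ ((:⊟ (κ (ℤ.+ 1 / 4) :⊠ (q :⊠ q))) :⊠ κ 1ℚ))) :⊠ κ (ℤ.+ 5 / 24) :⊠ κ ⟦ 1536 ⟧
                :≃ κ ⟦ 5 ⟧ :⊠ (q :⊠ (q :⊠ (q :⊠ (q :⊠ (q :⊠ κ 1ℚ)))))) ≃-refl ϖ)
            (R.sym (R.trans (*⇒⊠ (fromℕ 5) (π ^ 5)) (⊠-cong (fromℚ⇒ι ⟦ 5 ⟧) (R.trans (^⇒⊡ π 5) (⊡-cong π≃ 5)))))))))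

    β≃λ-expression : ∀ m → β (2 ℕ.* suc m ℕ.∸ 1) {{2l-1≢0 (suc m)}} ≃ λ-expression π π#0 (suc m)
    β≃λ-expression m = R.trans (β-odd≃ (2 ℕ.* suc m ℕ.∸ 1) m {{2l-1≢0 (suc m)}} (2l-1 m)) (R.trans (β≃ m) (R.sym (λ-expression≃ m)))

    λ≃ζ-expression : ∀ m → λ-expression π π#0 (suc m) ≃ ζ-expression π π#0 (suc m)
    λ≃ζ-expression m = R.trans (λ-expression≃ m) (R.sym (ζ-expression≃ m))

    ζ≃B-expression : ∀ m → ζ-expression π π#0 (suc m) ≃ B-expression π π#0 (suc m) B
    ζ≃B-expression m = R.trans (ζ-expression≃ m) (R.sym (B-expression≃ m))

mainTheorem1 : (π : ℝ) (isPi : IsPi π) (B : ℕ → ℚ) → IsBernoulli B →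
    let π#0 = IsPi⇒#0 {π} isPi in
    (β 1 ≈ π ÷ fromℕ 4 [ fromℕ-#0 4 ]) ×
    (β 3 ≈ π ^ 3 ÷ fromℕ 32 [ fromℕ-#0 32 ]) ×
    (β 5 ≈ (fromℕ 5 * π ^ 5) ÷ fromℕ 1536 [ fromℕ-#0 1536 ]) ×
    ((l : ℕ) .{{l>0 : NonZero l}} →
    (β (2 ℕ.* l ℕ.∸ 1) {{2l-1≢0 l}} ≈ λ-expression π π#0 l) ×
    (λ-expression π π#0 l ≈ ζ-expression π π#0 l) ×
    (ζ-expression π π#0 l ≈ B-expression π π#0 l B))
mainTheorem1 π isPi B isBernoulli =
  ≃⇒≈ (β 1) (π ÷ fromℕ 4 [ fromℕ-#0 4 ]) Formula.β1 ,
  ≃⇒≈ (β 3) (π ^ 3 ÷ fromℕ 32 [ fromℕ-#0 32 ]) Formula.β3 ,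
  ≃⇒≈ (β 5) ((fromℕ 5 * π ^ 5) ÷ fromℕ 1536 [ fromℕ-#0 1536 ]) Formula.β5 ,
  λ { (suc m) →
    ≃⇒≈ (β (2 ℕ.* suc m ℕ.∸ 1) {{2l-1≢0 (suc m)}}) (λ-expression π (IsPi⇒#0 {π} isPi) (suc m)) (Formula.β≃λ-expression m) ,
    ≃⇒≈ (λ-expression π (IsPi⇒#0 {π} isPi) (suc m)) (ζ-expression π (IsPi⇒#0 {π} isPi) (suc m)) (Formula.λ≃ζ-expression m) ,
    ≃⇒≈ (ζ-expression π (IsPi⇒#0 {π} isPi) (suc m)) (B-expression π (IsPi⇒#0 {π} isPi) (suc m) B) (Formula.ζ≃B-expression m) }
  where
  module Formula = Formulas B isBernoulli π (IsPi⇒#0 {π} isPi) (Zeros.π≃ϖ B isBernoulli isPi)
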